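{- The decision problem \textsc{Repacking} is strongly NP-hard, where \textsc{Repacking} is the following problem. Input: a positive integer capacity $\kappa$ and two legal configurations $\mathcal{C}_S$ (source) and $\mathcal{C}_T$ (target) for capacity $\kappa$ with $|\mathcal{C}_S|=|\mathcal{C}_T|$. Question: is there a reconfiguration sequence for capacity $\kappa$ from $\mathcal{C}_S$ to $\mathcal{C}_T$?
   Context: Items are positive integers (items of the same size are indistinguishable). A bunch is a finite (possibly empty) multiset of items; its volume $\mathrm{vol}(B)$ is the sum of its items. A configuration is a finite multiset of bunches, and $|\mathcal{C}|$ is the number of bunches of $\mathcal{C}$ counted with multiplicity (empty bunches included). A configuration is legal for capacity $\kappa$ if every bunch has volume at most $\kappa$. Two legal configurations $\mathcal{C},\mathcal{D}$ for capacity $\kappa$ are adjacent if $\mathcal{D}$ can be formed from $\mathcal{C}$ by the move of a single item: the multiset difference $\mathcal{C}\setminus\mathcal{D}$ consists of two bunches $B_d,B_r$, the multiset difference $\mathcal{D}\setminus\mathcal{C}$ consists of two bunches $B_d',B_r'$, and for some item $u$ in $B_d$, $B_d'$ is $B_d$ with one copy of $u$ removed and $B_r'$ is $B_r$ with one copy of $u$ added. A reconfiguration sequence for capacity $\kappa$ from $\mathcal{C}_S$ to $\mathcal{C}_T$ is a finite sequence of legal configurations for capacity $\kappa$, starting with $\mathcal{C}_S$ and ending with $\mathcal{C}_T$, in which consecutive configurations are adjacent. Strongly NP-hard means NP-hard even when all integers in the input are encoded in unary. -}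

module Defs where

open import Data.Bool.Base using (Bool; true; false; if_then_else_)
open import Data.Fin.Base using (Fin)
open import Data.List.Base
  using (List; []; _∷_; _++_; foldl; foldr; length; map; replicate)
open import Data.List.Membership.Propositional.Properties using (∈-∃++)
import Data.List.Membership.DecPropositional as DecMembership
import Data.List.Relation.Binary.Permutation.Setoid as SetoidPermutation
open import Data.List.Relation.Binary.Permutation.Propositional
  using (_↭_; ↭-refl; ↭-sym; ↭-trans; ↭-prep; ↭-setoid)
open import Data.List.Relation.Binary.Permutation.Propositional.Properties
  using (¬x∷xs↭[]; ∈-resp-↭; drop-∷; shift)
open import Data.List.Relation.Unary.All using (All)
open import Data.List.Relation.Unary.Any using (here)
open import Data.Nat.Base using (ℕ; _+_; _*_; _≤_; NonZero)
open import Data.Nat.ListAction using (sum)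
import Data.Nat.Properties as ℕ
open import Data.Product.Base using (Σ; ∃; ∃-syntax; _×_; _,_; proj₁; proj₂)
open import Data.Unit.Base using (⊤; tt)
import Data.Vec.Base as Vec
open Vec using (Vec; _∷_)
open import Function.Base using (_on_)
open import Function.Bundles using (_↔_; _⇔_)
open import Level using (0ℓ)
open import Relation.Binary.Construct.Closure.ReflexiveTransitive using (Star)
open import Relation.Binary.Core using (Rel)
open import Relation.Binary.Definitions using (Decidable; DecidableEquality)
open import Relation.Binary.PropositionalEquality.Core using (_≡_; refl; cong)
open import Relation.Nullary.Decidable using (yes; no; map′)
open import Relation.Unary using (Pred; _∈_)

------------------------------------------------------------------------
-- Multitape Turing machines

Finite : Set → Set
Finite A = ∃[ n ] (A ↔ Fin n)

data Symbol (Mark : Set) : Set where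
  blank : Symbol Mark
  bit   : Bool → Symbol Mark
  mark  : Mark → Symbol Mark

data Move : Set where
  left stay right : Move

-- A two-way infinite tape.  Both lists start with the cell next to the
-- head; all cells beyond their ends are blank.
record Tape (Mark : Set) : Set where
  constructor tape
  field
    before : List (Symbol Mark)
    head   : Symbol Mark
    after  : List (Symbol Mark)

open Tape public

module _ {Mark : Set} where

  blankTape : Tape Mark
  blankTape = tape [] blank []

  inputTape : List Bool → Tape Mark
  inputTape []       = blankTape
  inputTape (b ∷ bs) = tape [] (bit b) (map bit bs)

  move : Move → Tape Mark → Tape Mark
  move left  (tape []       h rs)       = tape [] blank (h ∷ rs)
  move left  (tape (l ∷ ls) h rs)       = tape ls l (h ∷ rs)
  move stay  t                          = t
  move right (tape ls       h [])       = tape (h ∷ ls) blank []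
  move right (tape ls       h (r ∷ rs)) = tape (h ∷ ls) r rs

  act : Symbol Mark × Move → Tape Mark → Tape Mark
  act (s , m) (tape ls _ rs) = move m (tape ls s rs)

  leadingBits : List (Symbol Mark) → List Bool
  leadingBits (bit b ∷ ss) = b ∷ leadingBits ss
  leadingBits _            = []

  bitsFromHead : Tape Mark → List Bool
  bitsFromHead t = leadingBits (head t ∷ after t)

-- One transition function for each element of Choice: the machine is
-- deterministic for Choice = ⊤ and nondeterministic for Choice = Bool.
record TuringMachine (Choice : Set) : Set₁ where
  field
    State        : Set
    Mark         : Set
    finiteStates : Finite State
    finiteMarks  : Finite Mark
    extraTapes   : ℕ
    start        : State
    final        : State → Bool
    δ            : Choice → State → Vec (Symbol Mark) (1 + extraTapes) →
                   State × Vec (Symbol Mark × Move) (1 + extraTapes)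

module Computation {Choice : Set} (M : TuringMachine Choice) where

  open TuringMachine M

  record Snapshot : Set where
    constructor snapshot
    field
      state : State
      tapes : Vec (Tape Mark) (1 + extraTapes)

  open Snapshot public

  initial : List Bool → Snapshot
  initial x =
    snapshot start (inputTape x ∷ Vec.replicate extraTapes blankTape)

  -- Final states are halting: no transition leaves them.
  step : Snapshot → Choice → Snapshot
  step (snapshot q ts) c = if final q then snapshot q ts else
    (let (q′ , actions) = δ c q (Vec.map head ts)
     in  snapshot q′ (Vec.zipWith act actions ts))

  run : List Choice → Snapshot → Snapshot
  run cs s = foldl step s cs

  Halted : Snapshot → Set
  Halted s = final (state s) ≡ true

  output : Snapshot → List Bool
  output s = bitsFromHead (Vec.last (tapes s))

------------------------------------------------------------------------
-- Polynomial time, NP and NP-hardness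

-- Coefficients, constant term first.
Polynomial : Set
Polynomial = List ℕ

eval : Polynomial → ℕ → ℕ
eval []      n = 0
eval (a ∷ p) n = a + n * eval p n

Language : Set₁
Language = Pred (List Bool) 0ℓ

PolynomialTime : (List Bool → List Bool) → Set₁
PolynomialTime f =
  Σ (TuringMachine ⊤) λ M → let open Computation M in
  ∃[ p ] ∀ x → ∃[ t ]
    (t ≤ eval p (length x) ×
     Halted (run (replicate t tt) (initial x)) ×
     output (run (replicate t tt) (initial x)) ≡ f x)

-- Final states of a nondeterministic machine are accepting; its running
-- time on an accepted input is that of a shortest accepting computation.
NP : Language → Set₁
NP L =
  Σ (TuringMachine Bool) λ M → let open Computation M in
  ∃[ p ] ∀ x →
    (x ∈ L) ⇔
    (∃[ cs ] (length cs ≤ eval p (length x) × Halted (run cs (initial x))))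

infix 4 _≤ₚ_

_≤ₚ_ : Language → Language → Set₁
L ≤ₚ L′ = ∃[ f ] (PolynomialTime f × (∀ x → (x ∈ L) ⇔ (f x ∈ L′)))

NP-hard : Language → Set₁
NP-hard L′ = ∀ L → NP L → L ≤ₚ L′

------------------------------------------------------------------------
-- Decision problems with integers in the input

-- The encoding of instances is relative to an encoding of the integers
-- that occur in them.
record DecisionProblem : Set₁ where
  field
    Instance : Set
    encode   : (ℕ → List Bool) → Instance → List Bool
    Yes      : Instance → Set

language : (ℕ → List Bool) → DecisionProblem → Language
language numeral P w = ∃[ I ] (encode numeral I ≡ w × Yes I)
  where open DecisionProblem P

-- The closing bit makes concatenations of numerals uniquely decodable.
unary : ℕ → List Bool
unary n = replicate n true ++ false ∷ []

StronglyNP-hard : DecisionProblem → Set₁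
StronglyNP-hard P = NP-hard (language unary P)

encodeList : {A : Set} → (A → List Bool) → List A → List Bool
encodeList e = foldr (λ x bits → true ∷ e x ++ bits) (false ∷ [])

------------------------------------------------------------------------
-- Items, bunches and configurations

record Item : Set where
  constructor item
  field
    size         : ℕ
    .{{nonZero}} : NonZero size

open Item public using (size)

_≟_ : DecidableEquality Item
item m ≟ item n = map′ (λ { refl → refl }) (cong size) (m ℕ.≟ n)

-- Multisets are lists considered up to permutation: bunches up to _↭_,
-- configurations up to _≋_, which also permutes within each bunch.
Bunch : Set
Bunch = List Item

Configuration : Set
Configuration = List Bunch

open SetoidPermutation (↭-setoid {A = Item}) public
  using () renaming (_↭_ to infix 4 _≋_)

vol : Bunch → ℕ
vol B = sum (map size B)

infix 4 _↭?_

_↭?_ : Decidable (_↭_ {A = Item})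
[]      ↭? []      = yes ↭-refl
[]      ↭? (y ∷ B) = no λ p → ¬x∷xs↭[] (↭-sym p)
(x ∷ A) ↭? B with DecMembership._∈?_ _≟_ x B
... | no x∉B = no λ p → x∉B (∈-resp-↭ p (here refl))
... | yes x∈B with B₁ , B₂ , refl ← ∈-∃++ x∈B =
  map′ (λ p → ↭-trans (↭-prep x p) (↭-sym (shift x B₁ B₂)))
       (λ p → drop-∷ (↭-trans p (shift x B₁ B₂)))
       (A ↭? B₁ ++ B₂)

removeOne : Configuration → Bunch → Configuration
removeOne []      B = []
removeOne (A ∷ C) B with A ↭? B
... | yes _ = C
... | no  _ = A ∷ removeOne C B

infixl 5 _∖_

-- Multiset difference: multiplicities are subtracted, truncating at 0.
_∖_ : Configuration → Configuration → Configuration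
C ∖ D = foldl removeOne C D

Legal : ℕ → Pred Configuration 0ℓ
Legal κ C = All (λ B → vol B ≤ κ) C

record Adjacent (C D : Configuration) : Set where
  field
    donor recipient donor′ recipient′ : Bunch
    removed   : C ∖ D ≋ donor ∷ recipient ∷ []
    added     : D ∖ C ≋ donor′ ∷ recipient′ ∷ []
    moved     : Item
    donate    : donor ↭ moved ∷ donor′
    receive   : recipient′ ↭ moved ∷ recipient

LegalConfiguration : ℕ → Set
LegalConfiguration κ = Σ Configuration (Legal κ)

-- The sequence may reach any list that represents the multiset D.
Reconfigurable : (κ : ℕ) → Rel (LegalConfiguration κ) 0ℓ
Reconfigurable κ C D =
  ∃[ E ] (Star (Adjacent on proj₁) C E × proj₁ E ≋ proj₁ D)

------------------------------------------------------------------------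
-- Repacking

record RepackingInstance : Set where
  field
    capacity      : ℕ
    .{{positive}} : NonZero capacity
    source target : LegalConfiguration capacity
    sameLength    : length (proj₁ source) ≡ length (proj₁ target)

Repacking : DecisionProblem
Repacking = record
  { Instance = RepackingInstance
  ; encode   = λ numeral I → let open RepackingInstance I in
      numeral capacity ++
      encodeConfiguration numeral (proj₁ source) ++
      encodeConfiguration numeral (proj₁ target)
  ; Yes      = λ I → let open RepackingInstance I in
      Reconfigurable capacity source target
  }
  where
  encodeConfiguration : (ℕ → List Bool) → Configuration → List Bool
  encodeConfiguration numeral =
    encodeList (encodeList (λ u → numeral (size u)))

{-# OPTIONS --safe #-}
module Submission where

-- An accepting computation of a nondeterministic machine within T steps is a
-- token game: the places are the states and tape cells at each time, a step
-- consumes tokens at one time and produces tokens at the next, and every token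
-- that is produced has to be consumed.  Such a game is bin packing with
-- individual capacities, equal in total to the volume of the items: each
-- reaction has a bin for what it consumes and a bin for what it produces, and
-- every place is represented in both by an item of a flagged size.  The digits
-- of the sizes name the places, so a full bin contains the right items up to
-- flags, and the flags record whether the reaction is chosen.  All numbers are
-- polynomial in the length of the input.
--
-- Packing becomes repacking when the small items start in a bunch with one
-- large item and the bins are the gaps left by fillers: source and target
-- differ by a swap of two large items, and the only room for it is the space
-- that the small items free when they are packed into the bins.

open import Defs hiding (_≟_)
open import Data.Bool.Base using (Bool; true; false; if_then_else_; not)
open import Data.Empty using (⊥; ⊥-elim)
open import Data.Fin.Base using (Fin; zero; suc; toℕ; fromℕ; inject₁)
import Data.Fin.Properties as Fin
open import Data.List.Base using (List; []; _∷_; _++_; _ʳ++_; allFin; applyUpTo; concatMap; filter; foldl; length; map; replicate; reverse; upTo)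
open import Data.List.Membership.Propositional using (_∈_; find; lose)
open import Data.List.Membership.Propositional.Properties using (∈-∃++; ∈-++⁺ˡ; ∈-++⁺ʳ; ∈-++⁻; ∈-map⁺; ∈-map⁻; ∈-concatMap⁺; ∈-concatMap⁻; ∈-allFin; ∈-upTo⁺; ∈-upTo⁻)
open import Data.List.Properties using (++-assoc; ++-identityʳ; concatMap-++; concatMap-cong; concatMap-map; filter-++; filter-accept; filter-all; filter-none; filter-reject; foldl-++; length-++; length-map; length-replicate; length-reverse; length-tabulate; length-upTo; length-ʳ++; map-++; map-applyUpTo; map-concatMap; map-cong; map-tabulate; map-upTo; map-∘; reverse-++; reverse-involutive; upTo-∷ʳ; ∷-injective; ∷-injectiveʳ)
import Data.List.Relation.Binary.Permutation.Homogeneous as Homogeneous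
open import Data.List.Relation.Binary.Permutation.Propositional
open import Data.List.Relation.Binary.Permutation.Propositional.Properties
  hiding (sum-↭; ++-assoc; ++-identityʳ)
  renaming (map⁺ to ↭-map⁺)
import Data.List.Relation.Binary.Permutation.Setoid as SetoidPermutation
import Data.List.Relation.Binary.Permutation.Setoid.Properties as SetoidPermutationₚ
open import Data.List.Relation.Unary.All as All using (All; []; _∷_)
import Data.List.Relation.Unary.All.Properties as All
open import Data.List.Relation.Unary.AllPairs as AllPairs using (AllPairs; []; _∷_)
import Data.List.Relation.Unary.AllPairs.Properties as AllPairs
open import Data.List.Relation.Unary.Any using (Any; here; there)
open import Data.List.Relation.Unary.Unique.Propositional using (Unique)
open import Data.List.Relation.Unary.Unique.Propositional.Properties using (allFin⁺; upTo⁺)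
open import Data.Maybe.Base using (Maybe; just; nothing)
open import Data.Nat.Base using (ℕ; zero; suc; pred; _+_; _*_; _^_; _∸_; _≤_; _<_; z≤n; s≤s; >-nonZero; _≡ᵇ_)
open import Data.Nat.ListAction using (sum)
open import Data.Nat.ListAction.Properties using (sum-++; sum-↭)
open import Data.Nat.Properties
import Data.Nat.Properties as ℕ
open import Data.Nat.Tactic.RingSolver using (solve-∀)
open import Data.Product.Base using (Σ; ∃-syntax; _×_; _,_; proj₁; proj₂)
open import Data.Sum.Base using (_⊎_; inj₁; inj₂; [_,_]′)
open import Data.Sum.Function.Propositional using (_⊎-↔_)
open import Data.Unit.Base using (⊤; tt)
open import Data.Vec.Base as Vec using (Vec; []; _∷_; lookup; tabulate; updateAt)
import Data.Vec.Properties as Vec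
open import Function.Base using (_∘_; _on_; id)
open import Function.Bundles using (Equivalence; Inverse; _⇔_; mk⇔)
open import Function.Construct.Composition using (_↔-∘_; _⇔-∘_)
open import Function.Construct.Symmetry using (↔-sym)
open import Relation.Binary.Construct.Closure.ReflexiveTransitive as Star using (Star; ε; _◅_; _◅◅_)
open import Relation.Binary.PropositionalEquality
  using (_≡_; _≢_; refl; cong; cong₂; subst; subst₂; sym; module ≡-Reasoning)
  renaming (trans to ≡-trans)
open import Relation.Nullary.Decidable using (Dec; yes; no; does; ¬?)
open import Relation.Nullary.Negation using (¬_; contradiction)

open SetoidPermutation (↭-setoid {A = Item})
  using () renaming (↭-refl to ≋-refl; ↭-sym to ≋-sym; ↭-trans to ≋-trans; ↭-prep to ≋-prep; ↭-swap to ≋-swap; ↭-reflexive to ≋-reflexive)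

-- Sizes are written in unary and must be polynomial themselves, which rules out one digit per
-- place. Instead there is one digit per `slot` (control, two sorts of hubs, one for each tape),
-- whose value is an address within the slot. The number of digits depends on the machine only, and
-- it suffices because a bin of a reaction has at most one item of each slot. The two bins of a
-- reaction must agree on its use. Both contain the hub of the reaction, whose flag weighs as much
-- as the flags of all places in the bin: an exactly full bin has either a flagged hub or flagged
-- places, never a mixture. Hardness also demands a machine that writes the instance. Therefore
-- places, reactions and addresses are defined over any carrier with the needed arithmetic: numbers
-- in the combinatorial proof, expressions over loop variables in the program. The volume of all
-- items, on which the capacity depends, is found by running the enumeration of the bins once merely
-- to count.

module ≋ₚ = SetoidPermutationₚ (↭-setoid {A = Item})
open Homogeneous using (prep; swap)

-- Multiplicities of bunches

hit : Bunch → Bunch → ℕ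
hit B A = if does (A ↭? B) then 1 else 0

hit-yes : ∀ {A B} → A ↭ B → hit B A ≡ 1
hit-yes {A} {B} p with A ↭? B
... | yes _ = refl
... | no ¬p = contradiction p ¬p

hit-no : ∀ {A B} → ¬ (A ↭ B) → hit B A ≡ 0
hit-no {A} {B} ¬p with A ↭? B
... | yes p = contradiction p ¬p
... | no _  = refl

hit-cong : ∀ B {A A′} → A ↭ A′ → hit B A ≡ hit B A′
hit-cong B {A} {A′} p with A′ ↭? B
... | yes q = hit-yes (↭-trans p q)
... | no ¬q = hit-no λ q → ¬q (↭-trans (↭-sym p) q)

mult : Bunch → Configuration → ℕ
mult B []      = 0
mult B (A ∷ C) = hit B A + mult B C

mult-≋ : ∀ B {C D} → C ≋ D → mult B C ≡ mult B D
mult-≋ B (Homogeneous.refl xs) = go xs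
  where
  open import Data.List.Relation.Binary.Pointwise.Base using (Pointwise; []; _∷_)
  go : ∀ {C D} → Pointwise _↭_ C D → mult B C ≡ mult B D
  go []       = refl
  go (p ∷ ps) = cong₂ _+_ (hit-cong B p) (go ps)
mult-≋ B (Homogeneous.prep p ps) = cong₂ _+_ (hit-cong B p) (mult-≋ B ps)
mult-≋ B (Homogeneous.swap {C} {D} {x} {y} {x′} {y′} p q ps) = begin
  hit B x + (hit B y + mult B C)    ≡⟨ cong₂ _+_ (hit-cong B p) (cong₂ _+_ (hit-cong B q) (mult-≋ B ps)) ⟩
  hit B x′ + (hit B y′ + mult B D)  ≡⟨ +-assoc (hit B x′) (hit B y′) (mult B D) ⟨
  (hit B x′ + hit B y′) + mult B D  ≡⟨ cong (_+ mult B D) (+-comm (hit B x′) (hit B y′)) ⟩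
  (hit B y′ + hit B x′) + mult B D  ≡⟨ +-assoc (hit B y′) (hit B x′) (mult B D) ⟩
  hit B y′ + (hit B x′ + mult B D)  ∎
  where open ≡-Reasoning
mult-≋ B (Homogeneous.trans ps qs) = ≡-trans (mult-≋ B ps) (mult-≋ B qs)

mult-++ : ∀ B C D → mult B (C ++ D) ≡ mult B C + mult B D
mult-++ B []      D = refl
mult-++ B (A ∷ C) D = ≡-trans (cong (hit B A +_) (mult-++ B C D)) (sym (+-assoc (hit B A) _ _))

mult-removeOne : ∀ B C A → mult B (removeOne C A) ≡ mult B C ∸ hit B A
mult-removeOne B []       A = sym (0∸n≡0 (hit B A))
mult-removeOne B (A′ ∷ C) A with A′ ↭? A
... | yes p = begin
  mult B C                         ≡⟨ m+n∸m≡n (hit B A) _ ⟨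
  (hit B A + mult B C) ∸ hit B A   ≡⟨ cong (λ k → (k + mult B C) ∸ hit B A) (hit-cong B p) ⟨
  (hit B A′ + mult B C) ∸ hit B A  ∎
  where open ≡-Reasoning
... | no ¬p = ≡-trans (cong (hit B A′ +_) (mult-removeOne B C A)) lemma
  where
  lemma : hit B A′ + (mult B C ∸ hit B A) ≡ (hit B A′ + mult B C) ∸ hit B A
  lemma with A ↭? B
  ... | no _ = refl
  ... | yes q rewrite hit-no {A′} {B} (λ r → ¬p (↭-trans r (↭-sym q))) = refl

mult-∖ : ∀ B C D → mult B (C ∖ D) ≡ mult B C ∸ mult B D
mult-∖ B C []      = refl
mult-∖ B C (A ∷ D) = begin
  mult B (removeOne C A ∖ D)          ≡⟨ mult-∖ B (removeOne C A) D ⟩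
  mult B (removeOne C A) ∸ mult B D   ≡⟨ cong (_∸ mult B D) (mult-removeOne B C A) ⟩
  (mult B C ∸ hit B A) ∸ mult B D     ≡⟨ ∸-+-assoc (mult B C) (hit B A) (mult B D) ⟩
  mult B C ∸ (hit B A + mult B D)     ∎
  where open ≡-Reasoning

mult-extract : ∀ A D {n} → mult A D ≡ suc n → ∃[ D′ ] D ≋ A ∷ D′
mult-extract A (B ∷ D) eq with B ↭? A
... | yes p = D , prep p ≋-refl
... | no _ with D′ , q ← mult-extract A D eq =
  B ∷ D′ , ≋-trans (≋-prep B q) (≋-swap B A ≋-refl)

-- Through this, identities about `_∖_` become arithmetic of truncated subtraction.
mult⇒≋ : ∀ C D → (∀ B → mult B C ≡ mult B D) → C ≋ D
mult⇒≋ []      []      eq = ≋-refl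
mult⇒≋ []      (A ∷ D) eq with () ← ≡-trans (eq A) (cong (_+ mult A D) (hit-yes {A} ↭-refl))
mult⇒≋ (A ∷ C) D       eq
  with D′ , p ← mult-extract A D (sym (≡-trans (cong (_+ mult A C) (sym (hit-yes {A} ↭-refl))) (eq A))) =
  ≋-trans (≋-prep A (mult⇒≋ C D′ λ B →
    +-cancelˡ-≡ (hit B A) _ _ (≡-trans (eq B) (mult-≋ B p)))) (≋-sym p)

∖-cong : ∀ {C C′ D D′} → C ≋ C′ → D ≋ D′ → C ∖ D ≋ C′ ∖ D′
∖-cong {C} {C′} {D} {D′} p q = mult⇒≋ _ _ λ B → begin
  mult B (C ∖ D)          ≡⟨ mult-∖ B C D ⟩
  mult B C ∸ mult B D     ≡⟨ cong₂ _∸_ (mult-≋ B p) (mult-≋ B q) ⟩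
  mult B C′ ∸ mult B D′   ≡⟨ mult-∖ B C′ D′ ⟨
  mult B (C′ ∖ D′)        ∎
  where open ≡-Reasoning

-- Moves

-- `Adjacent` speaks of differences; here the bunches common to both sides are explicit, which is
-- the form in which moves are made and analysed. Unlike adjacency, it admits a move that changes
-- nothing up to permutation.
record Transfer (C D : Configuration) : Set where
  field
    donor recipient donor′ recipient′ : Bunch
    rest    : Configuration
    source≋  : C ≋ donor ∷ recipient ∷ rest
    target≋   : D ≋ donor′ ∷ recipient′ ∷ rest
    moved   : Item
    donate  : donor ↭ moved ∷ donor′
    receive : recipient′ ↭ moved ∷ recipient

adjacent⇒transfer : ∀ {C D} → Adjacent C D → Transfer C D
adjacent⇒transfer {C} {D} a = record
  -- The intersection of the two multisets: its multiplicities are the minima.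
  { rest    = C ∖ (C ∖ D)
  ; source≋  = ≋-trans (mult⇒≋ _ _ split) (≋ₚ.++⁺ʳ (C ∖ (C ∖ D)) removed)
  ; target≋   = ≋-trans (mult⇒≋ _ _ split′) (≋ₚ.++⁺ʳ (C ∖ (C ∖ D)) added)
  ; moved   = moved
  ; donate  = donate
  ; receive = receive
  }
  where
  open Adjacent a
  open ≡-Reasoning
  common : ∀ B → mult B (C ∖ (C ∖ D)) ≡ mult B C ∸ (mult B C ∸ mult B D)
  common B = ≡-trans (mult-∖ B C (C ∖ D)) (cong (mult B C ∸_) (mult-∖ B C D))
  split : ∀ B → mult B C ≡ mult B ((C ∖ D) ++ (C ∖ (C ∖ D)))
  split B = begin
    mult B C                                              ≡⟨ m+[n∸m]≡n (m∸n≤m (mult B C) (mult B D)) ⟨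
    (mult B C ∸ mult B D) + (mult B C ∸ (mult B C ∸ mult B D)) ≡⟨ cong₂ _+_ (mult-∖ B C D) (common B) ⟨
    mult B (C ∖ D) + mult B (C ∖ (C ∖ D))                 ≡⟨ mult-++ B (C ∖ D) _ ⟨
    mult B ((C ∖ D) ++ (C ∖ (C ∖ D)))                     ∎
  common-sym : ∀ x y → y ≡ (y ∸ x) + (x ∸ (x ∸ y))
  common-sym x y with ≤-total x y
  ... | inj₁ x≤y rewrite m≤n⇒m∸n≡0 x≤y = sym (m∸n+n≡m x≤y)
  ... | inj₂ y≤x rewrite m≤n⇒m∸n≡0 y≤x = sym (m∸[m∸n]≡n y≤x)
  split′ : ∀ B → mult B D ≡ mult B ((D ∖ C) ++ (C ∖ (C ∖ D)))
  split′ B = begin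
    mult B D                                              ≡⟨ common-sym (mult B C) (mult B D) ⟩
    (mult B D ∸ mult B C) + (mult B C ∸ (mult B C ∸ mult B D)) ≡⟨ cong₂ _+_ (mult-∖ B D C) (common B) ⟨
    mult B (D ∖ C) + mult B (C ∖ (C ∖ D))                 ≡⟨ mult-++ B (D ∖ C) _ ⟨
    mult B ((D ∖ C) ++ (C ∖ (C ∖ D)))                     ∎

hit-disjoint : ∀ B {X Y} → ¬ (X ↭ Y) → hit B X ≡ 0 ⊎ hit B Y ≡ 0
hit-disjoint B {X} {Y} ¬p with X ↭? B
... | no _  = inj₁ refl
... | yes q = inj₂ (hit-no λ r → ¬p (↭-trans q (↭-sym r)))

∷↭-irrefl : ∀ {u : Item} {B B′} → B ↭ u ∷ B′ → ¬ (B ↭ B′)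
∷↭-irrefl p q = 1+n≢n (≡-trans (sym (↭-length p)) (↭-length q))

-- For each bunch, either both hits among the `X`s or both hits among the `Y`s vanish, so truncated
-- subtraction cancels exactly `R`.
∖-disjoint : ∀ {X₁ X₂ Y₁ Y₂ C D R} →
  ¬ (X₁ ↭ Y₁) → ¬ (X₁ ↭ Y₂) → ¬ (X₂ ↭ Y₁) → ¬ (X₂ ↭ Y₂) →
  C ≋ X₁ ∷ X₂ ∷ R → D ≋ Y₁ ∷ Y₂ ∷ R → C ∖ D ≋ X₁ ∷ X₂ ∷ []
∖-disjoint {X₁} {X₂} {Y₁} {Y₂} {C} {D} {R} ¬11 ¬12 ¬21 ¬22 p q = mult⇒≋ _ _ λ B → begin
  mult B (C ∖ D)      ≡⟨ mult-∖ B C D ⟩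
  mult B C ∸ mult B D ≡⟨ cong₂ _∸_ (mult-≋ B p) (mult-≋ B q) ⟩
  (hit B X₁ + (hit B X₂ + mult B R)) ∸ (hit B Y₁ + (hit B Y₂ + mult B R))
    ≡⟨ arith (hit B X₁) (hit B X₂) (hit B Y₁) (hit B Y₂) (mult B R)
         (hit-disjoint B ¬11) (hit-disjoint B ¬12) (hit-disjoint B ¬21) (hit-disjoint B ¬22) ⟩
  hit B X₁ + (hit B X₂ + 0) ∎
  where
  open ≡-Reasoning
  cancel : ∀ a b m → (a + (b + m)) ∸ m ≡ a + (b + 0)
  cancel a b m rewrite sym (+-assoc a b m) | m+n∸n≡m (a + b) m | +-identityʳ b = refl
  none : ∀ c e m → m ∸ (c + (e + m)) ≡ 0
  none c e m = m≤n⇒m∸n≡0 (≤-trans (m≤n+m m e) (m≤n+m (e + m) c))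
  arith : ∀ a b c e m → a ≡ 0 ⊎ c ≡ 0 → a ≡ 0 ⊎ e ≡ 0 → b ≡ 0 ⊎ c ≡ 0 → b ≡ 0 ⊎ e ≡ 0 →
    (a + (b + m)) ∸ (c + (e + m)) ≡ a + (b + 0)
  arith a b _ _ m (inj₂ refl) (inj₂ refl) _           _           = cancel a b m
  arith a b _ _ m _           _           (inj₂ refl) (inj₂ refl) = cancel a b m
  arith _ _ c e m (inj₁ refl) _           (inj₁ refl) _           = none c e m
  arith _ _ c e m (inj₁ refl) _           (inj₂ refl) (inj₁ refl) = none 0 e m
  arith _ _ c e m (inj₂ refl) (inj₁ refl) (inj₁ refl) _           = none 0 e m
  arith _ _ c e m (inj₂ refl) (inj₁ refl) (inj₂ refl) (inj₁ refl) = none 0 e m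

-- The only exception to adjacency is a donor that, without the item, equals the recipient: then the
-- two bunches merely trade places. Otherwise each old bunch differs from each new one; two of the
-- four comparisons are settled by length.
transfer⇒adjacent : ∀ {C D} → Transfer C D → C ≋ D ⊎ Adjacent C D
transfer⇒adjacent {C} {D} m with Transfer.donor′ m ↭? Transfer.recipient m
... | yes p = inj₁ (≋-trans source≋ (≋-trans (swap donor↭ (↭-sym p) ≋-refl) (≋-sym target≋)))
  where
  open Transfer m
  donor↭ : donor ↭ recipient′
  donor↭ = ↭-trans donate (↭-trans (↭-prep moved p) (↭-sym receive))
... | no ¬p = inj₂ record
  { removed = ∖-disjoint (∷↭-irrefl donate) ¬d↭r′ (¬p ∘ ↭-sym) (∷↭-irrefl receive ∘ ↭-sym) source≋ target≋
  ; added   = ∖-disjoint (∷↭-irrefl donate ∘ ↭-sym) ¬p (¬d↭r′ ∘ ↭-sym) (∷↭-irrefl receive) target≋ source≋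
  ; moved   = moved
  ; donate  = donate
  ; receive = receive
  }
  where
  open Transfer m
  ¬d↭r′ : ¬ (donor ↭ recipient′)
  ¬d↭r′ q = ¬p (drop-∷ (↭-trans (↭-sym donate) (↭-trans q receive)))

adjacent-sym : ∀ {C D} → Adjacent C D → Adjacent D C
adjacent-sym a = record
  { removed = ≋-trans added (≋-swap donor′ recipient′ ≋-refl)
  ; added   = ≋-trans removed (≋-swap donor recipient ≋-refl)
  ; moved   = moved
  ; donate  = receive
  ; receive = donate
  }
  where open Adjacent a

adjacent-respˡ : ∀ {C C′ D} → C ≋ C′ → Adjacent C D → Adjacent C′ D
adjacent-respˡ {D = D} p a = record
  { removed = ≋-trans (∖-cong (≋-sym p) (≋-refl {x = D})) removed
  ; added   = ≋-trans (∖-cong (≋-refl {x = D}) (≋-sym p)) added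
  ; moved   = moved
  ; donate  = donate
  ; receive = receive
  }
  where open Adjacent a

vol-↭ : ∀ {A B} → A ↭ B → vol A ≡ vol B
vol-↭ p = sum-↭ (↭-map⁺ size p)

vol-++ : ∀ A B → vol (A ++ B) ≡ vol A + vol B
vol-++ A B = ≡-trans (cong sum (map-++ size A B)) (sum-++ (map size A) (map size B))

-- Reconfiguration up to the order of lists

module Paths (κ : ℕ) where

  legal-≋ : ∀ {C D} → C ≋ D → Legal κ C → Legal κ D
  legal-≋ = ≋ₚ.All-resp-↭ λ p → ≤-trans (≤-reflexive (vol-↭ (↭-sym p)))

  infix 4 _⇉_
  _⇉_ : LegalConfiguration κ → LegalConfiguration κ → Set
  C ⇉ D = Adjacent (proj₁ C) (proj₁ D)

  -- Moves act on lists, so the end is fixed only up to `_≋_`. The legality of the start is an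
  -- argument, so that paths can be composed without matching proofs of legality.
  Path : Configuration → Configuration → Set
  Path C D = (l : Legal κ C) →
    Σ (LegalConfiguration κ) λ E → Star _⇉_ (C , l) E × proj₁ E ≋ D

  path-≋ : ∀ {C D} → C ≋ D → Path C D
  path-≋ p l = (_ , l) , ε , p

  -- Only the first move of a sequence mentions its start, so for another list of the same multiset
  -- just that move has to be adapted.
  replay : ∀ {C C′ E : LegalConfiguration κ} → proj₁ C ≋ proj₁ C′ → Star _⇉_ C E →
    Σ (LegalConfiguration κ) λ E′ → Star _⇉_ C′ E′ × proj₁ E′ ≋ proj₁ E
  replay {C′ = C′} p ε = C′ , ε , ≋-sym p
  replay p (a ◅ as) = _ , adjacent-respˡ p a ◅ as , ≋-refl

  infixr 5 _⊙_
  _⊙_ : ∀ {C D E} → Path C D → Path D E → Path C E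
  (P ⊙ Q) l with (D′ , l′) , as , p ← P l with E′ , bs , q ← Q (legal-≋ p l′)
    with E″ , cs , r ← replay (≋-sym p) bs = E″ , as ◅◅ cs , ≋-trans r q

  path-transfer : ∀ {C D} → Transfer C D → Legal κ D → Path C D
  path-transfer m l with transfer⇒adjacent m
  ... | inj₁ p = path-≋ p
  ... | inj₂ a = λ _ → (_ , l) , a ◅ ε , ≋-refl

  path-sym : ∀ {C D} → Legal κ C → Path C D → Path D C
  path-sym l P l′ with E , as , p ← P l = replay p (Star.reverse adjacent-sym as)

  donation : ∀ u A F R → Legal κ (A ∷ (u ∷ F) ∷ R) → Path ((u ∷ A) ∷ F ∷ R) (A ∷ (u ∷ F) ∷ R)
  donation u A F R = path-transfer record
    { source≋ = ≋-refl ; target≋ = ≋-refl ; donate = ↭-refl ; receive = ↭-refl }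

  -- The donor shrinks and every intermediate recipient is contained in the last one, so the single
  -- bound on `D ++ F` keeps all steps legal.
  pour : ∀ D A F R → vol (D ++ F) ≤ κ → Path ((D ++ A) ∷ F ∷ R) (A ∷ (D ++ F) ∷ R)
  pour []      A F R v = path-≋ ≋-refl
  pour (u ∷ D) A F R v l@(vA ∷ vF ∷ vR) =
    (donation u (D ++ A) F R (≤-trans (m≤n+m _ (size u)) vA ∷ vuF ∷ vR) ⊙
     pour D A (u ∷ F) R (≤-trans (≤-reflexive (vol-↭ (shift u D F))) v) ⊙
     path-≋ (≋-prep A (prep (shift u D F) ≋-refl))) l
    where
    vuF : vol (u ∷ F) ≤ κ
    vuF = ≤-trans (+-monoʳ-≤ (size u) (≤-trans (m≤n+m (vol F) (vol D)) (≤-reflexive (sym (vol-++ D F))))) v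

-- Bin packing with individual capacities

record Packing (caps : List ℕ) (items : List Item) : Set where
  field
    bins     : List (ℕ × Bunch)
    capacity : map proj₁ bins ≡ caps
    fits     : All (λ b → vol (proj₂ b) ≤ proj₁ b) bins
    packed   : concatMap proj₂ bins ↭ items

concatMap-↭ : ∀ {A B : Set} (f : A → List B) {xs ys} → xs ↭ ys → concatMap f xs ↭ concatMap f ys
concatMap-↭ f refl = refl
concatMap-↭ f (prep x p) = ++⁺ˡ (f x) (concatMap-↭ f p)
concatMap-↭ f (swap x y p) = ↭-trans (shifts (f x) (f y)) (++⁺ˡ (f y) (++⁺ˡ (f x) (concatMap-↭ f p)))
concatMap-↭ f (trans p q) = ↭-trans (concatMap-↭ f p) (concatMap-↭ f q)

mkItem : ℕ → Item
mkItem n = item (suc n)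

-- Swapping large 1 and large 2 takes a detour through the third bunch, which
-- has room for a second large item only when all the small items have left it
-- for the bunches with fillers; before that no large item or filler can move.
module Blockade (h : ℕ) where

  -- This leaves room 3 beside `Y₀`, room 7 beside `Z₀`, and room 5 in the third bunch when its
  -- small items have volume `h`. In `Sound` all small items have size at least 8, and so have the
  -- large ones, of size above `h`: none of these rooms can be used.
  κ : ℕ
  κ = 10 + 2 * h

  open Paths κ

  large : ℕ → Item
  large j = mkItem (j + h)

  -- For `c ≤ h` the size is `κ ∸ c`, so a bunch with this filler has room exactly `c`; and the
  -- filler is then larger than every large item in use.
  filler : ℕ → Item
  filler c = mkItem (9 + 2 * h ∸ c)

  layout : Bunch → Bunch → Bunch → List ℕ → Configuration
  layout Y Z items caps = Y ∷ Z ∷ (large 4 ∷ items) ∷ map (λ c → filler c ∷ []) caps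

  Y₀ Z₀ Y₁ Z₁ : Bunch
  Y₀ = large 3 ∷ large 2 ∷ []
  Z₀ = large 1 ∷ large 0 ∷ []
  Y₁ = large 3 ∷ large 1 ∷ []
  Z₁ = large 2 ∷ large 0 ∷ []

  source target : Bunch → List ℕ → Configuration
  source = layout Y₀ Z₀
  target = layout Y₁ Z₁

  filler-size : ∀ {c} → c ≤ h → size (filler c) + c ≡ κ
  filler-size {c} c≤h = cong suc (m∸n+n≡m (≤-trans c≤h (≤-trans (m≤m+n h (h + 0)) (m≤n+m (2 * h) 9))))

  large-pair : ∀ i j → i + j ≤ 8 → vol (large i ∷ large j ∷ []) ≤ κ
  large-pair i j i+j≤8 = begin
    suc (i + h) + (suc (j + h) + 0)  ≡⟨ regroup i j h ⟩
    2 + (i + j) + 2 * h              ≤⟨ +-monoˡ-≤ (2 * h) (+-monoʳ-≤ 2 i+j≤8) ⟩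
    κ                                ∎
    where
    open ≤-Reasoning
    regroup : ∀ i j h → suc (i + h) + (suc (j + h) + 0) ≡ 2 + (i + j) + 2 * h
    regroup = solve-∀

  -- From a packing to a reconfiguration

  module Complete {caps items} (caps≤h : All (_≤ h) caps) (packing : Packing caps items)
    where

    open Packing packing

    empty full : ℕ × Bunch → Bunch
    empty (c , D) = filler c ∷ []
    full  (c , D) = D ++ filler c ∷ []

    full-vol : ∀ {b} → proj₁ b ≤ h → vol (proj₂ b) ≤ proj₁ b → vol (full b) ≤ κ
    full-vol {c , D} c≤h v = begin
      vol (D ++ filler c ∷ [])        ≡⟨ vol-++ D (filler c ∷ []) ⟩
      vol D + (size (filler c) + 0)   ≤⟨ +-monoˡ-≤ _ v ⟩
      c + (size (filler c) + 0)       ≡⟨ cong (c +_) (+-identityʳ _) ⟩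
      c + size (filler c)             ≡⟨ +-comm c _ ⟩
      size (filler c) + c             ≡⟨ filler-size c≤h ⟩
      κ                               ∎
      where open ≤-Reasoning

    small : All (λ b → proj₁ b ≤ h) bins
    small = All.map⁻ (subst (All (_≤ h)) (sym capacity) caps≤h)

    full-legal : Legal κ (map full bins)
    full-legal = All.map⁺ (All.zipWith (λ { {b} (c≤h , v) → full-vol {b} c≤h v }) (small , fits))

    pourAll : ∀ bs A R → Legal κ (map full bs) →
      Path ((concatMap proj₂ bs ++ A) ∷ map empty bs ++ R) (A ∷ map full bs ++ R)
    pourAll []             A R []       = path-≋ ≋-refl
    pourAll ((c , D) ∷ bs) A R (v ∷ vs) =
      path-≋ (prep (↭-reflexive (++-assoc D _ A)) ≋-refl) ⊙
      pour D (concatMap proj₂ bs ++ A) (filler c ∷ []) (map empty bs ++ R) v ⊙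
      path-≋ (≋-prep _ (≋-sym (≋ₚ.↭-shift (map empty bs) R))) ⊙
      pourAll bs A (full (c , D) ∷ R) vs ⊙
      path-≋ (≋-prep _ (≋ₚ.↭-shift (map full bs) R))

    loaded : Bunch → Bunch → Configuration
    loaded Y Z = (large 4 ∷ []) ∷ map full bins ++ Y ∷ Z ∷ []

    layout≋ : ∀ Y Z → layout Y Z items caps ≋ (concatMap proj₂ bins ++ large 4 ∷ []) ∷ map empty bins ++ Y ∷ Z ∷ []
    layout≋ Y Z = subst (λ F → Y ∷ Z ∷ (large 4 ∷ items) ∷ F ≋ X ∷ map empty bins ++ Y ∷ Z ∷ [])
      (≡-trans (map-∘ bins) (cong (map _) capacity))
      (≋-trans (≋ₚ.++-comm (Y ∷ Z ∷ []) ((large 4 ∷ items) ∷ map empty bins)) (prep X↭ ≋-refl))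
      where
      X : Bunch
      X = concatMap proj₂ bins ++ large 4 ∷ []
      X↭ : large 4 ∷ items ↭ X
      X↭ = ↭-trans (↭-prep _ (↭-sym packed)) (++-comm (large 4 ∷ []) (concatMap proj₂ bins))

    load : ∀ Y Z → Path (layout Y Z items caps) (loaded Y Z)
    load Y Z = path-≋ (layout≋ Y Z) ⊙ pourAll bins (large 4 ∷ []) (Y ∷ Z ∷ []) full-legal

    loaded≋ : ∀ Y Z → loaded Y Z ≋ (large 4 ∷ []) ∷ Y ∷ Z ∷ map full bins
    loaded≋ Y Z = ≋-prep _ (≋ₚ.++-comm (map full bins) (Y ∷ Z ∷ []))

    large-legal : ∀ i → i ≤ 4 → vol (large i ∷ []) ≤ κ
    large-legal i i≤4 = ≤-trans (≤-reflexive (+-identityʳ _)) (≤-trans (m≤m+n _ _)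
      (large-pair i 0 (≤-trans (≤-reflexive (+-identityʳ i)) (≤-trans i≤4 (m≤m+n 4 4)))))

    -- `large 2` waits beside `large 4` while `large 1` joins `large 3`; then it takes the vacated
    -- place beside `large 0`.
    exchange : Path (loaded Y₀ Z₀) (loaded Y₁ Z₁)
    exchange =
      path-≋ (≋-trans (loaded≋ Y₀ Z₀) (swap ↭-refl (↭-swap _ _ ↭-refl) ≋-refl)) ⊙
      donation (large 2) (large 3 ∷ []) (large 4 ∷ []) (Z₀ ∷ F)
        (large-legal 3 (m≤m+n 3 1) ∷ large-pair 2 4 (m≤m+n 6 2) ∷ large-pair 1 0 (m≤m+n 1 7) ∷ full-legal) ⊙
      path-≋ (≋-trans (≋-prep _ (≋-swap _ _ ≋-refl)) (≋-swap _ _ ≋-refl)) ⊙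
      donation (large 1) (large 0 ∷ []) (large 3 ∷ []) ((large 2 ∷ large 4 ∷ []) ∷ F)
        (large-legal 0 z≤n ∷ large-pair 1 3 (m≤m+n 4 4) ∷ large-pair 2 4 (m≤m+n 6 2) ∷ full-legal) ⊙
      path-≋ (≋-trans (≋-prep _ (≋-swap _ _ ≋-refl)) (≋-trans (≋-swap _ _ ≋-refl) (≋-prep _ ≋-refl))) ⊙
      donation (large 2) (large 4 ∷ []) (large 0 ∷ []) ((large 1 ∷ large 3 ∷ []) ∷ F)
        (large-legal 4 ≤-refl ∷ large-pair 2 0 (m≤m+n 2 6) ∷ large-pair 1 3 (m≤m+n 4 4) ∷ full-legal) ⊙
      path-≋ (≋-trans (≋-prep _ (swap ↭-refl (↭-swap _ _ ↭-refl) ≋-refl)) (≋-sym (loaded≋ Y₁ Z₁)))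
      where
      F : Configuration
      F = map full bins

    -- Moves are reversible: the small items return to `large 4` along the path that would load them
    -- from the target, read backwards.
    reconfigure : Legal κ (target items caps) → Path (source items caps) (target items caps)
    reconfigure l = load Y₀ Z₀ ⊙ exchange ⊙ path-sym l (load Y₁ Z₁)

  -- From a reconfiguration to a packing

  join : Bunch × Bunch → Bunch
  join (K , D) = K ++ D

  cores : List ℕ → List Bunch
  cores caps = Y₀ ∷ Z₀ ∷ (large 4 ∷ []) ∷ map (λ c → filler c ∷ []) caps

  -- The invariant that holds until a packing shows up: each bunch consists of a core, the large
  -- items or the filler that it has in the source, and of small items, which may wander.
  record Blocked (items : Bunch) (caps : List ℕ) (C : Configuration) : Set where
    field
      parts : List (Bunch × Bunch)
      shape : C ≋ map join parts
      core  : map proj₁ parts ↭ cores caps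
      loose : concatMap proj₂ parts ↭ items

  module _ {A : Set} {f : A → Bunch} {B : Bunch} where

    ∈-map-↭⁻ : ∀ xs → Any (B ↭_) (map f xs) → ∃[ x ] (x ∈ xs × B ↭ f x)
    ∈-map-↭⁻ (x ∷ xs) (here q)  = x , here refl , q
    ∈-map-↭⁻ (x ∷ xs) (there q) with y , y∈ , r ← ∈-map-↭⁻ xs q = y , there y∈ , r

    ≋-map-∷ : ∀ {C} xs → B ∷ C ≋ map f xs →
      ∃[ x ] ∃[ xs′ ] (xs ↭ x ∷ xs′ × B ↭ f x × C ≋ map f xs′)
    ≋-map-∷ {C} xs p with x , x∈ , B↭ ← ∈-map-↭⁻ xs (≋ₚ.∈-resp-↭ p (here ↭-refl))
      with as , bs , refl ← ∈-∃++ x∈ =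
      x , as ++ bs , shift x as bs , B↭ ,
      subst (C ≋_) (sym (map-++ f as bs)) (≋ₚ.drop-∷ (≋-trans
        (subst (B ∷ C ≋_) (map-++ f as (x ∷ bs)) p)
        (≋-trans (≋ₚ.↭-shift (map f as) (map f bs)) (prep (↭-sym B↭) ≋-refl))))

  module Sound {caps items} (7≤h : 7 ≤ h) (caps≤h : All (_≤ h) caps)
    (8≤items : All (λ u → 8 ≤ size u) items) where

    core-big : All (All (λ u → suc h ≤ size u)) (cores caps)
    core-big = (big 3 ∷ big 2 ∷ []) ∷ (big 1 ∷ big 0 ∷ []) ∷ (big 4 ∷ []) ∷
      All.map⁺ (All.map (λ {c} c≤h → filler-big c≤h ∷ []) caps≤h)
      where
      big : ∀ j → suc h ≤ suc (j + h)
      big j = s≤s (m≤n+m h j)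
      filler-big : ∀ {c} → c ≤ h → suc h ≤ size (filler c)
      filler-big {c} c≤h = +-cancelʳ-≤ c _ _ (begin
        suc h + c            ≤⟨ +-monoʳ-≤ (suc h) c≤h ⟩
        suc h + h            ≤⟨ m≤n+m (suc h + h) 9 ⟩
        9 + (suc h + h)      ≡⟨ cong (10 +_) (cong (h +_) (sym (+-identityʳ h))) ⟩
        κ                    ≡⟨ filler-size c≤h ⟨
        size (filler c) + c  ∎)
        where open ≤-Reasoning

    no-loose : ∀ {D} → All (_∈ items) D → vol D ≤ 7 → D ≡ []
    no-loose {[]}    []       v = refl
    no-loose {u ∷ D} (u∈ ∷ _) v =
      contradiction (≤-trans (All.lookup 8≤items u∈) (≤-trans (m≤m+n _ _) v)) 1+n≰n

    -- Beyond `3 + 2 * h`, the volume of `Z₀`, the capacity leaves 7, one less than the least size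
    -- of a small item.
    slack : ∀ K D {a} → 3 + 2 * h + a ≤ vol K → vol (K ++ D) ≤ κ → a + vol D ≤ 7
    slack K D {a} K≥ v = +-cancelˡ-≤ (3 + 2 * h) _ _ (begin
      3 + 2 * h + (a + vol D)  ≡⟨ +-assoc (3 + 2 * h) a (vol D) ⟨
      3 + 2 * h + a + vol D    ≤⟨ +-monoˡ-≤ (vol D) K≥ ⟩
      vol K + vol D            ≡⟨ vol-++ K D ⟨
      vol (K ++ D)             ≤⟨ v ⟩
      κ                        ≡⟨ shuffle h ⟩
      3 + 2 * h + 7            ∎)
      where
      open ≤-Reasoning
      shuffle : ∀ h → 10 + 2 * h ≡ 3 + 2 * h + 7
      shuffle = solve-∀

    unblock : ∀ {fs} → map proj₁ fs ≡ map (λ c → filler c ∷ []) caps →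
      Legal κ (map join fs) → concatMap proj₂ fs ↭ items → Packing caps items
    unblock {fs} eq l p = record
      { bins = proj₁ r ; capacity = proj₁ (proj₂ r) ; fits = proj₁ (proj₂ (proj₂ r))
      ; packed = subst (_↭ items) (sym (proj₂ (proj₂ (proj₂ r)))) p }
      where
      go : ∀ cs fs → All (_≤ h) cs → map proj₁ fs ≡ map (λ c → filler c ∷ []) cs → Legal κ (map join fs) →
        Σ (List (ℕ × Bunch)) λ bs → map proj₁ bs ≡ cs × All (λ b → vol (proj₂ b) ≤ proj₁ b) bs ×
          concatMap proj₂ bs ≡ concatMap proj₂ fs
      go [] [] _ _ _ = [] , refl , [] , refl
      go (c ∷ cs) ((_ , D) ∷ fs) (c≤h ∷ cs≤h) eq (v ∷ vs) with refl , eq′ ← ∷-injective eq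
        with bs , eq₁ , fit , eq₂ ← go cs fs cs≤h eq′ vs =
        (c , D) ∷ bs , cong (c ∷_) eq₁ ,
        +-cancelˡ-≤ (size (filler c)) _ _ (≤-trans v (≤-reflexive (sym (filler-size c≤h)))) ∷ fit ,
        cong (D ++_) eq₂
      r = go caps fs caps≤h eq l

    all-loose : ∀ (fs : List (Bunch × Bunch)) → concatMap proj₂ fs ↭ items →
      ∀ {f} → f ∈ fs → All (_∈ items) (proj₂ f)
    all-loose _ p f∈ = All.tabulate λ u∈ → ∈-resp-↭ p (∈-concatMap⁺ proj₂ (lose f∈ u∈))

    Y-vol : ∀ h → 3 + 2 * h + 4 ≡ suc (3 + h) + (suc (2 + h) + 0)
    Y-vol = solve-∀

    Z-vol : ∀ h → 3 + 2 * h + 0 ≡ suc (1 + h) + (suc (0 + h) + 0)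
    Z-vol = solve-∀

    module _ {u} (big : suc h ≤ size u) where

      too-big : ∀ K D → 3 + 2 * h + 8 ≤ size u + vol K → ¬ (vol (u ∷ K ++ D) ≤ κ)
      too-big K D e v = contradiction (≤-trans (m≤m+n 8 (vol D)) (slack (u ∷ K) D {8} e v)) 1+n≰n

      too-big₀ : ∀ K D → 3 + 2 * h ≤ vol K → ¬ (vol (u ∷ K ++ D) ≤ κ)
      too-big₀ K D e = too-big K D (≤-trans (≤-reflexive (+-comm (3 + 2 * h) 8))
        (+-mono-≤ (≤-trans (s≤s 7≤h) big) e))

      -- The recipient of a large item or a filler can only be the bunch of large 4.
      vacant : ∀ {K D} → K ∈ cores caps → All (_∈ items) D → vol (u ∷ K ++ D) ≤ κ →
        K ≡ large 4 ∷ [] × D ≡ []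
      vacant {D = D} (here refl) _ v = contradiction v
        (too-big₀ Y₀ D (≤-trans (m≤m+n _ 4) (≤-reflexive (Y-vol h))))
      vacant {D = D} (there (here refl)) _ v = contradiction v
        (too-big₀ Z₀ D (≤-trans (m≤m+n _ 0) (≤-reflexive (Z-vol h))))
      vacant {D = D} (there (there (here refl))) D⊆ v =
        refl , no-loose D⊆ (≤-trans (m≤n+m _ 3) (slack (u ∷ large 4 ∷ []) D {3} (begin
          3 + 2 * h + 3          ≡⟨ X-vol h ⟩
          suc h + (5 + h + 0)    ≤⟨ +-monoˡ-≤ _ big ⟩
          size u + (5 + h + 0)   ∎) v))
        where
        open ≤-Reasoning
        X-vol : ∀ h → 3 + 2 * h + 3 ≡ suc h + (5 + h + 0)
        X-vol = solve-∀
      vacant {D = D} (there (there (there K∈))) _ v with c , c∈ , refl ← ∈-map⁻ _ K∈ =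
        contradiction v (too-big (filler c ∷ []) D (+-cancelʳ-≤ c _ _ (begin
          3 + 2 * h + 8 + c                        ≤⟨ +-monoʳ-≤ (3 + 2 * h + 8) (All.lookup caps≤h c∈) ⟩
          3 + 2 * h + 8 + h                        ≡⟨ F-vol h ⟩
          suc h + κ                                ≤⟨ +-monoˡ-≤ κ big ⟩
          size u + κ                               ≡⟨ cong (size u +_) (filler-size (All.lookup caps≤h c∈)) ⟨
          size u + (size (filler c) + c)           ≡⟨ +-assoc (size u) _ c ⟨
          size u + size (filler c) + c             ≡⟨ cong (λ k → size u + k + c) (+-identityʳ _) ⟨
          size u + (size (filler c) + 0) + c       ∎)))
        where
        open ≤-Reasoning
        F-vol : ∀ h → 3 + 2 * h + 8 + h ≡ suc h + (10 + 2 * h)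
        F-vol = solve-∀

    -- The bunch of `large 4` has no small items, and beside `Y₀` and `Z₀` there is no room for any.
    -- Hence all of them lie in the bunches with fillers, which is a packing.
    free : ∀ {C} (parts : List (Bunch × Bunch)) → C ≋ map join parts → map proj₁ parts ≡ cores caps →
      concatMap proj₂ parts ↭ items → Legal κ C → (large 4 ∷ [] , []) ∈ parts → Packing caps items
    free {C} ((Y , D₁) ∷ (Z , D₂) ∷ (X , D₃) ∷ fs) shape eq p l m
      with refl , eq₁ ← ∷-injective eq
      with refl , eq₂ ← ∷-injective eq₁
      with refl , eq₃ ← ∷-injective eq₂
      with v₁ ∷ v₂ ∷ v₃ ∷ vs ← legal-≋ shape l
      with no-loose {D₁} (all-loose ((Y₀ , D₁) ∷ (Z₀ , D₂) ∷ (X , D₃) ∷ fs) p (here refl))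
                    (≤-trans (m≤n+m _ 4) (slack Y₀ D₁ {4} (≤-reflexive (Y-vol h)) v₁))
         | no-loose {D₂} (all-loose ((Y₀ , D₁) ∷ (Z₀ , D₂) ∷ (X , D₃) ∷ fs) p (there (here refl)))
                    (slack Z₀ D₂ {0} (≤-reflexive (Z-vol h)) v₂)
         | m
    ... | refl | refl | there (there (here refl)) = unblock eq₃ vs p
    ... | refl | refl | there (there (there m′)) = ⊥-elim (no-large eq₃ m′)
      where
      arith : ∀ h → 10 + 2 * h ≡ 5 + (5 + h + h)
      arith = solve-∀
      -- A filler has size at least `10 + h`, but `large 4` only `5 + h`.
      no-large : map proj₁ fs ≡ map (λ c → filler c ∷ []) caps → ¬ ((large 4 ∷ [] , []) ∈ fs)
      no-large eq m with c , c∈ , e ← ∈-map⁻ _ (subst ((large 4 ∷ []) ∈_) eq (∈-map⁺ proj₁ m)) =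
        m+1+n≰m (5 + h + h) (begin
          5 + h + h + 5        ≡⟨ +-comm (5 + h + h) 5 ⟩
          5 + (5 + h + h)      ≡⟨ arith h ⟨
          κ                    ≡⟨ filler-size c≤h ⟨
          size (filler c) + c  ≡⟨ cong (λ u → size u + c) (proj₁ (∷-injective e)) ⟨
          5 + h + c            ≤⟨ +-monoʳ-≤ (5 + h) c≤h ⟩
          5 + h + h            ∎)
        where
        open ≤-Reasoning
        c≤h : c ≤ h
        c≤h = All.lookup caps≤h c∈

    module _ {C D} (b : Blocked items caps C) (lC : Legal κ C) (lD : Legal κ D) (a : Adjacent C D) where

      open Blocked b
      open Transfer (adjacent⇒transfer a)

      -- If the moved item belongs to a core, its recipient must be `large 4` without small items,
      -- and the configuration before the move already contains a packing. If it is a small item,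
      -- the cores stay as they are.
      step : Packing caps items ⊎ Blocked items caps D
      step
        with (K₁ , D₁) , ps₁ , p₁ , d↭ , q₁ ← ≋-map-∷ parts (≋-trans (≋-sym source≋) shape)
        with (K₂ , D₂) , ps₂ , p₂ , r↭ , q₂ ← ≋-map-∷ ps₁ q₁
        with p ← ↭-trans p₁ (↭-prep (K₁ , D₁) p₂)
        with loose′ ← ↭-trans (↭-sym (concatMap-↭ proj₂ p)) loose
        with core′ ← ↭-trans (↭-sym (↭-map⁺ proj₁ p)) core
        with ∈-++⁻ K₁ (∈-resp-↭ (↭-trans (↭-sym donate) d↭) (here refl))
      ... | inj₁ u∈K with parts₀ , eq , r ← ↭-map-inv proj₁ core
        with refl , refl ← vacant {moved} (All.lookup (All.lookup core-big (∈-resp-↭ core′ (here refl))) u∈K) {K₂} {D₂}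
               (∈-resp-↭ core′ (there (here refl))) (all-loose ((K₁ , D₁) ∷ (K₂ , D₂) ∷ ps₂) loose′ (there (here refl)))
               (≤-trans (≤-reflexive (vol-↭ (↭-trans (↭-prep moved (↭-sym r↭)) (↭-sym receive))))
                 (All.lookup (legal-≋ target≋ lD) (there (here refl)))) =
        inj₁ (free parts₀ (≋-trans shape (↭⇒↭ₛ′ ↭-isEquivalence (↭-map⁺ join r))) (sym eq)
          (↭-trans (↭-sym (concatMap-↭ proj₂ r)) loose) lC
          (∈-resp-↭ r (∈-resp-↭ (↭-sym p) (there (here refl)))))
      ... | inj₂ u∈D with as , bs , refl ← ∈-∃++ u∈D = inj₂ record
        { parts = (K₁ , as ++ bs) ∷ (K₂ , moved ∷ D₂) ∷ ps₂
        ; shape = ≋-trans target≋ (prep donor′↭ (prep recipient′↭ q₂))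
        ; core  = core′
        ; loose = ↭-trans loose↭ loose′
        }
        where
        donor′↭ : donor′ ↭ K₁ ++ as ++ bs
        donor′↭ = drop-∷ (↭-trans (↭-sym donate) (↭-trans d↭ (↭-trans
          (++⁺ˡ K₁ (shift moved as bs)) (shift moved K₁ (as ++ bs)))))
        recipient′↭ : recipient′ ↭ K₂ ++ moved ∷ D₂
        recipient′↭ = ↭-trans receive (↭-trans (↭-prep moved r↭) (↭-sym (shift moved K₂ D₂)))
        loose↭ : (as ++ bs) ++ moved ∷ D₂ ++ concatMap proj₂ ps₂ ↭ (as ++ moved ∷ bs) ++ D₂ ++ concatMap proj₂ ps₂
        loose↭ = ↭-trans (shift moved (as ++ bs) _) (++⁺ʳ (D₂ ++ concatMap proj₂ ps₂) (↭-sym (shift moved as bs)))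

    run-blocked : ∀ {C D : LegalConfiguration κ} → Blocked items caps (proj₁ C) → Star _⇉_ C D →
      Packing caps items ⊎ Blocked items caps (proj₁ D)
    run-blocked b ε = inj₂ b
    run-blocked {C} b (_◅_ {j = D} a as) =
      [ inj₁ , (λ b′ → run-blocked b′ as) ]′ (step b (proj₂ C) (proj₂ D) a)

    source-blocked : Blocked items caps (source items caps)
    source-blocked = record
      { parts = (Y₀ , []) ∷ (Z₀ , []) ∷ (large 4 ∷ [] , items) ∷ map unfilled caps
      ; shape = ≋-prep Y₀ (≋-prep Z₀ (≋-prep (large 4 ∷ items) (≋-reflexive shape-eq)))
      ; core  = ↭-prep Y₀ (↭-prep Z₀ (↭-prep (large 4 ∷ []) (↭-reflexive core-eq)))
      ; loose = ↭-reflexive (≡-trans (cong (items ++_) (none caps)) (++-identityʳ items))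
      }
      where
      unfilled : ℕ → Bunch × Bunch
      unfilled c = filler c ∷ [] , []
      shape-eq : map (λ c → filler c ∷ []) caps ≡ map join (map unfilled caps)
      shape-eq = map-∘ caps
      core-eq : map proj₁ (map unfilled caps) ≡ map (λ c → filler c ∷ []) caps
      core-eq = sym (map-∘ caps)
      none : ∀ cs → concatMap proj₂ (map unfilled cs) ≡ []
      none []       = refl
      none (c ∷ cs) = none cs

    -- No core of the source fits into `Y₁`: `Y₀`, `Z₀` and the third core contain the foreign items
    -- `large 2`, `large 0` and `large 4`, and a filler is too large.
    target-not-blocked : ∀ {items′} → ¬ Blocked items caps (target items′ caps)
    target-not-blocked b with ∈-map-↭⁻ (Blocked.parts b) (≋ₚ.∈-resp-↭ (Blocked.shape b) (here ↭-refl))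
    ... | (K , D) , KD∈ , p with ∈-resp-↭ (Blocked.core b) (∈-map⁺ proj₁ KD∈)
    ... | here refl with ∈-resp-↭ (↭-sym p) (there (here refl))
    ...   | here e         = contradiction (cong size e) λ ()
    ...   | there (here e) = contradiction (cong size e) λ ()
    target-not-blocked b | (K , D) , KD∈ , p | there (here refl) with ∈-resp-↭ (↭-sym p) (there (here refl))
    ...   | here e         = contradiction (cong size e) λ ()
    ...   | there (here e) = contradiction (cong size e) λ ()
    target-not-blocked b | (K , D) , KD∈ , p | there (there (here refl)) with ∈-resp-↭ (↭-sym p) (here refl)
    ...   | here e         = contradiction (cong size e) λ ()
    ...   | there (here e) = contradiction (cong size e) λ ()
    target-not-blocked b | (K , D) , KD∈ , p | there (there (there K∈)) with c , c∈ , refl ← ∈-map⁻ _ K∈ =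
      contradiction (All.lookup sizes (∈-resp-↭ (↭-sym p) (here refl))) (<⇒≱ (+-cancelʳ-≤ c _ _ (begin
        5 + h + c            ≤⟨ +-monoʳ-≤ (5 + h) (All.lookup caps≤h c∈) ⟩
        5 + h + h            ≤⟨ m≤n+m (5 + h + h) 5 ⟩
        5 + (5 + h + h)      ≡⟨ cong (λ k → 10 + (h + k)) (+-identityʳ h) ⟨
        κ                    ≡⟨ filler-size (All.lookup caps≤h c∈) ⟨
        size (filler c) + c  ∎)))
      where
      open ≤-Reasoning
      sizes : All (λ u → size u ≤ 4 + h) Y₁
      sizes = ≤-refl ∷ m≤n+m _ 2 ∷ []

    packable : ∀ {C D : LegalConfiguration κ} → Reconfigurable κ C D →
      proj₁ C ≡ source items caps → proj₁ D ≡ target items caps → Packing caps items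
    packable (E , as , q) refl refl =
      [ id , (λ b → let open Blocked b in ⊥-elim (target-not-blocked record
        { parts = parts ; shape = ≋-trans (≋-sym q) shape ; core = core ; loose = loose })) ]′
      (run-blocked source-blocked as)

  layout-legal : ∀ {Y Z items caps} → vol Y ≤ κ → vol Z ≤ κ → vol items ≤ h → All (_≤ h) caps → Legal κ (layout Y Z items caps)
  layout-legal {items = items} vY vZ vi caps≤h = vY ∷ vZ ∷ X-legal ∷ All.map⁺ (All.map filler-legal caps≤h)
    where
    X-legal : 5 + h + vol items ≤ κ
    X-legal = ≤-trans (+-monoʳ-≤ (5 + h) vi) (≤-trans (m≤n+m _ 5) (≤-reflexive (regroup h)))
      where
      regroup : ∀ h → 5 + (5 + h + h) ≡ 10 + 2 * h
      regroup = solve-∀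
    filler-legal : ∀ {c} → c ≤ h → size (filler c) + 0 ≤ κ
    filler-legal {c} c≤h = ≤-trans (≤-reflexive (+-identityʳ _)) (≤-trans (m≤m+n _ c) (≤-reflexive (filler-size c≤h)))

  source-legal : ∀ {items caps} → vol items ≤ h → All (_≤ h) caps → Legal κ (source items caps)
  source-legal = layout-legal (large-pair 3 2 (m≤m+n 5 3)) (large-pair 1 0 (m≤m+n 1 7))

  target-legal : ∀ {items caps} → vol items ≤ h → All (_≤ h) caps → Legal κ (target items caps)
  target-legal = layout-legal (large-pair 3 1 (m≤m+n 4 4)) (large-pair 2 0 (m≤m+n 2 6))

-- Instances are determined by their encodings

-- Membership in `language` provides some instance with the given encoding; decoding level by level
-- identifies it with the intended one.
PrefixFree : {A : Set} → (A → List Bool) → Set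
PrefixFree e = ∀ a b {u v} → e a ++ u ≡ e b ++ v → a ≡ b × u ≡ v

unary-prefix : PrefixFree unary
unary-prefix zero    zero    refl = refl , refl
unary-prefix (suc m) (suc n) eq with refl , p ← unary-prefix m n (∷-injectiveʳ eq) = refl , p

encodeList-prefix : ∀ {A : Set} {e : A → List Bool} → PrefixFree e → PrefixFree (encodeList e)
encodeList-prefix p []       []       refl = refl , refl
encodeList-prefix {e = e} p (a ∷ as) (b ∷ bs) {u} {v} eq
  with refl , q ← p a b (≡-trans (sym (++-assoc (e a) (encodeList e as) u)) (≡-trans (∷-injectiveʳ eq) (++-assoc (e b) (encodeList e bs) v)))
  with refl , r ← encodeList-prefix p as bs q = refl , r

item-prefix : PrefixFree (λ u → unary (size u))
item-prefix (item m) (item n) eq with refl , p ← unary-prefix m n eq = refl , p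

configuration-prefix : PrefixFree (encodeList (encodeList (λ u → unary (size u))))
configuration-prefix = encodeList-prefix (encodeList-prefix item-prefix)

encodeRepacking : RepackingInstance → List Bool
encodeRepacking = DecisionProblem.encode Repacking unary

module _ (I J : RepackingInstance) where

  private
    module I = RepackingInstance I
    module J = RepackingInstance J

  encoding-injective : encodeRepacking I ≡ encodeRepacking J →
    I.capacity ≡ J.capacity × proj₁ I.source ≡ proj₁ J.source × proj₁ I.target ≡ proj₁ J.target
  encoding-injective eq
    with c , eq₁ ← unary-prefix I.capacity J.capacity eq
    with s , eq₂ ← configuration-prefix (proj₁ I.source) (proj₁ J.source) eq₁
    with t , _ ← configuration-prefix (proj₁ I.target) (proj₁ J.target) {[]} {[]}
      (≡-trans (++-identityʳ _) (≡-trans eq₂ (sym (++-identityʳ _)))) = c , s , t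

-- An instance with the same encoding may carry other proofs of legality, so the statement to be
-- applied must hold for all of them.
yes-elim : ∀ {A : Set} {κ C₀ D₀} →
  (∀ {C D : LegalConfiguration κ} → Reconfigurable κ C D → proj₁ C ≡ C₀ → proj₁ D ≡ D₀ → A) →
  ∀ I → RepackingInstance.capacity I ≡ κ → proj₁ (RepackingInstance.source I) ≡ C₀ → proj₁ (RepackingInstance.target I) ≡ D₀ →
  DecisionProblem.Yes Repacking I → A
yes-elim f I refl p q y = f {RepackingInstance.source I} {RepackingInstance.target I} y p q

-- Positional notation with digits given by (position, value) pairs

Digits : Set
Digits = List (ℕ × ℕ)

at : ℕ → ℕ × ℕ → ℕ
at j (i , v) = if i ≡ᵇ j then v else 0

column : ℕ → Digits → ℕ
column j xs = sum (map (at j) xs)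

column-≤ : ∀ j xs → column j xs ≤ sum (map proj₂ xs)
column-≤ j [] = z≤n
column-≤ j ((i , v) ∷ xs) with i ≡ᵇ j
... | true  = +-monoʳ-≤ v (column-≤ j xs)
... | false = ≤-trans (column-≤ j xs) (m≤n+m _ v)

lower : Digits → Digits
lower []                 = []
lower ((zero  , v) ∷ xs) = lower xs
lower ((suc j , v) ∷ xs) = (j , v) ∷ lower xs

column-lower : ∀ j xs → column j (lower xs) ≡ column (suc j) xs
column-lower j []                 = refl
column-lower j ((zero  , v) ∷ xs) = column-lower j xs
column-lower j ((suc i , v) ∷ xs) = cong (at j (i , v) +_) (column-lower j xs)

lower-bound : ∀ {K xs} → All (λ d → proj₁ d < suc K) xs → All (λ d → proj₁ d < K) (lower xs)
lower-bound []                                   = []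
lower-bound {xs = (zero  , v) ∷ xs} (_ ∷ bs)     = lower-bound bs
lower-bound {xs = (suc j , v) ∷ xs} (s≤s b ∷ bs) = b ∷ lower-bound bs

module Positional (X : ℕ) where

  value : Digits → ℕ
  value xs = sum (map (λ d → proj₂ d * X ^ proj₁ d) xs)

  value-lower : ∀ xs → value xs ≡ column 0 xs + value (lower xs) * X
  value-lower []                 = refl
  value-lower ((zero  , v) ∷ xs) =
    ≡-trans (cong₂ _+_ (*-identityʳ v) (value-lower xs)) (sym (+-assoc v _ _))
  value-lower ((suc j , v) ∷ xs) = begin
    v * (X * X ^ j) + value xs                               ≡⟨ cong (v * (X * X ^ j) +_) (value-lower xs) ⟩
    v * (X * X ^ j) + (column 0 xs + value (lower xs) * X)   ≡⟨ regroup v X (X ^ j) (column 0 xs) (value (lower xs)) ⟩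
    column 0 xs + (v * X ^ j + value (lower xs)) * X         ∎
    where
    open ≡-Reasoning
    regroup : ∀ v X Y c l → v * (X * Y) + (c + l * X) ≡ c + (v * Y + l) * X
    regroup = solve-∀

  NoCarry : Digits → Set
  NoCarry xs = ∀ j → column j xs < X

  no-carry-lower : ∀ {xs} → NoCarry xs → NoCarry (lower xs)
  no-carry-lower {xs} n j = subst (_< X) (sym (column-lower j xs)) (n (suc j))

  value-< : ∀ K {xs} → All (λ d → proj₁ d < K) xs → NoCarry xs → value xs < X ^ K
  value-< zero    []     n = s≤s z≤n
  value-< (suc K) {xs} b n = begin-strict
    value xs                               ≡⟨ value-lower xs ⟩
    column 0 xs + value (lower xs) * X     <⟨ +-monoˡ-< _ (n 0) ⟩
    suc (value (lower xs)) * X             ≤⟨ *-monoˡ-≤ X (value-< K (lower-bound b) (no-carry-lower {xs} n)) ⟩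
    X ^ K * X                              ≡⟨ *-comm (X ^ K) X ⟩
    X * X ^ K                              ∎
    where open ≤-Reasoning

  regroup-suc : ∀ a q X → a + q * X + X ≡ a + (X + q * X)
  regroup-suc = solve-∀

  divMod-unique : ∀ {a b} q r → a < X → b < X → a + q * X ≡ b + r * X → a ≡ b × q ≡ r
  divMod-unique zero    zero    a< b< eq = ≡-trans (sym (+-identityʳ _)) (≡-trans eq (+-identityʳ _)) , refl
  divMod-unique {a} {b} zero (suc r) a< b< eq = contradiction a< (≤⇒≯ (≤-trans (m≤m+n X (r * X))
    (≤-trans (m≤n+m _ b) (≤-reflexive (≡-trans (sym eq) (+-identityʳ a))))))
  divMod-unique {a} {b} (suc q) zero a< b< eq = contradiction b< (≤⇒≯ (≤-trans (m≤m+n X (q * X))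
    (≤-trans (m≤n+m _ a) (≤-reflexive (≡-trans eq (+-identityʳ b))))))
  divMod-unique {a} {b} (suc q) (suc r) a< b< eq
    with p , refl ← divMod-unique q r a< b< (+-cancelʳ-≡ X _ _ (≡-trans (regroup-suc a q X) (≡-trans eq (sym (regroup-suc b r X))))) =
    p , refl

  -- Without carries the lowest column is the remainder of the value modulo the base, and the value
  -- of `lower` is the quotient.
  digits-unique : ∀ K {xs ys} → All (λ d → proj₁ d < K) xs → All (λ d → proj₁ d < K) ys →
    NoCarry xs → NoCarry ys → value xs ≡ value ys → ∀ j → column j xs ≡ column j ys
  digits-unique zero [] [] n m eq j = refl
  digits-unique (suc K) {xs} {ys} b c n m eq
    with p , q ← divMod-unique (value (lower xs)) (value (lower ys)) (n 0) (m 0)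
           (≡-trans (sym (value-lower xs)) (≡-trans eq (value-lower ys))) = λ where
    zero    → p
    (suc j) → ≡-trans (sym (column-lower j xs)) (≡-trans
      (digits-unique K (lower-bound b) (lower-bound c) (no-carry-lower {xs} n) (no-carry-lower {ys} m) q j)
      (column-lower j ys))

sum-concatMap : ∀ {A B : Set} (g : B → ℕ) (f : A → List B) xs →
  sum (map g (concatMap f xs)) ≡ sum (map (λ x → sum (map g (f x))) xs)
sum-concatMap g f []       = refl
sum-concatMap g f (x ∷ xs) = ≡-trans (cong sum (map-++ g (f x) _))
  (≡-trans (sum-++ (map g (f x)) _) (cong (sum (map g (f x)) +_) (sum-concatMap g f xs)))

sum-map-+ : ∀ {A : Set} (f g : A → ℕ) xs → sum (map (λ x → f x + g x) xs) ≡ sum (map f xs) + sum (map g xs)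
sum-map-+ f g []       = refl
sum-map-+ f g (x ∷ xs) = ≡-trans (cong (f x + g x +_) (sum-map-+ f g xs)) (regroup (f x) (g x) _ _)
  where
  regroup : ∀ a b c d → a + b + (c + d) ≡ a + c + (b + d)
  regroup = solve-∀

sum-map-≤ : ∀ {A : Set} {f : A → ℕ} {b} xs → All (λ x → f x ≤ b) xs → sum (map f xs) ≤ length xs * b
sum-map-≤ []       []       = z≤n
sum-map-≤ (x ∷ xs) (p ∷ ps) = +-mono-≤ p (sum-map-≤ xs ps)

sum-map-≥ : ∀ {A : Set} {f : A → ℕ} {b} xs → All (λ x → b ≤ f x) xs → length xs * b ≤ sum (map f xs)
sum-map-≥ []       []       = z≤n
sum-map-≥ (x ∷ xs) (p ∷ ps) = +-mono-≤ p (sum-map-≥ xs ps)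

All-concatMap : ∀ {A B : Set} {P : B → Set} {f : A → List B} {xs} →
  All (λ x → All P (f x)) xs → All P (concatMap f xs)
All-concatMap ps = All.concat⁺ (All.map⁺ ps)

-- Item sizes made of an address and a flag

-- `most` bounds the number of items of a bin. By `roomy` no carries occur when up to `most` items,
-- each with digit sum at most `4 * addresses`, are added; one further such summand is reserved for
-- the flag total of the bin.
record Numbering (Class : Set) : Set₁ where
  field
    slots addresses base most : ℕ
    Valid     : Class → Set
    slot addr weight : Class → ℕ
    slot<     : ∀ {c} → Valid c → slot c < slots
    addr<     : ∀ {c} → Valid c → addr c < addresses
    weight≤   : ∀ {c} → Valid c → weight c ≤ addresses
    injective : ∀ {c c′} → Valid c → Valid c′ → slot c ≡ slot c′ → addr c ≡ addr c′ → c ≡ c′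
    roomy     : suc most * (4 * addresses) < base

module Sizes {Class : Set} (N : Numbering Class) where

  open Numbering N
  open Positional base public

  Flagged : Set
  Flagged = Class × Bool

  flag : Flagged → ℕ
  flag (c , f) = if f then weight c else 0

  -- Digits are at least addresses but below 2 * addresses, so a digit of a bin
  -- with distinct slots comes from a single item; the last digit counts items.
  address : Class → Digits
  address c = (suc (slot c) , addresses + addr c) ∷ (suc slots , 1) ∷ []

  digits : Flagged → Digits
  digits (c , f) = (0 , flag (c , f)) ∷ address c

  bulk : Class → ℕ
  bulk c = (addresses + addr c) * base ^ suc (slot c) + base ^ suc slots

  weigh : Flagged → ℕ
  weigh (c , f) = flag (c , f) + bulk c

  weigh-≥ : ∀ z → base ^ suc slots ≤ weigh z
  weigh-≥ z = ≤-trans (m≤n+m _ _) (m≤n+m _ (flag z))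

  bulk≡ : ∀ c → bulk c ≡ value (address c)
  bulk≡ c = cong ((addresses + addr c) * base ^ suc (slot c) +_)
    (sym (≡-trans (+-identityʳ _) (*-identityˡ (base ^ suc slots))))

  weigh≡ : ∀ z → weigh z ≡ value (digits z)
  weigh≡ (c , f) = cong₂ _+_ (sym (*-identityʳ (flag (c , f)))) (bulk≡ c)

  load : List Class → ℕ → Digits
  load cs t = (0 , t) ∷ concatMap address cs

  values : ∀ {A : Set} {g : A → ℕ} (f : A → Digits) → (∀ x → g x ≡ value (f x)) →
    ∀ xs → sum (map g xs) ≡ value (concatMap f xs)
  values f eq xs = ≡-trans (cong sum (map-cong eq xs)) (sym (sum-concatMap _ f xs))

  column-total : ∀ {A : Set} {f : A → Digits} {b} {xs : List A} → All (λ x → sum (map proj₂ (f x)) ≤ b) xs →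
    ∀ j → column j (concatMap f xs) ≤ length xs * b
  column-total {f = f} {b} {xs} ps j = ≤-trans (column-≤ j (concatMap f xs))
    (≤-trans (≤-reflexive (sum-concatMap proj₂ f xs)) (sum-map-≤ xs ps))

  slotSum : ℕ → List Class → ℕ
  slotSum j cs = sum (map (λ c → at j (slot c , addresses + addr c)) cs)

  at-same : ∀ j v → at j (j , v) ≡ v
  at-same zero    v = refl
  at-same (suc j) v = at-same j v

  at-other : ∀ {i j} v → i ≢ j → at j (i , v) ≡ 0
  at-other {zero}  {zero}  v i≢j = contradiction refl i≢j
  at-other {zero}  {suc j} v i≢j = refl
  at-other {suc i} {zero}  v i≢j = refl
  at-other {suc i} {suc j} v i≢j = at-other v (i≢j ∘ cong suc)

  column-slotSum : ∀ {j} → j < slots → ∀ cs → column (suc j) (concatMap address cs) ≡ slotSum j cs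
  column-slotSum j< []       = refl
  column-slotSum {j} j< (c ∷ cs) = cong (at j (slot c , addresses + addr c) +_)
    (cong₂ _+_ (at-other 1 (>⇒≢ j<)) (column-slotSum j< cs))

  slotSum-∈ : ∀ {x xs} → x ∈ xs → addresses + addr x ≤ slotSum (slot x) xs
  slotSum-∈ {x} (here refl) = ≤-trans (≤-reflexive (sym (at-same (slot x) _))) (m≤m+n _ _)
  slotSum-∈ (there x∈)      = ≤-trans (slotSum-∈ x∈) (m≤n+m _ _)

  slotSum-search : ∀ j xs → slotSum j xs ≡ 0 ⊎ ∃[ x ] (x ∈ xs × slot x ≡ j)
  slotSum-search j []       = inj₁ refl
  slotSum-search j (x ∷ xs) with slot x ℕ.≟ j
  ... | yes p = inj₂ (x , here refl , p)
  ... | no ¬p with slotSum-search j xs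
  ...   | inj₁ p            = inj₁ (cong₂ _+_ (at-other _ ¬p) p)
  ...   | inj₂ (y , y∈ , p) = inj₂ (y , there y∈ , p)

  slotSum-absent : ∀ {j ys} → All (λ y → j ≢ slot y) ys → slotSum j ys ≡ 0
  slotSum-absent []       = refl
  slotSum-absent (p ∷ ps) = cong₂ _+_ (at-other _ (p ∘ sym)) (slotSum-absent ps)

  -- In the slot of `y` the total is below `2 * addresses`, while every class in that slot
  -- contributes at least `addresses`. So exactly one of the `xs` is there, and it has the address
  -- of `y`.
  matching : ∀ xs ys → All Valid xs → All Valid ys → AllPairs (_≢_ on slot) ys →
    (∀ {j} → j < slots → slotSum j xs ≡ slotSum j ys) → xs ↭ ys
  matching []       []       _ _ _ _ = ↭-refl
  matching (x ∷ xs) []       (v ∷ _) _ _ eq = contradiction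
    (≤-trans (m≤m+n addresses (addr x)) (≤-trans (slotSum-∈ {x} {x ∷ xs} (here refl)) (≤-reflexive (eq (slot< v)))))
    (<⇒≱ (≤-trans (s≤s z≤n) (addr< v)))
  matching xs       (y ∷ ys) vs (w ∷ ws) (d ∷ ds) eq with slotSum-search (slot y) xs
  ... | inj₁ none = contradiction
    (≤-trans (m≤m+n addresses (addr y)) (≤-trans (slotSum-∈ {y} {y ∷ ys} (here refl)) (≤-reflexive (≡-trans (sym (eq (slot< w))) none))))
    (<⇒≱ (≤-trans (s≤s z≤n) (addr< w)))
  ... | inj₂ (x , x∈ , sx) with as , bs , refl ← ∈-∃++ x∈ =
    ↭-trans (shift x as bs) (subst (λ c → x ∷ as ++ bs ↭ c ∷ ys) x≡y (↭-prep x (matching (as ++ bs) ys (All.tail vs′) ws ds eq′)))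
    where
    vs′ : All Valid (x ∷ as ++ bs)
    vs′ = All-resp-↭ (shift x as bs) vs
    rest : ∀ {j} → j < slots → at j (slot x , addresses + addr x) + slotSum j (as ++ bs) ≡ slotSum j (y ∷ ys)
    rest j< = ≡-trans (sym (sum-↭ (↭-map⁺ _ (shift x as bs)))) (eq j<)
    in-slot : addresses + addr x + slotSum (slot y) (as ++ bs) ≡ addresses + addr y
    in-slot = begin
      addresses + addr x + slotSum (slot y) (as ++ bs)
        ≡⟨ cong (_+ slotSum (slot y) (as ++ bs)) (≡-trans (sym (at-same (slot y) _)) (cong (λ i → at (slot y) (i , _)) (sym sx))) ⟩
      at (slot y) (slot x , addresses + addr x) + slotSum (slot y) (as ++ bs)  ≡⟨ rest (slot< w) ⟩
      slotSum (slot y) (y ∷ ys)  ≡⟨ cong₂ _+_ (at-same (slot y) _) (slotSum-absent d) ⟩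
      addresses + addr y + 0     ≡⟨ +-identityʳ _ ⟩
      addresses + addr y         ∎
      where open ≡-Reasoning
    alone : slotSum (slot y) (as ++ bs) ≡ 0
    alone with slotSum-search (slot y) (as ++ bs)
    ... | inj₁ none            = none
    ... | inj₂ (u , u∈ , su) = contradiction (addr< w) (≤⇒≯ (+-cancelˡ-≤ addresses _ _ (begin
      addresses + addresses                                     ≤⟨ +-mono-≤ (m≤m+n addresses (addr x)) (m≤m+n addresses (addr u)) ⟩
      addresses + addr x + (addresses + addr u)                 ≤⟨ +-monoʳ-≤ (addresses + addr x) (slotSum-∈ u∈) ⟩
      addresses + addr x + slotSum (slot u) (as ++ bs)          ≡⟨ cong (λ j → addresses + addr x + slotSum j (as ++ bs)) su ⟩
      addresses + addr x + slotSum (slot y) (as ++ bs)          ≡⟨ in-slot ⟩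
      addresses + addr y                                        ∎)))
      where open ≤-Reasoning
    x≡y : x ≡ y
    x≡y = injective (All.head vs′) w sx (+-cancelˡ-≡ addresses _ _
      (≡-trans (sym (+-identityʳ _)) (≡-trans (cong (addresses + addr x +_) (sym alone)) in-slot)))
    eq′ : ∀ {j} → j < slots → slotSum j (as ++ bs) ≡ slotSum j ys
    eq′ {j} j< = +-cancelˡ-≡ (at j (slot x , addresses + addr x)) _ _
      (≡-trans (rest j<) (cong (λ c → at j (slot c , addresses + addr c) + slotSum j ys) (sym x≡y)))

  module Decode {zs cs t} (vz : All (Valid ∘ proj₁) zs) (vc : All Valid cs) (distinct : AllPairs (_≢_ on slot) cs)
    (short : length cs ≤ most) (t≤ : t ≤ addresses) (eq : sum (map weigh zs) ≡ t + sum (map bulk cs)) where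

    top : ℕ
    top = base ^ suc slots

    value-load : value (load cs t) ≡ t + sum (map bulk cs)
    value-load = cong₂ _+_ (*-identityʳ t) (sym (values address bulk≡ cs))

    lead : Class → ℕ × ℕ
    lead c = suc (slot c) , addresses + addr c

    bulk-split : ∀ cs → sum (map bulk cs) ≡ value (map lead cs) + length cs * top
    bulk-split []       = refl
    bulk-split (c ∷ cs) = ≡-trans (cong (bulk c +_) (bulk-split cs)) (regroup ((addresses + addr c) * base ^ suc (slot c)) top (value (map lead cs)) (length cs * top))
      where
      regroup : ∀ a b c d → a + b + (c + d) ≡ a + c + (b + d)
      regroup = solve-∀

    room : ∀ {n b} → n ≤ most → b ≤ 4 * addresses → t + n * b < base
    room {n} {b} n≤ b≤ = ≤-<-trans (+-mono-≤ (≤-trans t≤ (m≤m+n addresses _)) (*-mono-≤ n≤ b≤)) roomy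

    lead-total : ∀ {c} → Valid c → addresses + addr c ≤ 2 * addresses
    lead-total v = +-monoʳ-≤ addresses (≤-trans (<⇒≤ (addr< v)) (m≤m+n addresses 0))

    lead-value : t + value (map lead cs) < top
    lead-value = subst (_< top) (cong (_+ value (map lead cs)) (*-identityʳ t))
      (value-< (suc slots) (s≤s z≤n ∷ All.map⁺ (All.map (λ v → s≤s (slot< v)) vc)) no-carry)
      where
      leads : ∀ {cs} → All Valid cs → sum (map proj₂ (map lead cs)) ≤ length cs * (2 * addresses)
      leads []       = z≤n
      leads (v ∷ vs) = +-mono-≤ (lead-total v) (leads vs)
      no-carry : NoCarry ((0 , t) ∷ map lead cs)
      no-carry j = ≤-<-trans (column-≤ j ((0 , t) ∷ map lead cs))
        (≤-<-trans (+-monoʳ-≤ t (leads vc)) (room short (*-monoˡ-≤ addresses (m≤m+n 2 2))))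

    -- Comparing digits presupposes a bound on the number of items. It comes from the leading term:
    -- every item contributes `top`, and what the capacity contains besides its own multiples of
    -- `top` stays below `top`.
    zs-short : length zs ≤ length cs
    zs-short = ≤-pred (*-cancelʳ-< top _ _ (begin-strict
      length zs * top                                    ≤⟨ sum-map-≥ zs (All.tabulate λ {z} _ → ≤-trans (m≤n+m top _) (m≤n+m _ (flag z))) ⟩
      sum (map weigh zs)                                 ≡⟨ eq ⟩
      t + sum (map bulk cs)                              ≡⟨ cong (t +_) (bulk-split cs) ⟩
      t + (value (map lead cs) + length cs * top)        ≡⟨ +-assoc t _ _ ⟨
      t + value (map lead cs) + length cs * top          <⟨ +-monoˡ-< _ lead-value ⟩
      suc (length cs) * top                              ∎))
      where open ≤-Reasoning

    columns : ∀ j → column j (concatMap digits zs) ≡ column j (load cs t)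
    columns = digits-unique (suc (suc slots)) (All-concatMap (All.map (λ {z} → digits-< {z}) vz))
      (s≤s z≤n ∷ All-concatMap (All.map address-< vc))
      (λ j → ≤-<-trans (column-total {f = digits} (All.map (λ {z} → digits-total {z}) vz) j)
        (≤-<-trans (m≤n+m _ t) (room (≤-trans zs-short short) ≤-refl)))
      (λ j → ≤-<-trans (column-≤ j (load cs t)) (≤-<-trans (+-monoʳ-≤ t
        (≤-trans (≤-reflexive (sum-concatMap proj₂ address cs)) (sum-map-≤ cs (All.map address-total vc))))
        (room short (*-monoˡ-≤ addresses (m≤m+n 3 1)))))
      (≡-trans (sym (values digits weigh≡ zs)) (≡-trans eq (sym value-load)))
      where
      address-< : ∀ {c} → Valid c → All (λ d → proj₁ d < suc (suc slots)) (address c)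
      address-< v = s≤s (≤-trans (slot< v) (n≤1+n slots)) ∷ ≤-refl ∷ []
      digits-< : ∀ {z} → Valid (proj₁ z) → All (λ d → proj₁ d < suc (suc slots)) (digits z)
      digits-< v = s≤s z≤n ∷ address-< v
      address-total : ∀ {c} → Valid c → sum (map proj₂ (address c)) ≤ 3 * addresses
      address-total {c} v = begin
        addresses + addr c + 1         ≡⟨ +-assoc addresses (addr c) 1 ⟩
        addresses + (addr c + 1)       ≡⟨ cong (addresses +_) (+-comm (addr c) 1) ⟩
        addresses + suc (addr c)       ≤⟨ +-monoʳ-≤ addresses (≤-trans (addr< v) (m≤m+n _ _)) ⟩
        3 * addresses                  ∎
        where open ≤-Reasoning
      digits-total : ∀ {z} → Valid (proj₁ z) → sum (map proj₂ (digits z)) ≤ 4 * addresses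
      digits-total {c , true}  v = +-mono-≤ (weight≤ v) (address-total v)
      digits-total {c , false} v = ≤-trans (address-total v) (m≤n+m _ addresses)

    flags : sum (map flag zs) ≡ t
    flags = ≡-trans (sym (first zs)) (≡-trans (columns 0) (≡-trans (cong (t +_) (rest cs)) (+-identityʳ t)))
      where
      first : ∀ zs → column 0 (concatMap digits zs) ≡ sum (map flag zs)
      first []       = refl
      first (z ∷ zs) = cong (flag z +_) (first zs)
      rest : ∀ cs → column 0 (concatMap address cs) ≡ 0
      rest []       = refl
      rest (c ∷ cs) = rest cs

    classes : map proj₁ zs ↭ cs
    classes = matching _ _ (All.map⁺ vz) vc distinct λ {j} j< → begin
      slotSum j (map proj₁ zs)                               ≡⟨ column-slotSum j< (map proj₁ zs) ⟨
      column (suc j) (concatMap address (map proj₁ zs))      ≡⟨ forget j zs ⟨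
      column (suc j) (concatMap digits zs)                   ≡⟨ columns (suc j) ⟩
      column (suc j) (concatMap address cs)                  ≡⟨ column-slotSum j< cs ⟩
      slotSum j cs                                           ∎
      where
      open ≡-Reasoning
      forget : ∀ j zs → column (suc j) (concatMap digits zs) ≡ column (suc j) (concatMap address (map proj₁ zs))
      forget j []             = refl
      forget j ((c , f) ∷ zs) = cong (at (suc j) (suc (slot c) , addresses + addr c) +_)
        (cong (at (suc j) (suc slots , 1) +_) (forget j zs))

-- Token games: choose reactions so that every token that is produced is consumed

-- Only the balance of tokens is required, not an order of firing. For the net of a machine, where
-- all reactions lead from one time to the next, the order is recovered from the times.
record Choice {P R : Set} (ins outs : R → List P) (init final : List P) (rs : List R) : Set where
  field
    chosen others : List R
    split   : rs ↭ chosen ++ others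
    balance : init ++ concatMap outs chosen ↭ final ++ concatMap ins chosen

-- Makes every bin of a packing exactly full, since the capacities add up to the volume of the
-- items.
sum-tight : ∀ {A : Set} {f g : A → ℕ} xs → All (λ x → f x ≤ g x) xs →
  sum (map f xs) ≡ sum (map g xs) → All (λ x → f x ≡ g x) xs
sum-tight []       []       eq = []
sum-tight {f = f} {g} (x ∷ xs) (p ∷ ps) eq = head≡ ∷ sum-tight xs ps
  (+-cancelˡ-≡ (f x) _ _ (≡-trans eq (cong (_+ sum (map g xs)) (sym head≡))))
  where
  tails : ∀ {xs} → All (λ x → f x ≤ g x) xs → sum (map f xs) ≤ sum (map g xs)
  tails []       = z≤n
  tails (p ∷ ps) = +-mono-≤ p (tails ps)
  head≡ : f x ≡ g x
  head≡ = ≤-antisym p (+-cancelʳ-≤ (sum (map g xs)) _ _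
    (≤-trans (≤-reflexive (sym eq)) (+-monoʳ-≤ (f x) (tails ps))))

map-++⁻ : ∀ {A B : Set} (f : A → B) xs {ys zs} → ys ++ zs ≡ map f xs →
  ∃[ as ] ∃[ bs ] (xs ≡ as ++ bs × ys ≡ map f as × zs ≡ map f bs)
map-++⁻ f xs       {[]}     eq = [] , xs , refl , refl , eq
map-++⁻ f (x ∷ xs) {y ∷ ys} eq with refl , eq′ ← ∷-injective eq
  with as , bs , refl , refl , eq″ ← map-++⁻ f xs {ys} eq′ = x ∷ as , bs , refl , refl , eq″

module Bag (A : Set) where
  open import Algebra.Solver.CommutativeMonoid (++-commutativeMonoid {A = A}) public
    using (solve; _⊜_; _⊕_)

++-cancelˡ-↭ : ∀ {A : Set} (xs : List A) {ys zs} → xs ++ ys ↭ xs ++ zs → ys ↭ zs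
++-cancelˡ-↭ []       p = p
++-cancelˡ-↭ (x ∷ xs) p = ++-cancelˡ-↭ xs (drop-∷ p)

concatMap-zip : ∀ {A B : Set} (f g : A → List B) xs →
  concatMap (λ x → f x ++ g x) xs ↭ concatMap f xs ++ concatMap g xs
concatMap-zip f g []       = ↭-refl
concatMap-zip {B = B} f g (x ∷ xs) = ↭-trans (++⁺ˡ (f x ++ g x) (concatMap-zip f g xs))
  (solve 4 (λ a b c d → (a ⊕ b) ⊕ (c ⊕ d) ⊜ (a ⊕ c) ⊕ (b ⊕ d)) ↭-refl (f x) (g x) _ _)
  where open Bag B

when : {A : Set} → Bool → List A → List A
when b xs = if b then xs else []

concatMap-when : ∀ {A B C : Set} (f : B → List C) (b : A → Bool) (g : A → B) xs →
  concatMap f (concatMap (λ x → when (b x) (g x ∷ [])) xs) ≡ concatMap (λ x → when (b x) (f (g x))) xs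
concatMap-when f b g []       = refl
concatMap-when f b g (x ∷ xs) = ≡-trans (concatMap-++ f (when (b x) (g x ∷ [])) _)
  (cong₂ _++_ (single (b x)) (concatMap-when f b g xs))
  where
  single : ∀ c → concatMap f (when c (g x ∷ [])) ≡ when c (f (g x))
  single true  = ++-identityʳ _
  single false = refl

concatMap-∘ : ∀ {A B C : Set} (f : B → List C) (g : A → List B) xs →
  concatMap f (concatMap g xs) ≡ concatMap (concatMap f ∘ g) xs
concatMap-∘ f g []       = refl
concatMap-∘ f g (x ∷ xs) = ≡-trans (concatMap-++ f (g x) _) (cong (concatMap f (g x) ++_) (concatMap-∘ f g xs))

partition-↭ : ∀ {A B : Set} (b : A → Bool) (g : A → B) xs →
  map g xs ↭ concatMap (λ x → when (b x) (g x ∷ [])) xs ++ concatMap (λ x → when (not (b x)) (g x ∷ [])) xs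
partition-↭ b g []       = ↭-refl
partition-↭ b g (x ∷ xs) with b x
... | true  = ↭-prep (g x) (partition-↭ b g xs)
... | false = ↭-trans (↭-prep (g x) (partition-↭ b g xs)) (↭-sym (shift (g x) _ _))

module TokenGame {P R : Set} (ins outs : R → List P) (balanced : ∀ r → length (ins r) ≡ length (outs r))
  (N : Numbering (P ⊎ R)) (weight-place : ∀ p → Numbering.weight N (inj₁ p) ≡ 1)
  (weight-hub : ∀ r → Numbering.weight N (inj₂ r) ≡ length (ins r))
  (init final : List P) (rs : List R) where

  open Numbering N
  open Sizes N

  -- The flag of a place tells that inB does not, or that outB does, use its
  -- reaction; the hub of a reaction makes this the same for all its places.
  data Bin : Set where
    inB outB   : R → Bin
    initB finB : P → Bin

  contents : Bin → Bool → List Flagged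
  contents (inB r)   s = (inj₂ r , s) ∷ map (λ p → inj₁ p , not s) (ins r)
  contents (outB r)  s = (inj₂ r , not s) ∷ map (λ p → inj₁ p , s) (outs r)
  contents (initB p) s = (inj₁ p , true) ∷ []
  contents (finB p)  s = (inj₁ p , false) ∷ []

  -- The items are those of a packing in which no reaction is chosen, except at the two ends:
  -- `initB` wants a flagged place but brings an unflagged one, and `finB` the reverse. Only chosen
  -- reactions can make up for this.
  initially : Bin → List Flagged
  initially (initB p) = (inj₁ p , false) ∷ []
  initially (finB p)  = (inj₁ p , true) ∷ []
  initially b         = contents b false

  classes : Bin → List (P ⊎ R)
  classes (inB r)   = inj₂ r ∷ map inj₁ (ins r)
  classes (outB r)  = inj₂ r ∷ map inj₁ (outs r)
  classes (initB p) = inj₁ p ∷ []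
  classes (finB p)  = inj₁ p ∷ []

  goal : Bin → ℕ
  goal (inB r)   = weight (inj₂ r)
  goal (outB r)  = weight (inj₂ r)
  goal (initB p) = 1
  goal (finB p)  = 0

  capacity : Bin → ℕ
  capacity b = goal b + sum (map bulk (classes b))

  reactionBins : List Bin
  reactionBins = concatMap (λ r → inB r ∷ outB r ∷ []) rs

  bins : List Bin
  bins = reactionBins ++ map initB init ++ map finB final

  tokens : List Flagged
  tokens = concatMap initially bins

  toItem : Flagged → Item
  toItem z = mkItem (pred (weigh z))

  record Admissible (b : Bin) : Set where
    field
      valid    : All Valid (classes b)
      distinct : AllPairs (_≢_ on slot) (classes b)
      short    : length (classes b) ≤ most

  flags-false : ∀ ps → sum (map flag (map (λ p → inj₁ p , false) ps)) ≡ 0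
  flags-false []       = refl
  flags-false (p ∷ ps) = flags-false ps

  flags-true : ∀ ps → sum (map flag (map (λ p → inj₁ p , true) ps)) ≡ length ps
  flags-true []       = refl
  flags-true (p ∷ ps) = cong₂ _+_ (weight-place p) (flags-true ps)

  flags-contents : ∀ b s → sum (map flag (contents b s)) ≡ goal b
  flags-contents (inB r)   true  = ≡-trans (cong (weight (inj₂ r) +_) (flags-false (ins r))) (+-identityʳ _)
  flags-contents (inB r)   false = ≡-trans (flags-true (ins r)) (sym (weight-hub r))
  flags-contents (outB r)  true  = ≡-trans (flags-true (outs r)) (≡-trans (sym (balanced r)) (sym (weight-hub r)))
  flags-contents (outB r)  false = ≡-trans (cong (weight (inj₂ r) +_) (flags-false (outs r))) (+-identityʳ _)
  flags-contents (initB p) s     = ≡-trans (+-identityʳ _) (weight-place p)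
  flags-contents (finB p)  s     = refl

  map-pairs : ∀ f (ps : List P) → map proj₁ (map (λ p → _,_ {B = λ (_ : P ⊎ R) → Bool} (inj₁ p) f) ps) ≡ map inj₁ ps
  map-pairs f ps = sym (map-∘ ps)

  classes-contents : ∀ b s → map proj₁ (contents b s) ≡ classes b
  classes-contents (inB r)   s = cong (inj₂ r ∷_) (map-pairs (not s) (ins r))
  classes-contents (outB r)  s = cong (inj₂ r ∷_) (map-pairs s (outs r))
  classes-contents (initB p) s = refl
  classes-contents (finB p)  s = refl

  classes-initially : ∀ b → map proj₁ (initially b) ≡ classes b
  classes-initially (inB r)   = classes-contents (inB r) false
  classes-initially (outB r)  = classes-contents (outB r) false
  classes-initially (initB p) = refl
  classes-initially (finB p)  = refl

  sum-weigh : ∀ zs → sum (map weigh zs) ≡ sum (map flag zs) + sum (map bulk (map proj₁ zs))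
  sum-weigh zs = ≡-trans (sum-map-+ flag (bulk ∘ proj₁) zs) (cong (λ xs → sum (map flag zs) + sum xs) (map-∘ zs))

  weigh-contents : ∀ b s → sum (map weigh (contents b s)) ≡ capacity b
  weigh-contents b s = ≡-trans (sum-weigh (contents b s))
    (cong₂ _+_ (flags-contents b s) (cong (sum ∘ map bulk) (classes-contents b s)))

  all-false : ∀ zs ps → map proj₁ zs ≡ map inj₁ ps → sum (map flag zs) ≡ 0 → zs ≡ map (λ p → inj₁ p , false) ps
  all-false []               []       eq t = refl
  all-false ((c , true) ∷ zs) (p ∷ ps) eq t with refl , _ ← ∷-injective eq
    with () ← ≡-trans (sym (cong (_+ sum (map flag zs)) (weight-place p))) t
  all-false ((c , false) ∷ zs) (p ∷ ps) eq t with refl , eq′ ← ∷-injective eq =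
    cong ((inj₁ p , false) ∷_) (all-false zs ps eq′ t)

  flags-≤ : ∀ zs ps → map proj₁ zs ≡ map inj₁ ps → sum (map flag zs) ≤ length ps
  flags-≤ []                 []       eq = z≤n
  flags-≤ ((c , true) ∷ zs)  (p ∷ ps) eq with refl , eq′ ← ∷-injective eq =
    +-mono-≤ (≤-reflexive (weight-place p)) (flags-≤ zs ps eq′)
  flags-≤ ((c , false) ∷ zs) (p ∷ ps) eq with refl , eq′ ← ∷-injective eq =
    m≤n⇒m≤1+n (flags-≤ zs ps eq′)

  all-true : ∀ zs ps → map proj₁ zs ≡ map inj₁ ps → sum (map flag zs) ≡ length ps → zs ≡ map (λ p → inj₁ p , true) ps
  all-true []               []       eq t = refl
  all-true ((c , true) ∷ zs) (p ∷ ps) eq t with refl , eq′ ← ∷-injective eq =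
    cong ((inj₁ p , true) ∷_) (all-true zs ps eq′ (suc-injective
      (≡-trans (sym (cong (_+ sum (map flag zs)) (weight-place p))) t)))
  all-true ((c , false) ∷ zs) (p ∷ ps) eq t with refl , eq′ ← ∷-injective eq =
    contradiction (subst (_≤ length ps) t (flags-≤ zs ps eq′)) 1+n≰n

  -- A flagged hub uses up the whole flag total, so no place is flagged; with an unflagged hub all
  -- places must be, as their number is the weight of the hub.
  hub-contents : ∀ r ps zs → length ps ≡ weight (inj₂ r) → map proj₁ zs ≡ inj₂ r ∷ map inj₁ ps →
    sum (map flag zs) ≡ weight (inj₂ r) →
    ∃[ s ] zs ≡ (inj₂ r , s) ∷ map (λ p → inj₁ p , not s) ps
  hub-contents r ps ((c , s) ∷ zs) len eq t with refl , eq′ ← ∷-injective eq with s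
  ... | true  = true , cong (_ ∷_) (all-false zs ps eq′ (+-cancelˡ-≡ (weight (inj₂ r)) _ _
    (≡-trans t (sym (+-identityʳ _)))))
  ... | false = false , cong (_ ∷_) (all-true zs ps eq′ (≡-trans t (sym len)))

  goal≤ : ∀ b → All Valid (classes b) → goal b ≤ addresses
  goal≤ (inB r)   (v ∷ _) = weight≤ v
  goal≤ (outB r)  (v ∷ _) = weight≤ v
  goal≤ (initB p) (v ∷ _) = subst (_≤ addresses) (weight-place p) (weight≤ v)
  goal≤ (finB p)  _       = z≤n

  decodeShape : ∀ b {zs zs′} → zs ↭ zs′ → map proj₁ zs′ ≡ classes b → sum (map flag zs′) ≡ goal b →
    ∃[ s ] zs ↭ contents b s
  decodeShape (inB r) {zs′ = zs′} p e t
    with s , refl ← hub-contents r (ins r) zs′ (sym (weight-hub r)) e t = s , p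
  decodeShape (outB r) {zs′ = zs′} p e t
    with hub-contents r (outs r) zs′ (≡-trans (sym (balanced r)) (sym (weight-hub r))) e t
  ... | true  , refl = false , p
  ... | false , refl = true , p
  -- `contents` ignores the bit of the bins at the ends, so any value will do.
  decodeShape (initB q) {zs} {zs′} p e t = true , subst (zs ↭_) (all-true zs′ (q ∷ []) e t) p
  decodeShape (finB q)  {zs} {zs′} p e t = true , subst (zs ↭_) (all-false zs′ (q ∷ []) e t) p

  decodeBin : ∀ b zs → Admissible b → All (Valid ∘ proj₁) zs → sum (map weigh zs) ≡ capacity b →
    ∃[ s ] zs ↭ contents b s
  decodeBin b zs adm vz eq =
    let zs′ , eq′ , p = ↭-map-inv proj₁ D.classes in
    decodeShape b p (sym eq′) (≡-trans (sym (sum-↭ (↭-map⁺ flag p))) D.flags)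
    where
    module D = Decode vz (Admissible.valid adm) (Admissible.distinct adm) (Admissible.short adm)
      (goal≤ b (Admissible.valid adm)) eq

  size-toItem : ∀ z → size (toItem z) ≡ weigh z
  size-toItem (c , f) = suc-pred (weigh (c , f))
    ⦃ >-nonZero (≤-trans (m^n>0 base ⦃ >-nonZero (≤-trans (s≤s z≤n) roomy) ⦄ (suc slots))
      (≤-trans (m≤n+m _ _) (m≤n+m (bulk c) (flag (c , f))))) ⦄

  vol-toItem : ∀ zs → vol (map toItem zs) ≡ sum (map weigh zs)
  vol-toItem []       = refl
  vol-toItem (z ∷ zs) = cong₂ _+_ (size-toItem z) (vol-toItem zs)

  load-initially : Bin → ℕ
  load-initially b = sum (map weigh (initially b))

  load-reactions : ∀ rs → sum (map capacity (concatMap (λ r → inB r ∷ outB r ∷ []) rs)) ≡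
    sum (map load-initially (concatMap (λ r → inB r ∷ outB r ∷ []) rs))
  load-reactions []       = refl
  load-reactions (r ∷ rs) = cong₂ _+_ (sym (weigh-contents (inB r) false))
    (cong₂ _+_ (sym (weigh-contents (outB r) false)) (load-reactions rs))

  load-init : ∀ ps → sum (map capacity (map initB ps)) ≡ length ps + sum (map load-initially (map initB ps))
  load-init []       = refl
  load-init (p ∷ ps) = ≡-trans (cong (capacity (initB p) +_) (load-init ps))
    (regroup (bulk (inj₁ p)) (length ps) _)
    where
    regroup : ∀ a b c → 1 + (a + 0) + (b + c) ≡ suc b + (0 + a + 0 + c)
    regroup = solve-∀

  load-fin : ∀ ps → length ps + sum (map capacity (map finB ps)) ≡ sum (map load-initially (map finB ps))
  load-fin []       = refl
  load-fin (p ∷ ps) = ≡-trans (regroup (bulk (inj₁ p)) (length ps) _)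
    (cong₂ (λ w s → w + bulk (inj₁ p) + 0 + s) (sym (weight-place p)) (load-fin ps))
    where
    regroup : ∀ a b c → suc b + (0 + (a + 0) + c) ≡ 1 + a + 0 + (b + c)
    regroup = solve-∀

  sum-map-++ : ∀ {A : Set} (f : A → ℕ) xs ys → sum (map f (xs ++ ys)) ≡ sum (map f xs) + sum (map f ys)
  sum-map-++ f xs ys = ≡-trans (cong sum (map-++ f xs ys)) (sum-++ (map f xs) _)

  -- The bins of a reaction are full of their own initial items. The unit that each `initB` lacks is
  -- the unit that a `finB` has in excess, and there are as many of the one as of the other.
  total : length init ≡ length final → sum (map capacity bins) ≡ sum (map weigh tokens)
  total eq = begin
    sum (map capacity bins)
      ≡⟨ sum-map-++ capacity reactionBins _ ⟩
    sum (map capacity reactionBins) + sum (map capacity (map initB init ++ map finB final))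
      ≡⟨ cong₂ _+_ (load-reactions rs) (≡-trans (sum-map-++ capacity (map initB init) _) ends) ⟩
    sum (map load-initially reactionBins) + sum (map load-initially (map initB init ++ map finB final))
      ≡⟨ sum-map-++ load-initially reactionBins _ ⟨
    sum (map load-initially bins)
      ≡⟨ sum-concatMap weigh initially bins ⟨
    sum (map weigh tokens) ∎
    where
    open ≡-Reasoning
    I F : ℕ
    I = sum (map load-initially (map initB init))
    F = sum (map capacity (map finB final))
    ends : sum (map capacity (map initB init)) + F ≡ sum (map load-initially (map initB init ++ map finB final))
    ends = begin
      sum (map capacity (map initB init)) + F    ≡⟨ cong (_+ F) (load-init init) ⟩
      length init + I + F                        ≡⟨ cong (_+ F) (+-comm (length init) I) ⟩
      I + length init + F                        ≡⟨ +-assoc I (length init) F ⟩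
      I + (length init + F)                      ≡⟨ cong (λ n → I + (n + F)) eq ⟩
      I + (length final + F)                     ≡⟨ cong (I +_) (load-fin final) ⟩
      I + sum (map load-initially (map finB final))   ≡⟨ sum-map-++ load-initially (map initB init) _ ⟨
      sum (map load-initially (map initB init ++ map finB final)) ∎

  Filling : Set
  Filling = List (Bin × List Flagged)

  unpack : ∀ bs (ps : List (ℕ × Bunch)) zs → map proj₁ ps ≡ map capacity bs →
    concatMap proj₂ ps ≡ map toItem zs → All (λ p → vol (proj₂ p) ≤ proj₁ p) ps →
    Σ Filling λ fs → map proj₁ fs ≡ bs × concatMap proj₂ fs ≡ zs ×
      All (λ f → sum (map weigh (proj₂ f)) ≤ capacity (proj₁ f)) fs
  unpack [] [] [] _ _ _ = [] , refl , refl , []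
  unpack (b ∷ bs) ((_ , D) ∷ ps) zs eq eq′ (v ∷ vs)
    with refl , eq₁ ← ∷-injective eq
    with as , zs′ , refl , refl , eq₂ ← map-++⁻ toItem zs {D} eq′
    with fs , refl , refl , fits ← unpack bs ps zs′ eq₁ eq₂ vs =
    (b , as) ∷ fs , refl , refl , ≤-trans (≤-reflexive (sym (vol-toItem as))) v ∷ fits

  Selection : Set
  Selection = List (Bin × Bool)

  filled : Selection → List Flagged
  filled = concatMap λ (b , s) → contents b s

  decodeAll : ∀ (fs : Filling) → All Admissible (map proj₁ fs) → All (Valid ∘ proj₁) (concatMap proj₂ fs) →
    All (λ f → sum (map weigh (proj₂ f)) ≡ capacity (proj₁ f)) fs →
    Σ Selection λ ss → map proj₁ ss ≡ map proj₁ fs × concatMap proj₂ fs ↭ filled ss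
  decodeAll [] _ _ _ = [] , refl , ↭-refl
  decodeAll ((b , zs) ∷ fs) (a ∷ as) vs (e ∷ es) =
    let s , p = decodeBin b zs a (All.++⁻ˡ zs vs) e
        ss , eq , q = decodeAll fs as (All.++⁻ʳ zs vs) es
    in (b , s) ∷ ss , cong (b ∷_) eq , ++⁺ p q

  -- A reaction with the bits of its two bins
  Halves : Set
  Halves = List (R × Bool × Bool)

  halves : R × Bool × Bool → List Flagged
  halves (r , s , s′) = contents (inB r) s ++ contents (outB r) s′

  peel : ∀ rs bs (ss : Selection) → map proj₁ ss ≡ concatMap (λ r → inB r ∷ outB r ∷ []) rs ++ bs →
    Σ Halves λ hs → Σ Selection λ ss′ → map proj₁ hs ≡ rs × map proj₁ ss′ ≡ bs ×
      filled ss ≡ concatMap halves hs ++ filled ss′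
  peel [] bs ss eq = [] , ss , refl , eq , refl
  peel (r ∷ rs) bs ((_ , s) ∷ (_ , s′) ∷ ss) eq
    with refl , eq′ ← ∷-injective eq with refl , eq″ ← ∷-injective eq′
    with hs , ss′ , refl , eq₁ , eq₂ ← peel rs bs ss eq″ =
    (r , s , s′) ∷ hs , ss′ , refl , eq₁ , (begin
      contents (inB r) s ++ contents (outB r) s′ ++ filled ss
        ≡⟨ cong (λ xs → contents (inB r) s ++ contents (outB r) s′ ++ xs) eq₂ ⟩
      contents (inB r) s ++ contents (outB r) s′ ++ concatMap halves hs ++ filled ss′
        ≡⟨ ++-assoc (contents (inB r) s) _ _ ⟨
      halves (r , s , s′) ++ concatMap halves hs ++ filled ss′
        ≡⟨ ++-assoc (halves (r , s , s′)) _ _ ⟨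
      (halves (r , s , s′) ++ concatMap halves hs) ++ filled ss′ ∎)
    where open ≡-Reasoning

  places : Bool → List P → List Flagged
  places f = map λ p → inj₁ p , f

  filled-init : ∀ ps bs (ss : Selection) → map proj₁ ss ≡ map initB ps ++ bs →
    Σ Selection λ ss′ → map proj₁ ss′ ≡ bs × filled ss ≡ places true ps ++ filled ss′
  filled-init [] bs ss eq = ss , eq , refl
  filled-init (p ∷ ps) bs ((_ , s) ∷ ss) eq with refl , eq′ ← ∷-injective eq
    with ss′ , eq₁ , eq₂ ← filled-init ps bs ss eq′ = ss′ , eq₁ , cong (_ ∷_) eq₂

  filled-fin : ∀ ps (ss : Selection) → map proj₁ ss ≡ map finB ps → filled ss ≡ places false ps
  filled-fin [] [] eq = refl
  filled-fin (p ∷ ps) ((_ , s) ∷ ss) eq with refl , eq′ ← ∷-injective eq = cong (_ ∷_) (filled-fin ps ss eq′)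

  tokens≡ : tokens ≡ concatMap (λ r → halves (r , false , false)) rs ++ places false init ++ places true final
  tokens≡ = begin
    concatMap initially (reactionBins ++ map initB init ++ map finB final)
      ≡⟨ concatMap-++ initially reactionBins _ ⟩
    concatMap initially reactionBins ++ concatMap initially (map initB init ++ map finB final)
      ≡⟨ cong₂ _++_ (concatMap-∘ initially _ rs) (concatMap-++ initially (map initB init) _) ⟩
    concatMap (λ r → initially (inB r) ++ initially (outB r) ++ []) rs ++ concatMap initially (map initB init) ++ concatMap initially (map finB final)
      ≡⟨ cong₂ _++_ (concatMap-cong (λ r → cong (initially (inB r) ++_) (++-identityʳ _)) rs) (cong₂ _++_ (initially-init init) (initially-fin final)) ⟩
    concatMap (λ r → halves (r , false , false)) rs ++ places false init ++ places true final ∎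
    where
    open ≡-Reasoning
    initially-init : ∀ ps → concatMap initially (map initB ps) ≡ places false ps
    initially-init []       = refl
    initially-init (p ∷ ps) = cong (_ ∷_) (initially-init ps)
    initially-fin : ∀ ps → concatMap initially (map finB ps) ≡ places true ps
    initially-fin []       = refl
    initially-fin (p ∷ ps) = cong (_ ∷_) (initially-fin ps)

  placeOf : Flagged → List P
  placeOf (inj₁ p , true) = p ∷ []
  placeOf _               = []

  hubOf : Flagged → List R
  hubOf (inj₂ r , true) = r ∷ []
  hubOf _               = []

  placeOf-places : ∀ f ps → concatMap placeOf (places f ps) ≡ when f ps
  placeOf-places true  []       = refl
  placeOf-places true  (p ∷ ps) = cong (p ∷_) (placeOf-places true ps)
  placeOf-places false []       = refl
  placeOf-places false (p ∷ ps) = placeOf-places false ps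

  hubOf-places : ∀ f ps → concatMap hubOf (places f ps) ≡ []
  hubOf-places f []       = refl
  hubOf-places f (p ∷ ps) = hubOf-places f ps

  placeOf-halves : ∀ h → concatMap placeOf (halves h) ≡
    when (not (proj₁ (proj₂ h))) (ins (proj₁ h)) ++ when (proj₂ (proj₂ h)) (outs (proj₁ h))
  placeOf-halves (r , s , s′) = ≡-trans (concatMap-++ placeOf (contents (inB r) s) _)
    (cong₂ _++_ (placeOf-places (not s) (ins r)) (placeOf-places s′ (outs r)))

  hubOf-halves : ∀ h → concatMap hubOf (halves h) ≡
    when (proj₁ (proj₂ h)) (proj₁ h ∷ []) ++ when (not (proj₂ (proj₂ h))) (proj₁ h ∷ [])
  hubOf-halves (r , s , s′) = ≡-trans (concatMap-++ hubOf (contents (inB r) s) _)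
    (cong₂ _++_ (hub s (not s) (ins r)) (hub (not s′) s′ (outs r)))
    where
    hub : ∀ s f ps → concatMap hubOf ((inj₂ r , s) ∷ places f ps) ≡ when s (r ∷ [])
    hub true  f ps = cong (r ∷_) (hubOf-places f ps)
    hub false f ps = hubOf-places f ps

  -- From a packing to a choice

  module Account (hs : Halves) (hs≡ : map proj₁ hs ≡ rs)
    (exact : concatMap halves hs ++ places true init ++ places false final ↭ tokens) where

    inSel inUns outSel outUns : List R
    inSel  = concatMap (λ h → when (proj₁ (proj₂ h)) (proj₁ h ∷ [])) hs
    inUns  = concatMap (λ h → when (not (proj₁ (proj₂ h))) (proj₁ h ∷ [])) hs
    outSel = concatMap (λ h → when (proj₂ (proj₂ h)) (proj₁ h ∷ [])) hs
    outUns = concatMap (λ h → when (not (proj₂ (proj₂ h))) (proj₁ h ∷ [])) hs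

    image : ∀ {A : Set} (f : Flagged → List A) hs t u → concatMap f (concatMap halves hs ++ places t init ++ places u final) ≡
      concatMap (concatMap f ∘ halves) hs ++ concatMap f (places t init) ++ concatMap f (places u final)
    image f hs t u = ≡-trans (concatMap-++ f (concatMap halves hs) _)
      (cong₂ _++_ (concatMap-∘ f halves hs) (concatMap-++ f (places t init) _))

    off : List R → Halves
    off = map λ r → r , false , false

    concatMap-off : ∀ {A : Set} (f : R × Bool × Bool → List A) rs → concatMap f (off rs) ≡ concatMap (λ r → f (r , false , false)) rs
    concatMap-off f []       = refl
    concatMap-off f (r ∷ rs) = cong (f (r , false , false) ++_) (concatMap-off f rs)

    exact′ : ∀ {A : Set} (f : Flagged → List A) →
      concatMap (concatMap f ∘ halves) hs ++ concatMap f (places true init) ++ concatMap f (places false final) ↭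
      concatMap (λ r → concatMap f (halves (r , false , false))) rs ++ concatMap f (places false init) ++ concatMap f (places true final)
    exact′ f = subst₂ _↭_ (image f hs true false)
      (≡-trans (cong (concatMap f) (≡-trans tokens≡ (cong (_++ places false init ++ places true final) (sym (concatMap-off halves rs)))))
        (≡-trans (image f (off rs) false true) (cong (_++ concatMap f (places false init) ++ concatMap f (places true final)) (concatMap-off _ rs))))
      (concatMap-↭ f exact)

    concatMap-[_] : ∀ {A : Set} (xs : List A) → concatMap (_∷ []) xs ≡ xs
    concatMap-[ [] ]     = refl
    concatMap-[ x ∷ xs ] = cong (x ∷_) concatMap-[ xs ]

    -- Flagged hubs are counted: initially each `outB` owns one; in the packing they are in the
    -- `inB` that use their reaction and in the `outB` that do not.
    hubs : inSel ++ outUns ↭ rs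
    hubs = begin
      inSel ++ outUns
        ↭⟨ concatMap-zip _ _ hs ⟨
      concatMap (λ h → when (proj₁ (proj₂ h)) (proj₁ h ∷ []) ++ when (not (proj₂ (proj₂ h))) (proj₁ h ∷ [])) hs
        ≡⟨ ≡-trans (cong₂ _++_ (concatMap-cong hubOf-halves hs) (cong₂ _++_ (hubOf-places true init) (hubOf-places false final))) (++-identityʳ _) ⟨
      concatMap (concatMap hubOf ∘ halves) hs ++ concatMap hubOf (places true init) ++ concatMap hubOf (places false final)
        ↭⟨ exact′ hubOf ⟩
      concatMap (λ r → concatMap hubOf (halves (r , false , false))) rs ++ concatMap hubOf (places false init) ++ concatMap hubOf (places true final)
        ≡⟨ ≡-trans (cong₂ _++_ (concatMap-cong (λ r → hubOf-halves (r , false , false)) rs) (cong₂ _++_ (hubOf-places false init) (hubOf-places true final))) (++-identityʳ _) ⟩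
      concatMap (_∷ []) rs
        ≡⟨ concatMap-[ rs ] ⟩
      rs ∎
      where open PermutationReasoning

    flow : (concatMap ins inUns ++ concatMap outs outSel) ++ init ↭ concatMap ins rs ++ final
    flow = begin
      (concatMap ins inUns ++ concatMap outs outSel) ++ init
        ≡⟨ cong (_++ init) (cong₂ _++_ (concatMap-when ins _ proj₁ hs) (concatMap-when outs _ proj₁ hs)) ⟩
      (concatMap (λ h → when (not (proj₁ (proj₂ h))) (ins (proj₁ h))) hs ++ concatMap (λ h → when (proj₂ (proj₂ h)) (outs (proj₁ h))) hs) ++ init
        ↭⟨ ++⁺ʳ init (concatMap-zip _ _ hs) ⟨
      concatMap (λ h → when (not (proj₁ (proj₂ h))) (ins (proj₁ h)) ++ when (proj₂ (proj₂ h)) (outs (proj₁ h))) hs ++ init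
        ≡⟨ cong₂ _++_ (concatMap-cong placeOf-halves hs)
             (≡-trans (cong₂ _++_ (placeOf-places true init) (placeOf-places false final)) (++-identityʳ init)) ⟨
      concatMap (concatMap placeOf ∘ halves) hs ++ concatMap placeOf (places true init) ++ concatMap placeOf (places false final)
        ↭⟨ exact′ placeOf ⟩
      concatMap (λ r → concatMap placeOf (halves (r , false , false))) rs ++ concatMap placeOf (places false init) ++ concatMap placeOf (places true final)
        ≡⟨ cong₂ _++_ (concatMap-cong (λ r → ≡-trans (placeOf-halves (r , false , false)) (++-identityʳ _)) rs)
             (cong₂ _++_ (placeOf-places false init) (placeOf-places true final)) ⟩
      concatMap ins rs ++ final ∎
      where open PermutationReasoning

    -- Hubs of equal reactions are interchangeable, so the two bins of a single occurrence may
    -- disagree. Only the multisets of reactions used on the two sides are equal, and the balance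
    -- depends on nothing else.
    sel↭ : inSel ↭ outSel
    sel↭ = ++-cancelˡ-↭ outUns (begin
      outUns ++ inSel   ↭⟨ ++-comm outUns inSel ⟩
      inSel ++ outUns   ↭⟨ hubs ⟩
      rs                ≡⟨ hs≡ ⟨
      map proj₁ hs      ↭⟨ partition-↭ (proj₂ ∘ proj₂) proj₁ hs ⟩
      outSel ++ outUns  ↭⟨ ++-comm outSel outUns ⟩
      outUns ++ outSel  ∎)
      where open PermutationReasoning

    in-split : rs ↭ inSel ++ inUns
    in-split = subst (_↭ inSel ++ inUns) hs≡ (partition-↭ (proj₁ ∘ proj₂) proj₁ hs)

    choice : Choice ins outs init final rs
    choice = record
      { chosen  = inSel
      ; others  = inUns
      ; split   = in-split
      ; balance = ++-cancelˡ-↭ (concatMap ins inUns) (begin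
          concatMap ins inUns ++ init ++ concatMap outs inSel
            ↭⟨ ++⁺ˡ (concatMap ins inUns) (++⁺ˡ init (concatMap-↭ outs sel↭)) ⟩
          concatMap ins inUns ++ init ++ concatMap outs outSel
            ↭⟨ solve 3 (λ a b c → a ⊕ (b ⊕ c) ⊜ (a ⊕ c) ⊕ b) ↭-refl (concatMap ins inUns) init (concatMap outs outSel) ⟩
          (concatMap ins inUns ++ concatMap outs outSel) ++ init
            ↭⟨ flow ⟩
          concatMap ins rs ++ final
            ↭⟨ ++⁺ʳ final (concatMap-↭ ins in-split) ⟩
          concatMap ins (inSel ++ inUns) ++ final
            ≡⟨ cong (_++ final) (concatMap-++ ins inSel inUns) ⟩
          (concatMap ins inSel ++ concatMap ins inUns) ++ final
            ↭⟨ solve 3 (λ a b c → (a ⊕ b) ⊕ c ⊜ b ⊕ (c ⊕ a)) ↭-refl (concatMap ins inSel) (concatMap ins inUns) final ⟩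
          concatMap ins inUns ++ final ++ concatMap ins inSel ∎)
      }
      where
      open PermutationReasoning
      open Bag P

  packing⇒choice : All Admissible bins → length init ≡ length final →
    Packing (map capacity bins) (map toItem tokens) → Choice ins outs init final rs
  packing⇒choice adm len packing
    -- Pulling the permutation back along `toItem` assigns a flagged class to every packed item.
    with zs , eq , p ← ↭-map-inv toItem (↭-sym (Packing.packed packing))
    with fs , fs≡ , refl , fits ← unpack bins (Packing.bins packing) zs (Packing.capacity packing) eq (Packing.fits packing)
    = go (decodeAll fs (subst (All Admissible) (sym fs≡) adm) (All-resp-↭ p valid) (sum-tight fs fits tight))
    where
    valid : All (Valid ∘ proj₁) tokens
    valid = All-concatMap (All.map (λ {b} a → All.map⁻ (subst (All Valid) (sym (classes-initially b)) (Admissible.valid a))) adm)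
    open ≡-Reasoning
    tight : sum (map (λ f → sum (map weigh (proj₂ f))) fs) ≡ sum (map (capacity ∘ proj₁) fs)
    tight = begin
      sum (map (λ f → sum (map weigh (proj₂ f))) fs)  ≡⟨ sum-concatMap weigh proj₂ fs ⟨
      sum (map weigh (concatMap proj₂ fs))            ≡⟨ sum-↭ (↭-map⁺ weigh p) ⟨
      sum (map weigh tokens)                          ≡⟨ total len ⟨
      sum (map capacity bins)                         ≡⟨ cong (sum ∘ map capacity) fs≡ ⟨
      sum (map capacity (map proj₁ fs))               ≡⟨ cong sum (map-∘ fs) ⟨
      sum (map (capacity ∘ proj₁) fs)                 ∎
    go : (Σ Selection λ ss → map proj₁ ss ≡ map proj₁ fs × concatMap proj₂ fs ↭ filled ss) → Choice ins outs init final rs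
    go (ss , eq , q)
      with hs , ss₁ , hs≡ , eq₁ , eq₂ ← peel rs _ ss (≡-trans eq fs≡)
      with ss₂ , eq₃ , eq₄ ← filled-init init _ ss₁ eq₁ =
      Account.choice hs hs≡ (subst (_↭ tokens)
        (≡-trans eq₂ (cong (concatMap halves hs ++_) (≡-trans eq₄ (cong (places true init ++_) (filled-fin final ss₂ eq₃)))))
        (↭-sym (↭-trans p q)))

  -- From a choice to a packing

  module Pack (choice : Choice ins outs init final rs) where

    open Choice choice
    open Bag Flagged

    pick : Bool → List R → Selection
    pick s = concatMap λ r → (inB r , s) ∷ (outB r , s) ∷ []

    bins-pick : ∀ s rs → map proj₁ (pick s rs) ≡ concatMap (λ r → inB r ∷ outB r ∷ []) rs
    bins-pick s []       = refl
    bins-pick s (r ∷ rs) = cong (λ bs → inB r ∷ outB r ∷ bs) (bins-pick s rs)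

    filled-pick : ∀ s rs → filled (pick s rs) ≡ concatMap (λ r → halves (r , s , s)) rs
    filled-pick s rs = ≡-trans (concatMap-∘ _ _ rs)
      (concatMap-cong (λ r → cong (contents (inB r) s ++_) (++-identityʳ _)) rs)

    hubs : Bool → List R → List Flagged
    hubs f = map λ r → inj₂ r , f

    spread : ∀ s rs → concatMap (λ r → halves (r , s , s)) rs ↭
      (hubs s rs ++ hubs (not s) rs) ++ places (not s) (concatMap ins rs) ++ places s (concatMap outs rs)
    spread s []       = ↭-refl
    spread s (r ∷ rs) = begin
      halves (r , s , s) ++ concatMap (λ r → halves (r , s , s)) rs
        ↭⟨ ++⁺ˡ (halves (r , s , s)) (spread s rs) ⟩
      halves (r , s , s) ++ (hubs s rs ++ hubs (not s) rs) ++ places (not s) (concatMap ins rs) ++ places s (concatMap outs rs)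
        ↭⟨ solve 8 (λ a b c d e f g h → ((a ⊕ b) ⊕ (c ⊕ d)) ⊕ ((e ⊕ f) ⊕ (g ⊕ h)) ⊜
             ((a ⊕ e) ⊕ (c ⊕ f)) ⊕ ((b ⊕ g) ⊕ (d ⊕ h))) ↭-refl
             ((inj₂ r , s) ∷ []) (places (not s) (ins r)) ((inj₂ r , not s) ∷ []) (places s (outs r))
             (hubs s rs) (hubs (not s) rs) (places (not s) (concatMap ins rs)) (places s (concatMap outs rs)) ⟩
      (hubs s (r ∷ rs) ++ hubs (not s) (r ∷ rs)) ++
        (places (not s) (ins r) ++ places (not s) (concatMap ins rs)) ++ (places s (outs r) ++ places s (concatMap outs rs))
        ≡⟨ cong₂ (λ xs ys → (hubs s (r ∷ rs) ++ hubs (not s) (r ∷ rs)) ++ xs ++ ys)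
             (map-++ _ (ins r) _) (map-++ _ (outs r) _) ⟨
      (hubs s (r ∷ rs) ++ hubs (not s) (r ∷ rs)) ++ places (not s) (concatMap ins (r ∷ rs)) ++ places s (concatMap outs (r ∷ rs)) ∎
      where open PermutationReasoning

    selection : Selection
    selection = (pick true chosen ++ pick false others) ++ map (λ p → initB p , false) init ++ map (λ p → finB p , false) final

    bins-selection : map proj₁ selection ↭ bins
    bins-selection = ↭-trans (↭-reflexive (≡-trans (map-++ proj₁ (pick true chosen ++ pick false others) _)
        (cong₂ _++_ (≡-trans (map-++ proj₁ (pick true chosen) _) (≡-trans
          (cong₂ _++_ (bins-pick true chosen) (bins-pick false others)) (sym (concatMap-++ _ chosen others))))
        (≡-trans (map-++ proj₁ (map (λ p → initB p , false) init) _) (cong₂ _++_ (sym (map-∘ init)) (sym (map-∘ final)))))))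
      (++⁺ʳ _ (concatMap-↭ _ (↭-sym split)))

    -- The balance is used once for each flag, in opposite directions: choosing reactions exchanges
    -- flagged and unflagged copies of the same places.
    flow : ∀ f → places f init ++ places f (concatMap outs chosen) ↭ places f final ++ places f (concatMap ins chosen)
    flow f = subst₂ _↭_ (map-++ _ init _) (map-++ _ final _) (↭-map⁺ _ balance)

    Ht Hf Ti Fi To Fo Tz Fz Ta Fa rest : List Flagged
    Ht = hubs true chosen
    Hf = hubs false chosen
    Ti = places true (concatMap ins chosen)
    Fi = places false (concatMap ins chosen)
    To = places true (concatMap outs chosen)
    Fo = places false (concatMap outs chosen)
    Ta = places true init
    Fa = places false init
    Tz = places true final
    Fz = places false final
    rest = concatMap (λ r → halves (r , false , false)) others

    filled-selection : filled selection ↭ tokens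
    filled-selection = begin
      filled selection
        ≡⟨ ≡-trans (concatMap-++ _ (pick true chosen ++ pick false others) _) (cong₂ _++_
             (≡-trans (concatMap-++ _ (pick true chosen) _) (cong₂ _++_ (filled-pick true chosen) (filled-pick false others)))
             (≡-trans (concatMap-++ _ (map (λ p → initB p , false) init) _) (cong₂ _++_ (filled-init′ init) (filled-fin′ final)))) ⟩
      (concatMap (λ r → halves (r , true , true)) chosen ++ rest) ++ Ta ++ Fz
        ↭⟨ ++⁺ʳ (Ta ++ Fz) (++⁺ʳ rest (spread true chosen)) ⟩
      (((Ht ++ Hf) ++ Fi ++ To) ++ rest) ++ Ta ++ Fz
        ↭⟨ solve 7 (λ a b c d e f g → (((a ⊕ b) ⊕ (c ⊕ d)) ⊕ e) ⊕ (f ⊕ g) ⊜ ((a ⊕ b) ⊕ e) ⊕ ((f ⊕ d) ⊕ (g ⊕ c))) ↭-refl Ht Hf Fi To rest Ta Fz ⟩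
      ((Ht ++ Hf) ++ rest) ++ (Ta ++ To) ++ (Fz ++ Fi)
        ↭⟨ ++⁺ˡ ((Ht ++ Hf) ++ rest) (++⁺ (flow true) (↭-sym (flow false))) ⟩
      ((Ht ++ Hf) ++ rest) ++ (Tz ++ Ti) ++ (Fa ++ Fo)
        ↭⟨ solve 7 (λ a b c d e f g → ((a ⊕ b) ⊕ e) ⊕ ((g ⊕ c) ⊕ (f ⊕ d)) ⊜ (((b ⊕ a) ⊕ (c ⊕ d)) ⊕ e) ⊕ (f ⊕ g)) ↭-refl Ht Hf Ti Fo rest Fa Tz ⟩
      (((Hf ++ Ht) ++ Ti ++ Fo) ++ rest) ++ Fa ++ Tz
        ↭⟨ ++⁺ʳ (Fa ++ Tz) (++⁺ʳ rest (↭-sym (spread false chosen))) ⟩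
      (concatMap (λ r → halves (r , false , false)) chosen ++ rest) ++ Fa ++ Tz
        ≡⟨ cong (_++ Fa ++ Tz) (concatMap-++ _ chosen others) ⟨
      concatMap (λ r → halves (r , false , false)) (chosen ++ others) ++ Fa ++ Tz
        ↭⟨ ++⁺ʳ (Fa ++ Tz) (concatMap-↭ _ (↭-sym split)) ⟩
      concatMap (λ r → halves (r , false , false)) rs ++ Fa ++ Tz
        ≡⟨ tokens≡ ⟨
      tokens ∎
      where
      open PermutationReasoning
      filled-init′ : ∀ ps → filled (map (λ p → initB p , false) ps) ≡ places true ps
      filled-init′ []       = refl
      filled-init′ (p ∷ ps) = cong (_ ∷_) (filled-init′ ps)
      filled-fin′ : ∀ ps → filled (map (λ p → finB p , false) ps) ≡ places false ps
      filled-fin′ []       = refl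
      filled-fin′ (p ∷ ps) = cong (_ ∷_) (filled-fin′ ps)

    bunch : Bin × Bool → ℕ × Bunch
    bunch (b , s) = capacity b , map toItem (contents b s)

    packing : Packing (map capacity bins) (map toItem tokens)
    -- The selection lists the chosen reactions before the others; its permutation to the order of
    -- `bins` carries the bits along.
    packing with ss , eq , p ← ↭-map-inv proj₁ bins-selection = record
      { bins     = map bunch ss
      ; capacity = ≡-trans (sym (map-∘ ss)) (≡-trans (map-∘ ss) (cong (map capacity) (sym eq)))
      ; fits     = All.map⁺ (All.tabulate λ { {b , s} _ → ≤-reflexive (≡-trans (vol-toItem (contents b s)) (weigh-contents b s)) })
      ; packed   = ↭-trans (↭-reflexive (unfold ss)) (↭-map⁺ toItem (↭-trans (concatMap-↭ _ (↭-sym p)) filled-selection))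
      }
      where
      unfold : ∀ ss → concatMap proj₂ (map bunch ss) ≡ map toItem (filled ss)
      unfold []             = refl
      unfold ((b , s) ∷ ss) = ≡-trans (cong (map toItem (contents b s) ++_) (unfold ss)) (sym (map-++ toItem (contents b s) _))

  -- The repacking instance of a token game

  module Repack (admissible : All Admissible bins) (same-number : length init ≡ length final)
    (8≤base : 8 ≤ base) {p : P} (p∈ : p ∈ init) where

    abstract

      -- The total volume bounds the volume of the small items and, being also the sum of all
      -- capacities, every single capacity, as the blockade requires.
      h : ℕ
      h = sum (map weigh tokens)

      h≡ : h ≡ sum (map weigh tokens)
      h≡ = refl

    items : List Item
    items = map toItem tokens

    caps : List ℕ
    caps = map capacity bins

    ∈-sum-≤ : ∀ {A : Set} (f : A → ℕ) {y ys} → y ∈ ys → f y ≤ sum (map f ys)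
    ∈-sum-≤ f (here refl) = m≤m+n _ _
    ∈-sum-≤ f (there y∈)  = ≤-trans (∈-sum-≤ f y∈) (m≤n+m _ _)

    caps≤h : All (_≤ h) caps
    caps≤h = All.map⁺ (All.tabulate λ b∈ → ≤-trans (∈-sum-≤ capacity b∈) (≤-reflexive (≡-trans (total same-number) (sym h≡))))

    8≤weigh : ∀ z → 8 ≤ weigh z
    8≤weigh z = ≤-trans 8≤base (≤-trans (m≤m*n base (base ^ slots) ⦃ >-nonZero (m^n>0 base ⦃ >-nonZero (≤-trans (s≤s z≤n) 8≤base) ⦄ slots) ⦄)
      (weigh-≥ z))

    8≤items : All (λ u → 8 ≤ size u) items
    8≤items = All.map⁺ (All.tabulate λ {z} _ → ≤-trans (8≤weigh z) (≤-reflexive (sym (size-toItem z))))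

    7≤h : 7 ≤ h
    7≤h = ≤-trans (n≤1+n 7) (subst (8 ≤_) (sym h≡) (≤-trans (8≤weigh (inj₁ p , false)) (∈-sum-≤ weigh {inj₁ p , false} {tokens}
      (∈-concatMap⁺ initially (lose {x = initB p} (∈-++⁺ʳ reactionBins (∈-++⁺ˡ (∈-map⁺ initB p∈))) (here refl))))))

    open Blockade h public

    volume : vol items ≤ h
    volume = ≤-reflexive (≡-trans (vol-toItem tokens) (sym h≡))

    repacking : RepackingInstance
    repacking = record
      { capacity   = κ
      ; source     = source items caps , source-legal volume caps≤h
      ; target     = target items caps , target-legal volume caps≤h
      ; sameLength = refl
      }

    choice⇒yes : Choice ins outs init final rs → DecisionProblem.Yes Repacking repacking
    choice⇒yes c = Complete.reconfigure caps≤h (Pack.packing c) (target-legal {items} {caps} volume caps≤h) (source-legal {items} {caps} volume caps≤h)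

    yes⇒choice : ∀ {C D : LegalConfiguration κ} → Reconfigurable κ C D →
      proj₁ C ≡ source items caps → proj₁ D ≡ target items caps → Choice ins outs init final rs
    yes⇒choice {C} {D} r p q = packing⇒choice admissible same-number (Sound.packable 7≤h caps≤h 8≤items {C} {D} r p q)

    choice⇔language : Choice ins outs init final rs ⇔ language unary Repacking (encodeRepacking repacking)
    choice⇔language = mk⇔ (λ c → repacking , refl , choice⇒yes c)
      (λ (I , eq , y) → let c , s , t = encoding-injective I repacking eq in yes-elim (λ {C} {D} → yes⇒choice {C} {D}) I c s t y)

-- Sub-multisets

infix 4 _⊑_
_⊑_ : {A : Set} → List A → List A → Set
xs ⊑ ys = ∃[ zs ] ys ↭ xs ++ zs

⊑-↭ : ∀ {A : Set} {xs xs′ ys : List A} → xs ↭ xs′ → xs ⊑ ys → xs′ ⊑ ys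
⊑-↭ p (zs , q) = zs , ↭-trans q (++⁺ʳ zs p)

⊑-++ : ∀ {A : Set} {xs xs′ ys ys′ : List A} → xs ⊑ ys → xs′ ⊑ ys′ → xs ++ xs′ ⊑ ys ++ ys′
⊑-++ {A} {xs} {xs′} (zs , p) (zs′ , q) = zs ++ zs′ , ↭-trans (++⁺ p q)
  (solve 4 (λ a b c d → (a ⊕ b) ⊕ (c ⊕ d) ⊜ (a ⊕ c) ⊕ (b ⊕ d)) ↭-refl xs zs xs′ zs′)
  where open Bag A

[]-⊑ : ∀ {A : Set} {ys : List A} → [] ⊑ ys
[]-⊑ {ys = ys} = ys , ↭-refl

∈-⊑ : ∀ {A : Set} {x : A} {ys} → x ∈ ys → x ∷ [] ⊑ ys
∈-⊑ {x = x} x∈ with as , bs , refl ← ∈-∃++ x∈ = as ++ bs , shift x as bs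

⊑-concatMap : ∀ {A B : Set} {f g : A → List B} → (∀ x → f x ⊑ g x) → ∀ xs → concatMap f xs ⊑ concatMap g xs
⊑-concatMap p []       = []-⊑
⊑-concatMap p (x ∷ xs) = ⊑-++ (p x) (⊑-concatMap p xs)

concatMap-∷ : ∀ {A B : Set} (f : A → B) (g : A → List B) xs →
  concatMap (λ x → f x ∷ g x) xs ↭ map f xs ++ concatMap g xs
concatMap-∷ f g []       = ↭-refl
concatMap-∷ f g (x ∷ xs) = ↭-prep (f x) (↭-trans (++⁺ˡ (g x) (concatMap-∷ f g xs)) (shifts (g x) (map f xs)))

concatMap-cong-↭ : ∀ {A B : Set} {f g : A → List B} → (∀ x → f x ↭ g x) → ∀ xs → concatMap f xs ↭ concatMap g xs
concatMap-cong-↭ p []       = ↭-refl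
concatMap-cong-↭ p (x ∷ xs) = ++⁺ (p x) (concatMap-cong-↭ p xs)

∈-concatMap-find : ∀ {A B : Set} (f : A → List B) {y} xs → y ∈ concatMap f xs → ∃[ x ] (x ∈ xs × y ∈ f x)
∈-concatMap-find f xs y∈ = find (∈-concatMap⁻ f y∈)

∈-concatMap-put : ∀ {A B : Set} (f : A → List B) {x y xs} → x ∈ xs → y ∈ f x → y ∈ concatMap f xs
∈-concatMap-put f x∈ y∈ = ∈-concatMap⁺ f (lose x∈ y∈)

vecs : {A : Set} → ∀ k → List A → List (Vec A k)
vecs zero    as = [] ∷ []
vecs (suc k) as = concatMap (λ a → map (a ∷_) (vecs k as)) as

∈-vecs : ∀ {A : Set} {k} {as : List A} (v : Vec A k) → (∀ i → lookup v i ∈ as) → v ∈ vecs k as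
∈-vecs []      p = here refl
∈-vecs (a ∷ v) p = ∈-concatMap-put (λ a → map (a ∷_) (vecs _ _)) (p zero) (∈-map⁺ (a ∷_) (∈-vecs v (p ∘ suc)))

vecs-∈ : ∀ {A : Set} k {as : List A} {v} → v ∈ vecs k as → ∀ i → lookup v i ∈ as
vecs-∈ (suc k) {as} v∈ i with a , a∈ , v∈′ ← ∈-concatMap-find (λ a → map (a ∷_) (vecs k as)) as v∈ with w , w∈ , refl ← ∈-map⁻ (a ∷_) v∈′ with i
... | zero  = a∈
... | suc i = vecs-∈ k w∈ i

update : {A : Set} → (ℕ → A) → ℕ → A → ℕ → A
update c h s p = if p ≡ᵇ h then s else c p

update-same : ∀ {A : Set} (c : ℕ → A) h s → update c h s h ≡ s
update-same c h s with h ≡ᵇ h | ≡ᵇ-refl h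
  where
  ≡ᵇ-refl : ∀ h → (h ≡ᵇ h) ≡ true
  ≡ᵇ-refl zero    = refl
  ≡ᵇ-refl (suc h) = ≡ᵇ-refl h
... | true | refl = refl

update-other : ∀ {A : Set} (c : ℕ → A) {h p} s → p ≢ h → update c h s p ≡ c p
update-other c {zero}  {zero}  s p≢h = contradiction refl p≢h
update-other c {zero}  {suc p} s p≢h = refl
update-other c {suc h} {zero}  s p≢h = refl
update-other c {suc h} {suc p} s p≢h = update-other (c ∘ suc) s (p≢h ∘ cong suc)

-- Absolute positions on a tape

shifted : Move → ℕ → ℕ
shifted left  j = j
shifted stay  j = 1 + j
shifted right j = 2 + j

module _ {Mark : Set} where

  nth : List (Symbol Mark) → ℕ → Symbol Mark
  nth []       j       = blank
  nth (s ∷ ss) zero    = s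
  nth (s ∷ ss) (suc j) = nth ss j

  -- Positions start at 0, and nothing is said about cells further to the left. The heads will start
  -- far enough to the right never to get there.
  record Located (h : ℕ) (t : Tape Mark) (c : ℕ → Symbol Mark) : Set where
    constructor located
    field
      here-head   : head t ≡ c h
      left-of     : ∀ j → j < h → nth (before t) j ≡ c (h ∸ suc j)
      right-of    : ∀ j → nth (after t) j ≡ c (suc h + j)

  write-located : ∀ {h t c} s → Located h t c → Located h (act (s , stay) t) (update c h s)
  write-located {h} {tape ls _ rs} {c} s (located _ l r) = located
    (sym (update-same c h s))
    (λ j j<h → ≡-trans (l j j<h) (sym (update-other c s (<⇒≢ (∸-monoʳ-< {o = 0} (s≤s z≤n) j<h)))))
    (λ j → ≡-trans (r j) (sym (update-other c s (>⇒≢ (s≤s (m≤m+n h j))))))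

  move-located : ∀ {j t c} m → Located (suc j) t c → Located (shifted m j) (move m t) c
  move-located stay l = l
  move-located {j} {tape [] s rs} {c} left (located e l r) =
    located (l 0 (s≤s z≤n)) (λ i i<j → l (suc i) (s≤s i<j))
      λ { zero → ≡-trans e (cong (λ p → c (suc p)) (sym (+-identityʳ j))) ; (suc i) → ≡-trans (r i) (cong (λ p → c (suc p)) (sym (+-suc j i))) }
  move-located {j} {tape (s′ ∷ ls) s rs} {c} left (located e l r) =
    located (l 0 (s≤s z≤n)) (λ i i<j → l (suc i) (s≤s i<j))
      λ { zero → ≡-trans e (cong (λ p → c (suc p)) (sym (+-identityʳ j))) ; (suc i) → ≡-trans (r i) (cong (λ p → c (suc p)) (sym (+-suc j i))) }
  move-located {j} {tape ls s []} {c} right (located e l r) =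
    located (≡-trans (r 0) (cong (λ p → c (2 + p)) (+-identityʳ j)))
      (λ { zero _ → e ; (suc i) (s≤s i<j) → l i i<j })
      λ i → ≡-trans (r (suc i)) (cong (λ p → c (2 + p)) (+-suc j i))
  move-located {j} {tape ls s (s′ ∷ rs)} {c} right (located e l r) =
    located (≡-trans (r 0) (cong (λ p → c (2 + p)) (+-identityʳ j)))
      (λ { zero _ → e ; (suc i) (s≤s i<j) → l i i<j })
      λ i → ≡-trans (r (suc i)) (cong (λ p → c (2 + p)) (+-suc j i))

  act-located : ∀ {j t c} a → Located (suc j) t c → Located (shifted (proj₂ a) j) (act a t) (update c (suc j) (proj₁ a))
  act-located {t = tape ls s rs} (s′ , m) l = move-located m (write-located s′ l)

-- Places and reactions over numbers or numerical expressions N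

data Place (State Mark : Set) (k : ℕ) (N : Set) : Set where
  control : N → State → Vec N k → Place State Mark k N
  cell    : N → Fin k → N → Symbol Mark → Place State Mark k N

data Reaction (State Mark : Set) (k : ℕ) (N : Set) : Set where
  step   : N → State → Bool → Vec (Symbol Mark) k → Vec N k → Reaction State Mark k N
  idle   : N → Fin k → N → Symbol Mark → Reaction State Mark k N
  accept : State → Vec N k → Reaction State Mark k N
  erase  : Fin k → N → Symbol Mark → Reaction State Mark k N

module Net (M : TuringMachine Bool) (N : Set) (# : ℕ → N) (_⊹_ : ℕ → N → N) (T : N) where

  open TuringMachine M

  k : ℕ
  k = 1 + extraTapes

  PlaceN ReactionN : Set
  PlaceN = Place State Mark k N
  ReactionN = Reaction State Mark k N

  -- In a final state the machine rests, so that accepting runs can be taken to have exactly `T`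
  -- steps.
  δ′ : Bool → State → Vec (Symbol Mark) k → State × Vec (Symbol Mark × Move) k
  δ′ c q σ = if final q then (q , Vec.map (_, stay) σ) else δ c q σ

  displace : Move → N → N
  displace left  j = j
  displace stay  j = 1 ⊹ j
  displace right j = 2 ⊹ j

  -- The heads of step are at the successors of the given positions, so that a
  -- move to the left needs no subtraction.
  ins outs : ReactionN → List PlaceN
  ins (step t q c σ js) = control t q (Vec.map (1 ⊹_) js) ∷
    map (λ i → cell t i (1 ⊹ lookup js i) (lookup σ i)) (allFin k)
  ins (idle t i p s)    = cell t i p s ∷ []
  ins (accept q hs)     = control T q hs ∷ []
  ins (erase i p s)     = cell T i p s ∷ []
  outs (step t q c σ js) = control (1 ⊹ t) (proj₁ (δ′ c q σ)) (tabulate λ i → displace (proj₂ (lookup (proj₂ (δ′ c q σ)) i)) (lookup js i)) ∷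
    map (λ i → cell (1 ⊹ t) i (1 ⊹ lookup js i) (proj₁ (lookup (proj₂ (δ′ c q σ)) i))) (allFin k)
  outs (idle t i p s)    = cell (1 ⊹ t) i p s ∷ []
  -- Together with `erase` this leaves the same tokens at time `1 + T` for every accepting run, so
  -- the goal of the game can be fixed in advance.
  outs (accept q hs)     = control (1 ⊹ T) start (Vec.replicate k (# 0)) ∷ []
  outs (erase i p s)     = cell (1 ⊹ T) i p blank ∷ []

  balanced : ∀ r → length (ins r) ≡ length (outs r)
  balanced (step t q c σ js) = cong suc (≡-trans (length-map _ (allFin k)) (sym (length-map _ (allFin k))))
  balanced (idle t i p s)    = refl
  balanced (accept q hs)     = refl
  balanced (erase i p s)     = refl

-- Enumerations of finite types

elements : {A : Set} → Finite A → List A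
elements (n , e) = map (Inverse.from e) (allFin n)

∈-elements : ∀ {A : Set} (f : Finite A) a → a ∈ elements f
∈-elements (n , e) a = subst (_∈ _) (Inverse.inverseʳ e refl) (∈-map⁺ (Inverse.from e) (∈-allFin (Inverse.to e a)))

other? : ∀ h p → Dec (p ≢ h)
other? h p = ¬? (p ℕ.≟ h)

without : ℕ → List ℕ → List ℕ
without h = filter (other? h)

unique-split : ∀ {h} {xs : List ℕ} → Unique xs → h ∈ xs → xs ↭ h ∷ without h xs
unique-split {h} {_ ∷ xs} (h∉ ∷ u) (here refl) = ↭-prep h (↭-reflexive (sym (≡-trans
  (filter-reject (other? h) (λ h≢h → h≢h refl)) (filter-all (other? h) (All.map (_∘ sym) h∉)))))
unique-split {h} {x ∷ xs} (x∉ ∷ u) (there h∈) = ↭-trans (↭-prep x (unique-split u h∈))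
  (↭-trans (↭-swap x h ↭-refl) (↭-prep h (↭-reflexive (sym (filter-accept (other? h) (All.lookup x∉ h∈))))))

bools : List Bool
bools = true ∷ false ∷ []

∈-bools : ∀ b → b ∈ bools
∈-bools true  = here refl
∈-bools false = there (here refl)

symbols : {Mark : Set} → Finite Mark → List (Symbol Mark)
symbols f = blank ∷ bit true ∷ bit false ∷ map mark (elements f)

∈-symbols : ∀ {Mark : Set} (f : Finite Mark) s → s ∈ symbols f
∈-symbols f blank       = here refl
∈-symbols f (bit true)  = there (here refl)
∈-symbols f (bit false) = there (there (here refl))
∈-symbols f (mark m)    = there (there (there (∈-map⁺ mark (∈-elements f m))))

-- The net of a machine

module Reactions (M : TuringMachine Bool) (T W P : ℕ) where

  open TuringMachine M
  open Net M ℕ id _+_ T public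

  states : List State
  states = elements finiteStates

  syms : List (Symbol Mark)
  syms = symbols finiteMarks

  stepsOf : ℕ → State → Bool → List ReactionN
  stepsOf t q c = concatMap (λ σ → map (step t q c σ) (vecs k (upTo P))) (vecs k syms)

  steps idles level : ℕ → List ReactionN
  steps t = concatMap (λ q → concatMap (stepsOf t q) bools) states
  idles t = concatMap (λ i → concatMap (λ s → map (λ p → idle t i p s) (upTo W)) syms) (allFin k)
  level t = steps t ++ idles t

  acceptsIn : State → List ReactionN
  acceptsIn q = when (final q) (map (accept q) (vecs k (upTo W)))

  accepts erases : List ReactionN
  accepts = concatMap acceptsIn states
  erases  = concatMap (λ i → concatMap (λ s → map (λ p → erase i p s) (upTo W)) syms) (allFin k)

  reactions : List ReactionN
  reactions = concatMap level (upTo T) ++ accepts ++ erases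

  -- What is remembered about listed reactions: the bounds that keep addresses in range, and the
  -- finality of accepted states, which makes a choice an accepting run.
  Good : ReactionN → Set
  Good (step t q c σ js) = t < T × (∀ i → lookup js i < P)
  Good (idle t i p s)    = t < T × p < W
  Good (accept q hs)     = final q ≡ true × (∀ i → lookup hs i < W)
  Good (erase i p s)     = p < W

  good-tape : ∀ {f : Fin k → ℕ → Symbol Mark → ReactionN} {r} →
    r ∈ concatMap (λ i → concatMap (λ s → map (λ p → f i p s) (upTo W)) syms) (allFin k) →
    ∃[ i ] ∃[ p ] ∃[ s ] (p < W × r ≡ f i p s)
  good-tape {f} r∈
    with i , _ , r₁ ← ∈-concatMap-find (λ i → concatMap (λ s → map (λ p → f i p s) (upTo W)) syms) (allFin k) r∈
    with s , _ , r₂ ← ∈-concatMap-find (λ s → map (λ p → f i p s) (upTo W)) syms r₁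
    with p , p∈ , refl ← ∈-map⁻ (λ p → f i p s) r₂ = i , p , s , ∈-upTo⁻ p∈ , refl

  good-level : ∀ {t r} → t < T → r ∈ level t → Good r
  good-level {t} t< r∈ with ∈-++⁻ (steps t) r∈
  ... | inj₂ r₁ with i , p , s , p< , refl ← good-tape r₁ = t< , p<
  ... | inj₁ r₁
    with q , _ , r₂ ← ∈-concatMap-find (λ q → concatMap (stepsOf t q) bools) states r₁
    with c , _ , r₃ ← ∈-concatMap-find (stepsOf t q) bools r₂
    with σ , _ , r₄ ← ∈-concatMap-find (λ σ → map (step t q c σ) (vecs k (upTo P))) (vecs k syms) r₃
    with js , js∈ , refl ← ∈-map⁻ (step t q c σ) r₄ = t< , λ i → ∈-upTo⁻ (vecs-∈ k js∈ i)

  good-accept : ∀ {q r} b → final q ≡ b → r ∈ when b (map (accept q) (vecs k (upTo W))) → Good r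
  good-accept {q} true eq r∈ with hs , hs∈ , refl ← ∈-map⁻ (accept q) r∈ = eq , λ i → ∈-upTo⁻ (vecs-∈ k hs∈ i)

  good : ∀ {r} → r ∈ reactions → Good r
  good r∈ with ∈-++⁻ (concatMap level (upTo T)) r∈
  ... | inj₁ r₁ with t , t∈ , r₂ ← ∈-concatMap-find level (upTo T) r₁ = good-level (∈-upTo⁻ t∈) r₂
  ... | inj₂ r₁ with ∈-++⁻ accepts r₁
  ...   | inj₁ r₂ with q , _ , r₃ ← ∈-concatMap-find acceptsIn states r₂ = good-accept (final q) refl r₃
  ...   | inj₂ r₂ with i , p , s , p< , refl ← good-tape r₂ = p<

  step-∈ : ∀ t q c σ js → (∀ i → lookup js i < P) → step t q c σ js ∈ steps t
  step-∈ t q c σ js js< = ∈-concatMap-put (λ q → concatMap (stepsOf t q) bools) (∈-elements finiteStates q)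
    (∈-concatMap-put (stepsOf t q) (∈-bools c)
    (∈-concatMap-put (λ σ → map (step t q c σ) (vecs k (upTo P))) (∈-vecs σ λ i → ∈-symbols finiteMarks _)
    (∈-map⁺ (step t q c σ) (∈-vecs js λ i → ∈-upTo⁺ (js< i)))))

  accept-∈ : ∀ {q} hs → final q ≡ true → (∀ i → lookup hs i < W) → accept q hs ∈ accepts
  accept-∈ {q} hs fin hs< = ∈-concatMap-put acceptsIn (∈-elements finiteStates q)
    (subst (λ b → accept q hs ∈ when b (map (accept q) (vecs k (upTo W)))) (sym fin)
      (∈-map⁺ (accept q) (∈-vecs hs λ i → ∈-upTo⁺ (hs< i))))

  select : (ℕ → Fin k → ℕ → Symbol Mark → ReactionN) → ℕ → List ReactionN
  select f t = concatMap (λ i → concatMap (λ s → map (λ p → f t i p s) (upTo W)) syms) (allFin k)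

  -- A configuration uses one symbol for each position. After symbols and positions have been
  -- interchanged in the enumeration, that symbol is picked position by position.
  select-⊑ : ∀ f t (ps : Fin k → List ℕ) → (∀ i → ps i ⊑ upTo W) → (cells : Fin k → ℕ → Symbol Mark) →
    concatMap (λ i → map (λ p → f t i p (cells i p)) (ps i)) (allFin k) ⊑ select f t
  select-⊑ f t ps sub cells = ⊑-concatMap per-tape (allFin k)
    where
    transpose : ∀ i ss xs → concatMap (λ p → map (λ s → f t i p s) ss) xs ↭ concatMap (λ s → map (λ p → f t i p s) xs) ss
    transpose i ss []       = ↭-reflexive (sym (none ss))
      where
      none : ∀ ss → concatMap (λ s → map (λ p → f t i p s) []) ss ≡ []
      none []       = refl
      none (s ∷ ss) = none ss
    transpose i ss (p ∷ xs) = ↭-trans (++⁺ˡ (map (f t i p) ss) (transpose i ss xs))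
      (↭-sym (concatMap-∷ (f t i p) (λ s → map (λ p → f t i p s) xs) ss))
    choose : ∀ i xs → map (λ p → f t i p (cells i p)) xs ⊑ concatMap (λ p → map (f t i p) syms) xs
    choose i []       = []-⊑
    choose i (p ∷ xs) = ⊑-++ (∈-⊑ (∈-map⁺ (f t i p) (∈-symbols finiteMarks (cells i p)))) (choose i xs)
    per-tape : ∀ i → map (λ p → f t i p (cells i p)) (ps i) ⊑ concatMap (λ s → map (λ p → f t i p s) (upTo W)) syms
    per-tape i with zs , q ← sub i with ys , r ← choose i (upTo W) =
      map (λ p → f t i p (cells i p)) zs ++ ys , ↭-trans (↭-sym (transpose i syms (upTo W))) (↭-trans r
        (↭-trans (++⁺ʳ ys (↭-trans (↭-map⁺ _ q) (↭-reflexive (map-++ _ (ps i) zs)))) (↭-reflexive (++-assoc (map _ (ps i)) _ ys))))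

  -- Runs in absolute coordinates

  record Global : Set where
    constructor global
    field
      state : State
      heads : Vec ℕ k
      cells : Fin k → ℕ → Symbol Mark

  open Global

  scanned : Global → Vec (Symbol Mark) k
  scanned a = tabulate λ i → cells a i (lookup (heads a) i)

  decision : Bool → Global → State × Vec (Symbol Mark × Move) k
  decision c a = δ′ c (state a) (scanned a)

  action : Bool → Global → Fin k → Symbol Mark × Move
  action c a i = lookup (proj₂ (decision c a)) i

  next : Global → Bool → Global
  next a c = global (proj₁ (decision c a))
    (tabulate λ i → displace (proj₂ (action c a i)) (pred (lookup (heads a) i)))
    (λ i → update (cells a i) (lookup (heads a) i) (proj₁ (action c a i)))

  cellsAt : ℕ → Global → (Fin k → List ℕ) → List PlaceN
  cellsAt t a ps = concatMap (λ i → map (λ p → cell t i p (cells a i p)) (ps i)) (allFin k)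

  encode : ℕ → Global → List PlaceN
  encode t a = control t (state a) (heads a) ∷ cellsAt t a (λ _ → upTo W)

  away : Global → Fin k → List ℕ
  away a i = without (lookup (heads a) i) (upTo W)

  headCells : ℕ → Global → (Fin k → Symbol Mark) → List PlaceN
  headCells t a σ = map (λ i → cell t i (lookup (heads a) i) (σ i)) (allFin k)

  upTo-split : ∀ {h} → h < W → upTo W ↭ h ∷ without h (upTo W)
  upTo-split h<W = unique-split (upTo⁺ W) (∈-upTo⁺ h<W)

  cells-split : ∀ t a → (∀ i → lookup (heads a) i < W) →
    cellsAt t a (λ _ → upTo W) ↭ headCells t a (λ i → cells a i (lookup (heads a) i)) ++ cellsAt t a (away a)
  cells-split t a h<W = ↭-trans
    (concatMap-cong-↭ (λ i → ↭-map⁺ (λ p → cell t i p (cells a i p)) (upTo-split (h<W i))) (allFin k))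
    (concatMap-∷ (λ i → cell t i (lookup (heads a) i) (cells a i (lookup (heads a) i))) _ (allFin k))

  map-≗-All : ∀ {A B : Set} {f g : A → B} {xs} → All (λ x → f x ≡ g x) xs → map f xs ≡ map g xs
  map-≗-All []       = refl
  map-≗-All (p ∷ ps) = cong₂ _∷_ p (map-≗-All ps)

  next-split : ∀ t a c → (∀ i → lookup (heads a) i < W) →
    cellsAt t (next a c) (λ _ → upTo W) ↭ headCells t a (λ i → proj₁ (action c a i)) ++ cellsAt t a (away a)
  next-split t a c h<W = ↭-trans (concatMap-cong-↭ per-tape (allFin k)) (concatMap-∷ _ _ (allFin k))
    where
    per-tape : ∀ i → map (λ p → cell t i p (cells (next a c) i p)) (upTo W) ↭
      cell t i (lookup (heads a) i) (proj₁ (action c a i)) ∷ map (λ p → cell t i p (cells a i p)) (away a i)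
    per-tape i = ↭-trans (↭-map⁺ _ (upTo-split (h<W i))) (↭-reflexive (cong₂ _∷_
      (cong (cell t i _) (update-same (cells a i) (lookup (heads a) i) _))
      (map-≗-All (All.map (λ p≢h → cong (cell t i _) (update-other (cells a i) _ p≢h)) (All.all-filter (other? _) (upTo W))))))

  stepAt : ℕ → Global → Bool → ReactionN
  stepAt t a c = step t (state a) c (scanned a) (Vec.map pred (heads a))

  positive : Global → Set
  positive a = ∀ i → 1 ≤ lookup (heads a) i

  suc-pred-≥ : ∀ {n} → 1 ≤ n → suc (pred n) ≡ n
  suc-pred-≥ {suc n} _ = refl

  heads-pred : ∀ a → positive a → ∀ i → suc (lookup (Vec.map pred (heads a)) i) ≡ lookup (heads a) i
  heads-pred a pos i = ≡-trans (cong suc (Vec.lookup-map i pred (heads a))) (suc-pred-≥ (pos i))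

  map-pred : ∀ {n} (hs : Vec ℕ n) → (∀ i → 1 ≤ lookup hs i) → Vec.map suc (Vec.map pred hs) ≡ hs
  map-pred []       p = refl
  map-pred (h ∷ hs) p = cong₂ _∷_ (suc-pred-≥ (p zero)) (map-pred hs (p ∘ suc))

  ins-stepAt : ∀ t a c → positive a → ins (stepAt t a c) ≡
    control t (state a) (heads a) ∷ headCells t a (λ i → cells a i (lookup (heads a) i))
  ins-stepAt t a c pos = cong₂ _∷_ (cong (control t (state a)) (map-pred (heads a) pos))
    (map-cong (λ i → cong₂ (cell t i) (heads-pred a pos i) (Vec.lookup∘tabulate (λ j → cells a j (lookup (heads a) j)) i)) (allFin k))

  outs-stepAt : ∀ t a c → positive a → outs (stepAt t a c) ≡
    control (suc t) (state (next a c)) (heads (next a c)) ∷ headCells (suc t) a (λ i → proj₁ (action c a i))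
  outs-stepAt t a c pos = cong₂ _∷_
    (cong (control (suc t) _) (Vec.tabulate-cong λ i → cong (displace (proj₂ (action c a i))) (Vec.lookup-map i pred (heads a))))
    (map-cong (λ i → cong (λ h → cell (suc t) i h (proj₁ (action c a i))) (heads-pred a pos i)) (allFin k))

  run : List Bool → Global → Global
  run cs a = foldl next a cs

  later : PlaceN → PlaceN
  later (control t q hs) = control (suc t) q hs
  later (cell t i p s)   = cell (suc t) i p s

  later-cellsAt : ∀ t a ps → map later (cellsAt t a ps) ≡ cellsAt (suc t) a ps
  later-cellsAt t a ps = ≡-trans (map-concatMap later _ (allFin k)) (concatMap-cong (λ i → sym (map-∘ (ps i))) (allFin k))

  time : PlaceN → ℕ
  time (control t q hs) = t
  time (cell t i p s)   = t

  time-of : ReactionN → ℕ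
  time-of (step t q c σ js) = t
  time-of (idle t i p s)    = t
  time-of (accept q hs)     = T
  time-of (erase i p s)     = T

  time-ins : ∀ r → All (λ p → time p ≡ time-of r) (ins r)
  time-ins (step t q c σ js) = refl ∷ All.map⁺ (All.tabulate λ _ → refl)
  time-ins (idle t i p s)    = refl ∷ []
  time-ins (accept q hs)     = refl ∷ []
  time-ins (erase i p s)     = refl ∷ []

  time-outs : ∀ r → All (λ p → time p ≡ suc (time-of r)) (outs r)
  time-outs (step t q c σ js) = refl ∷ All.map⁺ (All.tabulate λ _ → refl)
  time-outs (idle t i p s)    = refl ∷ []
  time-outs (accept q hs)     = refl ∷ []
  time-outs (erase i p s)     = refl ∷ []

  All-cellsAt : ∀ {Q : PlaceN → Set} {t} a ps → (∀ i p s → Q (cell t i p s)) → All Q (cellsAt t a ps)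
  All-cellsAt {t = t} a ps h = All-concatMap {f = λ i → map (λ p → cell t i p (cells a i p)) (ps i)} {xs = allFin k}
    (All.tabulate λ {i} _ → All.map⁺ (All.tabulate λ {p} _ → h i p _))

  time-cellsAt : ∀ t a ps → All (λ p → time p ≡ t) (cellsAt t a ps)
  time-cellsAt t a ps = All-cellsAt a ps λ _ _ _ → refl

  IsCell : PlaceN → Set
  IsCell (control t q hs) = ⊥
  IsCell (cell t i p s)   = ⊤

  cells-cellsAt : ∀ t a ps → All IsCell (cellsAt t a ps)
  cells-cellsAt t a ps = All-cellsAt a ps λ _ _ _ → tt

  ∈-cellsAt : ∀ {t a ps i p s} → cell t i p s ∈ cellsAt t a ps → s ≡ cells a i p × p ∈ ps i
  ∈-cellsAt {t} {a} {ps} c∈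
    with i , _ , c∈′ ← ∈-concatMap-find (λ i → map (λ p → cell t i p (cells a i p)) (ps i)) (allFin k) c∈
    with p , p∈ , refl ← ∈-map⁻ (λ p → cell t i p (cells a i p)) c∈′ = refl , p∈

  cell∉headCells : ∀ {A : Set} {t q hs} {f : A → PlaceN} xs → (∀ x → IsCell (f x)) → ¬ (control t q hs ∈ map f xs)
  cell∉headCells {f = f} xs p c∈ with x , _ , eq ← ∈-map⁻ f c∈ = subst IsCell (sym eq) (p x)

  find-step : ∀ {t q hs} r → time-of r ≡ t → t < T → control t q hs ∈ ins r →
    ∃[ c ] ∃[ σ ] ∃[ js ] (r ≡ step t q c σ js × hs ≡ Vec.map suc js)
  find-step (step t q c σ js) refl t<T (here refl) = c , σ , js , refl , refl
  find-step (step t q c σ js) refl t<T (there c∈)  = ⊥-elim (cell∉headCells (allFin k) (λ _ → tt) c∈)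
  find-step (idle t i p s)    refl t<T (here ())
  find-step (accept q hs)     refl t<T _           = contradiction t<T 1+n≰n
  find-step (erase i p s)     refl t<T _           = contradiction t<T 1+n≰n

  outs-later : ∀ {t} r → time-of r ≡ t → t < T → All IsCell (ins r) → outs r ≡ map later (ins r)
  outs-later (step t q c σ js) refl t<T (() ∷ _)
  outs-later (idle t i p s)    refl t<T _ = refl
  outs-later (accept q hs)     refl t<T _ = contradiction t<T 1+n≰n
  outs-later (erase i p s)     refl t<T _ = contradiction t<T 1+n≰n

  outs-later-all : ∀ {t} rs → All (λ r → time-of r ≡ t) rs → t < T → All IsCell (concatMap ins rs) →
    concatMap outs rs ≡ map later (concatMap ins rs)
  outs-later-all []       []       t<T _ = refl
  outs-later-all (r ∷ rs) (p ∷ ps) t<T cs = ≡-trans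
    (cong₂ _++_ (outs-later r p t<T (All.++⁻ˡ (ins r) cs)) (outs-later-all rs ps t<T (All.++⁻ʳ (ins r) cs)))
    (sym (map-++ later (ins r) _))

  map-pred-suc : ∀ {n} (js : Vec ℕ n) → Vec.map pred (Vec.map suc js) ≡ js
  map-pred-suc []       = refl
  map-pred-suc (j ∷ js) = cong (j ∷_) (map-pred-suc js)

  -- The cells that the reaction consumes are cells of `a`, where a position carries just one
  -- symbol; so the reaction reads what is scanned. Its heads are successors, hence positive, and
  -- they lie on listed cells, hence below `W`.
  recognise : ∀ {t} a c σ js rest → heads a ≡ Vec.map suc js →
    encode t a ↭ ins (step t (state a) c σ js) ++ rest →
    step t (state a) c σ js ≡ stepAt t a c × positive a × (∀ i → lookup (heads a) i < W)
  recognise {t} a@(global q _ cs) c σ js rest refl p = cong₂ (step t q c) σ≡ (sym (map-pred-suc js)) , pos , bound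
    where
    inside : ∀ i → cell t i (suc (lookup js i)) (lookup σ i) ∈ cellsAt t a (λ _ → upTo W)
    inside i = ∈-resp-↭ (↭-sym (drop-∷ p)) (∈-++⁺ˡ (∈-map⁺ (λ i → cell t i (suc (lookup js i)) (lookup σ i)) (∈-allFin i)))
    at-head : ∀ i → suc (lookup js i) ≡ lookup (heads a) i
    at-head i = sym (Vec.lookup-map i suc js)
    σ≡ : σ ≡ scanned a
    σ≡ = ≡-trans (sym (Vec.tabulate∘lookup σ)) (Vec.tabulate-cong λ i →
      ≡-trans (proj₁ (∈-cellsAt {t} {a} (inside i))) (cong (cs i) (at-head i)))
    pos : positive a
    pos i = subst (1 ≤_) (at-head i) (s≤s z≤n)
    bound : ∀ i → lookup (heads a) i < W
    bound i = subst (_< W) (at-head i) (∈-upTo⁻ (proj₂ (∈-cellsAt {t} {a} (inside i))))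

  -- The configuration has one control token, so a single step consumes it. All other tokens are
  -- cells, which at this time only `idle` can consume, and `idle` merely delays them by one.
  advance : ∀ {t} a rs → t < T → All (λ r → time-of r ≡ t) rs → encode t a ↭ concatMap ins rs →
    ∃[ c ] concatMap outs rs ↭ encode (suc t) (next a c)
  advance {t} a rs t<T times p
    with r , r∈ , c∈ ← ∈-concatMap-find ins rs (∈-resp-↭ p (here refl))
    with c , σ , js , refl , heads≡ ← find-step r (All.lookup times r∈) t<T c∈
    with as , bs , refl ← ∈-∃++ r∈ = finish (recognise a c σ js (concatMap ins (as ++ bs)) heads≡ q)
    where
    q : encode t a ↭ ins (step t (state a) c σ js) ++ concatMap ins (as ++ bs)
    q = ↭-trans p (concatMap-↭ ins (shift _ as bs))
    finish : step t (state a) c σ js ≡ stepAt t a c × positive a × (∀ i → lookup (heads a) i < W) →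
      ∃[ c′ ] concatMap outs (as ++ step t (state a) c σ js ∷ bs) ↭ encode (suc t) (next a c′)
    finish (eq , pos , bound) = c , (begin
      concatMap outs (as ++ r ∷ bs)
        ↭⟨ concatMap-↭ outs (shift r as bs) ⟩
      outs r ++ concatMap outs (as ++ bs)
        ≡⟨ cong₂ _++_ (≡-trans (cong outs eq) (outs-stepAt t a c pos)) (outs-later-all (as ++ bs) times′ t<T
             (All-resp-↭ (↭-sym rest) (cells-cellsAt t a (away a)))) ⟩
      control′ ∷ headCells′ ++ map later (concatMap ins (as ++ bs))
        ↭⟨ ↭-prep control′ (++⁺ˡ headCells′ (↭-map⁺ later rest)) ⟩
      control′ ∷ headCells′ ++ map later (cellsAt t a (away a))
        ≡⟨ cong (λ ps → control′ ∷ headCells′ ++ ps) (later-cellsAt t a (away a)) ⟩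
      control′ ∷ headCells′ ++ cellsAt (suc t) a (away a)
        ↭⟨ ↭-prep control′ (next-split (suc t) a c bound) ⟨
      encode (suc t) (next a c) ∎)
      where
      open PermutationReasoning
      control′ : PlaceN
      control′ = control (suc t) (state (next a c)) (heads (next a c))
      headCells′ : List PlaceN
      headCells′ = headCells (suc t) a (λ i → proj₁ (action c a i))
      times′ : All (λ r → time-of r ≡ t) (as ++ bs)
      times′ = All.tail (All-resp-↭ (shift r as bs) times)
      scanning : List PlaceN
      scanning = headCells t a (λ i → cells a i (lookup (heads a) i))
      rest : concatMap ins (as ++ bs) ↭ cellsAt t a (away a)
      rest = ++-cancelˡ-↭ scanning (↭-trans
        (↭-sym (drop-∷ (subst (λ ps → encode t a ↭ ps ++ concatMap ins (as ++ bs)) (≡-trans (cong ins eq) (ins-stepAt t a c pos)) q)))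
        (cells-split t a bound))

  -- From a choice to an accepting run

  split-level : ∀ t rs → All (λ r → t ≤ time-of r) rs → Σ (List ReactionN) λ now → Σ (List ReactionN) λ after →
    rs ↭ now ++ after × All (λ r → time-of r ≡ t) now × All (λ r → suc t ≤ time-of r) after
  split-level t []       []       = [] , [] , ↭-refl , [] , []
  split-level t (r ∷ rs) (b ∷ bs) with split-level t rs bs | m≤n⇒m<n∨m≡n b
  ... | now , after , p , ns , as | inj₁ t<r = now , r ∷ after ,
    ↭-trans (↭-prep r p) (↭-sym (shift r now after)) , ns , t<r ∷ as
  ... | now , after , p , ns , as | inj₂ t≡r = r ∷ now , after , ↭-prep r p , sym t≡r ∷ ns , as

  now? : ∀ t p → Dec (time p ≡ t)
  now? t p = time p ℕ.≟ t

  -- All products and all of `qs` are later than `t`. So the tokens of time `t` are just `ps` on the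
  -- one side and the consumption of `now` on the other.
  front : ∀ t {ps qs} now after → All (λ p → time p ≡ t) ps → All (λ p → t < time p) qs →
    All (λ r → time-of r ≡ t) now → All (λ r → suc t ≤ time-of r) after →
    ps ++ concatMap outs (now ++ after) ↭ qs ++ concatMap ins (now ++ after) → ps ↭ concatMap ins now
  front t {ps} {qs} now after p≡ q> now≡ after> p = begin
    ps                                                                  ≡⟨ ++-identityʳ ps ⟨
    ps ++ []                                                            ≡⟨ cong₂ _++_ (filter-all (now? t) p≡) (filter-none (now? t) outs>) ⟨
    filter (now? t) ps ++ filter (now? t) (concatMap outs (now ++ after)) ≡⟨ filter-++ (now? t) ps _ ⟨
    filter (now? t) (ps ++ concatMap outs (now ++ after))               ↭⟨ filter-↭ (now? t) p ⟩
    filter (now? t) (qs ++ concatMap ins (now ++ after))                ≡⟨ filter-++ (now? t) qs _ ⟩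
    filter (now? t) qs ++ filter (now? t) (concatMap ins (now ++ after))
      ≡⟨ cong₂ _++_ (filter-none (now? t) (All.map >⇒≢ q>)) (cong (filter (now? t)) (concatMap-++ ins now after)) ⟩
    filter (now? t) (concatMap ins now ++ concatMap ins after)          ≡⟨ filter-++ (now? t) (concatMap ins now) _ ⟩
    filter (now? t) (concatMap ins now) ++ filter (now? t) (concatMap ins after)
      ≡⟨ cong₂ _++_ (filter-all (now? t) ins≡) (filter-none (now? t) ins>) ⟩
    concatMap ins now ++ []                                             ≡⟨ ++-identityʳ _ ⟩
    concatMap ins now ∎
    where
    open PermutationReasoning
    ins≡ : All (λ p → time p ≡ t) (concatMap ins now)
    ins≡ = All-concatMap (All.map (λ {r} e → All.map (λ e′ → ≡-trans e′ e) (time-ins r)) now≡)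
    ins> : All (λ p → time p ≢ t) (concatMap ins after)
    ins> = All-concatMap (All.map (λ {r} t<r → All.map (λ e → >⇒≢ (subst (t <_) (sym e) t<r)) (time-ins r)) after>)
    outs> : All (λ p → time p ≢ t) (concatMap outs (now ++ after))
    outs> = All-concatMap (All.map (λ {r} t≤r → All.map (λ e → >⇒≢ (subst (t <_) (sym e) (s≤s t≤r))) (time-outs r))
      (All.++⁺ (All.map (≤-reflexive ∘ sym) now≡) (All.map <⇒≤ after>)))

  time-encode : ∀ t a → All (λ p → time p ≡ t) (encode t a)
  time-encode t a = refl ∷ time-cellsAt t a (λ _ → upTo W)

  accepting-state : ∀ {q hs} r → Good r → time-of r ≡ T → control T q hs ∈ ins r → final q ≡ true
  accepting-state (step t q c σ js) (t< , _) refl _           = contradiction t< 1+n≰n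
  accepting-state (idle t i p s)    (t< , _) refl _           = contradiction t< 1+n≰n
  accepting-state (accept q hs)     (fin , _) _   (here refl) = fin
  accepting-state (erase i p s)     _        _    (here ())

  -- Induction on the number of steps left: the reactions of time `t` are split off, what they
  -- consume is cancelled, and what they produce encodes the next configuration. At time `T` only
  -- `accept` can consume the control token.
  choice⇒accepting : ∀ n t a rs {ps} → t + n ≡ T → All (λ r → t ≤ time-of r) rs → All Good rs → All (λ p → T < time p) ps →
    encode t a ++ concatMap outs rs ↭ ps ++ concatMap ins rs →
    ∃[ cs ] (length cs ≡ n × final (state (run cs a)) ≡ true)
  choice⇒accepting n t a rs {ps} t+n≡T later-rs goods ps> p
    with now , after , q , now≡ , after> ← split-level t rs later-rs = go n t+n≡T
    where
    p′ : encode t a ++ concatMap outs (now ++ after) ↭ ps ++ concatMap ins (now ++ after)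
    p′ = ↭-trans (++⁺ˡ (encode t a) (concatMap-↭ outs (↭-sym q))) (↭-trans p (++⁺ˡ ps (concatMap-↭ ins q)))
    consumed : t ≤ T → encode t a ↭ concatMap ins now
    consumed t≤T = front t now after (time-encode t a) (All.map (≤-<-trans t≤T) ps>) now≡ after> p′
    goods′ : All Good (now ++ after)
    goods′ = All-resp-↭ q goods
    handover : t ≤ T → ∀ {es} → concatMap outs now ↭ es → es ++ concatMap outs after ↭ ps ++ concatMap ins after
    handover t≤T {es} adv = ++-cancelˡ-↭ (concatMap ins now) (begin
      concatMap ins now ++ es ++ concatMap outs after
        ↭⟨ ++⁺ (↭-sym (consumed t≤T)) (++⁺ʳ (concatMap outs after) (↭-sym adv)) ⟩
      encode t a ++ concatMap outs now ++ concatMap outs after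
        ≡⟨ cong (encode t a ++_) (concatMap-++ outs now after) ⟨
      encode t a ++ concatMap outs (now ++ after)
        ↭⟨ p′ ⟩
      ps ++ concatMap ins (now ++ after)
        ≡⟨ cong (ps ++_) (concatMap-++ ins now after) ⟩
      ps ++ concatMap ins now ++ concatMap ins after
        ↭⟨ shifts ps (concatMap ins now) ⟩
      concatMap ins now ++ ps ++ concatMap ins after ∎)
      where open PermutationReasoning
    go : ∀ n → t + n ≡ T → ∃[ cs ] (length cs ≡ n × final (state (run cs a)) ≡ true)
    go zero eq with refl ← ≡-trans (sym (+-identityʳ t)) eq
      with r , r∈ , c∈ ← ∈-concatMap-find ins now (∈-resp-↭ (consumed ≤-refl) (here refl)) =
      [] , refl , accepting-state r (All.lookup goods′ (∈-++⁺ˡ r∈)) (All.lookup now≡ r∈) c∈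
    go (suc n) eq with c , adv ← advance a now (≤-trans (s≤s (m≤m+n t n)) (≤-reflexive (≡-trans (sym (+-suc t n)) eq))) now≡
        (consumed (≤-trans (m≤m+n t (suc n)) (≤-reflexive eq)))
      with cs , len , fin ← choice⇒accepting n (suc t) (next a c) after {ps} (≡-trans (sym (+-suc t n)) eq) after>
        (All.++⁻ʳ now goods′) ps> (handover (≤-trans (m≤m+n t (suc n)) (≤-reflexive eq)) adv) =
      c ∷ cs , cong suc len , fin

  goals : List PlaceN
  goals = control (suc T) start (Vec.replicate k 0) ∷
    concatMap (λ i → map (λ p → cell (suc T) i p blank) (upTo W)) (allFin k)

  goals-late : All (λ p → T < time p) goals
  goals-late = ≤-refl ∷ All-concatMap {f = λ i → map (λ p → cell (suc T) i p blank) (upTo W)} {xs = allFin k}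
    (All.tabulate λ _ → All.map⁺ (All.tabulate λ _ → ≤-refl))

  -- From an accepting run to a choice

  levels : ℕ → ℕ → List ReactionN
  levels t zero    = []
  levels t (suc n) = level t ++ levels (suc t) n

  levels-upTo : ∀ f t n → (∀ i → f i ≡ t + i) → concatMap level (applyUpTo f n) ≡ levels t n
  levels-upTo f t zero    eq = refl
  levels-upTo f t (suc n) eq = cong₂ _++_ (cong level (≡-trans (eq 0) (+-identityʳ t)))
    (levels-upTo (f ∘ suc) (suc t) n λ i → ≡-trans (eq (suc i)) (+-suc t i))

  -- Heads start at `suc T` and move at most one cell per step.
  InRange : ℕ → Global → Set
  InRange t a = ∀ i → suc T ≤ lookup (heads a) i + t × lookup (heads a) i ≤ suc T + t

  displace-range : ∀ m {j t} → suc T ≤ suc j + t → suc j ≤ suc T + t →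
    suc T ≤ displace m j + suc t × displace m j ≤ suc T + suc t
  displace-range left  {j} {t} l u = ≤-trans l (≤-reflexive (sym (+-suc j t))) ,
    ≤-trans (n≤1+n j) (≤-trans u (+-monoʳ-≤ (suc T) (n≤1+n t)))
  displace-range stay  {j} {t} l u = ≤-trans l (+-monoʳ-≤ (suc j) (n≤1+n t)) , ≤-trans u (+-monoʳ-≤ (suc T) (n≤1+n t))
  displace-range right {j} {t} l u = ≤-trans l (≤-trans (n≤1+n _) (+-monoʳ-≤ (2 + j) (n≤1+n t))) ,
    ≤-trans (s≤s u) (≤-reflexive (sym (+-suc (suc T) t)))

  concatMap-singles : ∀ {A B C : Set} (g : B → List C) (f : A → B) (h : A → C) → (∀ x → g (f x) ≡ h x ∷ []) →
    ∀ xs → concatMap g (map f xs) ≡ map h xs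
  concatMap-singles g f h eq []       = refl
  concatMap-singles g f h eq (x ∷ xs) = cong₂ _++_ (eq x) (concatMap-singles g f h eq xs)

  tapewise : ∀ {A B : Set} (g : A → List B) (f : Fin k → ℕ → A) (h : Fin k → ℕ → B) (ps : Fin k → List ℕ) →
    (∀ i p → g (f i p) ≡ h i p ∷ []) → concatMap g (concatMap (λ i → map (f i) (ps i)) (allFin k)) ≡ concatMap (λ i → map (h i) (ps i)) (allFin k)
  tapewise g f h ps eq = ≡-trans (concatMap-∘ g (λ i → map (f i) (ps i)) (allFin k))
    (concatMap-cong (λ i → concatMap-singles g (f i) (h i) (eq i) (ps i)) (allFin k))

  module _ (2T<P : T + T < P) (P<W : P < W) where

    in-range-positive : ∀ {t a} → t ≤ T → InRange t a → positive a
    in-range-positive {t} {a} t≤T r i = +-cancelʳ-≤ T 1 _ (≤-trans (proj₁ (r i)) (+-monoʳ-≤ (lookup (heads a) i) t≤T))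

    in-range-≤ : ∀ {t a} → t ≤ T → InRange t a → ∀ i → lookup (heads a) i ≤ P
    in-range-≤ t≤T r i = ≤-trans (proj₂ (r i)) (≤-trans (s≤s (+-monoʳ-≤ T t≤T)) 2T<P)

    in-range-next : ∀ {t a} c → t ≤ T → InRange t a → InRange (suc t) (next a c)
    in-range-next {t} {a} c t≤T r i = subst (λ h → suc T ≤ h + suc t × h ≤ suc T + suc t)
      (sym (Vec.lookup∘tabulate (λ i → displace (proj₂ (action c a i)) (pred (lookup (heads a) i))) i))
      (displace-range (proj₂ (action c a i)) (subst (λ h → suc T ≤ h + t) (sym (suc-pred-≥ pos)) (proj₁ (r i)))
        (subst (_≤ suc T + t) (sym (suc-pred-≥ pos)) (proj₂ (r i))))
      where
      pos : 1 ≤ lookup (heads a) i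
      pos = in-range-positive {t} {a} t≤T r i

    record Partial (t n : ℕ) (a : Global) : Set where
      field
        chosen  : List ReactionN
        within  : chosen ⊑ levels t n ++ accepts ++ erases
        balance : encode t a ++ concatMap outs chosen ↭ goals ++ concatMap ins chosen

    -- Each time before `T` uses one `step`, and `idle` for the cells away from the heads; time `T`
    -- uses one `accept` and an `erase` for every cell.
    accepting⇒choice : ∀ n t a cs → t + n ≡ T → length cs ≡ n → InRange t a → final (state (run cs a)) ≡ true → Partial t n a
    accepting⇒choice zero t a [] eq _ r fin with refl ← ≡-trans (sym (+-identityʳ t)) eq = record
      { chosen  = accept (state a) (heads a) ∷ eraser
      ; within  = ⊑-++ (∈-⊑ (accept-∈ (heads a) fin λ i → ≤-<-trans (in-range-≤ {t} {a} ≤-refl r i) P<W))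
                       (select-⊑ (λ _ → erase) t (λ _ → upTo W) (λ _ → [] , ↭-reflexive (sym (++-identityʳ (upTo W)))) (cells a))
      ; balance = ↭-trans (↭-reflexive (cong (λ ps → encode t a ++ control (suc t) start (Vec.replicate k 0) ∷ ps) (tapewise outs _ (λ i p → cell (suc T) i p blank) _ (λ _ _ → refl))))
          (↭-trans (++-comm (encode t a) goals)
            (↭-reflexive (cong (λ ps → goals ++ control T (state a) (heads a) ∷ ps) (sym (tapewise ins _ (λ i p → cell T i p (cells a i p)) _ (λ _ _ → refl))))))
      }
      where
      eraser : List ReactionN
      eraser = concatMap (λ i → map (λ p → erase i p (cells a i p)) (upTo W)) (allFin k)
    accepting⇒choice (suc n) t a (c ∷ cs) eq len r fin = record
      { chosen  = (stepAt t a c ∷ []) ++ idlers ++ chosen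
      ; within  = ⊑-↭ (↭-reflexive (++-assoc (stepAt t a c ∷ []) idlers chosen))
          (subst ((stepAt t a c ∷ idlers) ++ chosen ⊑_) (sym (++-assoc (level t) _ _))
          (⊑-++ (⊑-++ (∈-⊑ (step-∈ t _ c _ _ js<)) (select-⊑ idle t (away a) away⊑ (cells a))) within))
      ; balance = begin
          encode t a ++ concatMap outs ((stepAt t a c ∷ []) ++ idlers ++ chosen)
            ≡⟨ cong (λ ps → encode t a ++ outs (stepAt t a c) ++ ps) (concatMap-++ outs idlers chosen) ⟩
          encode t a ++ outs (stepAt t a c) ++ concatMap outs idlers ++ concatMap outs chosen
            ↭⟨ ++⁺ ins↭ (↭-trans (↭-reflexive (sym (++-assoc (outs (stepAt t a c)) _ _))) (++⁺ʳ (concatMap outs chosen) outs↭)) ⟩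
          (ins (stepAt t a c) ++ concatMap ins idlers) ++ encode (suc t) (next a c) ++ concatMap outs chosen
            ↭⟨ ++⁺ˡ (ins (stepAt t a c) ++ concatMap ins idlers) balance ⟩
          (ins (stepAt t a c) ++ concatMap ins idlers) ++ goals ++ concatMap ins chosen
            ↭⟨ shifts (ins (stepAt t a c) ++ concatMap ins idlers) goals ⟩
          goals ++ (ins (stepAt t a c) ++ concatMap ins idlers) ++ concatMap ins chosen
            ≡⟨ cong (goals ++_) (++-assoc (ins (stepAt t a c)) _ _) ⟩
          goals ++ ins (stepAt t a c) ++ concatMap ins idlers ++ concatMap ins chosen
            ≡⟨ cong (λ ps → goals ++ ins (stepAt t a c) ++ ps) (concatMap-++ ins idlers chosen) ⟨
          goals ++ concatMap ins ((stepAt t a c ∷ []) ++ idlers ++ chosen) ∎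
      }
      where
      open PermutationReasoning
      t≤T : t ≤ T
      t≤T = ≤-trans (m≤m+n t (suc n)) (≤-reflexive eq)
      pos : positive a
      pos = in-range-positive {t} {a} t≤T r
      bound : ∀ i → lookup (heads a) i < W
      bound i = ≤-<-trans (in-range-≤ {t} {a} t≤T r i) P<W
      open Partial (accepting⇒choice n (suc t) (next a c) cs (≡-trans (sym (+-suc t n)) eq) (suc-injective len)
        (in-range-next {t} {a} c t≤T r) fin)
      idlers : List ReactionN
      idlers = concatMap (λ i → map (λ p → idle t i p (cells a i p)) (away a i)) (allFin k)
      js< : ∀ i → lookup (Vec.map pred (heads a)) i < P
      js< i = subst (_≤ P) (sym (heads-pred a pos i)) (in-range-≤ {t} {a} t≤T r i)
      away⊑ : ∀ i → away a i ⊑ upTo W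
      away⊑ i = lookup (heads a) i ∷ [] , ↭-trans (upTo-split (bound i)) (∷↭∷ʳ _ (away a i))
      ins↭ : encode t a ↭ ins (stepAt t a c) ++ concatMap ins idlers
      ins↭ = subst₂ (λ ps qs → encode t a ↭ ps ++ qs) (sym (ins-stepAt t a c pos))
        (sym (tapewise ins _ (λ i p → cell t i p (cells a i p)) (away a) (λ _ _ → refl)))
        (↭-prep _ (cells-split t a bound))
      outs↭ : outs (stepAt t a c) ++ concatMap outs idlers ↭ encode (suc t) (next a c)
      outs↭ = subst₂ (λ ps qs → ps ++ qs ↭ encode (suc t) (next a c)) (sym (outs-stepAt t a c pos))
        (sym (tapewise outs _ (λ i p → cell (suc t) i p (cells a i p)) (away a) (λ _ _ → refl)))
        (↭-prep _ (↭-sym (next-split (suc t) a c bound)))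

-- Acceptance as a token game

module Acceptance (M : TuringMachine Bool) (T : ℕ) (x : List Bool) where

  open TuringMachine M
  open Computation M using (Snapshot; snapshot; initial; Halted) renaming (step to next-snapshot; run to run-snapshot)

  -- Steps are listed for heads at `1 + j` with `j < P`; one move later these are still below `W`,
  -- which is `P + 2`. The cells of a tape are `suc T` blanks to the left of the input, the input,
  -- and `2 + T` further blanks.
  P W : ℕ
  P = suc (T + T + length x)
  W = suc T + (length x + (2 + T))

  open Reactions M T W P public

  2T<P : T + T < P
  2T<P = s≤s (m≤m+n (T + T) (length x))

  P<W : P < W
  P<W = ≤-trans (n≤1+n (suc P)) (≤-reflexive (regroup T (length x)))
    where
    regroup : ∀ T n → 3 + (T + T + n) ≡ suc T + (n + (2 + T))
    regroup = solve-∀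

  record Represents (s : Snapshot) (a : Global) : Set where
    constructor represents
    field
      same-state : Computation.state s ≡ Global.state a
      same-tapes : ∀ i → Located (lookup (Global.heads a) i) (lookup (Computation.tapes s) i) (Global.cells a i)

  act-all : ∀ q′ (acts : Vec (Symbol Mark × Move) k) (ts : Vec (Tape Mark) k) (hs : Vec ℕ k)
    (cells : Fin k → ℕ → Symbol Mark) → (∀ i → 1 ≤ lookup hs i) →
    (∀ i → Located (lookup hs i) (lookup ts i) (cells i)) →
    Represents (snapshot q′ (Vec.zipWith act acts ts))
      (global q′ (tabulate λ i → displace (proj₂ (lookup acts i)) (pred (lookup hs i)))
        (λ i → update (cells i) (lookup hs i) (proj₁ (lookup acts i))))
  act-all q′ acts ts hs cells pos loc = represents refl λ i →
    subst₂ (λ h t → Located h t (update (cells i) (lookup hs i) (proj₁ (lookup acts i))))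
      (sym (≡-trans (Vec.lookup∘tabulate (λ i → displace (proj₂ (lookup acts i)) (pred (lookup hs i))) i)
        (displace-shifted (proj₂ (lookup acts i)) _)))
      (sym (Vec.lookup-zipWith act i acts ts))
      (subst (λ h → Located (shifted (proj₂ (lookup acts i)) (pred (lookup hs i))) (act (lookup acts i) (lookup ts i))
          (update (cells i) h (proj₁ (lookup acts i)))) (suc-pred-≥ (pos i))
        (act-located (lookup acts i) (subst (λ h → Located h (lookup ts i) (cells i)) (sym (suc-pred-≥ (pos i))) (loc i))))
    where
    displace-shifted : ∀ m j → displace m j ≡ shifted m j
    displace-shifted left  j = refl
    displace-shifted stay  j = refl
    displace-shifted right j = refl

  act-stay : ∀ {n} (ts : Vec (Tape Mark) n) → Vec.zipWith act (Vec.map (_, stay) (Vec.map head ts)) ts ≡ ts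
  act-stay []       = refl
  act-stay (t ∷ ts) = cong (t ∷_) (act-stay ts)

  decide : Bool → State → Vec (Tape Mark) k → Snapshot
  decide c q ts = snapshot (proj₁ (δ′ c q (Vec.map head ts))) (Vec.zipWith act (proj₂ (δ′ c q (Vec.map head ts))) ts)

  -- A halted machine leaves its snapshot alone, whereas `δ′` rewrites every scanned symbol by
  -- itself and stays; on the tapes both are the identity.
  decide-step : ∀ c q ts → decide c q ts ≡ next-snapshot (snapshot q ts) c
  decide-step c q ts with final q
  ... | true  = cong (snapshot q) (act-stay ts)
  ... | false = refl

  represents-next : ∀ {s a} c → positive a → Represents s a → Represents (next-snapshot s c) (next a c)
  represents-next {snapshot q ts} {a@(global q hs cells)} c pos (represents refl loc) =
    subst (λ s → Represents s (next a c)) (decide-step c q ts)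
      (subst (λ σ → Represents (snapshot (proj₁ (δ′ c q (Vec.map head ts))) (Vec.zipWith act (proj₂ (δ′ c q (Vec.map head ts))) ts))
          (global (proj₁ (δ′ c q σ)) (tabulate λ i → displace (proj₂ (lookup (proj₂ (δ′ c q σ)) i)) (pred (lookup hs i)))
            (λ i → update (cells i) (lookup hs i) (proj₁ (lookup (proj₂ (δ′ c q σ)) i)))))
        read (act-all _ (proj₂ (δ′ c q (Vec.map head ts))) ts hs cells pos loc))
    where
    read : Vec.map head ts ≡ scanned a
    read = ≡-trans (sym (Vec.tabulate∘lookup (Vec.map head ts)))
      (Vec.tabulate-cong λ i → ≡-trans (Vec.lookup-map i head ts) (Located.here-head (loc i)))

  represents-run : ∀ n t cs {s a} → t + n ≡ T → length cs ≡ n → InRange t a → Represents s a →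
    Represents (run-snapshot cs s) (run cs a)
  represents-run zero    t []       eq len r rep = rep
  represents-run (suc n) t (c ∷ cs) {s} {a} eq len r rep =
    represents-run n (suc t) cs (≡-trans (sym (+-suc t n)) eq) (suc-injective len) (in-range-next 2T<P P<W {t} {a} c t≤T r)
      (represents-next {s} {a} c (in-range-positive 2T<P P<W {t} {a} t≤T r) rep)
    where
    t≤T : t ≤ T
    t≤T = ≤-trans (m≤m+n t (suc n)) (≤-reflexive eq)

  inputCells : ℕ → Symbol Mark
  inputCells = nth (replicate (suc T) blank ++ map bit x)

  initialCells : Fin k → ℕ → Symbol Mark
  initialCells zero    = inputCells
  initialCells (suc i) = λ _ → blank

  initialGlobal : Global
  initialGlobal = global start (Vec.replicate k (suc T)) initialCells

  nth-blanks : ∀ n {p} → p < n → (ss : List (Symbol Mark)) → nth (replicate n blank ++ ss) p ≡ blank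
  nth-blanks (suc n) {zero}  p<n       ss = refl
  nth-blanks (suc n) {suc p} (s≤s p<n) ss = nth-blanks n p<n ss

  nth-beyond : ∀ n p (ss : List (Symbol Mark)) → nth (replicate n blank ++ ss) (n + p) ≡ nth ss p
  nth-beyond zero    p ss = refl
  nth-beyond (suc n) p ss = nth-beyond n p ss

  represents-initial : Represents (initial x) initialGlobal
  represents-initial = represents refl λ
    { zero    → subst (λ c → Located (suc T) (inputTape x) c) refl input
    ; (suc i) → subst₂ (λ h t → Located h t (λ _ → blank)) (sym (Vec.lookup-replicate i (suc T)))
        (sym (Vec.lookup-replicate i blankTape)) (located refl (λ _ _ → refl) λ _ → refl)
    }
    where
    beyond : ∀ j → inputCells (suc (suc T) + j) ≡ nth (map bit x) (suc j)
    beyond j = ≡-trans (cong inputCells (sym (+-suc (suc T) j))) (nth-beyond (suc T) (suc j) (map bit x))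
    at-start : inputCells (suc T) ≡ nth (map bit x) 0
    at-start = ≡-trans (cong inputCells (sym (+-identityʳ (suc T)))) (nth-beyond (suc T) 0 (map bit x))
    before-start : ∀ j → j < suc T → blank ≡ inputCells (suc T ∸ suc j)
    before-start j j< = sym (nth-blanks (suc T) (s≤s (m∸n≤m T j)) (map bit x))
    shape : ∀ bs → head (inputTape bs) ≡ nth (map bit bs) 0 × before (inputTape bs) ≡ [] ×
      (∀ j → nth (after (inputTape bs)) j ≡ nth (map bit bs) (suc j))
    shape []       = refl , refl , λ _ → refl
    shape (b ∷ bs) = refl , refl , λ _ → refl
    input : Located (suc T) (inputTape x) inputCells
    input = let h , l , r = shape x in located (≡-trans h (sym at-start))
      (λ j j< → ≡-trans (cong (λ ss → nth ss j) l) (before-start j j<))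
      (λ j → ≡-trans (r j) (sym (beyond j)))

  bitCells : ℕ → List Bool → List PlaceN
  bitCells m []       = []
  bitCells m (b ∷ bs) = cell 0 zero m (bit b) ∷ bitCells (suc m) bs

  -- The initial places in an order in which a program can list them: the blanks by loops, the bits
  -- by one scan of the input.
  inputStarts otherStarts starts : List PlaceN
  inputStarts = map (λ p → cell 0 zero p blank) (upTo (suc T)) ++ bitCells (suc T) x ++
    map (λ p → cell 0 zero (suc T + (length x + p)) blank) (upTo (2 + T))
  otherStarts = concatMap (λ i → map (λ p → cell 0 (suc i) p blank) (upTo W)) (allFin extraTapes)
  starts      = control 0 start (Vec.replicate k (suc T)) ∷ inputStarts ++ otherStarts

  map-upTo-+ : ∀ {A : Set} (f : ℕ → A) m n → map f (upTo (m + n)) ≡ map f (upTo m) ++ map (λ p → f (m + p)) (upTo n)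
  map-upTo-+ f m n = ≡-trans (map-upTo f (m + n)) (≡-trans (go f m) (sym (cong₂ _++_ (map-upTo f m) (map-upTo _ n))))
    where
    go : ∀ {A : Set} (f : ℕ → A) m → applyUpTo f (m + n) ≡ applyUpTo f m ++ applyUpTo (λ p → f (m + p)) n
    go f zero    = refl
    go f (suc m) = cong (f 0 ∷_) (go (λ p → f (suc p)) m)

  inputStarts≡ : inputStarts ≡ map (λ p → cell 0 zero p (inputCells p)) (upTo W)
  inputStarts≡ = begin
    map (λ p → cell 0 zero p blank) (upTo (suc T)) ++ bitCells (suc T) x ++ map (λ p → cell 0 zero (suc T + (length x + p)) blank) (upTo (2 + T))
      ≡⟨ cong₂ _++_ (map-≗-All (All.tabulate λ p∈ → cong (cell 0 zero _) (sym (nth-blanks (suc T) (∈-upTo⁻ p∈) (map bit x)))))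
           (cong₂ _++_ (bits≡ (suc T) x (λ j → refl)) (map-cong (λ p → cong (cell 0 zero _) (sym (beyond x p))) (upTo (2 + T)))) ⟩
    map (λ p → cell 0 zero p (inputCells p)) (upTo (suc T)) ++
      map (λ p → cell 0 zero (suc T + p) (nth (map bit x) p)) (upTo (length x)) ++
      map (λ p → cell 0 zero (suc T + (length x + p)) (nth (map bit x) (length x + p))) (upTo (2 + T))
      ≡⟨ cong (map (λ p → cell 0 zero p (inputCells p)) (upTo (suc T)) ++_)
           (map-upTo-+ (λ p → cell 0 zero (suc T + p) (nth (map bit x) p)) (length x) (2 + T)) ⟨
    map (λ p → cell 0 zero p (inputCells p)) (upTo (suc T)) ++
      map (λ p → cell 0 zero (suc T + p) (nth (map bit x) p)) (upTo (length x + (2 + T)))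
      ≡⟨ cong (map (λ p → cell 0 zero p (inputCells p)) (upTo (suc T)) ++_)
           (map-cong (λ p → cong (cell 0 zero _) (nth-beyond (suc T) p (map bit x))) (upTo (length x + (2 + T)))) ⟨
    map (λ p → cell 0 zero p (inputCells p)) (upTo (suc T)) ++ map (λ p → cell 0 zero (suc T + p) (inputCells (suc T + p))) (upTo (length x + (2 + T)))
      ≡⟨ map-upTo-+ (λ p → cell 0 zero p (inputCells p)) (suc T) (length x + (2 + T)) ⟨
    map (λ p → cell 0 zero p (inputCells p)) (upTo W) ∎
    where
    open ≡-Reasoning
    beyond : ∀ bs p → nth (map bit bs) (length bs + p) ≡ blank {Mark}
    beyond []       p = refl
    beyond (b ∷ bs) p = beyond bs p
    bits≡ : ∀ m bs {f : ℕ → ℕ} → (∀ j → f j ≡ m + j) → bitCells m bs ≡ map (λ p → cell 0 zero (f p) (nth (map bit bs) p)) (upTo (length bs))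
    bits≡ m []       eq = refl
    bits≡ m (b ∷ bs) {f} eq = cong₂ _∷_ (cong (λ p → cell 0 zero p (bit b)) (≡-trans (sym (+-identityʳ m)) (sym (eq 0))))
      (≡-trans (bits≡ (suc m) bs (λ j → ≡-trans (eq (suc j)) (+-suc m j))) (≡-trans (map-upTo _ (length bs)) (sym (map-applyUpTo suc _ (length bs)))))

  starts≡ : starts ≡ encode 0 initialGlobal
  starts≡ = cong (control 0 start (Vec.replicate k (suc T)) ∷_) (cong₂ _++_ inputStarts≡
    (≡-trans (sym (concatMap-map onTape suc (allFin extraTapes)))
      (cong (concatMap onTape) (map-tabulate {n = extraTapes} (λ i → i) suc))))
    where
    onTape : Fin k → List PlaceN
    onTape i = map (λ p → cell 0 i p (initialCells i p)) (upTo W)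

  in-range-initial : InRange 0 initialGlobal
  in-range-initial i = subst (λ h → suc T ≤ h + 0 × h ≤ suc T + 0) (sym (Vec.lookup-replicate i (suc T)))
    (≤-reflexive (sym (+-identityʳ (suc T))) , ≤-reflexive (sym (+-identityʳ (suc T))))

  Accepting : Set
  Accepting = ∃[ cs ] (length cs ≡ T × Halted (run-snapshot cs (initial x)))

  same-final : ∀ cs → length cs ≡ T → final (Computation.state (run-snapshot cs (initial x))) ≡ final (Global.state (run cs initialGlobal))
  same-final cs len = cong final (Represents.same-state (represents-run T 0 cs refl len in-range-initial represents-initial))

  accepting⇔choice : Accepting ⇔ Choice ins outs starts goals reactions
  accepting⇔choice = mk⇔ to from
    where
    to : Accepting → Choice ins outs starts goals reactions
    to (cs , len , fin) = record
      { chosen  = chosen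
      ; others  = proj₁ within
      ; split   = subst (_↭ chosen ++ proj₁ within) (cong (_++ accepts ++ erases) (sym (levels-upTo id 0 T (λ _ → refl)))) (proj₂ within)
      ; balance = subst (λ ps → ps ++ concatMap outs chosen ↭ goals ++ concatMap ins chosen) (sym starts≡) balance
      }
      where open Partial (accepting⇒choice 2T<P P<W T 0 initialGlobal cs refl len in-range-initial (≡-trans (sym (same-final cs len)) fin))
    from : Choice ins outs starts goals reactions → Accepting
    from choice = let cs , len , fin = accepted in cs , len , ≡-trans (same-final cs len) fin
      where
      open Choice choice
      accepted : ∃[ cs ] (length cs ≡ T × final (Global.state (run cs initialGlobal)) ≡ true)
      accepted = choice⇒accepting T 0 initialGlobal chosen {goals} refl (All.tabulate λ _ → z≤n)
        (All.tabulate λ r∈ → good (∈-resp-↭ (↭-sym split) (∈-++⁺ˡ r∈))) goals-late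
        (subst (λ ps → ps ++ concatMap outs chosen ↭ goals ++ concatMap ins chosen) starts≡ balance)

-- Structured programs for Turing machines

Sym : Set
Sym = Symbol ⊤

finite-⊤ : Finite ⊤
finite-⊤ = 1 , ↔-sym Fin.1↔⊤

finite-⊎ : {A B : Set} → Finite A → Finite B → Finite (A ⊎ B)
finite-⊎ (m , f) (n , g) = m + n , ↔-sym Fin.+↔⊎ ↔-∘ (f ⊎-↔ g)

module Programs (N : ℕ) where

  Tapes : Set
  Tapes = Vec (Tape ⊤) (suc N)

  Index : Set
  Index = Fin (suc N)

  data Prog : Set where
    op     : Index → (Sym → Sym × Move) → Prog
    _⨾_    : Prog → Prog → Prog
    while  : Index → (Sym → Bool) → Prog → Prog
    branch : Index → (Sym → Bool) → Prog → Prog → Prog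

  infixr 5 _⨾_

  on-tape : Index → (Sym → Sym × Move) → Tapes → Tapes
  on-tape i f ts = updateAt ts i (λ t → act (f (head t)) t)

  scanned : Index → Tapes → Sym
  scanned i ts = head (lookup ts i)

  -- The number is the exact running time of the machine: an operation or a test takes one step,
  -- sequencing takes none.
  data Exec : Prog → Tapes → ℕ → Tapes → Set where
    op        : ∀ {i f ts} → Exec (op i f) ts 1 (on-tape i f ts)
    _⨾_       : ∀ {p q ts ts′ ts″ m n} → Exec p ts m ts′ → Exec q ts′ n ts″ → Exec (p ⨾ q) ts (m + n) ts″
    stop      : ∀ {i f p ts} → f (scanned i ts) ≡ false → Exec (while i f p) ts 1 ts
    again     : ∀ {i f p ts ts′ ts″ m n} → f (scanned i ts) ≡ true → Exec p ts m ts′ →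
                Exec (while i f p) ts′ n ts″ → Exec (while i f p) ts (suc (m + n)) ts″
    if-true   : ∀ {i f p q ts ts′ n} → f (scanned i ts) ≡ true → Exec p ts n ts′ → Exec (branch i f p q) ts (suc n) ts′
    if-false  : ∀ {i f p q ts ts′ n} → f (scanned i ts) ≡ false → Exec q ts n ts′ → Exec (branch i f p q) ts (suc n) ts′

  -- The states of the machine apart from the exit; loops and branches have one for the test.
  Control : Prog → Set
  Control (op i f)         = ⊤
  Control (p ⨾ q)          = Control p ⊎ Control q
  Control (while i f p)    = ⊤ ⊎ Control p
  Control (branch i f p q) = ⊤ ⊎ (Control p ⊎ Control q)

  finite-Control : ∀ p → Finite (Control p)
  finite-Control (op i f)         = finite-⊤
  finite-Control (p ⨾ q)          = finite-⊎ (finite-Control p) (finite-Control q)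
  finite-Control (while i f p)    = finite-⊎ finite-⊤ (finite-Control p)
  finite-Control (branch i f p q) = finite-⊎ finite-⊤ (finite-⊎ (finite-Control p) (finite-Control q))

  entry : ∀ p → Control p
  entry (op i f)         = tt
  entry (p ⨾ q)          = inj₁ (entry p)
  entry (while i f p)    = inj₁ tt
  entry (branch i f p q) = inj₁ tt

  Heads Actions : Set
  Heads   = Vec Sym (suc N)
  Actions = Vec (Sym × Move) (suc N)

  resting : Heads → Actions
  resting = Vec.map (_, stay)

  -- inj₁ tt is the exit.
  successor : ∀ p → Control p → Heads → ⊤ ⊎ Control p
  successor (op i f)         _               hs = inj₁ tt
  successor (p ⨾ q)          (inj₁ c)        hs = [ (λ _ → inj₂ (inj₂ (entry q))) , inj₂ ∘ inj₁ ]′ (successor p c hs)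
  successor (p ⨾ q)          (inj₂ c)        hs = [ inj₁ , inj₂ ∘ inj₂ ]′ (successor q c hs)
  successor (while i f p)    (inj₁ _)        hs = if f (lookup hs i) then inj₂ (inj₂ (entry p)) else inj₁ tt
  successor (while i f p)    (inj₂ c)        hs = [ (λ _ → inj₂ (inj₁ tt)) , inj₂ ∘ inj₂ ]′ (successor p c hs)
  successor (branch i f p q) (inj₁ _)        hs = inj₂ (inj₂ (if f (lookup hs i) then inj₁ (entry p) else inj₂ (entry q)))
  successor (branch i f p q) (inj₂ (inj₁ c)) hs = [ inj₁ , inj₂ ∘ inj₂ ∘ inj₁ ]′ (successor p c hs)
  successor (branch i f p q) (inj₂ (inj₂ c)) hs = [ inj₁ , inj₂ ∘ inj₂ ∘ inj₂ ]′ (successor q c hs)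

  actions : ∀ p → Control p → Heads → Actions
  actions (op i f)         _               hs = updateAt (resting hs) i (λ _ → f (lookup hs i))
  actions (p ⨾ q)          (inj₁ c)        hs = actions p c hs
  actions (p ⨾ q)          (inj₂ c)        hs = actions q c hs
  actions (while i f p)    (inj₁ _)        hs = resting hs
  actions (while i f p)    (inj₂ c)        hs = actions p c hs
  actions (branch i f p q) (inj₁ _)        hs = resting hs
  actions (branch i f p q) (inj₂ (inj₁ c)) hs = actions p c hs
  actions (branch i f p q) (inj₂ (inj₂ c)) hs = actions q c hs

  heads : Tapes → Heads
  heads = Vec.map head

  perform : Actions → Tapes → Tapes
  perform = Vec.zipWith act

  perform-resting : ∀ {n} (ts : Vec (Tape ⊤) n) → Vec.zipWith act (Vec.map (_, stay) (Vec.map head ts)) ts ≡ ts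
  perform-resting []       = refl
  perform-resting (t ∷ ts) = cong (t ∷_) (perform-resting ts)

  perform-op : ∀ {n} (i : Fin n) (f : Sym → Sym × Move) (ts : Vec (Tape ⊤) n) →
    Vec.zipWith act (updateAt (Vec.map (_, stay) (Vec.map head ts)) i (λ _ → f (lookup (Vec.map head ts) i))) ts ≡
    updateAt ts i (λ t → act (f (head t)) t)
  perform-op zero    f (t ∷ ts) = cong (act (f (head t)) t ∷_) (perform-resting ts)
  perform-op (suc i) f (t ∷ ts) = cong (t ∷_) (perform-op i f ts)

  data Reach (p : Prog) : Control p → Tapes → ℕ → Tapes → Set where
    exit : ∀ {c ts} → successor p c (heads ts) ≡ inj₁ tt → Reach p c ts 1 (perform (actions p c (heads ts)) ts)
    more : ∀ {c c′ ts ts′ n} → successor p c (heads ts) ≡ inj₂ c′ →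
           Reach p c′ (perform (actions p c (heads ts)) ts) n ts′ → Reach p c ts (suc n) ts′

  reach-⨾ʳ : ∀ {p q c ts n ts′} → Reach q c ts n ts′ → Reach (p ⨾ q) (inj₂ c) ts n ts′
  reach-⨾ʳ (exit e)   = exit (cong [ inj₁ , inj₂ ∘ inj₂ ]′ e)
  reach-⨾ʳ (more e r) = more (cong [ inj₁ , inj₂ ∘ inj₂ ]′ e) (reach-⨾ʳ r)

  reach-⨾ : ∀ {p q c ts ts′ ts″ m n} → Reach p c ts m ts′ → Reach q (entry q) ts′ n ts″ → Reach (p ⨾ q) (inj₁ c) ts (m + n) ts″
  reach-⨾ {q = q} (exit e)   s = more (cong [ (λ _ → inj₂ (inj₂ (entry q))) , inj₂ ∘ inj₁ ]′ e) (reach-⨾ʳ s)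
  reach-⨾ {q = q} (more e r) s = more (cong [ (λ _ → inj₂ (inj₂ (entry q))) , inj₂ ∘ inj₁ ]′ e) (reach-⨾ r s)

  reach-while : ∀ {i f p c ts ts′ ts″ m n} → Reach p c ts m ts′ → Reach (while i f p) (inj₁ tt) ts′ n ts″ →
    Reach (while i f p) (inj₂ c) ts (m + n) ts″
  reach-while (exit e)   s = more (cong [ (λ _ → inj₂ (inj₁ tt)) , inj₂ ∘ inj₂ ]′ e) s
  reach-while (more e r) s = more (cong [ (λ _ → inj₂ (inj₁ tt)) , inj₂ ∘ inj₂ ]′ e) (reach-while r s)

  reach-true : ∀ {i f p q c ts n ts′} → Reach p c ts n ts′ → Reach (branch i f p q) (inj₂ (inj₁ c)) ts n ts′
  reach-true (exit e)   = exit (cong [ inj₁ , inj₂ ∘ inj₂ ∘ inj₁ ]′ e)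
  reach-true (more e r) = more (cong [ inj₁ , inj₂ ∘ inj₂ ∘ inj₁ ]′ e) (reach-true r)

  reach-false : ∀ {i f p q c ts n ts′} → Reach q c ts n ts′ → Reach (branch i f p q) (inj₂ (inj₂ c)) ts n ts′
  reach-false (exit e)   = exit (cong [ inj₁ , inj₂ ∘ inj₂ ∘ inj₂ ]′ e)
  reach-false (more e r) = more (cong [ inj₁ , inj₂ ∘ inj₂ ∘ inj₂ ]′ e) (reach-false r)

  read : ∀ i ts (f : Sym → Bool) {b} → f (scanned i ts) ≡ b → f (lookup (heads ts) i) ≡ b
  read i ts f e = ≡-trans (cong f (Vec.lookup-map i head ts)) e

  reach : ∀ {p ts n ts′} → Exec p ts n ts′ → Reach p (entry p) ts n ts′
  reach (op {i} {f} {ts}) = subst (Reach (op i f) tt ts 1) (perform-op i f ts) (exit refl)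
  reach (e ⨾ e′) = reach-⨾ (reach e) (reach e′)
  reach (stop {i} {f} {p} {ts} e) = subst (Reach (while i f p) (inj₁ tt) ts 1) (perform-resting ts)
    (exit (cong (λ b → if b then inj₂ (inj₂ (entry p)) else inj₁ tt) (read i ts f e)))
  reach (again {i} {f} {p} {ts} {ts″ = ts″} e e₁ e₂) =
    more (cong (λ b → if b then inj₂ (inj₂ (entry p)) else inj₁ tt) (read i ts f e))
      (subst (λ ts → Reach (while i f p) (inj₂ (entry p)) ts _ ts″) (sym (perform-resting ts)) (reach-while (reach e₁) (reach e₂)))
  reach (if-true {i} {f} {p} {q} {ts} {ts′} e e₁) =
    more (cong (λ b → inj₂ (inj₂ (if b then inj₁ (entry p) else inj₂ (entry q)))) (read i ts f e))
      (subst (λ ts → Reach (branch i f p q) _ ts _ ts′) (sym (perform-resting ts)) (reach-true (reach e₁)))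
  reach (if-false {i} {f} {p} {q} {ts} {ts′} e e₁) =
    more (cong (λ b → inj₂ (inj₂ (if b then inj₁ (entry p) else inj₂ (entry q)))) (read i ts f e))
      (subst (λ ts → Reach (branch i f p q) _ ts _ ts′) (sym (perform-resting ts)) (reach-false (reach e₁)))

  machine : Prog → TuringMachine ⊤
  machine p = record
    { State        = ⊤ ⊎ Control p
    ; Mark         = ⊤
    ; finiteStates = finite-⊎ finite-⊤ (finite-Control p)
    ; finiteMarks  = finite-⊤
    ; extraTapes   = N
    ; start        = inj₂ (entry p)
    ; final        = [ (λ _ → true) , (λ _ → false) ]′
    ; δ            = λ _ q hs → [ (λ _ → q , resting hs) , (λ c → successor p c hs , actions p c hs) ]′ q
    }

  module _ (p : Prog) where

    open Computation (machine p)

    run-reach : ∀ {c ts n ts′} → Reach p c ts n ts′ →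
      run (replicate n tt) (snapshot (inj₂ c) ts) ≡ snapshot (inj₁ tt) ts′
    run-reach (exit {c} {ts} e) = cong (λ q → snapshot q (perform (actions p c (heads ts)) ts)) e
    run-reach (more {c} {ts = ts} {n = n} e r) = ≡-trans
      (cong (λ q → run (replicate n tt) (snapshot q (perform (actions p c (heads ts)) ts))) e) (run-reach r)

    run-exec : ∀ {ts n ts′} → Exec p ts n ts′ →
      run (replicate n tt) (snapshot (inj₂ (entry p)) ts) ≡ snapshot (inj₁ tt) ts′
    run-exec e = run-reach (reach e)

-- Counters, input and output on tapes

Blanks : List Sym → Set
Blanks = All (_≡ blank)

-- A counter is the distance of the head from a mark.
data Counter : ℕ → Tape ⊤ → Set where
  none : ∀ {rs} → Blanks rs → Counter 0 (tape [] (mark tt) rs)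
  some : ∀ {v rs} → Blanks rs → Counter (suc v) (tape (replicate v blank ++ mark tt ∷ []) blank rs)

nonzero : Sym → Bool
nonzero (mark _) = false
nonzero _        = true

counter-zero : ∀ {t} → Counter 0 t → nonzero (head t) ≡ false
counter-zero (none _) = refl

counter-suc : ∀ {v t} → Counter (suc v) t → nonzero (head t) ≡ true
counter-suc (some _) = refl

counter-inc : ∀ {v t} → Counter v t → Counter (suc v) (act (head t , right) t)
counter-inc (none [])                  = some []
counter-inc (none (refl ∷ bs))         = some bs
counter-inc (some {v} [])              = some {suc v} []
counter-inc (some {v} (refl ∷ bs))     = some {suc v} bs

counter-dec : ∀ {v t} → Counter (suc v) t → Counter v (act (head t , left) t)
counter-dec (some {zero} bs)  = none (refl ∷ bs)
counter-dec (some {suc v} bs) = some (refl ∷ bs)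

-- past is reversed.
record Input (past rest : List Bool) (t : Tape ⊤) : Set where
  constructor input
  field
    {margin} : ℕ
    behind   : before t ≡ map bit past
    ahead    : head t ∷ after t ≡ map bit rest ++ replicate margin blank

isBlank : Sym → Bool
isBlank blank = true
isBlank _     = false

isTrue : Sym → Bool
isTrue (bit true) = true
isTrue _          = false

input-end : ∀ {ps t} → Input ps [] t → isBlank (head t) ≡ true
input-end (input {suc m} _ refl) = refl

input-bit : ∀ {ps b ss t} → Input ps (b ∷ ss) t → head t ≡ bit b
input-bit (input _ refl) = refl

input-forward : ∀ {ps b ss t} → Input ps (b ∷ ss) t → Input (b ∷ ps) ss (act (head t , right) t)
input-forward {ss = []}     {tape ls h []}       (input {zero}  refl refl) = input {margin = 1} refl refl
input-forward {ss = []}     {tape ls h (r ∷ rs)} (input {suc m} refl refl) = input {margin = suc m} refl refl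
input-forward {ss = s ∷ ss} {tape ls h (r ∷ rs)} (input {m} refl refl)     = input {margin = m} refl refl

input-backward : ∀ {b ps ss t} → Input (b ∷ ps) ss t → Input ps (b ∷ ss) (act (head t , left) t)
input-backward {t = tape (l ∷ ls) h rs} (input {m} refl e) = input {margin = m} refl (cong (_ ∷_) e)

-- The output so far ends to the left of the head.
data Output : List Bool → Tape ⊤ → Set where
  output : ∀ w → Output w (tape (map bit (reverse w)) blank [])

output-put : ∀ {w t} b → Output w t → Output (w ++ b ∷ []) (act (bit b , right) t)
output-put b (output w) = subst (λ ls → Output (w ++ b ∷ []) (tape ls blank []))
  (cong (map bit) (reverse-++ w (b ∷ []))) (output (w ++ b ∷ []))

-- Gives every number a register, so that programs can be written without proofs of bounds; only
-- their correctness asks for `l ≤ R`.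
clamp : ∀ n → ℕ → Fin (suc n)
clamp n       zero    = zero
clamp zero    (suc l) = zero
clamp (suc n) (suc l) = suc (clamp n l)

toℕ-clamp : ∀ {n l} → l ≤ n → toℕ (clamp n l) ≡ l
toℕ-clamp z≤n     = refl
toℕ-clamp (s≤s p) = cong suc (toℕ-clamp p)

-- Programs on registers

record Config : Set where
  constructor config
  field
    env     : ℕ → ℕ
    past    : List Bool
    rest    : List Bool
    written : List Bool

open Config

module Registers (R : ℕ) where

  open Programs (2 + R) public

  inp out : Index
  inp = zero
  out = fromℕ (2 + R)

  reg : ℕ → Index
  reg l = suc (inject₁ (clamp R l))

  reg≢out : ∀ l → reg l ≢ out
  reg≢out l e = Fin.fromℕ≢inject₁ (sym (Fin.suc-injective e))

  reg-injective : ∀ {l m} → l ≤ R → m ≤ R → reg l ≡ reg m → l ≡ m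
  reg-injective p q e = ≡-trans (sym (toℕ-clamp p)) (≡-trans (cong toℕ (Fin.inject₁-injective (Fin.suc-injective e))) (toℕ-clamp q))

  record Holds (c : Config) (ts : Tapes) : Set where
    constructor holds
    field
      counters : ∀ l → l ≤ R → Counter (env c l) (lookup ts (reg l))
      inputs   : Input (past c) (rest c) (lookup ts inp)
      outputs  : Output (written c) (lookup ts out)

  Does : Prog → Config → ℕ → Config → Set
  Does p c b c′ = ∀ {ts} → Holds c ts → ∃[ n ] ∃[ ts′ ] (n ≤ b × Exec p ts n ts′ × Holds c′ ts′)

  infix 4 _≈_
  -- Environments are functions, and the updates below can only be compared pointwise.
  record _≈_ (c d : Config) : Set where
    constructor same
    field
      same-env     : ∀ l → env c l ≡ env d l
      same-past    : past c ≡ past d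
      same-rest    : rest c ≡ rest d
      same-written : written c ≡ written d

  ≈-refl : ∀ {c} → c ≈ c
  ≈-refl = same (λ _ → refl) refl refl refl

  ≈-sym : ∀ {c d} → c ≈ d → d ≈ c
  ≈-sym (same e p r w) = same (sym ∘ e) (sym p) (sym r) (sym w)

  ≈-trans : ∀ {c d e} → c ≈ d → d ≈ e → c ≈ e
  ≈-trans (same e p r w) (same e′ p′ r′ w′) = same (λ l → ≡-trans (e l) (e′ l)) (≡-trans p p′) (≡-trans r r′) (≡-trans w w′)

  holds-≈ : ∀ {c d ts} → c ≈ d → Holds c ts → Holds d ts
  holds-≈ {ts = ts} (same e refl refl refl) (holds r i o) = holds (λ l l≤R → subst (λ v → Counter v (lookup ts (reg l))) (e l) (r l l≤R)) i o

  does-≈ : ∀ {p c c′ d d′ b} → c ≈ c′ → d′ ≈ d → Does p c′ b d′ → Does p c b d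
  does-≈ e f p h = let n , ts′ , n≤ , x , h′ = p (holds-≈ e h) in n , ts′ , n≤ , x , holds-≈ f h′

  does-≤ : ∀ {p c d b b′} → b ≤ b′ → Does p c b d → Does p c b′ d
  does-≤ b≤ p h = let n , ts′ , n≤ , x , h′ = p h in n , ts′ , ≤-trans n≤ b≤ , x , h′

  infixr 5 _⨟_
  _⨟_ : ∀ {p q c d e b b′} → Does p c b d → Does q d b′ e → Does (p ⨾ q) c (b + b′) e
  (p ⨟ q) h = let m , ts′ , m≤ , x , h′ = p h ; n , ts″ , n≤ , y , h″ = q h′ in
    m + n , ts″ , +-mono-≤ m≤ n≤ , x ⨾ y , h″

  setReg : ℕ → ℕ → Config → Config
  setReg l v c = record c { env = update (env c) l v }

  module _ {l : ℕ} (l≤R : l ≤ R) (f : Sym → Sym × Move) where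

    op-reg : ∀ {v c} → (∀ {t} → Counter (env c l) t → Counter v (act (f (head t)) t)) → Does (op (reg l) f) c 1 (setReg l v c)
    op-reg {v} {c} acts {ts} (holds r i o) = 1 , _ , ≤-refl , op , holds counters
      (subst (Input (past c) (rest c)) (sym (Vec.lookup∘updateAt′ inp (reg l) (λ ()) ts)) i)
      (subst (Output (written c)) (sym (Vec.lookup∘updateAt′ out (reg l) (λ e → reg≢out l (sym e)) ts)) o)
      where
      counters : ∀ m → m ≤ R → Counter (update (env c) l v m) (lookup (on-tape (reg l) f ts) (reg m))
      counters m m≤R with m ≟ l
      ... | yes refl = subst₂ Counter (sym (update-same (env c) l v)) (sym (Vec.lookup∘updateAt (reg l) ts)) (acts (r l l≤R))
      ... | no m≢l   = subst₂ Counter (sym (update-other (env c) v m≢l))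
        (sym (Vec.lookup∘updateAt′ (reg m) (reg l) (m≢l ∘ reg-injective m≤R l≤R) ts)) (r m m≤R)

  inc dec : ℕ → Prog
  inc l = op (reg l) λ s → s , right
  dec l = op (reg l) λ s → s , left

  does-inc : ∀ {l c} → l ≤ R → Does (inc l) c 1 (setReg l (suc (env c l)) c)
  does-inc l≤R = op-reg l≤R _ counter-inc

  does-dec : ∀ {l v c} → l ≤ R → env c l ≡ suc v → Does (dec l) c 1 (setReg l v c)
  does-dec {v = v} l≤R e = op-reg l≤R _ λ {t} k → counter-dec (subst (λ n → Counter n t) e k)

  emit : Bool → Prog
  emit b = op out λ _ → bit b , right

  does-emit : ∀ {c} b → Does (emit b) c 1 (record c { written = written c ++ b ∷ [] })
  does-emit b {ts} (holds r i o) = 1 , _ , ≤-refl , op , holds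
    (λ l l≤R → subst (Counter _) (sym (Vec.lookup∘updateAt′ (reg l) out (reg≢out l) ts)) (r l l≤R))
    (subst (Input _ _) (sym (Vec.lookup∘updateAt′ inp out (λ ()) ts)) i)
    (subst (Output _) (sym (Vec.lookup∘updateAt out ts)) (output-put b o))

  forward backward : Prog
  forward  = op inp λ s → s , right
  backward = op inp λ s → s , left

  does-forward : ∀ {c b ss} → rest c ≡ b ∷ ss → Does forward c 1 (record c { past = b ∷ past c ; rest = ss })
  does-forward refl {t ∷ ts} (holds r i o) = 1 , _ , ≤-refl , op , holds r (input-forward i) o

  does-backward : ∀ {c b ps} → past c ≡ b ∷ ps → Does backward c 1 (record c { past = ps ; rest = b ∷ rest c })
  does-backward refl {t ∷ ts} (holds r i o) = 1 , _ , ≤-refl , op , holds r (input-backward i) o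

  countdown : ℕ → Prog → Prog
  countdown l p = while (reg l) nonzero (dec l ⨾ p)

  -- `c r` is the state with `r` rounds to go. Besides the `b` steps of the body, a round takes one
  -- step for the test and one for the decrement; the last test accounts for the 1.
  does-countdown : ∀ {l p} (c : ℕ → Config) b v → l ≤ R → (∀ r → r ≤ v → env (c r) l ≡ r) →
    (∀ r → r < v → Does p (setReg l r (c (suc r))) b (c r)) → Does (countdown l p) (c v) (v * (2 + b) + 1) (c 0)
  does-countdown c b zero l≤R value body {ts} h = 1 , ts , ≤-refl ,
    stop (counter-zero (subst (λ v → Counter v _) (value 0 ≤-refl) (Holds.counters h _ l≤R))) , h
  does-countdown c b (suc v) l≤R value body h =
    let m , ts′ , m≤ , x , h′ = (does-dec l≤R (value (suc v) ≤-refl) ⨟ body v ≤-refl) h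
        n , ts″ , n≤ , y , h″ = does-countdown c b v l≤R (λ r r≤v → value r (m≤n⇒m≤1+n r≤v)) (λ r r<v → body r (m≤n⇒m≤1+n r<v)) h′
    in suc (m + n) , ts″ , ≤-trans (s≤s (+-mono-≤ m≤ n≤)) (≤-reflexive (cong suc (sym (+-assoc (suc b) _ 1)))) ,
       again (counter-suc (subst (λ v → Counter v _) (value (suc v) ≤-refl) (Holds.counters h _ l≤R))) x y , h″

-- Numerical expressions

infixl 6 _⊞_ _⊟_
infixl 7 _⊠_

data Expr (V : Set) : Set where
  lit         : ℕ → Expr V
  var         : V → Expr V
  _⊞_ _⊠_ _⊟_ : Expr V → Expr V → Expr V

value : ∀ {V} → (V → ℕ) → Expr V → ℕ
value η (lit n) = n
value η (var v) = η v
value η (e ⊞ f) = value η e + value η f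
value η (e ⊠ f) = value η e * value η f
value η (e ⊟ f) = value η e ∸ value η f

value-cong : ∀ {V} {η θ : V → ℕ} → (∀ v → η v ≡ θ v) → ∀ e → value η e ≡ value θ e
value-cong p (lit n) = refl
value-cong p (var v) = p v
value-cong p (e ⊞ f) = cong₂ _+_ (value-cong p e) (value-cong p f)
value-cong p (e ⊠ f) = cong₂ _*_ (value-cong p e) (value-cong p f)
value-cong p (e ⊟ f) = cong₂ _∸_ (value-cong p e) (value-cong p f)

bound : ∀ {V} → Expr V → ℕ → ℕ
bound (lit n) m = n
bound (var v) m = m
bound (e ⊞ f) m = bound e m + bound f m
bound (e ⊠ f) m = bound e m * bound f m
bound (e ⊟ f) m = bound e m

value≤bound : ∀ {V} {η : V → ℕ} {m} → (∀ v → η v ≤ m) → ∀ e → value η e ≤ bound e m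
value≤bound p (lit n) = ≤-refl
value≤bound p (var v) = p v
value≤bound p (e ⊞ f) = +-mono-≤ (value≤bound p e) (value≤bound p f)
value≤bound p (e ⊠ f) = *-mono-≤ (value≤bound p e) (value≤bound p f)
value≤bound p (e ⊟ f) = ≤-trans (m∸n≤m _ (value _ f)) (value≤bound p e)

-- An upper bound on the number of scratch registers; sums in place of maxima are good enough, as
-- the number depends on the program only.
uses : ∀ {V} → Expr V → ℕ
uses (lit n) = 0
uses (var v) = 1
uses (e ⊞ f) = uses e + uses f
uses (e ⊠ f) = 1 + (uses e + uses f)
uses (e ⊟ f) = 2 + (uses e + uses f)

timeE : ∀ {V} → Expr V → ℕ → ℕ
timeE (lit n) m = n + 1
timeE (var v) m = (m * 3 + 1) + (m * 4 + 1)
timeE (e ⊞ f) m = timeE e m + timeE f m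
timeE (e ⊠ f) m = timeE e m + (bound e m * (2 + timeE f m) + 1)
timeE (e ⊟ f) m = timeE e m + (timeE f m + ((bound f m * 4 + 1) + (bound e m * 3 + 1)))

ones : ℕ → List Bool
ones n = replicate n true

ones-+ : ∀ m n → ones m ++ ones n ≡ ones (m + n)
ones-+ zero    n = refl
ones-+ (suc m) n = cong (true ∷_) (ones-+ m n)

-- The same code either prints or counts: bits deposited on the output are written, and bits
-- deposited in a register only add their number to it.
data Sink : Set where
  toReg : ℕ → Sink
  toOut : Sink

NotSink : Sink → ℕ → Set
NotSink (toReg a) l = l ≢ a
NotSink toOut     l = ⊤

Below : ℕ → Sink → Set
Below d (toReg a) = a < d
Below d toOut     = ⊤

below-not : ∀ {d l} s → Below d s → d ≤ l → NotSink s l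
below-not (toReg a) a<d d≤l = >⇒≢ (≤-trans a<d d≤l)
below-not toOut     _   _   = tt

below-≤ : ∀ {d d′} s → d ≤ d′ → Below d s → Below d′ s
below-≤ (toReg a) d≤ a<d = ≤-trans a<d d≤
below-≤ toOut     _  _   = tt

-- Programs for expressions

module Compile (R : ℕ) where

  open Registers R public

  deposit : Sink → List Bool → Config → Config
  deposit (toReg a) bs c = setReg a (env c a + length bs) c
  deposit toOut     bs c = record c { written = written c ++ bs }

  set-same : ∀ {l v} c → env (setReg l v c) l ≡ v
  set-same {l} {v} c = update-same (env c) l v

  set-other : ∀ {l v p} c → p ≢ l → env (setReg l v c) p ≡ env c p
  set-other c p≢l = update-other (env c) _ p≢l

  update-pointwise : ∀ {f g : ℕ → ℕ} l {v w} → v ≡ w → (∀ p → p ≢ l → f p ≡ g p) → ∀ p → update f l v p ≡ update g l w p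
  update-pointwise {f} {g} l {v} refl e p with p ≟ l
  ... | yes refl = ≡-trans (update-same f l v) (sym (update-same g l v))
  ... | no p≢l   = ≡-trans (update-other f v p≢l) (≡-trans (e p p≢l) (sym (update-other g v p≢l)))

  set-cong : ∀ {l v w c d} → v ≡ w → c ≈ d → setReg l v c ≈ setReg l w d
  set-cong {l} e (same f p r w) = same (update-pointwise l e λ q _ → f q) p r w

  set-set : ∀ {l v w c} → setReg l v (setReg l w c) ≈ setReg l v c
  set-set {l} {c = c} = same (update-pointwise {g = env c} l refl λ p p≢l → update-other (env c) _ p≢l) refl refl refl

  set-id : ∀ {l v c} → env c l ≡ v → setReg l v c ≈ c
  set-id {l} {v} {c} e = same pointwise refl refl refl
    where
    pointwise : ∀ p → update (env c) l v p ≡ env c p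
    pointwise p with p ≟ l
    ... | yes refl = ≡-trans (update-same (env c) l v) (sym e)
    ... | no p≢l   = update-other (env c) v p≢l

  set-comm : ∀ {l m v w c} → l ≢ m → setReg l v (setReg m w c) ≈ setReg m w (setReg l v c)
  set-comm {l} {m} {v} {w} {c} l≢m = same pointwise refl refl refl
    where
    pointwise : ∀ p → update (update (env c) m w) l v p ≡ update (update (env c) l v) m w p
    pointwise p with p ≟ l | p ≟ m
    ... | yes refl | yes refl = contradiction refl l≢m
    ... | yes refl | no p≢m   = ≡-trans (update-same (update (env c) m w) l v)
      (sym (≡-trans (update-other (update (env c) l v) w p≢m) (update-same (env c) l v)))
    ... | no p≢l   | yes refl = ≡-trans (update-other (update (env c) m w) v p≢l)
      (≡-trans (update-same (env c) m w) (sym (update-same (update (env c) l v) m w)))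
    ... | no p≢l   | no p≢m   = ≡-trans (update-other (update (env c) m w) v p≢l)
      (≡-trans (update-other (env c) w p≢m) (sym (≡-trans (update-other (update (env c) l v) w p≢m) (update-other (env c) v p≢l))))

  deposit-other : ∀ {l bs} s c → NotSink s l → env (deposit s bs c) l ≡ env c l
  deposit-other (toReg a) c l≢a = set-other c l≢a
  deposit-other toOut     c _   = refl

  deposit-cong : ∀ {bs cs c d} s → bs ≡ cs → c ≈ d → deposit s bs c ≈ deposit s cs d
  deposit-cong (toReg a) refl e@(same f _ _ _)  = set-cong (cong (_+ _) (f a)) e
  deposit-cong toOut     refl (same f p r refl) = same f p r refl

  deposit-[] : ∀ {c} s → deposit s [] c ≈ c
  deposit-[] (toReg a) = set-id (sym (+-identityʳ _))
  deposit-[] {c} toOut = same (λ _ → refl) refl refl (++-identityʳ (written c))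

  deposit-++ : ∀ {bs cs c} s → deposit s cs (deposit s bs c) ≈ deposit s (bs ++ cs) c
  deposit-++ {bs} {cs} {c} (toReg a) = ≈-trans set-set (set-cong
    (≡-trans (cong (_+ length cs) (set-same c)) (≡-trans (+-assoc (env c a) _ _) (cong (env c a +_) (sym (length-++ bs))))) ≈-refl)
  deposit-++ {bs} {c = c} toOut = same (λ _ → refl) refl refl (++-assoc (written c) bs _)

  deposit-set : ∀ {l v bs c} s → NotSink s l → setReg l v (deposit s bs c) ≈ deposit s bs (setReg l v c)
  deposit-set {l} {v} {bs} {c} (toReg a) l≢a = ≈-trans (set-comm l≢a)
    (set-cong (cong (_+ length bs) (sym (set-other c (λ e → l≢a (sym e))))) ≈-refl)
  deposit-set toOut _ = same (λ _ → refl) refl refl refl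

  Fresh : ℕ → Config → Set
  Fresh d c = ∀ l → d ≤ l → env c l ≡ 0

  put : Sink → Bool → Prog
  put (toReg a) b = inc a
  put toOut     b = emit b

  Reachable : Sink → Set
  Reachable s = Below (suc R) s

  does-put : ∀ {c} s b → Reachable s → Does (put s b) c 1 (deposit s (b ∷ []) c)
  does-put {c} (toReg a) b (s≤s a≤R) = does-≈ ≈-refl (set-cong (+-comm 1 (env c a)) ≈-refl) (does-inc a≤R)
  does-put toOut     b _ = does-emit b

  nop : Prog
  nop = op inp λ s → s , stay

  does-nop : ∀ {c} → Does nop c 1 c
  does-nop {c} {t ∷ ts} (holds r i o) = 1 , _ , ≤-refl , op , holds r i o

  -- Subtraction is truncated: at 0 the head is on the mark and must not be moved beyond it.
  decrement : ℕ → Prog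
  decrement d = branch (reg d) nonzero (dec d) nop

  does-decrement : ∀ {d c} → d ≤ R → Does (decrement d) c 2 (setReg d (pred (env c d)) c)
  does-decrement {d} {c} d≤R {ts} h = by-cases (env c d) refl
    where
    by-cases : ∀ v → env c d ≡ v → ∃[ n ] ∃[ ts′ ] (n ≤ 2 × Exec (decrement d) ts n ts′ × Holds (setReg d (pred v) c) ts′)
    by-cases zero    e = let n , ts′ , n≤ , x , h′ = does-nop h in
      suc n , ts′ , s≤s n≤ , if-false (counter-zero (subst (λ v → Counter v _) e (Holds.counters h d d≤R))) x , holds-≈ (≈-sym (set-id e)) h′
    by-cases (suc v) e = let n , ts′ , n≤ , x , h′ = does-dec d≤R e h in
      suc n , ts′ , s≤s n≤ , if-true (counter-suc (subst (λ v → Counter v _) e (Holds.counters h d d≤R))) x , h′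

  one-more : ∀ {r x} → r < x → suc (x ∸ suc r) ≡ x ∸ r
  one-more {r} {x} r<x = sym (+-∸-assoc 1 r<x)

  tally : ∀ {r x} → r < x → ones (x ∸ suc r) ++ true ∷ [] ≡ ones (x ∸ r)
  tally {r} {x} r<x = ≡-trans (ones-+ (x ∸ suc r) 1) (cong ones (≡-trans (+-comm (x ∸ suc r) 1) (one-more r<x)))

  unload : ∀ d s {c x} → d ≤ R → Reachable s → NotSink s d → env c d ≡ x →
    Does (countdown d (put s true)) c (x * 3 + 1) (deposit s (ones x) (setReg d 0 c))
  unload d s {c} {x} d≤R s≤R d≢s e = does-≈
    (≈-trans (≈-sym (set-id e)) (≈-sym (≈-trans (deposit-cong s (cong ones (n∸n≡0 x)) ≈-refl) (deposit-[] s)))) ≈-refl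
    (does-countdown state 1 x d≤R (λ r _ → ≡-trans (deposit-other s _ d≢s) (set-same c))
      λ r r<x → does-≈ (≈-trans (deposit-set s d≢s) (deposit-cong s refl set-set))
        (≈-trans (deposit-++ s) (deposit-cong s (tally r<x) ≈-refl)) (does-put s true s≤R))
    where
    state : ℕ → Config
    state r = deposit s (ones (x ∸ r)) (setReg d r c)

  clear : ∀ d {c x} → d ≤ R → env c d ≡ x → Does (countdown d nop) c (x * 3 + 1) (setReg d 0 c)
  clear d {c} {x} d≤R e = does-≈ (≈-sym (set-id e)) ≈-refl
    (does-countdown (λ r → setReg d r c) 1 x d≤R (λ r _ → set-same c) λ r _ → does-≈ set-set ≈-refl does-nop)

  add : ∀ {V} → Expr V → (V → ℕ) → ℕ → Sink → Prog
  add (lit zero)    ρ d s = nop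
  add (lit (suc n)) ρ d s = put s true ⨾ add (lit n) ρ d s
  add (var v)       ρ d s = countdown (ρ v) (inc d) ⨾ countdown d (inc (ρ v) ⨾ put s true)
  add (e ⊞ f)       ρ d s = add e ρ d s ⨾ add f ρ d s
  add (e ⊠ f)       ρ d s = add e ρ (suc d) (toReg d) ⨾ countdown d (add f ρ (suc d) s)
  add (e ⊟ f)       ρ d s = add e ρ (2 + d) (toReg d) ⨾ add f ρ (2 + d) (toReg (suc d)) ⨾
                            countdown (suc d) (decrement d) ⨾ countdown d (put s true)

  -- Registers from d on are free, and no variable lives in the sink.
  record Layout {V : Set} (ρ : V → ℕ) (d : ℕ) (s : Sink) (c : Config) (m : ℕ) : Set where
    field
      below   : ∀ v → ρ v < d
      unsunk  : ∀ v → NotSink s (ρ v)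
      sink<   : Below d s
      fresh   : Fresh d c
      limited : ∀ v → env c (ρ v) ≤ m

  fits : ∀ {d u} → d + suc u ≤ suc R → d ≤ R
  fits {d} {u} p = ≤-pred (≤-trans (≤-reflexive (+-comm 1 d)) (≤-trans (+-monoʳ-≤ d (s≤s z≤n)) p))

  reachable : ∀ {d u} s → d + u ≤ suc R → Below d s → Reachable s
  reachable {d} {u} s p = below-≤ s (≤-trans (m≤m+n d u) p)

  -- A variable is moved to register d and back, and counted on the way back.
  does-var : ∀ l d s {c m} → l < d → d ≤ R → NotSink s l → Below d s → env c d ≡ 0 → env c l ≤ m →
    Does (countdown l (inc d) ⨾ countdown d (inc l ⨾ put s true)) c ((m * 3 + 1) + (m * 4 + 1)) (deposit s (ones (env c l)) c)
  does-var l d s {c} {m} l<d d≤R l≢s s<d zero-d x≤m =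
    does-≤ (+-mono-≤ (+-monoˡ-≤ 1 (*-monoˡ-≤ 3 x≤m)) (+-monoˡ-≤ 1 (*-monoˡ-≤ 4 x≤m)))
      (does-≈ start ≈-refl (does-countdown moving 1 x l≤R (λ r _ → ≡-trans (set-other (setReg l r c) l≢d) (set-same c))
         λ r r<x → does-≈ (unmove r) (≈-trans (set-cong (cong suc (set-same {d} (setReg l r c))) ≈-refl) (≈-trans set-set (set-cong (one-more r<x) ≈-refl)))
           (does-inc {d} d≤R))
       ⨟
       does-≈ turn finish (does-countdown returning 2 x d≤R (λ r _ → ≡-trans (deposit-other s _ d≢s) (set-same {d} (setReg l (x ∸ r) c)))
         λ r r<x → does-≈ (unreturn r) ≈-refl
           (does-≈ ≈-refl (counted r<x) (does-inc {l} l≤R) ⨟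
            does-≈ ≈-refl (≈-trans (deposit-++ s) (deposit-cong s (tally r<x) ≈-refl)) (does-put s true (below-≤ s (m≤n⇒m≤1+n d≤R) s<d)))))
    where
    x : ℕ
    x = env c l
    l≢d : l ≢ d
    l≢d = <⇒≢ l<d
    l≤R : l ≤ R
    l≤R = ≤-trans (<⇒≤ l<d) d≤R
    d≢s : NotSink s d
    d≢s = below-not s s<d ≤-refl
    -- In `moving r` there are `r` units left to be moved from `l` to `d`; in `returning r` there
    -- are `r` left in `d`, and the others have been counted.
    moving returning : ℕ → Config
    moving r    = setReg d (x ∸ r) (setReg l r c)
    returning r = deposit s (ones (x ∸ r)) (setReg d r (setReg l (x ∸ r) c))
    start : c ≈ moving x
    start = ≈-trans (≈-sym (set-id refl)) (≈-sym (set-id (≡-trans (set-other c (λ e → l≢d (sym e))) (≡-trans zero-d (sym (n∸n≡0 x))))))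
    unmove : ∀ r → setReg l r (moving (suc r)) ≈ setReg d (x ∸ suc r) (setReg l r c)
    unmove r = ≈-trans (set-comm l≢d) (set-cong refl set-set)
    turn : moving 0 ≈ returning x
    turn = ≈-trans (set-cong refl (set-cong (sym (n∸n≡0 x)) ≈-refl))
      (≈-sym (≈-trans (deposit-cong s (cong ones (n∸n≡0 x)) ≈-refl) (deposit-[] s)))
    unreturn : ∀ r → setReg d r (returning (suc r)) ≈ deposit s (ones (x ∸ suc r)) (setReg d r (setReg l (x ∸ suc r) c))
    unreturn r = ≈-trans (deposit-set s d≢s) (deposit-cong s refl set-set)
    counted : ∀ {r} → r < x → setReg l (suc (env (deposit s (ones (x ∸ suc r)) (setReg d r (setReg l (x ∸ suc r) c))) l))
        (deposit s (ones (x ∸ suc r)) (setReg d r (setReg l (x ∸ suc r) c))) ≈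
      deposit s (ones (x ∸ suc r)) (setReg d r (setReg l (x ∸ r) c))
    counted {r} r<x = ≈-trans (set-cong (≡-trans (cong suc (≡-trans (deposit-other s _ l≢s)
        (≡-trans (set-other (setReg l (x ∸ suc r) c) l≢d) (set-same c)))) (one-more r<x)) ≈-refl)
      (≈-trans (deposit-set s l≢s) (deposit-cong s refl (≈-trans (set-comm l≢d) (set-cong refl set-set))))
    finish : returning 0 ≈ deposit s (ones x) c
    finish = deposit-cong s refl (≈-trans (set-cong refl (set-id refl)) (set-id zero-d))

  loaded : ∀ {d c} → env c d ≡ 0 → ∀ x → deposit (toReg d) (ones x) c ≈ setReg d x c
  loaded {d} {c} zero-d x = set-cong (cong₂ _+_ zero-d (length-replicate x)) ≈-refl

  module _ {V : Set} {ρ : V → ℕ} {d : ℕ} {s : Sink} {c : Config} {m : ℕ} (L : Layout ρ d s c m) where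

    open Layout L

    zero-at : env c d ≡ 0
    zero-at = fresh d ≤-refl

    d≢sink : NotSink s d
    d≢sink = below-not s sink< ≤-refl

    vars-deposit : ∀ bs v → env (deposit s bs c) (ρ v) ≡ env c (ρ v)
    vars-deposit bs v = deposit-other s c (unsunk v)

    vars-set : ∀ {l x} → d ≤ l → ∀ v → env (setReg l x c) (ρ v) ≡ env c (ρ v)
    vars-set d≤l v = set-other c (<⇒≢ (≤-trans (below v) d≤l))

    layout-deposit : ∀ bs → Layout ρ d s (deposit s bs c) m
    layout-deposit bs = record
      { below = below ; unsunk = unsunk ; sink< = sink<
      ; fresh = λ l d≤l → ≡-trans (deposit-other s c (below-not s sink< d≤l)) (fresh l d≤l)
      ; limited = λ v → subst (_≤ m) (sym (vars-deposit bs v)) (limited v) }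

    layout-set : ∀ {l x} → d ≤ l → Layout ρ (suc l) s (setReg l x c) m
    layout-set {l} d≤l = record
      { below = λ v → m≤n⇒m≤1+n (≤-trans (below v) d≤l) ; unsunk = unsunk ; sink< = below-≤ s (m≤n⇒m≤1+n d≤l) sink<
      ; fresh = λ p l<p → ≡-trans (set-other c (>⇒≢ l<p)) (fresh p (≤-trans d≤l (<⇒≤ l<p)))
      ; limited = λ v → subst (_≤ m) (sym (vars-set d≤l v)) (limited v) }

    layout-to : ∀ {d′ l} → d ≤ l → l < d′ → Layout ρ d′ (toReg l) c m
    layout-to d≤l l<d′ = record
      { below = λ v → ≤-trans (below v) (≤-trans d≤l (<⇒≤ l<d′)) ; unsunk = λ v → <⇒≢ (≤-trans (below v) d≤l) ; sink< = l<d′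
      ; fresh = λ p d′≤p → fresh p (≤-trans d≤l (≤-trans (<⇒≤ l<d′) d′≤p)) ; limited = limited }

    drop-set : ∀ {l x} → d ≤ l → setReg l 0 (setReg l x c) ≈ c
    drop-set d≤l = ≈-trans set-set (set-id (fresh _ d≤l))

  does-add : ∀ {V} (e : Expr V) {ρ d s c m} → Layout ρ d s c m → d + uses e ≤ suc R →
    Does (add e ρ d s) c (timeE e m) (deposit s (ones (value (env c ∘ ρ) e)) c)
  does-add (lit zero) {s = s} L _ = does-≈ ≈-refl (≈-sym (deposit-[] s)) does-nop
  does-add (lit (suc n)) {s = s} L u = does-≈ ≈-refl (deposit-++ s)
    (does-put s true (reachable s u (Layout.sink< L)) ⨟ does-add (lit n) (layout-deposit L _) u)
  does-add (var v) {ρ} {d} {s} {c} L u = does-var (ρ v) d s (below v) (fits u) (unsunk v) sink< (fresh d ≤-refl) (limited v)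
    where open Layout L
  does-add (e ⊞ f) {ρ} {d} {s} {c} {m} L u = does-≈ ≈-refl (≈-trans (deposit-++ s) (deposit-cong s
      (≡-trans (cong (λ y → ones x ++ ones y) (value-cong (vars-deposit L (ones x)) f)) (ones-+ x _)) ≈-refl))
    (does-add e L (≤-trans (+-monoʳ-≤ d (m≤m+n (uses e) (uses f))) u) ⨟
     does-add f (layout-deposit L (ones x)) (≤-trans (+-monoʳ-≤ d (m≤n+m (uses f) (uses e))) u))
    where
    x : ℕ
    x = value (env c ∘ ρ) e
  does-add (e ⊠ f) {ρ} {d} {s} {c} {m} L u =
    does-≈ ≈-refl (loaded (zero-at L) x) (does-add e (layout-to L ≤-refl ≤-refl) (room (m≤m+n (uses e) (uses f)))) ⨟
    does-≤ (+-monoˡ-≤ 1 (*-monoˡ-≤ (2 + timeE f m) (value≤bound (Layout.limited L) e)))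
      (does-≈ start finish (does-countdown state (timeE f m) x (fits u)
        (λ r _ → ≡-trans (deposit-other s _ (d≢sink L)) (set-same c))
        λ r r<x → does-≈ (unstate r) (restate r<x) (does-add f (layout-deposit (layout-set L ≤-refl) _) (room (m≤n+m (uses f) (uses e))))))
    where
    x y : ℕ
    x = value (env c ∘ ρ) e
    y = value (env c ∘ ρ) f
    room : ∀ {u′} → u′ ≤ uses e + uses f → suc d + u′ ≤ suc R
    room u′≤ = ≤-trans (≤-trans (s≤s (+-monoʳ-≤ d u′≤)) (≤-reflexive (sym (+-suc d _)))) u
    -- With `r` rounds to go, `f` has been added `x ∸ r` times.
    state : ℕ → Config
    state r = deposit s (ones ((x ∸ r) * y)) (setReg d r c)
    start : setReg d x c ≈ state x
    start = ≈-sym (≈-trans (deposit-cong s (cong (λ k → ones (k * y)) (n∸n≡0 x)) ≈-refl) (deposit-[] s))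
    finish : state 0 ≈ deposit s (ones (x * y)) c
    finish = deposit-cong s refl (set-id (zero-at L))
    unstate : ∀ r → setReg d r (state (suc r)) ≈ deposit s (ones ((x ∸ suc r) * y)) (setReg d r c)
    unstate r = ≈-trans (deposit-set s (d≢sink L)) (deposit-cong s refl set-set)
    restate : ∀ {r} → r < x →
      deposit s (ones (value (env (deposit s (ones ((x ∸ suc r) * y)) (setReg d r c)) ∘ ρ) f)) (deposit s (ones ((x ∸ suc r) * y)) (setReg d r c)) ≈ state r
    restate {r} r<x = ≈-trans (deposit-cong s (cong ones (value-cong (λ v → ≡-trans (vars-deposit (layout-set L ≤-refl) (ones ((x ∸ suc r) * y)) v) (vars-set L ≤-refl v)) f)) ≈-refl)
      (≈-trans (deposit-++ s) (deposit-cong s (≡-trans (ones-+ ((x ∸ suc r) * y) y)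
        (cong ones (≡-trans (+-comm ((x ∸ suc r) * y) y) (cong (_* y) (one-more r<x))))) ≈-refl))
  does-add (e ⊟ f) {ρ} {d} {s} {c} {m} L u =
    does-≈ ≈-refl (loaded (zero-at L) x) (does-add e (layout-to L ≤-refl (n≤1+n (suc d))) (room (m≤m+n (uses e) (uses f)))) ⨟
    does-≈ ≈-refl (≈-trans (loaded (Layout.fresh L₁ (suc d) ≤-refl) _) (set-cong (value-cong (vars-set L ≤-refl) f) ≈-refl))
      (does-add f (layout-to L₁ ≤-refl ≤-refl) (room (m≤n+m (uses f) (uses e)))) ⨟
    (does-≤ (+-monoˡ-≤ 1 (*-monoˡ-≤ 4 (value≤bound (Layout.limited L) f)))
      (does-≈ start ≈-refl (does-countdown state 2 y sd≤R (λ r _ → set-same {suc d} (setReg d (x ∸ (y ∸ r)) c))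
        λ r r<y → does-≈ set-set (restate r<y) (does-decrement d≤R))) ⨟
    does-≤ (+-monoˡ-≤ 1 (*-monoˡ-≤ 3 (≤-trans (m∸n≤m x y) (value≤bound (Layout.limited L) e))))
      (does-≈ ≈-refl (deposit-cong s refl finish) (unload d s d≤R (reachable s u (Layout.sink< L)) (d≢sink L) d-value)))
    where
    x y : ℕ
    x = value (env c ∘ ρ) e
    y = value (env c ∘ ρ) f
    L₁ : Layout ρ (suc d) s (setReg d x c) m
    L₁ = layout-set L ≤-refl
    room : ∀ {u′} → u′ ≤ uses e + uses f → 2 + d + u′ ≤ suc R
    room u′≤ = ≤-trans (≤-trans (s≤s (s≤s (+-monoʳ-≤ d u′≤))) (≤-reflexive (sym (≡-trans (+-suc d _) (cong suc (+-suc d _)))))) u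
    sd≤R : suc d ≤ R
    sd≤R = ≤-pred (≤-trans (m≤m+n (2 + d) _) (room ≤-refl))
    d≤R : d ≤ R
    d≤R = ≤-trans (n≤1+n d) sd≤R
    d≢sd : d ≢ suc d
    d≢sd = <⇒≢ ≤-refl
    -- With `r` decrements to go, `y ∸ r` of them have been made, and some may have had no effect.
    state : ℕ → Config
    state r = setReg (suc d) r (setReg d (x ∸ (y ∸ r)) c)
    start : setReg (suc d) y (setReg d x c) ≈ state y
    start = set-cong refl (set-cong (cong (x ∸_) (sym (n∸n≡0 y))) ≈-refl)
    restate : ∀ {r} → r < y → setReg d (pred (env (setReg (suc d) r (setReg d (x ∸ (y ∸ suc r)) c)) d)) (setReg (suc d) r (setReg d (x ∸ (y ∸ suc r)) c)) ≈ state r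
    restate {r} r<y = ≈-trans (set-comm d≢sd) (set-cong refl (≈-trans set-set (set-cong
      (≡-trans (cong pred (≡-trans (set-other (setReg d (x ∸ (y ∸ suc r)) c) d≢sd) (set-same {d} {x ∸ (y ∸ suc r)} c)))
        (≡-trans (pred[m∸n]≡m∸[1+n] x (y ∸ suc r)) (cong (x ∸_) (one-more r<y)))) ≈-refl)))
    d-value : env (state 0) d ≡ x ∸ y
    d-value = ≡-trans (set-other (setReg d (x ∸ (y ∸ 0)) c) d≢sd) (set-same c)
    finish : setReg d 0 (state 0) ≈ c
    finish = ≈-trans (set-comm d≢sd) (≈-trans (set-cong refl (drop-set L ≤-refl)) (set-id (Layout.fresh L (suc d) (n≤1+n d))))

-- Generators of bit strings; the index tells whether the input may be scanned

extend : {V : Set} → (V → ℕ) → ℕ → Maybe V → ℕ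
extend η n nothing  = n
extend η n (just v) = η v

data Gen (V : Set) : Bool → Set where
  ε     : ∀ {b} → Gen V b
  emit  : ∀ {b} → Bool → Gen V b
  _⊕_   : ∀ {b} → Gen V b → Gen V b → Gen V b
  tell  : ∀ {b} → Expr V → Gen V b
  for   : ∀ {b} → Expr V → Gen (Maybe V) b → Gen V b
  -- The body may not scan, since the only input head is in use.
  scan  : (Bool → Gen (Maybe V) false) → Gen V true
  -- The second generator has the length of the output of the first as a variable; this is how the
  -- total volume is obtained.
  store : ∀ {b} → Gen V b → Gen (Maybe V) b → Gen V b

infixr 5 _⊕_

indexed : ∀ {A : Set} → (ℕ → Bool → List A) → ℕ → List Bool → List A
indexed f i []       = []
indexed f i (b ∷ bs) = f i b ++ indexed f (suc i) bs

generate : ∀ {V b} → List Bool → (V → ℕ) → Gen V b → List Bool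
generate x η ε           = []
generate x η (emit b)    = b ∷ []
generate x η (g ⊕ h)     = generate x η g ++ generate x η h
generate x η (tell e)    = ones (value η e)
generate x η (for e g)   = concatMap (λ j → generate x (extend η j) g) (upTo (value η e))
generate x η (scan g)    = indexed (λ i b → generate x (extend η i) (g b)) 0 x
generate x η (store g h) = generate x (extend η (length (generate x η g))) h

indexed-cong : ∀ {A : Set} {f g : ℕ → Bool → List A} → (∀ i b → f i b ≡ g i b) → ∀ i bs → indexed f i bs ≡ indexed g i bs
indexed-cong p i []       = refl
indexed-cong p i (b ∷ bs) = cong₂ _++_ (p i b) (indexed-cong p (suc i) bs)

extend-cong : ∀ {V : Set} {η θ : V → ℕ} {m n} → (∀ v → η v ≡ θ v) → m ≡ n → ∀ v → extend η m v ≡ extend θ n v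
extend-cong p q nothing  = q
extend-cong p q (just v) = p v

generate-cong : ∀ {V b} x {η θ : V → ℕ} → (∀ v → η v ≡ θ v) → (g : Gen V b) → generate x η g ≡ generate x θ g
generate-cong x p ε           = refl
generate-cong x p (emit b)    = refl
generate-cong x p (g ⊕ h)     = cong₂ _++_ (generate-cong x p g) (generate-cong x p h)
generate-cong x p (tell e)    = cong ones (value-cong p e)
generate-cong x {η} {θ} p (for e g) = ≡-trans (cong (concatMap _ ∘ upTo) (value-cong p e))
  (concatMap-cong (λ j → generate-cong x (extend-cong p refl) g) (upTo (value θ e)))
generate-cong x p (scan g)    = indexed-cong (λ i b → generate-cong x (extend-cong p refl) (g b)) 0 x
generate-cong x p (store g h) = generate-cong x (extend-cong p (cong length (generate-cong x p g))) h

-- By `store` the length of an output becomes the value of a variable, on which later running times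
-- depend; so lengths need bounds of their own.
sizeG : ∀ {V b} → Gen V b → ℕ → ℕ
sizeG ε           m = 0
sizeG (emit b)    m = 1
sizeG (g ⊕ h)     m = sizeG g m + sizeG h m
sizeG (tell e)    m = bound e m
sizeG (for e g)   m = bound e m * sizeG g (m + bound e m)
sizeG (scan g)    m = m * (sizeG (g true) m + sizeG (g false) m)
sizeG (store g h) m = sizeG h (m + sizeG g m)

limit-extend : ∀ {V : Set} {η : V → ℕ} {m n m′} → (∀ v → η v ≤ m) → m ≤ m′ → n ≤ m′ → ∀ v → extend η n v ≤ m′
limit-extend p q r nothing  = r
limit-extend p q r (just v) = ≤-trans (p v) q

concatMap-length : ∀ {A B : Set} (f : A → List B) n xs → (∀ {x} → x ∈ xs → length (f x) ≤ n) → length (concatMap f xs) ≤ length xs * n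
concatMap-length f n []       p = z≤n
concatMap-length f n (x ∷ xs) p = ≤-trans (≤-reflexive (length-++ (f x))) (+-mono-≤ (p (here refl)) (concatMap-length f n xs (p ∘ there)))

size≤ : ∀ {V b} x (g : Gen V b) {η m} → (∀ v → η v ≤ m) → length x ≤ m → length (generate x η g) ≤ sizeG g m
size≤ x ε           p q = z≤n
size≤ x (emit b)    p q = ≤-refl
size≤ x (g ⊕ h)     p q = ≤-trans (≤-reflexive (length-++ (generate x _ g))) (+-mono-≤ (size≤ x g p q) (size≤ x h p q))
size≤ x (tell e)    p q = ≤-trans (≤-reflexive (length-replicate _)) (value≤bound p e)
size≤ x (for e g) {η} {m} p q = ≤-trans
  (concatMap-length _ (sizeG g (m + bound e m)) (upTo (value η e)) λ j∈ → size≤ x g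
    (limit-extend p (m≤m+n m _) (≤-trans (<⇒≤ (∈-upTo⁻ j∈)) (≤-trans (value≤bound p e) (m≤n+m _ m)))) (≤-trans q (m≤m+n m _)))
  (*-monoˡ-≤ _ (≤-trans (≤-reflexive (length-upTo (value η e))) (value≤bound p e)))
size≤ x (scan g) {η} {m} p q = ≤-trans (go 0 x q) (*-monoˡ-≤ (sizeG (g true) m + sizeG (g false) m) q)
  where
  go : ∀ i bs → i + length bs ≤ m → length (indexed (λ i b → generate x (extend η i) (g b)) i bs) ≤ length bs * (sizeG (g true) m + sizeG (g false) m)
  go i []       r = z≤n
  go i (b ∷ bs) r = ≤-trans (≤-reflexive (length-++ (generate x (extend η i) (g b))))
    (+-mono-≤ (≤-trans (size≤ x (g b) (limit-extend p ≤-refl (≤-trans (m≤m+n i _) r)) q) (either b))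
      (go (suc i) bs (≤-trans (≤-reflexive (sym (+-suc i _))) r)))
    where
    either : ∀ b → sizeG (g b) m ≤ sizeG (g true) m + sizeG (g false) m
    either true  = m≤m+n _ _
    either false = m≤n+m _ _
size≤ x (store g h) {η} {m} p q = size≤ x h (limit-extend p (m≤m+n m _) (≤-trans (size≤ x g p q) (m≤n+m _ m))) (≤-trans q (m≤m+n m _))

usesG : ∀ {V b} → Gen V b → ℕ
usesG ε           = 0
usesG (emit b)    = 0
usesG (g ⊕ h)     = usesG g + usesG h
usesG (tell e)    = uses e
usesG (for e g)   = 2 + (uses e + usesG g)
usesG (scan g)    = 1 + (usesG (g true) + usesG (g false))
usesG (store g h) = 1 + (usesG g + usesG h)

timeG : ∀ {V b} → Gen V b → ℕ → ℕ
timeG ε           m = 1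
timeG (emit b)    m = 1
timeG (g ⊕ h)     m = timeG g m + timeG h m
timeG (tell e)    m = timeE e m
timeG (for e g)   m = timeE e m + ((bound e m * (2 + (timeG g (m + bound e m) + 1)) + 1) + (bound e m * 3 + 1))
timeG (scan g)    m = (m * (4 + (timeG (g true) m + timeG (g false) m)) + 1) + (m * 3 + 1)
timeG (store g h) m = timeG g m + (timeG h (m + sizeG g m) + (sizeG g m * 3 + 1))

-- Programs for generators

module Coding (R : ℕ) where

  open Compile R public

  bind : {V : Set} → (V → ℕ) → ℕ → Maybe V → ℕ
  bind ρ l = extend ρ l

  -- `for` keeps the number of remaining rounds in `d` and the index in `suc d`. `scan` keeps in `d`
  -- the number of bits passed, which is at once the index and the way back to the start of the
  -- input.
  code : ∀ {V b} → Gen V b → (V → ℕ) → ℕ → Sink → Prog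
  code ε           ρ d s = nop
  code (emit b)    ρ d s = put s b
  code (g ⊕ h)     ρ d s = code g ρ d s ⨾ code h ρ d s
  code (tell e)    ρ d s = add e ρ d s
  code (for e g)   ρ d s = add e ρ (suc d) (toReg d) ⨾
                           countdown d (code g (bind ρ (suc d)) (2 + d) s ⨾ inc (suc d)) ⨾ countdown (suc d) nop
  code (scan g)    ρ d s = while inp (not ∘ isBlank)
                             (branch inp isTrue (code (g true) (bind ρ d) (suc d) s) (code (g false) (bind ρ d) (suc d) s) ⨾
                              forward ⨾ inc d) ⨾ countdown d backward
  code (store g h) ρ d s = code g ρ (suc d) (toReg d) ⨾ code h (bind ρ d) (suc d) s ⨾ countdown d nop

module Generate (R : ℕ) (x : List Bool) where

  open Coding R public

  Ready : Bool → Config → Set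
  Ready false c = ⊤
  Ready true  c = past c ≡ [] × rest c ≡ x

  past-deposit : ∀ s {bs c} → past (deposit s bs c) ≡ past c
  past-deposit (toReg a) = refl
  past-deposit toOut     = refl

  rest-deposit : ∀ s {bs c} → rest (deposit s bs c) ≡ rest c
  rest-deposit (toReg a) = refl
  rest-deposit toOut     = refl

  ready-deposit : ∀ {b} s {bs c} → Ready b c → Ready b (deposit s bs c)
  ready-deposit {false} s r = tt
  ready-deposit {true} s {bs} {c} (p , q) = ≡-trans (past-deposit s {bs} {c}) p , ≡-trans (rest-deposit s {bs} {c}) q

  ready-set : ∀ {b l v c} → Ready b c → Ready b (setReg l v c)
  ready-set {false} r = tt
  ready-set {true}  r = r

  layout-bind : ∀ {V : Set} {ρ : V → ℕ} {d s c m m′ l n} → Layout ρ d s c m → d ≤ l → m ≤ m′ → n ≤ m′ →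
    Layout (bind ρ l) (suc l) s (setReg l n c) m′
  layout-bind {ρ = ρ} {d} {s} {c} {m} {m′} {l} {n} L d≤l m≤m′ n≤m′ = record
    { below   = λ { nothing → ≤-refl ; (just v) → below L′ v }
    ; unsunk  = λ { nothing → below-not s (sink< L) d≤l ; (just v) → unsunk L v }
    ; sink<   = sink< L′
    ; fresh   = fresh L′
    ; limited = λ { nothing → ≤-trans (≤-reflexive (set-same {l} {n} c)) n≤m′ ; (just v) → ≤-trans (limited L′ v) m≤m′ }
    }
    where
    open Layout
    L′ : Layout ρ (suc l) s (setReg l n c) m
    L′ = layout-set L d≤l

  values-bind : ∀ {V : Set} {ρ : V → ℕ} {d s c m l n} → Layout ρ d s c m → d ≤ l →
    ∀ v → env (setReg l n c) (bind ρ l v) ≡ extend (env c ∘ ρ) n v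
  values-bind {c = c} {l = l} {n} L d≤l nothing  = set-same {l} {n} c
  values-bind L d≤l (just v) = vars-set L d≤l v

  seek : List Bool → List Bool → Config → Config
  seek ps ss c = record c { past = ps ; rest = ss }

  layout-seek : ∀ {V : Set} {ρ : V → ℕ} {d s c m} ps ss → Layout ρ d s c m → Layout ρ d s (seek ps ss c) m
  layout-seek ps ss L = record { below = below ; unsunk = unsunk ; sink< = sink< ; fresh = fresh ; limited = limited }
    where open Layout L

  seek-deposit : ∀ s {ps ss bs c} → seek ps ss (deposit s bs c) ≈ deposit s bs (seek ps ss c)
  seek-deposit (toReg a) = ≈-refl
  seek-deposit toOut     = ≈-refl

  -- The register d holds the number of bits to the left of the input head.
  rewind : ∀ d → d ≤ R → ∀ ps ss c → past c ≡ ps → rest c ≡ ss → env c d ≡ length ps →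
    Does (countdown d backward) c (length ps * 3 + 1) (seek [] (ps ʳ++ ss) (setReg d 0 c))
  rewind d d≤R [] ss c refl refl e {ts} h = 1 , ts , ≤-refl ,
    stop (counter-zero (subst (λ v → Counter v (lookup ts (reg d))) e (Holds.counters h d d≤R))) ,
    holds-≈ (same (λ l → sym (_≈_.same-env (set-id {d} {0} {c} e) l)) refl refl refl) h
  rewind d d≤R (b ∷ ps) ss c p refl e {ts} h =
    let m , ts′ , m≤ , y , h′ = (does-dec d≤R e ⨟ does-backward {setReg d (length ps) c} p) h
        n , ts″ , n≤ , z , h″ = rewind d d≤R ps (b ∷ ss) (seek ps (b ∷ ss) (setReg d (length ps) c)) refl refl (set-same {d} {length ps} c) h′
    in suc (m + n) , ts″ , s≤s (+-mono-≤ m≤ n≤) ,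
       again (counter-suc (subst (λ v → Counter v (lookup ts (reg d))) e (Holds.counters h d d≤R))) y z ,
       holds-≈ (same (_≈_.same-env (set-set {d} {0} {length ps} {c})) refl refl refl) h″

  Generates : ∀ {V b} → Gen V b → Set
  Generates {V} {b} g = ∀ {ρ : V → ℕ} {d s c m} → Layout ρ d s c m → d + usesG g ≤ suc R → Ready b c → length x ≤ m →
    Does (code g ρ d s) c (timeG g m) (deposit s (generate x (env c ∘ ρ) g) c)

  module For {V b} (e : Expr V) (g : Gen (Maybe V) b) (does-g : Generates g) {ρ : V → ℕ} {d s c m} (L : Layout ρ d s c m)
    (u : d + usesG (for e g) ≤ suc R) (ready : Ready b c) (x≤m : length x ≤ m) where

    n : ℕ
    n = value (env c ∘ ρ) e

    n≤ : n ≤ bound e m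
    n≤ = value≤bound (Layout.limited L) e

    room : ∀ {u′} → u′ ≤ uses e + usesG g → 2 + d + u′ ≤ suc R
    room u′≤ = ≤-trans (≤-trans (s≤s (s≤s (+-monoʳ-≤ d u′≤))) (≤-reflexive (sym (≡-trans (+-suc d _) (cong suc (+-suc d _)))))) u

    sd≤R : suc d ≤ R
    sd≤R = ≤-pred (≤-trans (m≤m+n (2 + d) _) (room ≤-refl))

    d≤R : d ≤ R
    d≤R = ≤-trans (n≤1+n d) sd≤R

    round : ℕ → List Bool
    round j = generate x (extend (env c ∘ ρ) j) g

    done : ℕ → List Bool
    done j = concatMap round (upTo j)

    done-suc : ∀ j → done j ++ round j ≡ done (suc j)
    done-suc j = ≡-trans (cong (done j ++_) (sym (++-identityʳ (round j))))
      (≡-trans (sym (concatMap-++ round (upTo j) (j ∷ []))) (cong (concatMap round) (upTo-∷ʳ j)))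

    -- With `r` rounds to go, `n ∸ r` is both the number of finished rounds and the index of the
    -- next one.
    state : ℕ → Config
    state r = deposit s (done (n ∸ r)) (setReg (suc d) (n ∸ r) (setReg d r c))

    d≢s : NotSink s d
    d≢s = d≢sink L

    sd≢s : NotSink s (suc d)
    sd≢s = below-not s (Layout.sink< L) (n≤1+n d)

    d≢sd : d ≢ suc d
    d≢sd = <⇒≢ ≤-refl

    start : setReg d n c ≈ state n
    start = ≈-sym (≈-trans (deposit-cong s (cong done (n∸n≡0 n)) (set-cong (n∸n≡0 n) ≈-refl)) (≈-trans (deposit-[] s)
      (set-id (Layout.fresh (layout-set L ≤-refl) (suc d) ≤-refl))))

    before-round : ℕ → Config
    before-round r = deposit s (done (n ∸ suc r)) (setReg (suc d) (n ∸ suc r) (setReg d r c))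

    enter : ∀ r → setReg d r (state (suc r)) ≈ before-round r
    enter r = ≈-trans (deposit-set s d≢s) (deposit-cong s refl (≈-trans (set-comm d≢sd) (set-cong refl set-set)))

    layout-round : ∀ {r} → r < n → Layout (bind ρ (suc d)) (2 + d) s (before-round r) (m + bound e m)
    layout-round {r} r<n = layout-deposit (layout-bind (layout-set L ≤-refl) ≤-refl (m≤m+n m _)
      (≤-trans (m∸n≤m n (suc r)) (≤-trans n≤ (m≤n+m _ m)))) _

    round-values : ∀ {r} → r < n → ∀ v → env (before-round r) (bind ρ (suc d) v) ≡ extend (env c ∘ ρ) (n ∸ suc r) v
    round-values {r} r<n v = ≡-trans (vars-deposit (layout-bind {m′ = m + bound e m} (layout-set L ≤-refl) ≤-refl (m≤m+n m _)
        (≤-trans (m∸n≤m n (suc r)) (≤-trans n≤ (m≤n+m _ m)))) (done (n ∸ suc r)) v)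
      (≡-trans (values-bind {l = suc d} {n ∸ suc r} (layout-set L {d} {r} ≤-refl) ≤-refl v) (extend-cong (λ w → vars-set L ≤-refl w) refl v))

    after-round : ∀ {r} → r < n → deposit s (generate x (env (before-round r) ∘ bind ρ (suc d)) g) (before-round r) ≈
      deposit s (done (n ∸ r)) (setReg (suc d) (n ∸ suc r) (setReg d r c))
    after-round {r} r<n = ≈-trans (deposit-++ s) (deposit-cong s (≡-trans (cong (done (n ∸ suc r) ++_) (generate-cong x (round-values r<n) g))
      (≡-trans (done-suc (n ∸ suc r)) (cong done (one-more r<n)))) ≈-refl)

    next-index : ∀ {r} → r < n → setReg (suc d) (suc (env (deposit s (done (n ∸ r)) (setReg (suc d) (n ∸ suc r) (setReg d r c))) (suc d)))
      (deposit s (done (n ∸ r)) (setReg (suc d) (n ∸ suc r) (setReg d r c))) ≈ state r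
    next-index {r} r<n = ≈-trans (deposit-set s sd≢s) (deposit-cong s refl (≈-trans set-set (set-cong
      (≡-trans (cong suc (≡-trans (deposit-other s _ sd≢s) (set-same {suc d} {n ∸ suc r} (setReg d r c)))) (one-more r<n)) ≈-refl)))

    index-value : env (state 0) (suc d) ≡ n
    index-value = ≡-trans (deposit-other s _ sd≢s) (set-same {suc d} {n} (setReg d 0 c))

    finish : setReg (suc d) 0 (state 0) ≈ deposit s (done n) c
    finish = ≈-trans (deposit-set s sd≢s) (deposit-cong s refl (≈-trans (drop-set (layout-set L ≤-refl) ≤-refl) (set-id (zero-at L))))

    does-for : Does (code (for e g) ρ d s) c (timeG (for e g) m) (deposit s (done n) c)
    does-for =
      does-≈ ≈-refl (loaded (zero-at L) n) (does-add e (layout-to L ≤-refl ≤-refl)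
        (≤-trans (n≤1+n _) (room (m≤m+n (uses e) (usesG g))))) ⨟
      (does-≤ (+-monoˡ-≤ 1 (*-monoˡ-≤ (2 + (timeG g (m + bound e m) + 1)) n≤))
        (does-≈ start ≈-refl (does-countdown state _ n d≤R
          (λ r _ → ≡-trans (deposit-other s _ d≢s) (≡-trans (set-other (setReg d r c) d≢sd) (set-same {d} {r} c)))
          λ r r<n → does-≈ (enter r) ≈-refl
            (does-≈ ≈-refl (after-round r<n) (does-g (layout-round r<n) (room (m≤n+m (usesG g) (uses e)))
              (ready-deposit s (ready-set (ready-set ready))) (≤-trans x≤m (m≤m+n m _))) ⨟
             does-≈ ≈-refl (next-index r<n) (does-inc sd≤R)))) ⨟
       does-≤ (+-monoˡ-≤ 1 (*-monoˡ-≤ 3 n≤)) (does-≈ ≈-refl finish (clear (suc d) sd≤R index-value)))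

  does-bit : ∀ {p q c c′ t} b {ss} → rest c ≡ b ∷ ss → Does (if b then p else q) c t c′ →
    Does (branch inp isTrue p q) c (suc t) c′
  does-bit {c = c} true r does {ts} h = let n , ts′ , n≤ , y , h′ = does h in suc n , ts′ , s≤s n≤ ,
    if-true (cong isTrue (input-bit (subst (λ ss → Input (past c) ss (lookup ts inp)) r (Holds.inputs h)))) y , h′
  does-bit {c = c} false r does {ts} h = let n , ts′ , n≤ , y , h′ = does h in suc n , ts′ , s≤s n≤ ,
    if-false (cong isTrue (input-bit (subst (λ ss → Input (past c) ss (lookup ts inp)) r (Holds.inputs h)))) y , h′

  module Scan {V} (g : Bool → Gen (Maybe V) false) (does-g : ∀ b → Generates (g b)) {ρ : V → ℕ} {d s c m} (L : Layout ρ d s c m)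
    (u : d + usesG (scan g) ≤ suc R) (ready : Ready true c) (x≤m : length x ≤ m) where

    d≤R : d ≤ R
    d≤R = fits u

    d≢s : NotSink s d
    d≢s = d≢sink L

    room : ∀ {u′} → u′ ≤ usesG (g true) + usesG (g false) → suc d + u′ ≤ suc R
    room u′≤ = ≤-trans (≤-trans (s≤s (+-monoʳ-≤ d u′≤)) (≤-reflexive (sym (+-suc d _)))) u

    f : ℕ → Bool → List Bool
    f i b = generate x (extend (env c ∘ ρ) i) (g b)

    time : ℕ
    time = timeG (g true) m + timeG (g false) m

    state : List Bool → List Bool → List Bool → Config
    state ps ss w = deposit s w (setReg d (length ps) (seek ps ss c))

    past-state : ∀ ps ss w → past (state ps ss w) ≡ ps
    past-state ps ss w = past-deposit s

    rest-state : ∀ ps ss w → rest (state ps ss w) ≡ ss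
    rest-state ps ss w = rest-deposit s

    d-state : ∀ ps ss w → env (state ps ss w) d ≡ length ps
    d-state ps ss w = ≡-trans (deposit-other s _ d≢s) (set-same {d} {length ps} (seek ps ss c))

    chosen : ∀ b → Prog
    chosen b = if b then code (g true) (bind ρ d) (suc d) s else code (g false) (bind ρ d) (suc d) s

    does-chosen : ∀ ps b ss w → length ps ≤ m → Does (chosen b) (state ps (b ∷ ss) w) time (state ps (b ∷ ss) (w ++ f (length ps) b))
    does-chosen ps b ss w ps≤m = by b
      where
      L₁ : Layout (bind ρ d) (suc d) s (setReg d (length ps) (seek ps (b ∷ ss) c)) m
      L₁ = layout-bind (layout-seek ps (b ∷ ss) L) ≤-refl ≤-refl ps≤m
      values : ∀ v → env (state ps (b ∷ ss) w) (bind ρ d v) ≡ extend (env c ∘ ρ) (length ps) v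
      values v = ≡-trans (vars-deposit L₁ w v) (values-bind {l = d} {length ps} (layout-seek ps (b ∷ ss) L) ≤-refl v)
      result : ∀ b′ → deposit s (generate x (env (state ps (b ∷ ss) w) ∘ bind ρ d) (g b′)) (state ps (b ∷ ss) w) ≈
        state ps (b ∷ ss) (w ++ f (length ps) b′)
      result b′ = ≈-trans (deposit-++ s) (deposit-cong s (cong (w ++_) (generate-cong x values (g b′))) ≈-refl)
      by : ∀ b′ → Does (chosen b′) (state ps (b ∷ ss) w) time (state ps (b ∷ ss) (w ++ f (length ps) b′))
      by true  = does-≤ (m≤m+n _ _) (does-≈ ≈-refl (result true) (does-g true (layout-deposit L₁ w) (room (m≤m+n _ _)) tt x≤m))
      by false = does-≤ (m≤n+m _ _) (does-≈ ≈-refl (result false) (does-g false (layout-deposit L₁ w) (room (m≤n+m _ _)) tt x≤m))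

    loop : Prog
    loop = while inp (not ∘ isBlank) (branch inp isTrue (chosen true) (chosen false) ⨾ forward ⨾ inc d)

    choose : ∀ {c c′ t} b → Does (chosen b) c t c′ → Does (if b then chosen true else chosen false) c t c′
    choose true  does = does
    choose false does = does

    does-chars : ∀ ps ss w → length ps + length ss ≤ m →
      Does loop (state ps ss w) (length ss * (4 + time) + 1) (state (ss ʳ++ ps) [] (w ++ indexed f (length ps) ss))
    does-chars ps [] w _ {ts} h = 1 , ts , ≤-refl ,
      stop (cong not (input-end (subst (λ ss → Input (past (state ps [] w)) ss (lookup ts inp)) (rest-state ps [] w) (Holds.inputs h)))) ,
      holds-≈ (deposit-cong s (sym (++-identityʳ w)) ≈-refl) h
    does-chars ps (b ∷ ss) w len {ts} h =
      let m₁ , ts′ , m≤ , y , h′ = body h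
          n₁ , ts″ , n≤ , z , h″ = does-chars (b ∷ ps) ss w′ (≤-trans (≤-reflexive (sym (+-suc (length ps) (length ss)))) len) h′
      in suc (m₁ + n₁) , ts″ , ≤-trans (s≤s (+-mono-≤ m≤ n≤)) (≤-reflexive (regroup time (length ss))) ,
        again (cong (not ∘ isBlank) (input-bit (subst (λ zs → Input (past (state ps (b ∷ ss) w)) zs (lookup ts inp)) (rest-state ps (b ∷ ss) w) (Holds.inputs h)))) y z ,
        holds-≈ (deposit-cong s (++-assoc w _ _) ≈-refl) h″
      where
      regroup : ∀ t n → suc ((suc t + 2) + (n * (4 + t) + 1)) ≡ suc n * (4 + t) + 1
      regroup = solve-∀
      w′ : List Bool
      w′ = w ++ f (length ps) b
      body : Does (branch inp isTrue (chosen true) (chosen false) ⨾ forward ⨾ inc d) (state ps (b ∷ ss) w) (suc time + 2) (state (b ∷ ps) ss w′)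
      body = does-bit b (rest-state ps (b ∷ ss) w) (choose b (does-chosen ps b ss w (≤-trans (m≤m+n _ _) len))) ⨟
        (does-≈ ≈-refl moved (does-forward (rest-state ps (b ∷ ss) w′)) ⨟ does-≈ ≈-refl counted (does-inc d≤R))
        where
        mid : Config
        mid = deposit s w′ (setReg d (length ps) (seek (b ∷ ps) ss c))
        moved : seek (b ∷ past (state ps (b ∷ ss) w′)) ss (state ps (b ∷ ss) w′) ≈ mid
        moved = ≈-trans (same (λ _ → refl) (cong (b ∷_) (past-state ps (b ∷ ss) w′)) refl refl) (seek-deposit s)
        counted : setReg d (suc (env mid d)) mid ≈ state (b ∷ ps) ss w′
        counted = ≈-trans (deposit-set s d≢s) (deposit-cong s refl (≈-trans set-set (set-cong
          (cong suc (≡-trans (deposit-other s _ d≢s) (set-same {d} {length ps} (seek (b ∷ ps) ss c)))) ≈-refl)))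

    does-scan : Does (code (scan g) ρ d s) c (timeG (scan g) m) (deposit s (generate x (env c ∘ ρ) (scan g)) c)
    does-scan = does-≤ (+-monoˡ-≤ 1 (*-monoˡ-≤ (4 + time) x≤m)) (does-≈ start ≈-refl (does-chars [] x [] x≤m)) ⨟
      does-≤ (+-monoˡ-≤ 1 (*-monoˡ-≤ 3 (≤-trans (≤-reflexive (≡-trans (length-ʳ++ x) (+-identityʳ _))) x≤m)))
        (does-≈ ≈-refl finish (rewind d d≤R (x ʳ++ []) [] (state (x ʳ++ []) [] all) (past-state _ [] all) (rest-state (x ʳ++ []) [] all) (d-state (x ʳ++ []) [] all)))
      where
      all : List Bool
      all = indexed f 0 x
      seek-id : ∀ {ps ss} → past c ≡ ps → rest c ≡ ss → seek ps ss c ≈ c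
      seek-id refl refl = ≈-refl
      start : c ≈ state [] x []
      start = ≈-sym (≈-trans (deposit-[] s) (≈-trans (set-id (zero-at L)) (seek-id (proj₁ ready) (proj₂ ready))))
      finish : seek [] ((x ʳ++ []) ʳ++ []) (setReg d 0 (state (x ʳ++ []) [] all)) ≈ deposit s all c
      finish = ≈-trans (≈-trans (same (_≈_.same-env (deposit-set s d≢s)) refl refl (_≈_.same-written (deposit-set {d} {0} {all} {setReg d (length (x ʳ++ [])) (seek (x ʳ++ []) [] c)} s d≢s)))
        (seek-deposit s {[]} {(x ʳ++ []) ʳ++ []} {all} {setReg d 0 (setReg d (length (x ʳ++ [])) (seek (x ʳ++ []) [] c))}))
        (deposit-cong s refl (≈-trans set-set (≈-trans (set-id (zero-at L))
          (seek-id (proj₁ ready) (≡-trans (proj₂ ready) (sym (reverse-involutive x)))))))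

  module Store {V b} (g : Gen V b) (h : Gen (Maybe V) b) (does-g : Generates g) (does-h : Generates h) {ρ : V → ℕ} {d s c m} (L : Layout ρ d s c m)
    (u : d + usesG (store g h) ≤ suc R) (ready : Ready b c) (x≤m : length x ≤ m) where

    d≤R : d ≤ R
    d≤R = fits u

    room : ∀ {u′} → u′ ≤ usesG g + usesG h → suc d + u′ ≤ suc R
    room u′≤ = ≤-trans (≤-trans (s≤s (+-monoʳ-≤ d u′≤)) (≤-reflexive (sym (+-suc d _)))) u

    stored : List Bool
    stored = generate x (env c ∘ ρ) g

    n : ℕ
    n = length stored

    n≤ : n ≤ sizeG g m
    n≤ = size≤ x g (Layout.limited L) x≤m

    d≢s : NotSink s d
    d≢s = d≢sink L

    filled : deposit (toReg d) stored c ≈ setReg d n c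
    filled = set-cong (cong (_+ n) (zero-at L)) ≈-refl

    used : List Bool
    used = generate x (extend (env c ∘ ρ) n) h

    final-d : env (deposit s used (setReg d n c)) d ≡ n
    final-d = ≡-trans (deposit-other s _ d≢s) (set-same {d} {n} c)

    finish : setReg d 0 (deposit s used (setReg d n c)) ≈ deposit s used c
    finish = ≈-trans (deposit-set s d≢s) (deposit-cong s refl (drop-set L ≤-refl))

    does-store : Does (code (store g h) ρ d s) c (timeG (store g h) m) (deposit s used c)
    does-store = does-≈ ≈-refl filled (does-g (layout-to L ≤-refl ≤-refl) (room (m≤m+n _ _)) ready x≤m) ⨟
      (does-≈ ≈-refl (deposit-cong s (generate-cong x (values-bind {l = d} {n} L ≤-refl) h) ≈-refl)
         (does-h (layout-bind L ≤-refl (m≤m+n m _) (≤-trans n≤ (m≤n+m _ m))) (room (m≤n+m _ _)) (ready-set ready) (≤-trans x≤m (m≤m+n m _))) ⨟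
       does-≤ (+-monoˡ-≤ 1 (*-monoˡ-≤ 3 n≤)) (does-≈ ≈-refl finish (clear d d≤R final-d)))

  does-code : ∀ {V b} (g : Gen V b) → Generates g
  does-code ε {s = s} L u r x≤m = does-≈ ≈-refl (≈-sym (deposit-[] s)) does-nop
  does-code (emit b) {s = s} L u r x≤m = does-put s b (reachable s u (Layout.sink< L))
  does-code (g ⊕ h) {ρ} {d} {s} {c} L u r x≤m = does-≈ ≈-refl (≈-trans (deposit-++ s) (deposit-cong s
      (cong (generate x (env c ∘ ρ) g ++_) (generate-cong x (vars-deposit L _) h)) ≈-refl))
    (does-code g L (≤-trans (+-monoʳ-≤ d (m≤m+n _ _)) u) r x≤m ⨟
     does-code h (layout-deposit L (generate x (env c ∘ ρ) g)) (≤-trans (+-monoʳ-≤ d (m≤n+m _ _)) u) (ready-deposit s r) x≤m)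
  does-code (tell e) L u r x≤m = does-add e L u
  does-code (for e g) L u r x≤m = For.does-for e g (does-code g) L u r x≤m
  does-code (scan g) L u r x≤m = Scan.does-scan g (λ b → does-code (g b)) L u r x≤m
  does-code (store g h) L u r x≤m = Store.does-store g h (does-code g) (does-code h) L u r x≤m

-- Polynomial bounds

_⊞ₚ_ : Polynomial → Polynomial → Polynomial
[]      ⊞ₚ q       = q
(a ∷ p) ⊞ₚ []      = a ∷ p
(a ∷ p) ⊞ₚ (b ∷ q) = a + b ∷ (p ⊞ₚ q)

_⊠ₚ_ : Polynomial → Polynomial → Polynomial
[]      ⊠ₚ q = []
(a ∷ p) ⊠ₚ q = map (a *_) q ⊞ₚ (0 ∷ (p ⊠ₚ q))

_∘ₚ_ : Polynomial → Polynomial → Polynomial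
[]      ∘ₚ q = []
(a ∷ p) ∘ₚ q = (a ∷ []) ⊞ₚ (q ⊠ₚ (p ∘ₚ q))

eval-⊞ : ∀ p q n → eval (p ⊞ₚ q) n ≡ eval p n + eval q n
eval-⊞ []      q       n = refl
eval-⊞ (a ∷ p) []      n = sym (+-identityʳ _)
eval-⊞ (a ∷ p) (b ∷ q) n = ≡-trans (cong (λ k → a + b + n * k) (eval-⊞ p q n)) (regroup a b n (eval p n) (eval q n))
  where
  regroup : ∀ a b n x y → a + b + n * (x + y) ≡ a + n * x + (b + n * y)
  regroup = solve-∀

eval-scale : ∀ a q n → eval (map (a *_) q) n ≡ a * eval q n
eval-scale a []      n = sym (*-zeroʳ a)
eval-scale a (b ∷ q) n = ≡-trans (cong (λ k → a * b + n * k) (eval-scale a q n)) (regroup a b n (eval q n))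
  where
  regroup : ∀ a b n x → a * b + n * (a * x) ≡ a * (b + n * x)
  regroup = solve-∀

eval-⊠ : ∀ p q n → eval (p ⊠ₚ q) n ≡ eval p n * eval q n
eval-⊠ []      q n = refl
eval-⊠ (a ∷ p) q n = ≡-trans (eval-⊞ (map (a *_) q) _ n)
  (≡-trans (cong₂ (λ k l → k + n * l) (eval-scale a q n) (eval-⊠ p q n)) (regroup a n (eval p n) (eval q n)))
  where
  regroup : ∀ a n x y → a * y + n * (x * y) ≡ (a + n * x) * y
  regroup = solve-∀

eval-∘ : ∀ p q n → eval (p ∘ₚ q) n ≡ eval p (eval q n)
eval-∘ []      q n = refl
eval-∘ (a ∷ p) q n = ≡-trans (eval-⊞ (a ∷ []) (q ⊠ₚ (p ∘ₚ q)) n)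
  (cong₂ _+_ (≡-trans (cong (a +_) (*-zeroʳ n)) (+-identityʳ a))
    (≡-trans (eval-⊠ q (p ∘ₚ q) n) (cong (eval q n *_) (eval-∘ p q n))))

eval-mono : ∀ p {m n} → m ≤ n → eval p m ≤ eval p n
eval-mono []      m≤n = z≤n
eval-mono (a ∷ p) m≤n = +-monoʳ-≤ a (*-mono-≤ m≤n (eval-mono p m≤n))

-- Composition is needed besides sums and products, since a variable bound inside a generator is
-- limited only by a function of the limit of the outer variables.
Bounded : (ℕ → ℕ) → Set
Bounded f = ∃[ p ] (∀ n → f n ≤ eval p n)

bounded-const : ∀ c → Bounded (λ _ → c)
bounded-const c = c ∷ [] , λ n → m≤m+n c _

bounded-id : Bounded (λ n → n)
bounded-id = 0 ∷ 1 ∷ [] , λ n → ≤-reflexive (sym (≡-trans (cong (λ k → n * (1 + k)) (*-zeroʳ n)) (*-identityʳ n)))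

bounded-+ : ∀ {f g} → Bounded f → Bounded g → Bounded (λ n → f n + g n)
bounded-+ (p , f≤) (q , g≤) = p ⊞ₚ q , λ n → ≤-trans (+-mono-≤ (f≤ n) (g≤ n)) (≤-reflexive (sym (eval-⊞ p q n)))

bounded-* : ∀ {f g} → Bounded f → Bounded g → Bounded (λ n → f n * g n)
bounded-* (p , f≤) (q , g≤) = p ⊠ₚ q , λ n → ≤-trans (*-mono-≤ (f≤ n) (g≤ n)) (≤-reflexive (sym (eval-⊠ p q n)))

bounded-∘ : ∀ {f g} → Bounded f → Bounded g → Bounded (λ n → f (g n))
bounded-∘ (p , f≤) (q , g≤) = p ∘ₚ q , λ n → ≤-trans (f≤ _) (≤-trans (eval-mono p (g≤ n)) (≤-reflexive (sym (eval-∘ p q n))))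

bounded-bound : ∀ {V} (e : Expr V) → Bounded (bound e)
bounded-bound (lit n) = bounded-const n
bounded-bound (var v) = bounded-id
bounded-bound (e ⊞ f) = bounded-+ (bounded-bound e) (bounded-bound f)
bounded-bound (e ⊠ f) = bounded-* (bounded-bound e) (bounded-bound f)
bounded-bound (e ⊟ f) = bounded-bound e

bounded-countdown : ∀ {f} k → Bounded f → Bounded (λ n → f n * k + 1)
bounded-countdown k b = bounded-+ (bounded-* b (bounded-const k)) (bounded-const 1)

bounded-timeE : ∀ {V} (e : Expr V) → Bounded (timeE e)
bounded-timeE (lit n) = bounded-const (n + 1)
bounded-timeE (var v) = bounded-+ (bounded-countdown 3 bounded-id) (bounded-countdown 4 bounded-id)
bounded-timeE (e ⊞ f) = bounded-+ (bounded-timeE e) (bounded-timeE f)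
bounded-timeE (e ⊠ f) = bounded-+ (bounded-timeE e)
  (bounded-+ (bounded-* (bounded-bound e) (bounded-+ (bounded-const 2) (bounded-timeE f))) (bounded-const 1))
bounded-timeE (e ⊟ f) = bounded-+ (bounded-timeE e) (bounded-+ (bounded-timeE f)
  (bounded-+ (bounded-countdown 4 (bounded-bound f)) (bounded-countdown 3 (bounded-bound e))))

bounded-sizeG : ∀ {V b} (g : Gen V b) → Bounded (sizeG g)
bounded-sizeG ε           = bounded-const 0
bounded-sizeG (emit b)    = bounded-const 1
bounded-sizeG (g ⊕ h)     = bounded-+ (bounded-sizeG g) (bounded-sizeG h)
bounded-sizeG (tell e)    = bounded-bound e
bounded-sizeG (for e g)   = bounded-* (bounded-bound e) (bounded-∘ (bounded-sizeG g) (bounded-+ bounded-id (bounded-bound e)))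
bounded-sizeG (scan g)    = bounded-* bounded-id (bounded-+ (bounded-sizeG (g true)) (bounded-sizeG (g false)))
bounded-sizeG (store g h) = bounded-∘ (bounded-sizeG h) (bounded-+ bounded-id (bounded-sizeG g))

bounded-timeG : ∀ {V b} (g : Gen V b) → Bounded (timeG g)
bounded-timeG ε           = bounded-const 1
bounded-timeG (emit b)    = bounded-const 1
bounded-timeG (g ⊕ h)     = bounded-+ (bounded-timeG g) (bounded-timeG h)
bounded-timeG (tell e)    = bounded-timeE e
bounded-timeG (for e g)   = bounded-+ (bounded-timeE e) (bounded-+
  (bounded-+ (bounded-* (bounded-bound e) (bounded-+ (bounded-const 2)
    (bounded-+ (bounded-∘ (bounded-timeG g) (bounded-+ bounded-id (bounded-bound e))) (bounded-const 1)))) (bounded-const 1))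
  (bounded-countdown 3 (bounded-bound e)))
bounded-timeG (scan g)    = bounded-+
  (bounded-+ (bounded-* bounded-id (bounded-+ (bounded-const 4) (bounded-+ (bounded-timeG (g true)) (bounded-timeG (g false))))) (bounded-const 1))
  (bounded-countdown 3 bounded-id)
bounded-timeG (store g h) = bounded-+ (bounded-timeG g)
  (bounded-+ (bounded-∘ (bounded-timeG h) (bounded-+ bounded-id (bounded-sizeG g))) (bounded-countdown 3 (bounded-sizeG g)))

-- Generators run in polynomial time

module Setup (R : ℕ) where

  open Coding R

  marked : ℕ → Prog
  marked l = op (reg l) λ _ → mark tt , stay

  -- A blank tape is not yet a counter: the cell that stands for 0 has to be marked.
  setup : ℕ → Prog
  setup zero    = marked 0
  setup (suc n) = setup n ⨾ marked (suc n)

  record Partial (n : ℕ) (x : List Bool) (ts : Tapes) : Set where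
    field
      ready : ∀ l → l ≤ R → l < n → Counter 0 (lookup ts (reg l))
      empty : ∀ l → l ≤ R → n ≤ l → lookup ts (reg l) ≡ blankTape
      text  : lookup ts inp ≡ inputTape x
      blankOut : lookup ts out ≡ blankTape

  mark-next : ∀ {n x ts} → n ≤ R → Partial n x ts → Partial (suc n) x (on-tape (reg n) (λ _ → mark tt , stay) ts)
  mark-next {n} {x} {ts} n≤R p = record
    { ready = λ l l≤R l<sn → new l l≤R (≤-pred l<sn)
    ; empty = λ l l≤R n<l → ≡-trans (other l l≤R (>⇒≢ n<l)) (empty l l≤R (<⇒≤ n<l))
    ; text  = ≡-trans (Vec.lookup∘updateAt′ inp (reg n) (λ ()) ts) text
    ; blankOut = ≡-trans (Vec.lookup∘updateAt′ out (reg n) (λ e → reg≢out n (sym e)) ts) blankOut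
    }
    where
    open Partial p
    other : ∀ l → l ≤ R → l ≢ n → lookup (on-tape (reg n) (λ _ → mark tt , stay) ts) (reg l) ≡ lookup ts (reg l)
    other l l≤R l≢n = Vec.lookup∘updateAt′ (reg l) (reg n) (l≢n ∘ reg-injective l≤R n≤R) ts
    new : ∀ l → l ≤ R → l ≤ n → Counter 0 (lookup (on-tape (reg n) (λ _ → mark tt , stay) ts) (reg l))
    new l l≤R l≤n with l ≟ n
    ... | yes refl = subst (Counter 0) (sym (≡-trans (Vec.lookup∘updateAt (reg n) ts) (cong (act (mark tt , stay)) (empty n l≤R ≤-refl)))) (none [])
    ... | no l≢n   = subst (Counter 0) (sym (other l l≤R l≢n)) (ready l l≤R (≤∧≢⇒< l≤n l≢n))

  does-setup : ∀ n {x ts} → n ≤ R → Partial 0 x ts → ∃[ ts′ ] (Exec (setup n) ts (suc n) ts′ × Partial (suc n) x ts′)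
  does-setup zero    n≤R p = _ , op , mark-next n≤R p
  does-setup (suc n) {ts = ts} n≤R p = let ts′ , y , q = does-setup n (<⇒≤ n≤R) p in
    on-tape (reg (suc n)) (λ _ → mark tt , stay) ts′ ,
    subst (λ k → Exec (setup (suc n)) ts k (on-tape (reg (suc n)) (λ _ → mark tt , stay) ts′)) (+-comm (suc n) 1) (y ⨾ op) ,
    mark-next n≤R q

  initialConfig : List Bool → Config
  initialConfig x = config (λ _ → 0) [] x []

  input-initial : ∀ x → Input [] x (inputTape x)
  -- On the empty input the head is on a blank, which counts as the margin.
  input-initial []      = input {margin = 1} refl refl
  input-initial (b ∷ x) = input {margin = 0} refl (sym (++-identityʳ _))

  holds-initial : ∀ {x ts} → Partial (suc R) x ts → Holds (initialConfig x) ts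
  holds-initial {x} p = holds (λ l l≤R → ready l l≤R (s≤s l≤R))
    (subst (Input [] x) (sym text) (input-initial x)) (subst (Output []) (sym blankOut) (output []))
    where open Partial p

  -- The output tape with the head on the first of the reversed bits us.
  facing : List Bool → List Bool → Tape ⊤
  facing []       vs = tape [] blank (map bit vs ++ blank ∷ [])
  facing (u ∷ us) vs = tape (map bit us) (bit u) (map bit vs ++ blank ∷ [])

  facing-left : ∀ u us vs → act (head (facing (u ∷ us) vs) , left) (facing (u ∷ us) vs) ≡ facing us (u ∷ vs)
  facing-left u []        vs = refl
  facing-left u (u′ ∷ us) vs = refl

  output-left : ∀ us → act (blank , left) (tape (map bit us) blank []) ≡ facing us []
  output-left []       = refl
  output-left (u ∷ us) = refl

  leftward : Prog
  leftward = op out λ s → s , left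

  return : Prog
  return = while out (not ∘ isBlank) leftward

  does-return : ∀ us vs {ts} → lookup ts out ≡ facing us vs →
    ∃[ n ] ∃[ ts′ ] (n ≤ length us * 2 + 1 × Exec return ts n ts′ × lookup ts′ out ≡ facing [] (us ʳ++ vs))
  does-return [] vs {ts} e = 1 , ts , ≤-refl , stop (cong (not ∘ isBlank ∘ head) e) , e
  does-return (u ∷ us) vs {ts} e =
    let n , ts′ , n≤ , y , e′ = does-return us (u ∷ vs) {on-tape out (λ s → s , left) ts}
          (≡-trans (Vec.lookup∘updateAt out ts) (≡-trans (cong (λ t → act (head t , left) t) e) (facing-left u us vs)))
    in suc (1 + n) , ts′ , s≤s (s≤s n≤) , again (cong (not ∘ isBlank ∘ head) e) op y , e′

  -- The output of a machine is read from the head to the right, so the head must return to the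
  -- first bit; it finds it by the blank to the left of it.
  rewindOutput : Prog
  rewindOutput = leftward ⨾ return ⨾ op out (λ s → s , right)

  does-rewindOutput : ∀ {w ts} → Output w (lookup ts out) →
    ∃[ n ] ∃[ ts′ ] (n ≤ length w * 2 + 3 × Exec rewindOutput ts n ts′ × bitsFromHead (lookup ts′ out) ≡ w)
  does-rewindOutput {w} {ts} o =
    let n , ts′ , n≤ , y , e′ = does-return (reverse w) [] {on-tape out (λ s → s , left) ts}
          (≡-trans (Vec.lookup∘updateAt out ts) (shape o))
    in 1 + (n + 1) , on-tape out (λ s → s , right) ts′ ,
      ≤-trans (s≤s (+-monoˡ-≤ 1 n≤)) (≤-reflexive (≡-trans (cong (λ k → suc (k * 2 + 1 + 1)) (length-reverse w)) (regroup (length w)))) ,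
      op ⨾ y ⨾ op ,
      ≡-trans (cong bitsFromHead (≡-trans (Vec.lookup∘updateAt out ts′) (cong (λ t → act (head t , right) t) e′)))
        (≡-trans (bits (reverse w ʳ++ [])) (reverse-involutive w))
    where
    regroup : ∀ n → suc (n * 2 + 1 + 1) ≡ n * 2 + 3
    regroup = solve-∀
    shape : ∀ {w t} → Output w t → act (head t , left) t ≡ facing (reverse w) []
    shape (output w) = output-left (reverse w)
    leading : ∀ vs → leadingBits (map bit vs ++ blank ∷ []) ≡ vs
    leading []       = refl
    leading (v ∷ vs) = cong (v ∷_) (leading vs)
    bits : ∀ vs → bitsFromHead (act (blank , right) (facing [] vs)) ≡ vs
    bits []       = refl
    bits (v ∷ vs) = cong (v ∷_) (leading vs)

last-lookup : ∀ {A : Set} {n} (xs : Vec A (suc n)) → Vec.last xs ≡ lookup xs (fromℕ n)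
last-lookup (x ∷ [])     = refl
last-lookup (x ∷ y ∷ xs) = last-lookup (y ∷ xs)

generate-polynomial : ∀ (g : Gen ⊥ true) → PolynomialTime (λ x → generate x ⊥-elim g)
generate-polynomial g = machine program , proj₁ time , λ x → runs x
  where
  R : ℕ
  R = usesG g
  open Coding R
  open Setup R
  program : Prog
  program = setup R ⨾ code g ⊥-elim 0 toOut ⨾ rewindOutput
  time : Bounded (λ m → suc R + (timeG g m + (sizeG g m * 2 + 3)))
  time = bounded-+ (bounded-const (suc R)) (bounded-+ (bounded-timeG g) (bounded-+ (bounded-* (bounded-sizeG g) (bounded-const 2)) (bounded-const 3)))
  open Computation (machine program) using (run; initial; Halted) renaming (output to result)
  runs : ∀ x → ∃[ t ] (t ≤ eval (proj₁ time) (length x) × Halted (run (replicate t tt) (initial x)) ×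
    result (run (replicate t tt) (initial x)) ≡ generate x ⊥-elim g)
  runs x =
    let ts₁ , e₁ , p₁ = does-setup R ≤-refl partial
        n₂ , ts₂ , n₂≤ , e₂ , h₂ = does-code g layout (n≤1+n R) (refl , refl) ≤-refl (holds-initial p₁)
        n₃ , ts₃ , n₃≤ , e₃ , w = does-rewindOutput (Holds.outputs h₂)
        done = run-exec program (e₁ ⨾ e₂ ⨾ e₃)
    in suc R + (n₂ + n₃) ,
      ≤-trans (+-monoʳ-≤ (suc R) (+-mono-≤ n₂≤ (≤-trans n₃≤ (+-monoˡ-≤ 3 (*-monoˡ-≤ 2 (≤-trans (≤-reflexive (cong length (generate-cong x (λ ()) g))) (size≤ x g {⊥-elim} (λ ()) ≤-refl))))))) (proj₂ time (length x)) ,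
      cong (λ s → [ (λ _ → true) , (λ _ → false) ]′ (Computation.state s)) done ,
      ≡-trans (cong (bitsFromHead ∘ Vec.last ∘ Computation.tapes) done)
        (≡-trans (cong bitsFromHead (last-lookup ts₃)) (≡-trans w (generate-cong x (λ ()) g)))
    where
    open Generate R x using (does-code)
    blank-at : ∀ i → lookup (inputTape {⊤} x ∷ Vec.replicate (2 + R) blankTape) (suc i) ≡ blankTape
    blank-at i = Vec.lookup-replicate i blankTape
    partial : Partial 0 x (inputTape x ∷ Vec.replicate (2 + R) blankTape)
    partial = record { ready = λ _ _ () ; empty = λ l _ _ → blank-at (inject₁ (clamp R l)) ; text = refl ; blankOut = blank-at (fromℕ (suc R)) }
    layout : Layout {⊥} ⊥-elim 0 toOut (initialConfig x) (length x)
    layout = record { below = λ () ; unsunk = λ () ; sink< = tt ; fresh = λ _ _ → refl ; limited = λ () }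

-- Codes of finite types and vectors

codeOf : {A : Set} → Finite A → A → ℕ
codeOf (n , e) a = toℕ (Inverse.to e a)

codeOf-< : ∀ {A : Set} (f : Finite A) a → codeOf f a < proj₁ f
codeOf-< (n , e) a = Fin.toℕ<n (Inverse.to e a)

codeOf-injective : ∀ {A : Set} (f : Finite A) {a b} → codeOf f a ≡ codeOf f b → a ≡ b
codeOf-injective (n , e) eq = ≡-trans (sym (Inverse.inverseʳ e refl))
  (≡-trans (cong (Inverse.from e) (Fin.toℕ-injective eq)) (Inverse.inverseʳ e refl))

module _ {Mark : Set} (f : Finite Mark) where

  symbolCode : Symbol Mark → ℕ
  symbolCode blank       = 0
  symbolCode (bit false) = 1
  symbolCode (bit true)  = 2
  symbolCode (mark m)    = 3 + codeOf f m

  symbolCode-< : ∀ s → symbolCode s < 3 + proj₁ f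
  symbolCode-< blank       = s≤s z≤n
  symbolCode-< (bit false) = s≤s (s≤s z≤n)
  symbolCode-< (bit true)  = s≤s (s≤s (s≤s z≤n))
  symbolCode-< (mark m)    = s≤s (s≤s (s≤s (codeOf-< f m)))

  symbolCode-injective : ∀ {s u} → symbolCode s ≡ symbolCode u → s ≡ u
  symbolCode-injective {blank}     {blank}     eq = refl
  symbolCode-injective {bit false} {bit false} eq = refl
  symbolCode-injective {bit true}  {bit true}  eq = refl
  symbolCode-injective {mark m}    {mark m′}   eq = cong mark (codeOf-injective f (suc-injective (suc-injective (suc-injective eq))))
  symbolCode-injective {blank}     {bit false} ()
  symbolCode-injective {blank}     {bit true}  ()
  symbolCode-injective {mark _}    {bit false} ()
  symbolCode-injective {mark _}    {bit true}  ()
  symbolCode-injective {bit false} {blank}     ()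
  symbolCode-injective {bit true}  {blank}     ()
  symbolCode-injective {bit false} {bit true}  ()
  symbolCode-injective {bit true}  {bit false} ()
  symbolCode-injective {bit false} {mark _}    ()
  symbolCode-injective {bit true}  {mark _}    ()

boolCode : Bool → ℕ
boolCode true  = 1
boolCode false = 0

boolCode-< : ∀ b → boolCode b < 2
boolCode-< true  = s≤s (s≤s z≤n)
boolCode-< false = s≤s z≤n

boolCode-injective : ∀ {b c} → boolCode b ≡ boolCode c → b ≡ c
boolCode-injective {true}  {true}  eq = refl
boolCode-injective {false} {false} eq = refl

-- Pairing in mixed radix. The codes of words, rules and addresses are iterations of it, which gives
-- both their bounds and their injectivity.
pair-< : ∀ {a q X Y} → a < X → q < Y → a + q * X < Y * X
pair-< {q = q} {X} a<X q<Y = ≤-trans (+-monoˡ-< (q * X) a<X) (*-monoˡ-≤ X q<Y)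

pair-injective : ∀ {a b X} q r → a < X → b < X → a + q * X ≡ b + r * X → a ≡ b × q ≡ r
pair-injective {X = X} = Positional.divMod-unique X

-- Addresses over numbers or numerical expressions N

module Codes (M : TuringMachine Bool) where

  open TuringMachine M

  tapes stateCount symbolCount : ℕ
  tapes = 1 + extraTapes
  stateCount = proj₁ finiteStates
  symbolCount = 3 + proj₁ finiteMarks

  wordCode : ∀ {n} → Vec (Symbol Mark) n → ℕ
  wordCode []      = 0
  wordCode (s ∷ σ) = symbolCode finiteMarks s + wordCode σ * symbolCount

  ruleCode : State → Bool → Vec (Symbol Mark) tapes → ℕ
  ruleCode q c σ = codeOf finiteStates q + (boolCode c + wordCode σ * 2) * stateCount

  ruleCount : ℕ
  ruleCount = symbolCount ^ tapes * 2 * stateCount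

module Addresses (M : TuringMachine Bool) (N : Set) (# : ℕ → N) (_⊞_ _⊠_ : N → N → N) (T W : N) where

  open TuringMachine M
  open Codes M

  radix : ∀ {n} → N → Vec N n → N
  radix b []       = # 0
  radix b (d ∷ ds) = d ⊞ (radix b ds ⊠ b)

  power : N → ℕ → N
  power b zero    = # 1
  power b (suc n) = b ⊠ power b n

  timeCount : N
  timeCount = # 2 ⊞ T

  Class : Set
  Class = Place State Mark tapes N ⊎ Reaction State Mark tapes N

  -- All slots within a bin differ. The hubs of `step` and `accept` can share a slot, and so can
  -- those of `idle` and `erase`: no bin has two hubs, and their addresses differ in the time, which
  -- is below `T` for the former and `T` for the latter.
  slot : Class → ℕ
  slot (inj₁ (control t q hs))    = 0
  slot (inj₁ (cell t i p s))      = 3 + toℕ i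
  slot (inj₂ (step t q c σ js))   = 1
  slot (inj₂ (idle t i p s))      = 2
  slot (inj₂ (accept q hs))       = 1
  slot (inj₂ (erase i p s))       = 2

  tapeAddress : N → Fin tapes → N → Symbol Mark → N
  tapeAddress t i p s = # (toℕ i + symbolCode finiteMarks s * tapes) ⊞ ((t ⊞ (p ⊠ timeCount)) ⊠ # (symbolCount * tapes))

  addr : Class → N
  addr (inj₁ (control t q hs))  = # (codeOf finiteStates q) ⊞ ((t ⊞ (radix W hs ⊠ timeCount)) ⊠ # stateCount)
  addr (inj₁ (cell t i p s))    = tapeAddress t i p s
  addr (inj₂ (step t q c σ js)) = # (ruleCode q c σ) ⊞ ((t ⊞ (radix W js ⊠ timeCount)) ⊠ # ruleCount)
  addr (inj₂ (idle t i p s))    = tapeAddress t i p s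
  -- Choice and word are padding, which gives the address the form of that of a step at time `T`.
  addr (inj₂ (accept q hs))     = # (ruleCode q true (Vec.replicate tapes blank)) ⊞ ((T ⊞ (radix W hs ⊠ timeCount)) ⊠ # ruleCount)
  addr (inj₂ (erase i p s))     = tapeAddress T i p s

  -- A sum of the ranges of the three forms of addresses; the last summand makes it a bound for the
  -- weights, too.
  addressBound : N
  addressBound = ((power W tapes ⊠ timeCount) ⊠ # stateCount) ⊞ (((W ⊠ timeCount) ⊠ # (symbolCount * tapes)) ⊞
    (((power W tapes ⊠ timeCount) ⊠ # ruleCount) ⊞ # (1 + tapes)))

  -- A bin has at most `2 + tapes` items: a hub, a control place and one cell for each tape. One
  -- more summand provides for the flag total, as in `roomy`.
  base : N
  base = # 1 ⊞ (# (3 + tapes) ⊠ (# 4 ⊠ addressBound))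

  bulkN : Class → N
  bulkN c = ((addressBound ⊞ addr c) ⊠ power base (1 + slot c)) ⊞ power base (4 + tapes)

  weightOf : Class → ℕ
  weightOf (inj₁ _)                   = 1
  weightOf (inj₂ (step t q c σ js))   = 1 + tapes
  weightOf (inj₂ _)                   = 1

  weighN : Class × Bool → N
  weighN (c , f) = # (if f then weightOf c else 0) ⊞ bulkN c

-- The numbering of places and hubs

module Numbers (M : TuringMachine Bool) (T : ℕ) (x : List Bool) where

  open TuringMachine M
  open Acceptance M T x public
  open Codes M public
  open Addresses M ℕ id _+_ _*_ T W public

  radix-< : ∀ {n} {b} (v : Vec ℕ n) → (∀ i → lookup v i < b) → radix b v < power b n
  radix-< []      p = s≤s z≤n
  radix-< {suc n} {b} (d ∷ v) p = ≤-trans (pair-< (p zero) (radix-< v (p ∘ suc))) (≤-reflexive (*-comm (power b n) b))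

  radix-injective : ∀ {n} {b} (v w : Vec ℕ n) → (∀ i → lookup v i < b) → (∀ i → lookup w i < b) → radix b v ≡ radix b w → v ≡ w
  radix-injective []      []      p q eq = refl
  radix-injective {b = b} (d ∷ v) (e ∷ w) p q eq with refl , eq′ ← pair-injective (radix b v) (radix b w) (p zero) (q zero) eq =
    cong (d ∷_) (radix-injective v w (p ∘ suc) (q ∘ suc) eq′)

  wordCode-< : ∀ {n} (σ : Vec (Symbol Mark) n) → wordCode σ < symbolCount ^ n
  wordCode-< []      = s≤s z≤n
  wordCode-< {suc n} (s ∷ σ) = ≤-trans (pair-< (symbolCode-< finiteMarks s) (wordCode-< σ)) (≤-reflexive (*-comm (symbolCount ^ n) symbolCount))

  wordCode-injective : ∀ {n} (σ τ : Vec (Symbol Mark) n) → wordCode σ ≡ wordCode τ → σ ≡ τ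
  wordCode-injective []      []      eq = refl
  wordCode-injective (s ∷ σ) (u ∷ τ) eq
    with p , eq′ ← pair-injective (wordCode σ) (wordCode τ) (symbolCode-< finiteMarks s) (symbolCode-< finiteMarks u) eq =
    cong₂ _∷_ (symbolCode-injective finiteMarks p) (wordCode-injective σ τ eq′)

  ruleCode-< : ∀ q c σ → ruleCode q c σ < ruleCount
  ruleCode-< q c σ = pair-< (codeOf-< finiteStates q) (pair-< (boolCode-< c) (wordCode-< σ))

  ruleCode-injective : ∀ {q c σ q′ c′ σ′} → ruleCode q c σ ≡ ruleCode q′ c′ σ′ → q ≡ q′ × c ≡ c′ × σ ≡ σ′
  ruleCode-injective {q} {c} {σ} {q′} {c′} {σ′} eq
    with p , eq′ ← pair-injective (boolCode c + wordCode σ * 2) (boolCode c′ + wordCode σ′ * 2) (codeOf-< finiteStates q) (codeOf-< finiteStates q′) eq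
    with r , eq″ ← pair-injective (wordCode σ) (wordCode σ′) (boolCode-< c) (boolCode-< c′) eq′ =
    codeOf-injective finiteStates p , boolCode-injective r , wordCode-injective σ σ′ eq″

  InBounds : ∀ {n} → Vec ℕ n → Set
  InBounds v = ∀ i → lookup v i < W

  Valid : Class → Set
  Valid (inj₁ (control t q hs))  = t < timeCount × InBounds hs
  Valid (inj₁ (cell t i p s))    = t < timeCount × p < W
  Valid (inj₂ (step t q c σ js)) = t < T × InBounds js
  Valid (inj₂ (idle t i p s))    = t < T × p < W
  Valid (inj₂ (accept q hs))     = InBounds hs
  Valid (inj₂ (erase i p s))     = p < W

  T<timeCount : ∀ {t} → t < T → t < timeCount
  T<timeCount t<T = ≤-trans t<T (m≤n+m T 2)

  T-level : T < timeCount
  T-level = s≤s (n≤1+n T)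

  timed-< : ∀ {t n Y a X} (v : Vec ℕ n) → t < timeCount → radix W v < Y → a < X → a + (t + radix W v * timeCount) * X < Y * timeCount * X
  timed-< v t< r< a< = pair-< a< (pair-< t< r<)

  tape-code-< : ∀ i s → toℕ i + symbolCode finiteMarks s * tapes < symbolCount * tapes
  tape-code-< i s = pair-< (Fin.toℕ<n i) (symbolCode-< finiteMarks s)

  tapeAddress-< : ∀ {t p} i s → t < timeCount → p < W → tapeAddress t i p s < W * timeCount * (symbolCount * tapes)
  tapeAddress-< i s t< p< = pair-< (tape-code-< i s) (pair-< t< p<)

  tapeAddress-injective : ∀ {t p i s t′ p′ i′ s′} → t < timeCount → t′ < timeCount → tapeAddress t i p s ≡ tapeAddress t′ i′ p′ s′ →
    t ≡ t′ × i ≡ i′ × p ≡ p′ × s ≡ s′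
  tapeAddress-injective {t} {p} {i} {s} {t′} {p′} {i′} {s′} t< t′< eq
    with e₁ , e₂ ← pair-injective (t + p * timeCount) (t′ + p′ * timeCount) (tape-code-< i s) (tape-code-< i′ s′) eq
    with e₃ , e₄ ← pair-injective (symbolCode finiteMarks s) (symbolCode finiteMarks s′) (Fin.toℕ<n i) (Fin.toℕ<n i′) e₁
    with e₅ , e₆ ← pair-injective p p′ t< t′< e₂ = e₅ , Fin.toℕ-injective e₃ , e₆ , symbolCode-injective finiteMarks e₄

  timed-injective : ∀ {t t′ n a a′ X} (v w : Vec ℕ n) → t < timeCount → t′ < timeCount → InBounds v → InBounds w → a < X → a′ < X →
    a + (t + radix W v * timeCount) * X ≡ a′ + (t′ + radix W w * timeCount) * X → a ≡ a′ × t ≡ t′ × v ≡ w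
  timed-injective {t} {t′} v w t< t′< v< w< a< a′< eq
    with e₁ , e₂ ← pair-injective (t + radix W v * timeCount) (t′ + radix W w * timeCount) a< a′< eq
    with e₃ , e₄ ← pair-injective (radix W v) (radix W w) t< t′< e₂ = e₁ , e₃ , radix-injective v w v< w< e₄

  boundC boundT boundR : ℕ
  boundC = power W tapes * timeCount * stateCount
  boundT = W * timeCount * (symbolCount * tapes)
  boundR = power W tapes * timeCount * ruleCount

  boundC≤ : boundC ≤ addressBound
  boundC≤ = m≤m+n boundC _

  boundT≤ : boundT ≤ addressBound
  boundT≤ = ≤-trans (m≤m+n boundT _) (m≤n+m _ boundC)

  boundR≤ : boundR ≤ addressBound
  boundR≤ = ≤-trans (≤-trans (m≤m+n boundR _) (m≤n+m _ boundT)) (m≤n+m _ boundC)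

  weight-bound : 1 + tapes ≤ addressBound
  weight-bound = ≤-trans (≤-trans (m≤n+m _ boundR) (m≤n+m _ boundT)) (m≤n+m _ boundC)

  addr-< : ∀ {c} → Valid c → addr c < addressBound
  addr-< {inj₁ (control t q hs)}  (t< , hs<) = ≤-trans (timed-< hs t< (radix-< hs hs<) (codeOf-< finiteStates q)) boundC≤
  addr-< {inj₁ (cell t i p s)}    (t< , p<)  = ≤-trans (tapeAddress-< i s t< p<) boundT≤
  addr-< {inj₂ (step t q c σ js)} (t< , js<) = ≤-trans (timed-< js (T<timeCount t<) (radix-< js js<) (ruleCode-< q c σ)) boundR≤
  addr-< {inj₂ (idle t i p s)}    (t< , p<)  = ≤-trans (tapeAddress-< i s (T<timeCount t<) p<) boundT≤
  addr-< {inj₂ (accept q hs)}     hs<        = ≤-trans (timed-< hs T-level (radix-< hs hs<) (ruleCode-< q true (Vec.replicate tapes blank))) boundR≤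
  addr-< {inj₂ (erase i p s)}     p<         = ≤-trans (tapeAddress-< i s T-level p<) boundT≤

  slot-< : ∀ c → slot c < 3 + tapes
  slot-< (inj₁ (control t q hs))  = s≤s z≤n
  slot-< (inj₁ (cell t i p s))    = s≤s (s≤s (s≤s (Fin.toℕ<n i)))
  slot-< (inj₂ (step t q c σ js)) = s≤s (s≤s z≤n)
  slot-< (inj₂ (idle t i p s))    = s≤s (s≤s (s≤s z≤n))
  slot-< (inj₂ (accept q hs))     = s≤s (s≤s z≤n)
  slot-< (inj₂ (erase i p s))     = s≤s (s≤s (s≤s z≤n))

  weight-≤ : ∀ c → weightOf c ≤ addressBound
  weight-≤ (inj₁ _)                 = ≤-trans (s≤s z≤n) weight-bound
  weight-≤ (inj₂ (step t q c σ js)) = weight-bound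
  weight-≤ (inj₂ (idle t i p s))    = ≤-trans (s≤s z≤n) weight-bound
  weight-≤ (inj₂ (accept q hs))     = ≤-trans (s≤s z≤n) weight-bound
  weight-≤ (inj₂ (erase i p s))     = ≤-trans (s≤s z≤n) weight-bound

  slot-place≢hub : ∀ p r → slot (inj₁ p) ≢ slot (inj₂ r)
  slot-place≢hub (control _ _ _) (step _ _ _ _ _) ()
  slot-place≢hub (control _ _ _) (idle _ _ _ _)   ()
  slot-place≢hub (control _ _ _) (accept _ _)     ()
  slot-place≢hub (control _ _ _) (erase _ _ _)    ()
  slot-place≢hub (cell _ _ _ _)  (step _ _ _ _ _) ()
  slot-place≢hub (cell _ _ _ _)  (idle _ _ _ _)   ()
  slot-place≢hub (cell _ _ _ _)  (accept _ _)     ()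
  slot-place≢hub (cell _ _ _ _)  (erase _ _ _)    ()

  addr-injective : ∀ {c c′} → Valid c → Valid c′ → slot c ≡ slot c′ → addr c ≡ addr c′ → c ≡ c′
  addr-injective {inj₁ (control t q hs)} {inj₁ (control t′ q′ hs′)} (t< , v<) (t′< , w<) _ eq
    with e , refl , refl ← timed-injective hs hs′ t< t′< v< w< (codeOf-< finiteStates q) (codeOf-< finiteStates q′) eq
    with refl ← codeOf-injective finiteStates e = refl
  addr-injective {inj₁ (cell t i p s)} {inj₁ (cell t′ i′ p′ s′)} (t< , _) (t′< , _) _ eq
    with refl , refl , refl , refl ← tapeAddress-injective {t} {p} {i} {s} {t′} {p′} {i′} {s′} t< t′< eq = refl
  addr-injective {inj₂ (step t q c σ js)} {inj₂ (step t′ q′ c′ σ′ js′)} (t< , v<) (t′< , w<) _ eq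
    with e , refl , refl ← timed-injective js js′ (T<timeCount t<) (T<timeCount t′<) v< w< (ruleCode-< q c σ) (ruleCode-< q′ c′ σ′) eq
    with refl , refl , refl ← ruleCode-injective {q} {c} {σ} {q′} {c′} {σ′} e = refl
  addr-injective {inj₂ (step t q c σ js)} {inj₂ (accept q′ hs)} (t< , v<) w< _ eq
    with _ , refl , _ ← timed-injective js hs (T<timeCount t<) T-level v< w< (ruleCode-< q c σ) (ruleCode-< q′ true (Vec.replicate tapes blank)) eq =
    contradiction t< 1+n≰n
  addr-injective {inj₂ (accept q hs)} {inj₂ (step t′ q′ c′ σ′ js′)} v< (t< , w<) _ eq
    with _ , refl , _ ← timed-injective hs js′ T-level (T<timeCount t<) v< w< (ruleCode-< q true (Vec.replicate tapes blank)) (ruleCode-< q′ c′ σ′) eq =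
    contradiction t< 1+n≰n
  addr-injective {inj₂ (accept q hs)} {inj₂ (accept q′ hs′)} v< w< _ eq
    with e , _ , refl ← timed-injective hs hs′ T-level T-level v< w< (ruleCode-< q true (Vec.replicate tapes blank)) (ruleCode-< q′ true (Vec.replicate tapes blank)) eq
    with refl , _ ← ruleCode-injective {q} {true} {Vec.replicate tapes blank} {q′} {true} {Vec.replicate tapes blank} e = refl
  addr-injective {inj₂ (idle t i p s)} {inj₂ (idle t′ i′ p′ s′)} (t< , _) (t′< , _) _ eq
    with refl , refl , refl , refl ← tapeAddress-injective {t} {p} {i} {s} {t′} {p′} {i′} {s′} (T<timeCount t<) (T<timeCount t′<) eq = refl
  addr-injective {inj₂ (idle t i p s)} {inj₂ (erase i′ p′ s′)} (t< , _) _ _ eq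
    with refl , _ ← tapeAddress-injective {t} {p} {i} {s} {T} {p′} {i′} {s′} (T<timeCount t<) T-level eq = contradiction t< 1+n≰n
  addr-injective {inj₂ (erase i p s)} {inj₂ (idle t′ i′ p′ s′)} _ (t< , _) _ eq
    with refl , _ ← tapeAddress-injective {T} {p} {i} {s} {t′} {p′} {i′} {s′} T-level (T<timeCount t<) eq = contradiction t< 1+n≰n
  addr-injective {inj₂ (erase i p s)} {inj₂ (erase i′ p′ s′)} _ _ _ eq
    with _ , refl , refl , refl ← tapeAddress-injective {T} {p} {i} {s} {T} {p′} {i′} {s′} T-level T-level eq = refl

  addr-injective {inj₁ p} {inj₂ r} _ _ e _ = contradiction e (slot-place≢hub p r)
  addr-injective {inj₂ r} {inj₁ p} _ _ e _ = contradiction (sym e) (slot-place≢hub p r)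

  numbering : Numbering Class
  numbering = record
    { slots = 3 + tapes ; addresses = addressBound ; base = base ; most = 2 + tapes
    ; Valid = Valid ; slot = slot ; addr = addr ; weight = weightOf
    ; slot< = λ {c} _ → slot-< c ; addr< = addr-< ; weight≤ = λ {c} _ → weight-≤ c ; injective = addr-injective ; roomy = ≤-refl }

  hub-weight : ∀ r → weightOf (inj₂ r) ≡ length (ins r)
  hub-weight (step t q c σ js) = cong suc (sym (≡-trans (length-map _ (allFin k)) (length-tabulate {n = k} id)))
  hub-weight (idle t i p s)    = refl
  hub-weight (accept q hs)     = refl
  hub-weight (erase i p s)     = refl

  -- The bins of a machine are admissible

  module Game = TokenGame ins outs balanced numbering (λ _ → refl) hub-weight starts goals reactions

  open Game public hiding (places)
  open Sizes numbering public using (weigh; flag; bulk)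

  suc-P<W : suc P < W
  suc-P<W = ≤-reflexive (regroup T (length x))
    where
    regroup : ∀ T n → 3 + (T + T + n) ≡ suc T + (n + (2 + T))
    regroup = solve-∀

  0<W : 0 < W
  0<W = s≤s z≤n

  displace-≤ : ∀ m j → displace m j ≤ 2 + j
  displace-≤ left  j = m≤n+m j 2
  displace-≤ stay  j = n≤1+n (1 + j)
  displace-≤ right j = ≤-refl

  Placed : PlaceN → Set
  Placed p = Valid (inj₁ p)

  valid-ins : ∀ r → Good r → All Placed (ins r)
  valid-ins (step t q c σ js) (t< , js<) =
    (T<timeCount t< , λ i → subst (_< W) (sym (Vec.lookup-map i suc js)) (≤-<-trans (js< i) P<W)) ∷
    All.map⁺ (All.tabulate λ {i} _ → T<timeCount t< , ≤-<-trans (js< i) P<W)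
  valid-ins (idle t i p s)    (t< , p<)  = (T<timeCount t< , p<) ∷ []
  valid-ins (accept q hs)     (_ , hs<)  = (T-level , hs<) ∷ []
  valid-ins (erase i p s)     p<         = (T-level , p<) ∷ []

  valid-outs : ∀ r → Good r → All Placed (outs r)
  valid-outs (step t q c σ js) (t< , js<) =
    (s≤s (≤-trans t< (n≤1+n T)) , λ i → subst (_< W) (sym (Vec.lookup∘tabulate
      (λ i → displace (proj₂ (lookup (proj₂ (δ′ c q σ)) i)) (lookup js i)) i))
      (≤-<-trans (displace-≤ (proj₂ (lookup (proj₂ (δ′ c q σ)) i)) (lookup js i)) (≤-<-trans (s≤s (js< i)) suc-P<W))) ∷
    All.map⁺ (All.tabulate λ {i} _ → s≤s (≤-trans t< (n≤1+n T)) , ≤-<-trans (js< i) P<W)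
  valid-outs (idle t i p s)    (t< , p<) = (s≤s (≤-trans t< (n≤1+n T)) , p<) ∷ []
  valid-outs (accept q hs)     _         = (≤-refl , λ i → subst (_< W) (sym (Vec.lookup-replicate i 0)) 0<W) ∷ []
  valid-outs (erase i p s)     p<        = (≤-refl , p<) ∷ []

  valid-hub : ∀ r → Good r → Valid (inj₂ r)
  valid-hub (step t q c σ js) (t< , js<) = t< , λ i → <-trans (js< i) P<W
  valid-hub (idle t i p s)    g          = g
  valid-hub (accept q hs)     (_ , hs<)  = hs<
  valid-hub (erase i p s)     g          = g

  cells-distinct : ∀ (f : Fin k → PlaceN) → (∀ i → slot (inj₁ (f i)) ≡ 3 + toℕ i) → AllPairs (_≢_ on slot) (map inj₁ (map f (allFin k)))
  cells-distinct f eq = AllPairs.map⁺ (AllPairs.map⁺ (AllPairs.map (λ {i} {j} i≢j e → i≢j (Fin.toℕ-injective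
    (+-cancelˡ-≡ 3 _ _ (≡-trans (sym (eq i)) (≡-trans e (eq j)))))) (allFin⁺ k)))

  control-first : ∀ {c} (f : Fin k → PlaceN) → slot c < 3 → (∀ i → slot (inj₁ (f i)) ≡ 3 + toℕ i) →
    All (λ d → slot c ≢ slot d) (map inj₁ (map f (allFin k)))
  control-first f c< eq = All.map⁺ (All.map⁺ (All.tabulate λ {i} _ e → <⇒≢ (≤-trans c< (m≤m+n 3 (toℕ i))) (≡-trans e (eq i))))

  distinct-step : ∀ {r t q hs} (f : Fin k → PlaceN) → slot (inj₂ r) ≡ 1 → (∀ i → slot (inj₁ (f i)) ≡ 3 + toℕ i) →
    AllPairs (_≢_ on slot) (inj₂ r ∷ map inj₁ (control t q hs ∷ map f (allFin k)))
  distinct-step {r} {t} {q} {hs} f r1 eq =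
    ((λ e → 1+n≢0 (≡-trans (sym r1) e)) ∷ control-first {inj₂ r} f (subst (_< 3) (sym r1) (s≤s (s≤s z≤n))) eq) ∷
    control-first {inj₁ (control t q hs)} f (s≤s z≤n) eq ∷ cells-distinct f eq

  single : ∀ r p → AllPairs (_≢_ on slot) (inj₂ r ∷ inj₁ p ∷ [])
  single r p = ((λ e → slot-place≢hub p r (sym e)) ∷ []) ∷ [] ∷ []

  distinct-ins : ∀ r → AllPairs (_≢_ on slot) (inj₂ r ∷ map inj₁ (ins r))
  distinct-ins (step t q c σ js)  = distinct-step {step t q c σ js} (λ i → cell t i (1 + lookup js i) (lookup σ i)) refl (λ _ → refl)
  distinct-ins r@(idle t i p s)   = single r _
  distinct-ins r@(accept q hs)    = single r _
  distinct-ins r@(erase i p s)    = single r _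

  distinct-outs : ∀ r → AllPairs (_≢_ on slot) (inj₂ r ∷ map inj₁ (outs r))
  distinct-outs (step t q c σ js) = distinct-step {step t q c σ js}
    (λ i → cell (1 + t) i (1 + lookup js i) (proj₁ (lookup (proj₂ (δ′ c q σ)) i))) refl (λ _ → refl)
  distinct-outs r@(idle t i p s)  = single r _
  distinct-outs r@(accept q hs)   = single r _
  distinct-outs r@(erase i p s)   = single r _

  weight-≤-tapes : ∀ r → weightOf (inj₂ r) ≤ 1 + tapes
  weight-≤-tapes (step t q c σ js) = ≤-refl
  weight-≤-tapes (idle t i p s)    = s≤s z≤n
  weight-≤-tapes (accept q hs)     = s≤s z≤n
  weight-≤-tapes (erase i p s)     = s≤s z≤n

  short-ins : ∀ r → length (map {B = Class} inj₁ (ins r)) ≤ 1 + tapes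
  short-ins r = ≤-trans (≤-reflexive (≡-trans (length-map inj₁ (ins r)) (sym (hub-weight r)))) (weight-≤-tapes r)

  short-outs : ∀ r → length (map {B = Class} inj₁ (outs r)) ≤ 1 + tapes
  short-outs r = ≤-trans (≤-reflexive (≡-trans (length-map inj₁ (outs r)) (≡-trans (sym (balanced r)) (sym (hub-weight r))))) (weight-≤-tapes r)

  tape-places : (Fin k → ℕ → PlaceN) → List (Fin k) → List PlaceN
  tape-places f = concatMap λ i → map (f i) (upTo W)

  All-tape-places : ∀ {Q : PlaceN → Set} f → (∀ i {p} → p < W → Q (f i p)) → ∀ is → All Q (tape-places f is)
  All-tape-places f h []       = []
  All-tape-places f h (i ∷ is) = All.++⁺ (All.map⁺ (All.tabulate λ p∈ → h i (∈-upTo⁻ p∈))) (All-tape-places f h is)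

  length-tape-places : ∀ f g is → length (tape-places f is) ≡ length (tape-places g is)
  length-tape-places f g []       = refl
  length-tape-places f g (i ∷ is) = ≡-trans (length-++ (map (f i) (upTo W))) (≡-trans
    (cong₂ _+_ (≡-trans (length-map (f i) (upTo W)) (sym (length-map (g i) (upTo W)))) (length-tape-places f g is))
    (sym (length-++ (map (g i) (upTo W)))))

  valid-starts : All Placed starts
  valid-starts = subst (All Placed) (sym starts≡)
    ((s≤s z≤n , λ i → subst (_< W) (sym (Vec.lookup-replicate i (suc T))) (s≤s (≤-trans (s≤s (m≤n+m T 1)) (≤-trans (m≤n+m _ (length x)) (m≤n+m _ T))))) ∷
     All-tape-places (λ i p → cell 0 i p (initialCells i p)) (λ i p< → s≤s z≤n , p<) (allFin k))

  valid-goals : All Placed goals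
  valid-goals = (≤-refl , λ i → subst (_< W) (sym (Vec.lookup-replicate i 0)) 0<W) ∷
    All-tape-places (λ i p → cell (suc T) i p blank) (λ i p< → ≤-refl , p<) (allFin k)

  admissible : All Admissible bins
  admissible = All.++⁺ (All-concatMap {xs = reactions} (All.tabulate λ {r} r∈ → inAdm r (good r∈) ∷ outAdm r (good r∈) ∷ []))
    (All.++⁺ (All.map⁺ (All.map (λ v → one v) valid-starts)) (All.map⁺ (All.map (λ v → last v) valid-goals)))
    where
    inAdm : ∀ r → Good r → Admissible (inB r)
    inAdm r g = record { valid = valid-hub r g ∷ All.map⁺ (valid-ins r g) ; distinct = distinct-ins r ; short = s≤s (short-ins r) }
    outAdm : ∀ r → Good r → Admissible (outB r)
    outAdm r g = record { valid = valid-hub r g ∷ All.map⁺ (valid-outs r g) ; distinct = distinct-outs r ; short = s≤s (short-outs r) }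
    one : ∀ {p} → Placed p → Admissible (initB p)
    one v = record { valid = v ∷ [] ; distinct = [] ∷ [] ; short = s≤s z≤n }
    last : ∀ {p} → Placed p → Admissible (finB p)
    last v = record { valid = v ∷ [] ; distinct = [] ∷ [] ; short = s≤s z≤n }

  same-number : length starts ≡ length goals
  same-number = ≡-trans (cong length starts≡)
    (cong suc (length-tape-places (λ i p → cell 0 i p (initialCells i p)) (λ i p → cell (suc T) i p blank) (allFin k)))

  8≤base : 8 ≤ base
  8≤base = ≤-trans (m≤m+n 8 5) (s≤s (*-mono-≤ {3} {3 + tapes} {4} (m≤m+n 3 tapes) (*-monoʳ-≤ 4 {1} (≤-trans (s≤s z≤n) weight-bound))))

  first-start : PlaceN
  first-start = control 0 start (Vec.replicate k (suc T))

  open Game.Repack admissible same-number 8≤base (here {x = first-start} refl) public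

  accepting⇔language : Accepting ⇔ language unary Repacking (encodeRepacking repacking)
  accepting⇔language = mk⇔ (λ a → Equivalence.to choice⇔language (Equivalence.to accepting⇔choice a))
    (λ l → Equivalence.from accepting⇔choice (Equivalence.from choice⇔language l))

-- Generator combinators

rename : ∀ {V V′ : Set} → (V → V′) → Expr V → Expr V′
rename ρ (lit n) = lit n
rename ρ (var v) = var (ρ v)
rename ρ (e ⊞ f) = rename ρ e ⊞ rename ρ f
rename ρ (e ⊠ f) = rename ρ e ⊠ rename ρ f
rename ρ (e ⊟ f) = rename ρ e ⊟ rename ρ f

value-rename : ∀ {V V′ : Set} (η : V′ → ℕ) (ρ : V → V′) e → value η (rename ρ e) ≡ value (η ∘ ρ) e
value-rename η ρ (lit n) = refl
value-rename η ρ (var v) = refl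
value-rename η ρ (e ⊞ f) = cong₂ _+_ (value-rename η ρ e) (value-rename η ρ f)
value-rename η ρ (e ⊠ f) = cong₂ _*_ (value-rename η ρ e) (value-rename η ρ f)
value-rename η ρ (e ⊟ f) = cong₂ _∸_ (value-rename η ρ e) (value-rename η ρ f)

at-var : ∀ {V : Set} → V → Expr ⊤ → Expr V
at-var v = rename λ _ → v

value-at : ∀ {V} (η : V → ℕ) {v n} → η v ≡ n → ∀ e → value η (at-var v e) ≡ value (λ _ → n) e
value-at η {v} p e = ≡-trans (value-rename η (λ _ → v) e) (value-cong (λ _ → p) e)

gather : ∀ {A : Set} {V b} → List A → (A → Gen V b) → Gen V b
gather []       g = ε
gather (a ∷ as) g = g a ⊕ gather as g

sumE : ∀ {V} → List (Expr V) → Expr V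
sumE []       = lit 0
sumE (e ∷ es) = e ⊞ sumE es

-- The binders keep the outer variables reachable along the given renaming.
nest : ∀ {V b} n → Expr V → (∀ {V′} → (V → V′) → Vec (Expr V′) n → Gen V′ b) → Gen V b
nest zero    e body = body id []
nest (suc n) e body = for e (nest n (rename just e) λ ρ es → body (ρ ∘ just) (var (ρ nothing) ∷ es))

module Generated (x : List Bool) where

  ⟦_⟧ : ∀ {V b} → Gen V b → (V → ℕ) → List Bool
  ⟦ g ⟧ η = generate x η g

  generate-gather : ∀ {A : Set} {V b} (as : List A) (g : A → Gen V b) η → ⟦ gather as g ⟧ η ≡ concatMap (λ a → ⟦ g a ⟧ η) as
  generate-gather []       g η = refl
  generate-gather (a ∷ as) g η = cong (⟦ g a ⟧ η ++_) (generate-gather as g η)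

  generate-nest : ∀ {V b} n (e : Expr V) (body : ∀ {V′} → (V → V′) → Vec (Expr V′) n → Gen V′ b) η (G : Vec ℕ n → List Bool) →
    (∀ {V′} (ρ : V → V′) es η′ → (∀ v → η′ (ρ v) ≡ η v) → ⟦ body ρ es ⟧ η′ ≡ G (Vec.map (value η′) es)) →
    ⟦ nest n e body ⟧ η ≡ concatMap G (vecs n (upTo (value η e)))
  generate-nest zero    e body η G p = ≡-trans (p id [] η (λ _ → refl)) (sym (++-identityʳ _))
  generate-nest (suc n) e body η G p = ≡-trans
    (concatMap-cong (λ j → ≡-trans
      (generate-nest n (rename just e) _ (extend η j) (λ js → G (j ∷ js)) λ ρ es η′ q →
        ≡-trans (p (ρ ∘ just) (var (ρ nothing) ∷ es) η′ (λ v → q (just v))) (cong (λ i → G (i ∷ Vec.map (value η′) es)) (q nothing)))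
      (≡-trans (cong (λ m → concatMap (λ js → G (j ∷ js)) (vecs n (upTo m))) (value-rename (extend η j) just e))
        (sym (concatMap-map G (j ∷_) (vecs n (upTo (value η e)))))))
      (upTo (value η e)))
    (sym (concatMap-∘ G (λ a → map (a ∷_) (vecs n (upTo (value η e)))) (upTo (value η e))))

-- Evaluation of symbolic places, reactions and addresses

module _ {State Mark : Set} {k : ℕ} {N N′ : Set} (f : N → N′) where

  mapPlace : Place State Mark k N → Place State Mark k N′
  mapPlace (control t q hs) = control (f t) q (Vec.map f hs)
  mapPlace (cell t i p s)   = cell (f t) i (f p) s

  mapReaction : Reaction State Mark k N → Reaction State Mark k N′
  mapReaction (step t q c σ js) = step (f t) q c σ (Vec.map f js)
  mapReaction (idle t i p s)    = idle (f t) i (f p) s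
  mapReaction (accept q hs)     = accept q (Vec.map f hs)
  mapReaction (erase i p s)     = erase i (f p) s

  mapClass : Place State Mark k N ⊎ Reaction State Mark k N → Place State Mark k N′ ⊎ Reaction State Mark k N′
  mapClass (inj₁ p) = inj₁ (mapPlace p)
  mapClass (inj₂ r) = inj₂ (mapReaction r)

module Evaluate (M : TuringMachine Bool) {V : Set} (η : V → ℕ) (T̂ Ŵ : Expr V) where

  open TuringMachine M
  open Codes M

  T W : ℕ
  T = value η T̂
  W = value η Ŵ

  module NetE = Net M (Expr V) lit (λ n e → lit n ⊞ e) T̂
  module Netℕ = Net M ℕ id _+_ T
  module AddrE = Addresses M (Expr V) lit _⊞_ _⊠_ T̂ Ŵ
  module Addrℕ = Addresses M ℕ id _+_ _*_ T W

  ⟪_⟫ : Expr V → ℕ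
  ⟪_⟫ = value η

  value-displace : ∀ m j → ⟪ NetE.displace m j ⟫ ≡ Netℕ.displace m ⟪ j ⟫
  value-displace left  j = refl
  value-displace stay  j = refl
  value-displace right j = refl

  value-ins : ∀ r → map (mapPlace ⟪_⟫) (NetE.ins r) ≡ Netℕ.ins (mapReaction ⟪_⟫ r)
  value-ins (step t q c σ js) = cong₂ _∷_
    (cong (control ⟪ t ⟫ q) (≡-trans (sym (Vec.map-∘ ⟪_⟫ (lit 1 ⊞_) js)) (Vec.map-∘ (1 +_) ⟪_⟫ js)))
    (≡-trans (sym (map-∘ (allFin NetE.k))) (map-cong (λ i → cong (λ h → cell ⟪ t ⟫ i (suc h) (lookup σ i)) (sym (Vec.lookup-map i ⟪_⟫ js))) (allFin NetE.k)))
  value-ins (idle t i p s)    = refl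
  value-ins (accept q hs)     = refl
  value-ins (erase i p s)     = refl

  value-outs : ∀ r → map (mapPlace ⟪_⟫) (NetE.outs r) ≡ Netℕ.outs (mapReaction ⟪_⟫ r)
  value-outs (step t q c σ js) = cong₂ _∷_
    (cong (control (suc ⟪ t ⟫) _) (≡-trans (sym (Vec.tabulate-∘ ⟪_⟫ λ i → NetE.displace (motion i) (lookup js i))) (Vec.tabulate-cong λ i →
      ≡-trans (value-displace (motion i) (lookup js i)) (cong (Netℕ.displace (motion i)) (sym (Vec.lookup-map i ⟪_⟫ js))))))
    (≡-trans (sym (map-∘ (allFin NetE.k))) (map-cong (λ i → cong (λ h → cell (suc ⟪ t ⟫) i (suc h) (proj₁ (lookup (proj₂ (NetE.δ′ c q σ)) i)))
      (sym (Vec.lookup-map i ⟪_⟫ js))) (allFin NetE.k)))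
    where
    motion : Fin NetE.k → Move
    motion i = proj₂ (lookup (proj₂ (NetE.δ′ c q σ)) i)
  value-outs (idle t i p s)    = refl
  value-outs (accept q hs)     = cong (λ hs → control (suc T) start hs ∷ []) (Vec.map-replicate ⟪_⟫ (lit 0) NetE.k)
  value-outs (erase i p s)     = refl

  value-radix : ∀ {n} b (v : Vec (Expr V) n) → ⟪ AddrE.radix b v ⟫ ≡ Addrℕ.radix ⟪ b ⟫ (Vec.map ⟪_⟫ v)
  value-radix b []      = refl
  value-radix b (d ∷ v) = cong (λ r → ⟪ d ⟫ + r * ⟪ b ⟫) (value-radix b v)

  value-power : ∀ b n → ⟪ AddrE.power b n ⟫ ≡ Addrℕ.power ⟪ b ⟫ n
  value-power b zero    = refl
  value-power b (suc n) = cong (⟪ b ⟫ *_) (value-power b n)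

  value-slot : ∀ c → AddrE.slot c ≡ Addrℕ.slot (mapClass ⟪_⟫ c)
  value-slot (inj₁ (control t q hs))  = refl
  value-slot (inj₁ (cell t i p s))    = refl
  value-slot (inj₂ (step t q c σ js)) = refl
  value-slot (inj₂ (idle t i p s))    = refl
  value-slot (inj₂ (accept q hs))     = refl
  value-slot (inj₂ (erase i p s))     = refl

  value-addr : ∀ c → ⟪ AddrE.addr c ⟫ ≡ Addrℕ.addr (mapClass ⟪_⟫ c)
  value-addr (inj₁ (control t q hs))  =
    cong (λ r → codeOf finiteStates q + (⟪ t ⟫ + r * (2 + T)) * stateCount) (value-radix Ŵ hs)
  value-addr (inj₁ (cell t i p s))    = refl
  value-addr (inj₂ (step t q c σ js)) =
    cong (λ r → ruleCode q c σ + (⟪ t ⟫ + r * (2 + T)) * ruleCount) (value-radix Ŵ js)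
  value-addr (inj₂ (idle t i p s))    = refl
  value-addr (inj₂ (accept q hs))     =
    cong (λ r → ruleCode q true (Vec.replicate tapes blank) + (T + r * (2 + T)) * ruleCount) (value-radix Ŵ hs)
  value-addr (inj₂ (erase i p s))     = refl

  value-addressBound : ⟪ AddrE.addressBound ⟫ ≡ Addrℕ.addressBound
  value-addressBound = cong (λ w → w * (2 + T) * stateCount + (W * (2 + T) * (symbolCount * tapes) + (w * (2 + T) * ruleCount + (1 + tapes))))
    (value-power Ŵ tapes)

  value-base : ⟪ AddrE.base ⟫ ≡ Addrℕ.base
  value-base = cong (λ a → 1 + (3 + tapes) * (4 * a)) value-addressBound

  value-base-power : ∀ n → ⟪ AddrE.power AddrE.base n ⟫ ≡ Addrℕ.power Addrℕ.base n
  value-base-power n = ≡-trans (value-power AddrE.base n) (cong (λ b → Addrℕ.power b n) value-base)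

  value-bulk : ∀ c → ⟪ AddrE.bulkN c ⟫ ≡ Addrℕ.bulkN (mapClass ⟪_⟫ c)
  value-bulk c = cong₂ _+_ (cong₂ _*_ (cong₂ _+_ value-addressBound (value-addr c))
    (≡-trans (value-base-power (1 + AddrE.slot c)) (cong (λ s → Addrℕ.power Addrℕ.base (1 + s)) (value-slot c))))
    (value-base-power (4 + tapes))

module Transfers (x : List Bool) where

  open Generated x public

  module _ {A : Set} {V : Set} {b : Bool} {η : V → ℕ} (G : A → List Bool) where

    gather-⟦⟧ : ∀ {I : Set} (f : I → List A) (g : I → Gen V b) is → (∀ i → ⟦ g i ⟧ η ≡ concatMap G (f i)) →
      ⟦ gather is g ⟧ η ≡ concatMap G (concatMap f is)
    gather-⟦⟧ f g is p = ≡-trans (generate-gather is g η) (≡-trans (concatMap-cong p is) (sym (concatMap-∘ G f is)))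

    for-⟦⟧ : ∀ (f : ℕ → List A) e (g : Gen (Maybe V) b) {m} → value η e ≡ m → (∀ j → ⟦ g ⟧ (extend η j) ≡ concatMap G (f j)) →
      ⟦ for e g ⟧ η ≡ concatMap G (concatMap f (upTo m))
    for-⟦⟧ f e g refl p = ≡-trans (concatMap-cong p (upTo (value η e))) (sym (concatMap-∘ G f (upTo (value η e))))

    for-map-⟦⟧ : ∀ (f : ℕ → A) e (g : Gen (Maybe V) b) {m} → value η e ≡ m → (∀ j → ⟦ g ⟧ (extend η j) ≡ G (f j)) →
      ⟦ for e g ⟧ η ≡ concatMap G (map f (upTo m))
    for-map-⟦⟧ f e g refl p = ≡-trans (concatMap-cong p (upTo (value η e))) (sym (concatMap-map G f (upTo (value η e))))

    nest-⟦⟧ : ∀ {n} (f : Vec ℕ n → A) e (body : ∀ {V′} → (V → V′) → Vec (Expr V′) n → Gen V′ b) {m} → value η e ≡ m →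
      (∀ {V′} (ρ : V → V′) es η′ → (∀ v → η′ (ρ v) ≡ η v) → ⟦ body ρ es ⟧ η′ ≡ G (f (Vec.map (value η′) es))) →
      ⟦ nest n e body ⟧ η ≡ concatMap G (map f (vecs n (upTo m)))
    nest-⟦⟧ {n} f e body refl p = ≡-trans (generate-nest n e body η (G ∘ f) p) (sym (concatMap-map G f (vecs n (upTo (value η e)))))

-- The generator of the repacking instance

module Construction (M : TuringMachine Bool) (p : Polynomial) where

  open TuringMachine M

  horner : Polynomial → Expr ⊤
  horner []      = lit 0
  horner (a ∷ p) = lit a ⊞ var tt ⊠ horner p

  T₀ P₀ W₀ : Expr ⊤
  T₀ = horner p
  P₀ = lit 1 ⊞ (T₀ ⊞ T₀ ⊞ var tt)
  W₀ = (lit 1 ⊞ T₀) ⊞ (var tt ⊞ (lit 2 ⊞ T₀))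

  horner-eval : ∀ p n → value (λ _ → n) (horner p) ≡ eval p n
  horner-eval []      n = refl
  horner-eval (a ∷ p) n = cong (λ e → a + n * e) (horner-eval p n)

  k : ℕ
  k = 1 + extraTapes

  PlaceE ReactionE : Set → Set
  PlaceE V = Place State Mark k (Expr V)
  ReactionE V = Reaction State Mark k (Expr V)

  -- A generator to be run at each reaction or place. It is used under binders, so it is told how
  -- the outer variables are embedded there.
  ReactionGen PlaceGen : Set → Bool → Set₁
  ReactionGen V b = ∀ {V′} → (V → V′) → ReactionE V′ → Gen V′ b
  PlaceGen V b    = ∀ {V′} → (V → V′) → PlaceE V′ → Gen V′ b

  words : List (Vec (Symbol Mark) k)
  words = vecs k (symbols finiteMarks)

  stepG : ∀ {V b} → V → ReactionGen V b → State → Bool → Vec (Symbol Mark) k → Gen (Maybe V) b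
  stepG v leaf q c σ = nest k (at-var (just v) P₀) λ ρ js → leaf (ρ ∘ just) (step (var (ρ nothing)) q c σ js)

  stepsG idlesG : ∀ {V b} → V → ReactionGen V b → Gen (Maybe V) b
  stepsG v leaf = gather (elements finiteStates) λ q → gather bools λ c → gather words (stepG v leaf q c)

  tapeG : ∀ {V b} → (Fin k → Symbol Mark → Gen V b) → Gen V b
  tapeG g = gather (allFin k) λ i → gather (symbols finiteMarks) (g i)

  idleG : ∀ {V b} → V → ReactionGen V b → Fin k → Symbol Mark → Gen (Maybe V) b
  idleG v leaf i s = for (at-var (just v) W₀) (leaf (just ∘ just) (idle (var (just nothing)) i (var nothing) s))

  idlesG v leaf = tapeG (idleG v leaf)

  acceptG : ∀ {V b} → V → ReactionGen V b → State → Bool → Gen V b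
  acceptG v leaf q true  = nest k (at-var v W₀) λ ρ hs → leaf ρ (accept q hs)
  acceptG v leaf q false = ε

  acceptsG : ∀ {V b} → V → ReactionGen V b → Gen V b
  acceptsG v leaf = gather (elements finiteStates) λ q → acceptG v leaf q (final q)

  eraseG : ∀ {V b} → V → ReactionGen V b → Fin k → Symbol Mark → Gen V b
  eraseG v leaf i s = for (at-var v W₀) (leaf just (erase i (var nothing) s))

  reactionsG : ∀ {V b} → V → ReactionGen V b → Gen V b
  reactionsG v leaf = for (at-var v T₀) (stepsG v leaf ⊕ idlesG v leaf) ⊕ acceptsG v leaf ⊕ tapeG (eraseG v leaf)

  leftG rightG : ∀ {V b} → V → PlaceGen V b → Gen (Maybe V) b
  leftG v leaf  = leaf just (cell (lit 0) zero (var nothing) blank)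
  rightG v leaf = leaf just (cell (lit 0) zero ((lit 1 ⊞ at-var (just v) T₀) ⊞ (var (just v) ⊞ var nothing)) blank)

  bitG : ∀ {V b} → V → PlaceGen V b → Bool → Gen (Maybe V) b
  bitG v leaf c = leaf just (cell (lit 0) zero ((lit 1 ⊞ at-var (just v) T₀) ⊞ var nothing) (bit c))

  blankG : ∀ {V b} → V → PlaceGen V b → Fin extraTapes → Gen V b
  blankG v leaf i = for (at-var v W₀) (leaf just (cell (lit 0) (suc i) (var nothing) blank))

  -- The leaf must work for both indices: it also occurs under `scan`, where scanning is forbidden.
  startsG : ∀ {V} → V → (∀ {b} → PlaceGen V b) → Gen V true
  startsG v leaf =
    leaf id (control (lit 0) start (Vec.replicate k (lit 1 ⊞ at-var v T₀))) ⊕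
    (for (lit 1 ⊞ at-var v T₀) (leftG v leaf) ⊕ scan (bitG v leaf) ⊕ for (lit 2 ⊞ at-var v T₀) (rightG v leaf)) ⊕
    gather (allFin extraTapes) (blankG v leaf)

  goalG : ∀ {V b} → V → PlaceGen V b → Fin k → Gen V b
  goalG v leaf i = for (at-var v W₀) (leaf just (cell (lit 1 ⊞ at-var (just v) T₀) i (var nothing) blank))

  goalsG : ∀ {V b} → V → PlaceGen V b → Gen V b
  goalsG v leaf = leaf id (control (lit 1 ⊞ at-var v T₀) start (Vec.replicate k (lit 0))) ⊕ gather (allFin k) (goalG v leaf)

  ClassE : Set → Set
  ClassE V = PlaceE V ⊎ ReactionE V

  -- A bin is given by its goal, its classes and its initial contents.
  BinGen : Set → Bool → Set₁
  BinGen V b = ∀ {V′} → (V → V′) → ℕ → List (ClassE V′) → List (ClassE V′ × Bool) → Gen V′ b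

  module _ {V : Set} (v : V) where

    insE outsE : ReactionE V → List (PlaceE V)
    insE  = Net.ins M (Expr V) lit (λ n e → lit n ⊞ e) (at-var v T₀)
    outsE = Net.outs M (Expr V) lit (λ n e → lit n ⊞ e) (at-var v T₀)

    weightE : ClassE V → ℕ
    weightE = Addresses.weightOf M (Expr V) lit _⊞_ _⊠_ (at-var v T₀) (at-var v W₀)

    bulkE : ClassE V → Expr V
    bulkE = Addresses.bulkN M (Expr V) lit _⊞_ _⊠_ (at-var v T₀) (at-var v W₀)

    weighE : ClassE V × Bool → Expr V
    weighE = Addresses.weighN M (Expr V) lit _⊞_ _⊠_ (at-var v T₀) (at-var v W₀)

  with-flag : ∀ {V} → Bool → List (PlaceE V) → List (ClassE V × Bool)
  with-flag f = map λ p → inj₁ p , f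

  reactionBinsG : ∀ {V b} → V → BinGen V b → ReactionGen V b
  reactionBinsG v leaf ρ r =
    leaf ρ (weightE (ρ v) (inj₂ r)) (inj₂ r ∷ map inj₁ (insE (ρ v) r)) ((inj₂ r , false) ∷ with-flag true (insE (ρ v) r)) ⊕
    leaf ρ (weightE (ρ v) (inj₂ r)) (inj₂ r ∷ map inj₁ (outsE (ρ v) r)) ((inj₂ r , true) ∷ with-flag false (outsE (ρ v) r))

  startBinG goalBinG : ∀ {V b} → BinGen V b → PlaceGen V b
  startBinG leaf ρ p = leaf ρ 1 (inj₁ p ∷ []) ((inj₁ p , false) ∷ [])
  goalBinG leaf ρ p  = leaf ρ 0 (inj₁ p ∷ []) ((inj₁ p , true) ∷ [])

  -- One enumeration of the bins serves three purposes, with leaves that count the volume, list the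
  -- items and list the bunches with fillers.
  binsG : ∀ {V} → V → (∀ {b} → BinGen V b) → Gen V true
  binsG v leaf = reactionsG v (reactionBinsG v leaf) ⊕ startsG v (startBinG leaf) ⊕ goalsG v (goalBinG leaf)

  -- The first bit is the cons of `encodeList`; the rest is the unary numeral.
  itemG : ∀ {V b} → Expr V → Gen V b
  itemG e = emit true ⊕ tell e ⊕ emit false

  countLeaf itemLeaf : ∀ {V b} → V → BinGen V b
  countLeaf v ρ g cs zs = gather zs λ z → tell (weighE (ρ v) z)
  itemLeaf v ρ g cs zs  = gather zs λ z → itemG (weighE (ρ v) z)

  -- The size has the form of `filler`, with `u` standing for `h` and the capacity computed from the
  -- goal and the classes of the bin.
  fillerLeaf : ∀ {V b} → V → V → BinGen V b
  fillerLeaf v u ρ g cs zs =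
    emit true ⊕ itemG (lit 1 ⊞ ((lit 9 ⊞ lit 2 ⊠ var (ρ u)) ⊟ (lit g ⊞ sumE (map (bulkE (ρ v)) cs)))) ⊕ emit false

  largeG : ∀ {V b} → V → ℕ → Gen V b
  largeG u j = itemG (lit (suc j) ⊞ var u)

  pairG : ∀ {V b} → V → ℕ → ℕ → Gen V b
  pairG u i j = emit true ⊕ largeG u i ⊕ largeG u j ⊕ emit false

  layoutG : ∀ {V} → V → V → (i j i′ j′ : ℕ) → Gen V true
  layoutG v u i j i′ j′ = pairG u i j ⊕ pairG u i′ j′ ⊕
    (emit true ⊕ largeG u 4 ⊕ binsG v (itemLeaf v) ⊕ emit false) ⊕ binsG v (fillerLeaf v u) ⊕ emit false

  lengthG : Gen ⊥ true
  lengthG = scan λ _ → emit true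

  totalG : Gen (Maybe ⊥) true
  totalG = binsG nothing (countLeaf nothing)

  instanceG : Gen (Maybe (Maybe ⊥)) true
  instanceG = (tell (lit 10 ⊞ lit 2 ⊠ var nothing) ⊕ emit false) ⊕
    layoutG (just nothing) nothing 3 2 1 0 ⊕ layoutG (just nothing) nothing 3 1 2 0

  -- The capacity comes first in the encoding and every filler depends on `h`, so the total volume
  -- has to be known before anything is printed. Counting it in turn requires the length of the
  -- input.
  repackingG : Gen ⊥ true
  repackingG = store lengthG (store totalG instanceG)

  -- Correctness of the generator

  module Correct (x : List Bool) where

    n T : ℕ
    n = length x
    T = value (λ _ → n) T₀

    open Transfers x public
    open Numbers M T x public hiding (k)

    module _ {V : Set} (v : V) {η : V → ℕ} (n≡ : η v ≡ n) where

      value-T : value η (at-var v T₀) ≡ T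
      value-T = value-at η n≡ T₀

      value-W : value η (at-var v W₀) ≡ W
      value-W = value-at η n≡ W₀

      value-P : value η (at-var v P₀) ≡ P
      value-P = value-at η n≡ P₀

    module _ {V : Set} {b : Bool} {v : V} {η : V → ℕ} (n≡ : η v ≡ n) (leaf : ReactionGen V b) (G : ReactionN → List Bool)
      (correct : ∀ {V′} (ρ : V → V′) r η′ → (∀ u → η′ (ρ u) ≡ η u) → ⟦ leaf ρ r ⟧ η′ ≡ G (mapReaction (value η′) r)) where

      generate-accept : ∀ q c → ⟦ acceptG v leaf q c ⟧ η ≡ concatMap G (when c (map (accept q) (vecs k (upTo W))))
      generate-accept q true  = nest-⟦⟧ G (accept q) (at-var v W₀) (λ ρ hs → leaf ρ (accept q hs)) (value-W v n≡)
        λ ρ hs η′ r → correct ρ (accept q hs) η′ r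
      generate-accept q false = refl

      generate-step : ∀ t q c σ → ⟦ stepG v leaf q c σ ⟧ (extend η t) ≡ concatMap G (map (step t q c σ) (vecs k (upTo P)))
      generate-step t q c σ = nest-⟦⟧ G (step t q c σ) (at-var (just v) P₀) (λ ρ js → leaf (ρ ∘ just) (step (var (ρ nothing)) q c σ js))
        (value-P (just v) n≡) λ ρ js η′ r → ≡-trans (correct (ρ ∘ just) (step (var (ρ nothing)) q c σ js) η′ (λ u → r (just u)))
          (cong (λ t → G (step t q c σ (Vec.map (value η′) js))) (r nothing))

      generate-steps : ∀ t → ⟦ stepsG v leaf ⟧ (extend η t) ≡ concatMap G (steps t)
      generate-steps t = gather-⟦⟧ G (λ q → concatMap (stepsOf t q) bools) (λ q → gather bools λ c → gather words (stepG v leaf q c)) states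
        λ q → gather-⟦⟧ G (stepsOf t q) (λ c → gather words (stepG v leaf q c)) bools
          λ c → gather-⟦⟧ G (λ σ → map (step t q c σ) (vecs k (upTo P))) (stepG v leaf q c) words (generate-step t q c)

      generate-idles : ∀ t → ⟦ idlesG v leaf ⟧ (extend η t) ≡ concatMap G (idles t)
      generate-idles t = gather-⟦⟧ G (λ i → concatMap (λ s → map (λ p → idle t i p s) (upTo W)) syms) (λ i → gather syms (idleG v leaf i)) (allFin k)
        λ i → gather-⟦⟧ G (λ s → map (λ p → idle t i p s) (upTo W)) (idleG v leaf i) syms
          λ s → for-map-⟦⟧ G (λ p → idle t i p s) (at-var (just v) W₀) (leaf (just ∘ just) (idle (var (just nothing)) i (var nothing) s)) (value-W (just v) n≡)
            λ p → correct (just ∘ just) (idle (var (just nothing)) i (var nothing) s) (extend (extend η t) p) (λ _ → refl)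

      generate-erases : ⟦ tapeG (eraseG v leaf) ⟧ η ≡ concatMap G erases
      generate-erases = gather-⟦⟧ G (λ i → concatMap (λ s → map (λ p → erase i p s) (upTo W)) syms) (λ i → gather syms (eraseG v leaf i)) (allFin k)
        λ i → gather-⟦⟧ G (λ s → map (λ p → erase i p s) (upTo W)) (eraseG v leaf i) syms
          λ s → for-map-⟦⟧ G (λ p → erase i p s) (at-var v W₀) (leaf just (erase i (var nothing) s)) (value-W v n≡)
            λ p → correct just (erase i (var nothing) s) (extend η p) (λ _ → refl)

      generate-reactions : ⟦ reactionsG v leaf ⟧ η ≡ concatMap G reactions
      generate-reactions = ≡-trans (cong₂ _++_
        (for-⟦⟧ G level (at-var v T₀) (stepsG v leaf ⊕ idlesG v leaf) (value-T v n≡) λ t →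
          ≡-trans (cong₂ _++_ (generate-steps t) (generate-idles t)) (sym (concatMap-++ G (steps t) (idles t))))
        (cong₂ _++_ (gather-⟦⟧ G acceptsIn (λ q → acceptG v leaf q (final q)) states (λ q → generate-accept q (final q))) generate-erases))
        (sym (≡-trans (concatMap-++ G (concatMap level (upTo T)) (accepts ++ erases)) (cong (concatMap G (concatMap level (upTo T)) ++_) (concatMap-++ G accepts erases))))

    module _ {V : Set} {v : V} {η : V → ℕ} (n≡ : η v ≡ n) (G : PlaceN → List Bool) where

      concatMap-bits : ∀ i bs → indexed (λ j b → G (cell 0 zero (suc T + j) (bit b))) i bs ≡ concatMap G (bitCells (suc T + i) bs)
      concatMap-bits i []       = refl
      concatMap-bits i (b ∷ bs) = cong (G (cell 0 zero (suc T + i) (bit b)) ++_)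
        (≡-trans (concatMap-bits (suc i) bs) (cong (λ m → concatMap G (bitCells m bs)) (+-suc (suc T) i)))

      module _ (leaf : ∀ {b} → PlaceGen V b)
        (correct : ∀ {b V′} (ρ : V → V′) q η′ → (∀ u → η′ (ρ u) ≡ η u) → ⟦ leaf {b} ρ q ⟧ η′ ≡ G (mapPlace (value η′) q)) where

        leftBlanks rightBlanks : List PlaceN
        leftBlanks  = map (λ p → cell 0 zero p blank) (upTo (suc T))
        rightBlanks = map (λ p → cell 0 zero (suc T + (length x + p)) blank) (upTo (2 + T))

        generate-left : ⟦ for {b = true} (lit 1 ⊞ at-var v T₀) (leftG v leaf) ⟧ η ≡ concatMap G leftBlanks
        generate-left = for-map-⟦⟧ G (λ p → cell 0 zero p blank) (lit 1 ⊞ at-var v T₀) (leftG v leaf) (cong suc (value-T v n≡))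
          λ p → correct just (cell (lit 0) zero (var nothing) blank) (extend η p) (λ _ → refl)

        generate-right : ⟦ for {b = true} (lit 2 ⊞ at-var v T₀) (rightG v leaf) ⟧ η ≡ concatMap G rightBlanks
        generate-right = for-map-⟦⟧ G (λ p → cell 0 zero (suc T + (length x + p)) blank) (lit 2 ⊞ at-var v T₀) (rightG v leaf) (cong (2 +_) (value-T v n≡))
          λ p → ≡-trans (correct just (cell (lit 0) zero ((lit 1 ⊞ at-var (just v) T₀) ⊞ (var (just v) ⊞ var nothing)) blank) (extend η p) (λ _ → refl))
            (cong₂ (λ t m → G (cell 0 zero (suc t + (m + p)) blank)) (value-T (just v) n≡) n≡)

        generate-bits : ⟦ scan (bitG v leaf) ⟧ η ≡ concatMap G (bitCells (suc T) x)
        generate-bits = ≡-trans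
          (indexed-cong (λ i b → ≡-trans (correct just (cell (lit 0) zero ((lit 1 ⊞ at-var (just v) T₀) ⊞ var nothing) (bit b)) (extend η i) (λ _ → refl))
            (cong (λ t → G (cell 0 zero (suc t + i) (bit b))) (value-T (just v) {extend η i} n≡))) 0 x)
          (≡-trans (concatMap-bits 0 x) (cong (λ m → concatMap G (bitCells m x)) (+-identityʳ (suc T))))

        generate-blanks : ⟦ gather {b = true} (allFin extraTapes) (blankG v leaf) ⟧ η ≡ concatMap G otherStarts
        generate-blanks = gather-⟦⟧ G (λ i → map (λ p → cell 0 (suc i) p blank) (upTo W)) (blankG v leaf) (allFin extraTapes)
          λ i → for-map-⟦⟧ G (λ p → cell 0 (suc i) p blank) (at-var v W₀) (leaf just (cell (lit 0) (suc i) (var nothing) blank)) (value-W v n≡)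
            λ p → correct just (cell (lit 0) (suc i) (var nothing) blank) (extend η p) (λ _ → refl)

        generate-starts : ⟦ startsG v leaf ⟧ η ≡ concatMap G starts
        generate-starts = cong₂ _++_
          (≡-trans (correct id (control (lit 0) start (Vec.replicate k (lit 1 ⊞ at-var v T₀))) η (λ _ → refl)) (cong (λ hs → G (control 0 start hs))
            (≡-trans (Vec.map-replicate (value η) (lit 1 ⊞ at-var v T₀) k) (cong (λ t → Vec.replicate k (suc t)) (value-T v n≡)))))
          (≡-trans (cong₂ _++_ (≡-trans (cong₂ _++_ generate-left (cong₂ _++_ generate-bits generate-right))
              (sym (≡-trans (concatMap-++ G leftBlanks (bitCells (suc T) x ++ rightBlanks))
                (cong (concatMap G leftBlanks ++_) (concatMap-++ G (bitCells (suc T) x) rightBlanks))))) generate-blanks)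
            (sym (concatMap-++ G inputStarts otherStarts)))

      module _ {b : Bool} (leaf : PlaceGen V b)
        (correct : ∀ {V′} (ρ : V → V′) q η′ → (∀ u → η′ (ρ u) ≡ η u) → ⟦ leaf ρ q ⟧ η′ ≡ G (mapPlace (value η′) q)) where

        generate-goals : ⟦ goalsG v leaf ⟧ η ≡ concatMap G goals
        generate-goals = cong₂ _++_
          (≡-trans (correct id (control (lit 1 ⊞ at-var v T₀) start (Vec.replicate k (lit 0))) η (λ _ → refl))
            (cong₂ (λ t hs → G (control (suc t) start hs)) (value-T v n≡) (Vec.map-replicate (value η) (lit 0) k)))
          (gather-⟦⟧ G (λ i → map (λ p → cell (suc T) i p blank) (upTo W)) (goalG v leaf) (allFin k)
            λ i → for-map-⟦⟧ G (λ p → cell (suc T) i p blank) (at-var v W₀) (leaf just (cell (lit 1 ⊞ at-var (just v) T₀) i (var nothing) blank)) (value-W v n≡)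
              λ p → ≡-trans (correct just (cell (lit 1 ⊞ at-var (just v) T₀) i (var nothing) blank) (extend η p) (λ _ → refl))
                (cong (λ t → G (cell (suc t) i p blank)) (value-T (just v) {extend η p} n≡)))

    -- The intended output of a leaf as a function of the evaluated data of a bin; each use of
    -- `binsG` is compared with one such function.
    Summarised : Set
    Summarised = ℕ → List Class → List (Class × Bool) → List Bool

    summary : Summarised → Bin → List Bool
    summary F b = F (goal b) (classes b) (initially b)

    module _ {V : Set} (η : V → ℕ) where

      evalClass : ClassE V → Class
      evalClass = mapClass (value η)

      evalFlagged : ClassE V × Bool → Class × Bool
      evalFlagged (c , f) = evalClass c , f

    power≡^ : ∀ b m → power b m ≡ b ^ m
    power≡^ b zero    = refl
    power≡^ b (suc m) = cong (b *_) (power≡^ b m)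

    bulkN≡bulk : ∀ c → bulkN c ≡ bulk c
    bulkN≡bulk c = cong₂ _+_ (cong ((addressBound + addr c) *_) (power≡^ base (1 + slot c))) (power≡^ base (4 + tapes))

    module _ {V : Set} {v : V} {η : V → ℕ} (n≡ : η v ≡ n) where

      private
        module E = Evaluate M η (at-var v T₀) (at-var v W₀)

      eval-bulk : ∀ c → value η (bulkE v c) ≡ bulk (evalClass η c)
      eval-bulk c = ≡-trans (E.value-bulk c)
        (≡-trans (cong₂ (λ t w → Addresses.bulkN M ℕ id _+_ _*_ t w (evalClass η c)) (value-T v n≡) (value-W v n≡)) (bulkN≡bulk (evalClass η c)))

      eval-weight : ∀ c → weightE v c ≡ weightOf (evalClass η c)
      eval-weight (inj₁ _)                 = refl
      eval-weight (inj₂ (step t q c σ js)) = refl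
      eval-weight (inj₂ (idle t i p s))    = refl
      eval-weight (inj₂ (accept q hs))     = refl
      eval-weight (inj₂ (erase i p s))     = refl

      eval-weigh : ∀ z → value η (weighE v z) ≡ weigh (evalFlagged η z)
      eval-weigh (c , true)  = cong₂ _+_ (eval-weight c) (eval-bulk c)
      eval-weigh (c , false) = eval-bulk c

      eval-ins : ∀ r → map (mapPlace (value η)) (insE v r) ≡ ins (mapReaction (value η) r)
      eval-ins r = ≡-trans (E.value-ins r) (cong (λ t → Net.ins M ℕ id _+_ t (mapReaction (value η) r)) (value-T v n≡))

      eval-outs : ∀ r → map (mapPlace (value η)) (outsE v r) ≡ outs (mapReaction (value η) r)
      eval-outs r = ≡-trans (E.value-outs r) (cong (λ t → Net.outs M ℕ id _+_ t (mapReaction (value η) r)) (value-T v n≡))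

      eval-sum : ∀ cs → value η (sumE (map (bulkE v) cs)) ≡ sum (map bulk (map (evalClass η) cs))
      eval-sum []       = refl
      eval-sum (c ∷ cs) = cong₂ _+_ (eval-bulk c) (eval-sum cs)

    map-classes : ∀ {V : Set} (η : V → ℕ) {ps qs} → map (mapPlace (value η)) ps ≡ qs → map (evalClass η) (map inj₁ ps) ≡ map inj₁ qs
    map-classes η {ps} refl = ≡-trans (sym (map-∘ ps)) (map-∘ ps)

    map-flags : ∀ {V : Set} (η : V → ℕ) f {ps qs} → map (mapPlace (value η)) ps ≡ qs →
      map (evalFlagged η) (with-flag f ps) ≡ map (λ p → inj₁ p , f) qs
    map-flags η f {ps} refl = ≡-trans (sym (map-∘ ps)) (map-∘ ps)

    module _ {V : Set} {v : V} {η : V → ℕ} (n≡ : η v ≡ n) (leaf : ∀ {b} → BinGen V b) (F : Summarised)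
      (correct : ∀ {b V′} (ρ : V → V′) g cs zs η′ → (∀ u → η′ (ρ u) ≡ η u) →
        ⟦ leaf {b} ρ g cs zs ⟧ η′ ≡ F g (map (evalClass η′) cs) (map (evalFlagged η′) zs)) where

      correct-reaction : ∀ {b V′} (ρ : V → V′) r η′ → (∀ u → η′ (ρ u) ≡ η u) →
        ⟦ reactionBinsG {b = b} v leaf ρ r ⟧ η′ ≡ summary F (inB (mapReaction (value η′) r)) ++ summary F (outB (mapReaction (value η′) r))
      correct-reaction ρ r η′ p = cong₂ _++_
        (≡-trans (correct ρ (weightE (ρ v) (inj₂ r)) (inj₂ r ∷ map inj₁ (insE (ρ v) r)) ((inj₂ r , false) ∷ with-flag true (insE (ρ v) r)) η′ p)
          (cong₃ F (eval-weight n≡′ (inj₂ r)) (cong (inj₂ (mapReaction (value η′) r) ∷_) (map-classes η′ {insE (ρ v) r} (eval-ins n≡′ r)))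
            (cong ((inj₂ (mapReaction (value η′) r) , false) ∷_) (map-flags η′ true {insE (ρ v) r} (eval-ins n≡′ r)))))
        (≡-trans (correct ρ (weightE (ρ v) (inj₂ r)) (inj₂ r ∷ map inj₁ (outsE (ρ v) r)) ((inj₂ r , true) ∷ with-flag false (outsE (ρ v) r)) η′ p)
          (cong₃ F (eval-weight n≡′ (inj₂ r)) (cong (inj₂ (mapReaction (value η′) r) ∷_) (map-classes η′ {outsE (ρ v) r} (eval-outs n≡′ r)))
            (cong ((inj₂ (mapReaction (value η′) r) , true) ∷_) (map-flags η′ false {outsE (ρ v) r} (eval-outs n≡′ r)))))
        where
        n≡′ : η′ (ρ v) ≡ n
        n≡′ = ≡-trans (p v) n≡
        cong₃ : ∀ (F : Summarised) {g g′ cs cs′ zs zs′} → g ≡ g′ → cs ≡ cs′ → zs ≡ zs′ → F g cs zs ≡ F g′ cs′ zs′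
        cong₃ F refl refl refl = refl

      generate-bins : ⟦ binsG v leaf ⟧ η ≡ concatMap (summary F) bins
      generate-bins = ≡-trans (cong₂ _++_
          (≡-trans (generate-reactions n≡ (reactionBinsG v leaf) (λ r → summary F (inB r) ++ summary F (outB r)) correct-reaction)
            (≡-trans (concatMap-cong (λ r → cong (summary F (inB r) ++_) (sym (++-identityʳ (summary F (outB r))))) reactions)
              (sym (concatMap-∘ (summary F) (λ r → inB r ∷ outB r ∷ []) reactions))))
          (cong₂ _++_
            (≡-trans (generate-starts n≡ (summary F ∘ initB) (startBinG leaf) λ ρ q η′ p → correct ρ 1 _ _ η′ p) (sym (concatMap-map (summary F) initB starts)))
            (≡-trans (generate-goals n≡ (summary F ∘ finB) (goalBinG leaf) λ ρ q η′ p → correct ρ 0 _ _ η′ p) (sym (concatMap-map (summary F) finB goals)))))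
        (sym (≡-trans (concatMap-++ (summary F) reactionBins (map initB starts ++ map finB goals))
          (cong (concatMap (summary F) reactionBins ++_) (concatMap-++ (summary F) (map initB starts) (map finB goals)))))

    encodeBunch : Bunch → List Bool
    encodeBunch = encodeList (λ u → unary (size u))

    encodeList-concatMap : ∀ {A : Set} (e : A → List Bool) as → encodeList e as ≡ concatMap (λ a → true ∷ e a) as ++ false ∷ []
    encodeList-concatMap e []       = refl
    encodeList-concatMap e (a ∷ as) = cong (true ∷_) (≡-trans (cong (e a ++_) (encodeList-concatMap e as)) (sym (++-assoc (e a) _ _)))

    generate-tokens : ∀ {V b} {v : V} {η : V → ℕ} (n≡ : η v ≡ n) (g : ℕ → List Bool) (G : Expr V → Gen V b) →
      (∀ e → ⟦ G e ⟧ η ≡ g (value η e)) → ∀ zs →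
      ⟦ gather zs (λ z → G (weighE v z)) ⟧ η ≡ concatMap (g ∘ weigh) (map (evalFlagged η) zs)
    generate-tokens {v = v} {η} n≡ g G p zs = ≡-trans (generate-gather zs (λ z → G (weighE v z)) η) (≡-trans
      (concatMap-cong (λ z → ≡-trans (p (weighE v z)) (cong g (eval-weigh n≡ z))) zs)
      (sym (concatMap-map (g ∘ weigh) (evalFlagged η) zs)))

    tokens-summary : (g : ℕ → List Bool) → concatMap (summary (λ _ _ → concatMap (g ∘ weigh))) bins ≡ concatMap (g ∘ weigh) tokens
    tokens-summary g = sym (concatMap-∘ (g ∘ weigh) initially bins)

    module _ {V : Set} {v : V} {η : V → ℕ} (n≡ : η v ≡ n) where

      generate-count : length (⟦ binsG v (countLeaf v) ⟧ η) ≡ h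
      generate-count = ≡-trans (cong length (≡-trans
          (generate-bins n≡ (countLeaf v) (λ _ _ → concatMap (ones ∘ weigh))
            λ ρ g cs zs η′ p → generate-tokens (≡-trans (p v) n≡) ones tell (λ _ → refl) zs)
          (tokens-summary ones))) (≡-trans (length-ones tokens) (sym h≡))
        where
        length-ones : ∀ zs → length (concatMap (ones ∘ weigh) zs) ≡ sum (map weigh zs)
        length-ones []       = refl
        length-ones (z ∷ zs) = ≡-trans (length-++ (ones (weigh z))) (cong₂ _+_ (length-replicate (weigh z)) (length-ones zs))

      generate-items : ⟦ binsG v (itemLeaf v) ⟧ η ++ false ∷ [] ≡ encodeBunch items
      generate-items = ≡-trans (cong (_++ false ∷ []) (≡-trans
          (generate-bins n≡ (itemLeaf v) (λ _ _ → concatMap (λ z → true ∷ unary (weigh z)))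
            λ ρ g cs zs η′ p → generate-tokens (≡-trans (p v) n≡) (λ m → true ∷ unary m) itemG (λ _ → refl) zs)
          (≡-trans (tokens-summary (λ m → true ∷ unary m))
            (≡-trans (concatMap-cong (λ z → cong (λ m → true ∷ unary m) (sym (size-toItem z))) tokens)
              (sym (concatMap-map (λ u → true ∷ unary (size u)) toItem tokens))))))
        (sym (encodeList-concatMap (λ u → unary (size u)) items))

      module _ {u : V} (u≡ : η u ≡ h) where

        generate-fillers : ⟦ binsG v (fillerLeaf v u) ⟧ η ++ false ∷ [] ≡ encodeList encodeBunch (map (λ c → filler c ∷ []) caps)
        generate-fillers = ≡-trans (cong (_++ false ∷ []) (≡-trans
            (generate-bins n≡ (fillerLeaf v u) (λ g cs zs → true ∷ encodeBunch (filler (g + sum (map bulk cs)) ∷ []))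
              λ ρ g cs zs η′ p → cong (λ m → true ∷ true ∷ unary (suc m) ++ false ∷ [])
                (cong₂ _∸_ (cong (λ m → 9 + 2 * m) (≡-trans (p u) u≡)) (cong (g +_) (eval-sum (≡-trans (p v) n≡) cs))))
            (≡-trans (sym (concatMap-map (λ c → true ∷ encodeBunch (filler c ∷ [])) capacity bins))
              (sym (concatMap-map (λ B → true ∷ encodeBunch B) (λ c → filler c ∷ []) caps)))))
          (sym (encodeList-concatMap encodeBunch (map (λ c → filler c ∷ []) caps)))

        generate-pair : ∀ i j → ⟦ pairG {b = true} u i j ⟧ η ≡ true ∷ encodeBunch (large i ∷ large j ∷ [])
        generate-pair i j = cong (λ m → true ∷ true ∷ unary (suc (i + m)) ++ true ∷ unary (suc (j + m)) ++ false ∷ []) u≡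

        generate-layout : ∀ i j i′ j′ → ⟦ layoutG v u i j i′ j′ ⟧ η ≡
          encodeList encodeBunch (layout (large i ∷ large j ∷ []) (large i′ ∷ large j′ ∷ []) items caps)
        generate-layout i j i′ j′ = cong₂ _++_ (generate-pair i j) (cong₂ _++_ (generate-pair i′ j′)
          (cong₂ _++_ (cong₂ (λ m w → true ∷ true ∷ unary (suc (4 + m)) ++ w) u≡ generate-items) generate-fillers))

    generate-length : length (⟦ lengthG ⟧ ⊥-elim) ≡ n
    generate-length = go 0 x
      where
      go : ∀ i bs → length (indexed (λ _ _ → true ∷ []) i bs) ≡ length bs
      go i []       = refl
      go i (b ∷ bs) = cong suc (go (suc i) bs)

    -- Replaces the stored length by a variable equal to it, so that the generator that follows can
    -- be treated for any environment with the right values.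
    generate-store : ∀ {V b} (η : V → ℕ) (g : Gen V b) (g′ : Gen (Maybe V) b) {w} →
      (∀ m → m ≡ length (⟦ g ⟧ η) → ⟦ g′ ⟧ (extend η m) ≡ w) → ⟦ store g g′ ⟧ η ≡ w
    generate-store η g g′ p = p (length (⟦ g ⟧ η)) refl

    generate-instance : (η : Maybe (Maybe ⊥) → ℕ) → η (just nothing) ≡ n → η nothing ≡ h → ⟦ instanceG ⟧ η ≡ encodeRepacking repacking
    generate-instance η n≡ u≡ = cong₂ _++_ (cong (λ m → unary (10 + 2 * m)) u≡)
      (cong₂ _++_ (generate-layout {v = just nothing} {η} n≡ {nothing} u≡ 3 2 1 0)
                  (generate-layout {v = just nothing} {η} n≡ {nothing} u≡ 3 1 2 0))

    generate-repacking : generate x ⊥-elim repackingG ≡ encodeRepacking repacking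
    generate-repacking = generate-store ⊥-elim lengthG (store totalG instanceG) λ m₁ e₁ →
      generate-store (extend ⊥-elim m₁) totalG instanceG λ m₂ e₂ →
        generate-instance (extend (extend ⊥-elim m₁) m₂) (≡-trans e₁ generate-length)
          (≡-trans e₂ (generate-count {v = nothing} {extend ⊥-elim m₁} (≡-trans e₁ generate-length)))

-- Runs of exact length, and hardness

module _ (M : TuringMachine Bool) where

  open TuringMachine M
  open Computation M renaming (step to next; run to runs)

  halted-stays : ∀ s → Halted s → ∀ cs → runs cs s ≡ s
  halted-stays s h []       = refl
  halted-stays s h (c ∷ cs) = ≡-trans (cong (runs cs) (next-halted s h)) (halted-stays s h cs)
    where
    next-halted : ∀ s → Halted s → next s c ≡ s
    next-halted (snapshot q ts) h rewrite h = refl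

  -- A halted run is padded with arbitrary choices, as nothing leaves a final state; the token game
  -- has a fixed number of levels and needs runs of exactly that length.
  halts-within⇔halts-at : ∀ s t → (∃[ cs ] (length cs ≤ t × Halted (runs cs s))) ⇔ (∃[ cs ] (length cs ≡ t × Halted (runs cs s)))
  halts-within⇔halts-at s t = mk⇔
    (λ (cs , l , h) → cs ++ replicate (t ∸ length cs) true ,
      ≡-trans (length-++ cs) (≡-trans (cong (length cs +_) (length-replicate (t ∸ length cs))) (m+[n∸m]≡n l)) ,
      subst Halted (≡-trans (sym (halted-stays (runs cs s) h (replicate (t ∸ length cs) true))) (sym (foldl-++ next s cs _))) h)
    (λ (cs , e , h) → cs , ≤-reflexive e , h)

theorem2 : StronglyNP-hard Repacking
theorem2 L (M , p , decides) = (λ x → generate x ⊥-elim repackingG) , generate-polynomial repackingG , λ x →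
  subst (λ w → (L x) ⇔ language unary Repacking w) (sym (Correct.generate-repacking x))
    (Correct.accepting⇔language x ⇔-∘ subst (λ t → (L x) ⇔ (∃[ cs ] (length cs ≡ t × Halted (run cs (initial x))))) (sym (horner-eval p (length x)))
      (halts-within⇔halts-at M (initial x) (eval p (length x)) ⇔-∘ decides x))
  where
  open Construction M p
  open Computation M
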